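{- Let $\mathcal P$ and $\mathcal Q$ be Clements--Lindström posets. (1) Suppose $\mathcal P$ and $\mathcal Q$ have the same rank. Then the diamond product $\mathcal P\diamond\mathcal Q$ is Macaulay if and only if either $\mathcal P\cong\mathcal Q$, or one of $\mathcal P,\mathcal Q$ is a path and the other is two-dimensional with a side of length two. (2) Suppose $\mathcal P$ is the $m\times n$ and $\mathcal Q$ is the $m'\times n'$ Clements--Lindström poset, with $m\le n$, $m'\le n'$ and $m,m'>1$. Then the wedge product $\mathcal P\vee\mathcal Q$ is Macaulay if and only if either ($m\le m'$ and $n\le n'$) or ($m'\le m$ and $n'\le n$).
   Context: For positive integers $d_1,\dots,d_n$, the $d_1\times\cdots\times d_n$ Clements--Lindström poset is $\{\mathbf a\in\mathbb N^n: 0\le a_i<d_i\ \forall i\}$ with componentwise order (a product of chains with $d_1,\dots,d_n$ vertices; equivalently the nonzero monomials of $K[x_1,\ldots,x_n]/(x_1^{d_1},\ldots,x_n^{d_n})$ under divisibility). It is ranked by $a_1+\cdots+a_n$. Its dimension is the number of its elements of rank one (i.e. the number of $i$ with $d_i>1$); its side lengths are the $d_i>1$. A path is a one-dimensional Clements--Lindström poset, i.e. a finite chain. For a ranked poset $\mathcal R$, $\mathcal R_{[d]}$ is the set of elements of rank $d$; the rank of $\mathcal R$ is the largest rank of an element; for $A\subseteq\mathcal R$ the upper shadow is $\nabla A=\{b: b\text{ covers some }a\in A\}$. Given an additional total order on $\mathcal R$ (not required to be related to the partial order), $\mathrm{Seg}_d\,q$ denotes the set of the $q$ largest elements of $\mathcal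 R_{[d]}$ in the total order. $\mathcal R$ is Macaulay if there is a total order on $\mathcal R$ such that for every $d$ and every $A\subseteq\mathcal R_{[d]}$: (i) $|\nabla\mathrm{Seg}_d|A||\le|\nabla A|$, and (ii) $\nabla\mathrm{Seg}_d|A|=\mathrm{Seg}_{d+1}|\nabla\mathrm{Seg}_d|A||$. The wedge product $\mathcal P\vee\mathcal Q$ of posets with unique least elements is the disjoint union with the two least elements identified. The diamond product $\mathcal P\diamond\mathcal Q$ of ranked posets of the same rank with unique least and unique largest elements is the disjoint union with the two least elements identified and the two largest elements identified. In both, $a\le b$ iff $a\le b$ holds in $\mathcal P$ or in $\mathcal Q$; ranks are inherited. -}

module Defs where

open import Data.Fin.Base using (Fin; toℕ; fromℕ<)
open import Data.Fin.Properties using (toℕ<n; toℕ-injective; toℕ-fromℕ<)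
open import Data.List.Base as List
  using (List; []; _∷_; _++_; allFin; cartesianProductWith; deduplicate; filter; length; take)
open import Data.List.Extrema.Nat using (max; v≤max⁺; max≤v⁺)
open import Data.List.Membership.Propositional.Properties using (∈-allFin)
import Data.List.Relation.Binary.Subset.Setoid as SetoidSubset
import Data.List.Relation.Unary.All as AllL
open import Data.List.Relation.Unary.AllPairs.Core using ([]; _∷_)
import Data.List.Relation.Unary.All.Properties as AllLₚ
open import Data.List.Relation.Unary.Any as AnyL using (here; any?)
import Data.List.Relation.Unary.Any.Properties as AnyLₚ
open import Data.List.Relation.Unary.Enumerates.Setoid using (IsEnumeration)
import Data.List.Relation.Unary.Enumerates.Setoid.Properties as Enumₚ
import Data.List.Relation.Unary.Unique.DecSetoid.Properties as Uniqueₚ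
open import Data.List.Relation.Unary.Unique.Propositional.Properties using (allFin⁺)
import Data.List.Relation.Unary.Unique.Setoid as SetoidUnique
import Data.List.Relation.Unary.Unique.Setoid.Properties as Uniqueₛ
import Data.List.Sort as Sort
open import Data.Nat.Base using (ℕ; zero; suc; pred; _+_; z≤n; s≤s)
import Data.Nat.Base as ℕ
import Data.Nat.Properties as ℕₚ
open import Data.Product.Base using (Σ-syntax; ∃; ∃₂; _×_; _,_; proj₁; proj₂)
open import Data.Sum.Base using (_⊎_; inj₁; inj₂; [_,_]′)
open import Data.Vec.Base as Vec using (Vec; []; _∷_; toList)
import Data.Vec.Properties as Vecₚ
open import Data.Vec.Relation.Unary.All using (All; []; _∷_)
open import Data.Vec.Relation.Binary.Pointwise.Inductive as PW using (Pointwise; []; _∷_)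
open import Function.Base using (_∘_; _on_)
open import Level using (0ℓ)
open import Relation.Binary.Bundles using (DecPoset; DecTotalOrder)
open import Relation.Binary.Core using (Rel; REL)
open import Relation.Binary.Consequences using (total∧dec⇒dec)
open import Relation.Binary.Definitions using (Decidable; Maximum; Minimum; _Respects_)
open import Relation.Binary.Structures using (IsTotalOrder)
import Relation.Binary.Construct.Flip.EqAndOrd as Flip
import Relation.Binary.Construct.NonStrictToStrict as ToStrict
open import Relation.Binary.Morphism.Structures using (IsOrderIsomorphism)
open import Relation.Binary.PropositionalEquality
  using (_≡_; refl; sym; trans; cong; setoid; subst₂)
open import Relation.Nullary.Decidable using (Dec; yes; no; map′; ¬?; _×-dec_; _⊎-dec_)
open import Relation.Nullary.Negation using (¬_; contradiction)
open import Relation.Unary using (Pred)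
import Relation.Unary as U

record RankedPoset : Set₁ where
  field
    decPoset : DecPoset 0ℓ 0ℓ 0ℓ

  open DecPoset decPoset public
  open ToStrict _≈_ _≤_ public using (_<_)

  infix 4 _⋖_

  _⋖_ : Rel Carrier 0ℓ
  a ⋖ b = a < b × (∀ c → ¬ (a < c × c < b))

  open SetoidUnique Eq.setoid public using (Unique)

  field
    elements        : List Carrier
    elements-all    : IsEnumeration Eq.setoid elements
    elements-unique : Unique elements

    rank         : Carrier → ℕ
    rank-cong    : ∀ {a b} → a ≈ b → rank a ≡ rank b
    rank-strict  : ∀ {a b} → a < b → rank a ℕ.< rank b
    rank-cover   : ∀ {a b} → a ⋖ b → rank b ≡ suc (rank a)
    rank-minimal : ∀ {a} → (∀ b → b ≤ a → b ≈ a) → rank a ≡ 0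

  exists? : {P : Pred Carrier 0ℓ} → P Respects _≈_ → U.Decidable P → Dec (∃ P)
  exists? {P} resp P? = map′ AnyL.satisfied to (any? P? elements)
    where
    to : ∃ P → AnyL.Any P elements
    to (a , Pa) = AnyL.map (λ a≈x → resp a≈x Pa) (elements-all a)

  _<?_ : Decidable _<_
  _<?_ = ToStrict.<-decidable _≈_ _≤_ _≟_ _≤?_

  <-respʳ-≈ : ∀ {a b c} → b ≈ c → a < b → a < c
  <-respʳ-≈ b≈c (a≤b , a≉b) = ≤-respʳ-≈ b≈c a≤b , λ a≈c → a≉b (Eq.trans a≈c (Eq.sym b≈c))

  <-respˡ-≈ : ∀ {a b c} → a ≈ b → a < c → b < c
  <-respˡ-≈ a≈b (a≤c , a≉c) = ≤-respˡ-≈ a≈b a≤c , λ b≈c → a≉c (Eq.trans a≈b b≈c)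

  _⋖?_ : Decidable _⋖_
  a ⋖? b = (a <? b) ×-dec
    map′ (λ ¬∃ c between → ¬∃ (c , between)) (λ none (c , between) → none c between)
      (¬? (exists? (λ x≈y (a<x , x<b) → <-respʳ-≈ x≈y a<x , <-respˡ-≈ x≈y x<b)
                   (λ c → (a <? c) ×-dec (c <? b))))

  rank-mono : ∀ {a b} → a ≤ b → rank a ℕ.≤ rank b
  rank-mono {a} {b} a≤b with a ≟ b
  ... | yes a≈b = ℕₚ.≤-reflexive (rank-cong a≈b)
  ... | no  a≉b = ℕₚ.<⇒≤ (rank-strict (a≤b , a≉b))

HasLeast : RankedPoset → Set
HasLeast R = ∃ (Minimum _≤_) where open RankedPoset R

HasGreatest : RankedPoset → Set
HasGreatest R = ∃ (Maximum _≤_) where open RankedPoset R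

module _ (R : RankedPoset) where
  open RankedPoset R

  level : ℕ → List Carrier
  level d = filter (λ a → rank a ℕₚ.≟ d) elements

  height : ℕ
  height = max 0 (List.map rank elements)

  dimension : ℕ
  dimension = length (level 1)

  ∇ : List Carrier → List Carrier
  ∇ A = filter (λ b → any? (_⋖? b) A) elements

infix 4 _≅_

_≅_ : RankedPoset → RankedPoset → Set
P ≅ Q = ∃ (IsOrderIsomorphism P._≈_ Q._≈_ P._≤_ Q._≤_)
  where
  module P = RankedPoset P
  module Q = RankedPoset Q

-- Finite subsets are lists without repetition, so that cardinality is
-- `length`; both `∇ A` and `Seg d q` are free of repetitions because
-- `elements` is.

module _ (R : RankedPoset) where
  open RankedPoset R
  open SetoidSubset Eq.setoid using (_⊆_)

  module _ (_≼_ : Rel Carrier 0ℓ) (isTotalOrder : IsTotalOrder _≈_ _≼_) where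
    open IsTotalOrder isTotalOrder using () renaming
      (reflexive to ≼-reflexive; antisym to ≼-antisym; total to ≼-total)

    decTotalOrder : DecTotalOrder 0ℓ 0ℓ 0ℓ
    decTotalOrder = record
      { isDecTotalOrder = record
        { isTotalOrder = isTotalOrder
        ; _≟_          = _≟_
        ; _≤?_         = total∧dec⇒dec ≼-reflexive ≼-antisym ≼-total _≟_
        }
      }

    -- Sorting for the opposite order puts the largest elements first.
    Seg : ℕ → ℕ → List Carrier
    Seg d q = take q (sort (level R d))
      where open Sort (Flip.decTotalOrder decTotalOrder) using (sort)

    IsMacaulayOrder : Set
    IsMacaulayOrder =
      ∀ (d : ℕ) (A : List Carrier) → Unique A → AllL.All (λ a → rank a ≡ d) A →
      let S  = Seg d (length A)
          S′ = Seg (suc d) (length (∇ R S))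
      in length (∇ R S) ℕ.≤ length (∇ R A)
         × (∇ R S ⊆ S′ × S′ ⊆ ∇ R S)

  Macaulay : Set₁
  Macaulay = ∃₂ IsMacaulayOrder

-- `transˡ` and `transʳ` are what transitivity of the glued order needs:
-- a chain passing from one poset to the other lies in one of them.
record Gluing (P Q : RankedPoset) : Set₁ where
  private
    module P = RankedPoset P
    module Q = RankedPoset Q

  infix 4 _≍_ _≍?_
  field
    _≍_    : REL P.Carrier Q.Carrier 0ℓ
    _≍?_   : Decidable _≍_
    respˡ  : ∀ {p p′ q} → p P.≈ p′ → p ≍ q → p′ ≍ q
    respʳ  : ∀ {p q q′} → q Q.≈ q′ → p ≍ q → p ≍ q′
    monoˡ  : ∀ {p p′ q q′} → p ≍ q → p′ ≍ q′ → p P.≤ p′ → q Q.≤ q′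
    monoʳ  : ∀ {p p′ q q′} → p ≍ q → p′ ≍ q′ → q Q.≤ q′ → p P.≤ p′
    transˡ : ∀ {p p′ q q′} → p P.≤ p′ → p′ ≍ q → q Q.≤ q′ → (∃ (p ≍_)) ⊎ (∃ (_≍ q′))
    transʳ : ∀ {p p′ q q′} → q Q.≤ q′ → p ≍ q′ → p P.≤ p′ → (∃ (_≍ q)) ⊎ (∃ (p′ ≍_))
    rank-≍ : ∀ {p q} → p ≍ q → P.rank p ≡ Q.rank q

module _ {P Q : RankedPoset} (G : Gluing P Q) where
  private
    module P = RankedPoset P
    module Q = RankedPoset Q
  open Gluing G

  module Glue where

    Carrier : Set
    Carrier = P.Carrier ⊎ Q.Carrier

    infix 4 _≈_ _≤_

    _≈_ : Rel Carrier 0ℓ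
    inj₁ p ≈ inj₁ p′ = p P.≈ p′
    inj₁ p ≈ inj₂ q  = p ≍ q
    inj₂ q ≈ inj₁ p  = p ≍ q
    inj₂ q ≈ inj₂ q′ = q Q.≈ q′

    _≤_ : Rel Carrier 0ℓ
    a ≤ b = (∃ λ p → a ≈ inj₁ p × ∃ λ p′ → b ≈ inj₁ p′ × p P.≤ p′)
          ⊎ (∃ λ q → a ≈ inj₂ q × ∃ λ q′ → b ≈ inj₂ q′ × q Q.≤ q′)

    rank : Carrier → ℕ
    rank = [ P.rank , Q.rank ]′

    ≈-refl : ∀ {a} → a ≈ a
    ≈-refl {inj₁ _} = P.Eq.refl
    ≈-refl {inj₂ _} = Q.Eq.refl

    ≈-sym : ∀ {a b} → a ≈ b → b ≈ a
    ≈-sym {inj₁ _} {inj₁ _} = P.Eq.sym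
    ≈-sym {inj₁ _} {inj₂ _} p≍q = p≍q
    ≈-sym {inj₂ _} {inj₁ _} p≍q = p≍q
    ≈-sym {inj₂ _} {inj₂ _} = Q.Eq.sym

    ≈-trans : ∀ {a b c} → a ≈ b → b ≈ c → a ≈ c
    ≈-trans {inj₁ _} {inj₁ _} {inj₁ _} u v = P.Eq.trans u v
    ≈-trans {inj₁ _} {inj₁ _} {inj₂ _} u v = respˡ (P.Eq.sym u) v
    ≈-trans {inj₁ _} {inj₂ _} {inj₁ _} u v =
      P.antisym (monoʳ u v Q.refl) (monoʳ v u Q.refl)
    ≈-trans {inj₁ _} {inj₂ _} {inj₂ _} u v = respʳ v u
    ≈-trans {inj₂ _} {inj₁ _} {inj₁ _} u v = respˡ v u
    ≈-trans {inj₂ _} {inj₁ _} {inj₂ _} u v =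
      Q.antisym (monoˡ u v P.refl) (monoˡ v u P.refl)
    ≈-trans {inj₂ _} {inj₂ _} {inj₁ _} u v = respʳ (Q.Eq.sym u) v
    ≈-trans {inj₂ _} {inj₂ _} {inj₂ _} u v = Q.Eq.trans u v

    _≈?_ : Decidable _≈_
    inj₁ p ≈? inj₁ p′ = p P.≟ p′
    inj₁ p ≈? inj₂ q  = p ≍? q
    inj₂ q ≈? inj₁ p  = p ≍? q
    inj₂ q ≈? inj₂ q′ = q Q.≟ q′

    meet : ∀ a {b c} → a ≈ b → a ≈ c → b ≈ c
    meet a {b} {c} a≈b a≈c = ≈-trans {b} {a} {c} (≈-sym {a} {b} a≈b) a≈c

    ≤-reflexive : ∀ {a b} → a ≈ b → a ≤ b
    ≤-reflexive {inj₁ p} {b} a≈b = inj₁ (p , P.Eq.refl , p , ≈-sym {inj₁ p} {b} a≈b , P.refl)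
    ≤-reflexive {inj₂ q} {b} a≈b = inj₂ (q , Q.Eq.refl , q , ≈-sym {inj₂ q} {b} a≈b , Q.refl)

    ≤-trans : ∀ {a b c} → a ≤ b → b ≤ c → a ≤ c
    ≤-trans {a} {b} {c} (inj₁ (p , ap , p₁ , bp₁ , u)) (inj₁ (p₂ , bp₂ , p′ , cp′ , v)) =
      inj₁ (p , ap , p′ , cp′ ,
            P.trans u (P.trans (P.reflexive (meet b {inj₁ p₁} {inj₁ p₂} bp₁ bp₂)) v))
    ≤-trans {a} {b} {c} (inj₂ (q , aq , q₁ , bq₁ , u)) (inj₂ (q₂ , bq₂ , q′ , cq′ , v)) =
      inj₂ (q , aq , q′ , cq′ ,
            Q.trans u (Q.trans (Q.reflexive (meet b {inj₂ q₁} {inj₂ q₂} bq₁ bq₂)) v))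
    ≤-trans {a} {b} {c} (inj₁ (p , ap , p₁ , bp₁ , u)) (inj₂ (q₁ , bq₁ , q′ , cq′ , v))
      with meet b {inj₁ p₁} {inj₂ q₁} bp₁ bq₁
    ... | p₁≍q₁ with transˡ u p₁≍q₁ v
    ...   | inj₁ (q₀ , p≍q₀) =
      inj₂ (q₀ , ≈-trans {a} {inj₁ p} {inj₂ q₀} ap p≍q₀ , q′ , cq′ ,
            Q.trans (monoˡ p≍q₀ p₁≍q₁ u) v)
    ...   | inj₂ (p₀ , p₀≍q′) =
      inj₁ (p , ap , p₀ , ≈-trans {c} {inj₂ q′} {inj₁ p₀} cq′ p₀≍q′ ,
            P.trans u (monoʳ p₁≍q₁ p₀≍q′ v))
    ≤-trans {a} {b} {c} (inj₂ (q , aq , q₁ , bq₁ , u)) (inj₁ (p₁ , bp₁ , p′ , cp′ , v))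
      with meet b {inj₁ p₁} {inj₂ q₁} bp₁ bq₁
    ... | p₁≍q₁ with transʳ u p₁≍q₁ v
    ...   | inj₁ (p₀ , p₀≍q) =
      inj₁ (p₀ , ≈-trans {a} {inj₂ q} {inj₁ p₀} aq p₀≍q , p′ , cp′ ,
            P.trans (monoʳ p₀≍q p₁≍q₁ u) v)
    ...   | inj₂ (q₀ , p′≍q₀) =
      inj₂ (q , aq , q₀ , ≈-trans {c} {inj₁ p′} {inj₂ q₀} cp′ p′≍q₀ ,
            Q.trans u (monoˡ p₁≍q₁ p′≍q₀ v))

    ≤-antisym : ∀ {a b} → a ≤ b → b ≤ a → a ≈ b
    ≤-antisym {a} {b} (inj₁ (p , ap , p₁ , bp₁ , u)) (inj₁ (p₂ , bp₂ , p₃ , ap₃ , v)) =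
      ≈-trans {a} {inj₁ p} {b} ap (≈-sym {b} {inj₁ p} (≈-trans {b} {inj₁ p₁} {inj₁ p} bp₁
        (P.antisym (P.trans (P.reflexive (meet b {inj₁ p₁} {inj₁ p₂} bp₁ bp₂))
                     (P.trans v (P.reflexive (meet a {inj₁ p₃} {inj₁ p} ap₃ ap)))) u)))
    ≤-antisym {a} {b} (inj₂ (q , aq , q₁ , bq₁ , u)) (inj₂ (q₂ , bq₂ , q₃ , aq₃ , v)) =
      ≈-trans {a} {inj₂ q} {b} aq (≈-sym {b} {inj₂ q} (≈-trans {b} {inj₂ q₁} {inj₂ q} bq₁
        (Q.antisym (Q.trans (Q.reflexive (meet b {inj₂ q₁} {inj₂ q₂} bq₁ bq₂))
                     (Q.trans v (Q.reflexive (meet a {inj₂ q₃} {inj₂ q} aq₃ aq)))) u)))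
    ≤-antisym {a} {b} (inj₁ (p , ap , p₁ , bp₁ , u)) (inj₂ (q , bq , q₁ , aq₁ , v)) =
      ≈-trans {a} {inj₂ q₁} {b} aq₁ (≈-sym {b} {inj₂ q₁} (≈-trans {b} {inj₂ q} {inj₂ q₁} bq
        (Q.antisym v (monoˡ (meet a {inj₁ p} {inj₂ q₁} ap aq₁)
                            (meet b {inj₁ p₁} {inj₂ q} bp₁ bq) u))))
    ≤-antisym {a} {b} (inj₂ (q , aq , q₁ , bq₁ , u)) (inj₁ (p , bp , p₁ , ap₁ , v)) =
      ≈-trans {a} {inj₁ p₁} {b} ap₁ (≈-sym {b} {inj₁ p₁} (≈-trans {b} {inj₁ p} {inj₁ p₁} bp
        (P.antisym v (monoʳ (meet a {inj₁ p₁} {inj₂ q} ap₁ aq)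
                            (meet b {inj₁ p} {inj₂ q₁} bp bq₁) u))))

    _≤?_ : Decidable _≤_
    a ≤? b =
      P.exists?
        (λ {x} {y} x≈y (ax , p′ , bp′ , l) →
          ≈-trans {a} {inj₁ x} {inj₁ y} ax x≈y , p′ , bp′ , P.≤-respˡ-≈ x≈y l)
        (λ p → (a ≈? inj₁ p) ×-dec
          P.exists?
            (λ {x} {y} x≈y (bx , l) → ≈-trans {b} {inj₁ x} {inj₁ y} bx x≈y , P.≤-respʳ-≈ x≈y l)
            (λ p′ → (b ≈? inj₁ p′) ×-dec (p P.≤? p′)))
      ⊎-dec
      Q.exists?
        (λ {x} {y} x≈y (ax , q′ , bq′ , l) →
          ≈-trans {a} {inj₂ x} {inj₂ y} ax x≈y , q′ , bq′ , Q.≤-respˡ-≈ x≈y l)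
        (λ q → (a ≈? inj₂ q) ×-dec
          Q.exists?
            (λ {x} {y} x≈y (bx , l) → ≈-trans {b} {inj₂ x} {inj₂ y} bx x≈y , Q.≤-respʳ-≈ x≈y l)
            (λ q′ → (b ≈? inj₂ q′) ×-dec (q Q.≤? q′)))

    decPoset : DecPoset 0ℓ 0ℓ 0ℓ
    decPoset = record
      { Carrier = Carrier ; _≈_ = _≈_ ; _≤_ = _≤_
      ; isDecPartialOrder = record
        { isPartialOrder = record
          { isPreorder = record
            { isEquivalence = record
              { refl  = λ {a} → ≈-refl {a}
              ; sym   = λ {a} {b} → ≈-sym {a} {b}
              ; trans = λ {a} {b} {c} → ≈-trans {a} {b} {c}
              }
            ; reflexive = λ {a} {b} → ≤-reflexive {a} {b}
            ; trans     = λ {a} {b} {c} → ≤-trans {a} {b} {c}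
            }
          ; antisym = λ {a} {b} → ≤-antisym {a} {b}
          }
        ; _≟_  = _≈?_
        ; _≤?_ = _≤?_
        }
      }

    open ToStrict _≈_ _≤_ using (_<_)

    elements : List Carrier
    elements = deduplicate _≈?_ (List.map inj₁ P.elements ++ List.map inj₂ Q.elements)

    elements-all : IsEnumeration (DecPoset.Eq.setoid decPoset) elements
    elements-all = Enumₚ.deduplicate⁺ (DecPoset.Eq.decSetoid decPoset) all
      where
      all : IsEnumeration (DecPoset.Eq.setoid decPoset)
              (List.map inj₁ P.elements ++ List.map inj₂ Q.elements)
      all (inj₁ p) = AnyLₚ.++⁺ˡ (AnyLₚ.map⁺ (P.elements-all p))
      all (inj₂ q) = AnyLₚ.++⁺ʳ (List.map inj₁ P.elements) (AnyLₚ.map⁺ (Q.elements-all q))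

    rank-cong : ∀ {a b} → a ≈ b → rank a ≡ rank b
    rank-cong {inj₁ _} {inj₁ _} = P.rank-cong
    rank-cong {inj₁ _} {inj₂ _} = rank-≍
    rank-cong {inj₂ _} {inj₁ _} = sym ∘ rank-≍
    rank-cong {inj₂ _} {inj₂ _} = Q.rank-cong

    join : ∀ {a b} c d → a ≈ c → b ≈ d → c ≈ d → a ≈ b
    join {a} {b} c d a≈c b≈d c≈d =
      ≈-trans {a} {c} {b} a≈c (≈-trans {c} {d} {b} c≈d (≈-sym {b} {d} b≈d))

    rank-strict : ∀ {a b} → a < b → rank a ℕ.< rank b
    rank-strict {a} {b} (inj₁ (p , ap , p′ , bp′ , u) , a≉b) =
      subst₂ ℕ._<_ (sym (rank-cong {a} {inj₁ p} ap)) (sym (rank-cong {b} {inj₁ p′} bp′))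
        (P.rank-strict (u , λ e → a≉b (join {a} {b} (inj₁ p) (inj₁ p′) ap bp′ e)))
    rank-strict {a} {b} (inj₂ (q , aq , q′ , bq′ , u) , a≉b) =
      subst₂ ℕ._<_ (sym (rank-cong {a} {inj₂ q} aq)) (sym (rank-cong {b} {inj₂ q′} bq′))
        (Q.rank-strict (u , λ e → a≉b (join {a} {b} (inj₂ q) (inj₂ q′) aq bq′ e)))

    rank-cover : ∀ {a b} → a < b × (∀ c → ¬ (a < c × c < b)) → rank b ≡ suc (rank a)
    rank-cover {a} {b} ((inj₁ (p , ap , p′ , bp′ , u) , a≉b) , none) =
      subst₂ (λ x y → y ≡ suc x)
        (sym (rank-cong {a} {inj₁ p} ap)) (sym (rank-cong {b} {inj₁ p′} bp′))
        (P.rank-cover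
          ( (u , λ e → a≉b (join {a} {b} (inj₁ p) (inj₁ p′) ap bp′ e))
          , λ c ((p≤c , p≉c) , (c≤p′ , c≉p′)) → none (inj₁ c)
              ( (inj₁ (p , ap , c , P.Eq.refl , p≤c) , λ a≈c → p≉c (meet a {inj₁ p} {inj₁ c} ap a≈c))
              , (inj₁ (c , P.Eq.refl , p′ , bp′ , c≤p′) ,
                 λ c≈b → c≉p′ (≈-trans {inj₁ c} {b} {inj₁ p′} c≈b bp′)))))
    rank-cover {a} {b} ((inj₂ (q , aq , q′ , bq′ , u) , a≉b) , none) =
      subst₂ (λ x y → y ≡ suc x)
        (sym (rank-cong {a} {inj₂ q} aq)) (sym (rank-cong {b} {inj₂ q′} bq′))
        (Q.rank-cover
          ( (u , λ e → a≉b (join {a} {b} (inj₂ q) (inj₂ q′) aq bq′ e))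
          , λ c ((q≤c , q≉c) , (c≤q′ , c≉q′)) → none (inj₂ c)
              ( (inj₂ (q , aq , c , Q.Eq.refl , q≤c) , λ a≈c → q≉c (meet a {inj₂ q} {inj₂ c} aq a≈c))
              , (inj₂ (c , Q.Eq.refl , q′ , bq′ , c≤q′) ,
                 λ c≈b → c≉q′ (≈-trans {inj₂ c} {b} {inj₂ q′} c≈b bq′)))))

    rank-minimal : ∀ {a} → (∀ b → b ≤ a → b ≈ a) → rank a ≡ 0
    rank-minimal {inj₁ p} min =
      P.rank-minimal λ p′ p′≤p → min (inj₁ p′) (inj₁ (p′ , P.Eq.refl , p , P.Eq.refl , p′≤p))
    rank-minimal {inj₂ q} min =
      Q.rank-minimal λ q′ q′≤q → min (inj₂ q′) (inj₂ (q′ , Q.Eq.refl , q , Q.Eq.refl , q′≤q))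

  glue : RankedPoset
  glue = record
    { decPoset        = Glue.decPoset
    ; elements        = Glue.elements
    ; elements-all    = Glue.elements-all
    ; elements-unique = Uniqueₚ.deduplicate-! (DecPoset.Eq.decSetoid Glue.decPoset) _
    ; rank            = Glue.rank
    ; rank-cong       = λ {a} {b} → Glue.rank-cong {a} {b}
    ; rank-strict     = λ {a} {b} → Glue.rank-strict {a} {b}
    ; rank-cover      = λ {a} {b} → Glue.rank-cover {a} {b}
    ; rank-minimal    = λ {a} → Glue.rank-minimal {a}
    }

rank-least : (R : RankedPoset) ((⊥ , _) : HasLeast R) → RankedPoset.rank R ⊥ ≡ 0
rank-least R (⊥ , ⊥≤) = R.rank-minimal λ b b≤⊥ → R.antisym b≤⊥ (⊥≤ b)
  where module R = RankedPoset R

rank-greatest : (R : RankedPoset) ((⊤ , _) : HasGreatest R) → RankedPoset.rank R ⊤ ≡ height R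
rank-greatest R (⊤ , ≤⊤) = ℕₚ.≤-antisym
  (v≤max⁺ 0 (List.map R.rank R.elements)
    (inj₂ (AnyLₚ.map⁺ (AnyL.map (ℕₚ.≤-reflexive ∘ R.rank-cong) (R.elements-all ⊤)))))
  (max≤v⁺ {xs = List.map R.rank R.elements} z≤n (AllLₚ.map⁺ (AllL.universal (R.rank-mono ∘ ≤⊤) R.elements)))
  where module R = RankedPoset R

module _ (P Q : RankedPoset) (P⊥ : HasLeast P) (Q⊥ : HasLeast Q) where
  private
    module P = RankedPoset P
    module Q = RankedPoset Q
    ⊥P = proj₁ P⊥ ; ⊥P≤ = proj₂ P⊥
    ⊥Q = proj₁ Q⊥ ; ⊥Q≤ = proj₂ Q⊥

    rank-⊥ : ∀ {p q} → p P.≈ ⊥P → q Q.≈ ⊥Q → P.rank p ≡ Q.rank q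
    rank-⊥ p≈ q≈ = trans (P.rank-cong p≈) (trans (rank-least P P⊥)
                     (sym (trans (Q.rank-cong q≈) (rank-least Q Q⊥))))

    below-⊥P : ∀ {p p′} → p P.≤ p′ → p′ P.≈ ⊥P → p P.≈ ⊥P
    below-⊥P u e = P.antisym (P.trans u (P.reflexive e)) (⊥P≤ _)

    below-⊥Q : ∀ {q q′} → q Q.≤ q′ → q′ Q.≈ ⊥Q → q Q.≈ ⊥Q
    below-⊥Q u e = Q.antisym (Q.trans u (Q.reflexive e)) (⊥Q≤ _)

    ⊥P-≤ : ∀ {p p′} → p P.≈ ⊥P → p P.≤ p′
    ⊥P-≤ e = P.trans (P.reflexive e) (⊥P≤ _)

    ⊥Q-≤ : ∀ {q q′} → q Q.≈ ⊥Q → q Q.≤ q′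
    ⊥Q-≤ e = Q.trans (Q.reflexive e) (⊥Q≤ _)

  wedge : RankedPoset
  wedge = glue {P} {Q} record
    { _≍_    = λ p q → p P.≈ ⊥P × q Q.≈ ⊥Q
    ; _≍?_   = λ p q → (p P.≟ ⊥P) ×-dec (q Q.≟ ⊥Q)
    ; respˡ  = λ p≈p′ (e , f) → P.Eq.trans (P.Eq.sym p≈p′) e , f
    ; respʳ  = λ q≈q′ (e , f) → e , Q.Eq.trans (Q.Eq.sym q≈q′) f
    ; monoˡ  = λ (_ , f) _ _ → ⊥Q-≤ f
    ; monoʳ  = λ (e , _) _ _ → ⊥P-≤ e
    ; transˡ = λ u (e , f) _ → inj₁ (⊥Q , below-⊥P u e , Q.Eq.refl)
    ; transʳ = λ u (e , f) _ → inj₁ (⊥P , P.Eq.refl , below-⊥Q u f)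
    ; rank-≍ = λ (e , f) → rank-⊥ e f
    }

  module _ (P⊤ : HasGreatest P) (Q⊤ : HasGreatest Q) (sameHeight : height P ≡ height Q) where
    private
      ⊤P = proj₁ P⊤ ; ≤⊤P = proj₂ P⊤
      ⊤Q = proj₁ Q⊤ ; ≤⊤Q = proj₂ Q⊤

      rank-⊤ : ∀ {p q} → p P.≈ ⊤P → q Q.≈ ⊤Q → P.rank p ≡ Q.rank q
      rank-⊤ p≈ q≈ = trans (P.rank-cong p≈) (trans (rank-greatest P P⊤) (trans sameHeight
                       (sym (trans (Q.rank-cong q≈) (rank-greatest Q Q⊤)))))

      above-⊤P : ∀ {p p′} → p P.≤ p′ → p P.≈ ⊤P → p′ P.≈ ⊤P
      above-⊤P u e = P.antisym (≤⊤P _) (P.trans (P.reflexive (P.Eq.sym e)) u)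

      above-⊤Q : ∀ {q q′} → q Q.≤ q′ → q Q.≈ ⊤Q → q′ Q.≈ ⊤Q
      above-⊤Q u e = Q.antisym (≤⊤Q _) (Q.trans (Q.reflexive (Q.Eq.sym e)) u)

      -- In rank zero the least and largest elements coincide on both sides.
      collapseQ : ⊤P P.≤ ⊥P → ⊤Q Q.≤ ⊥Q
      collapseQ u with ⊥Q Q.≟ ⊤Q
      ... | yes e = Q.reflexive (Q.Eq.sym e)
      ... | no ≉  = contradiction (Q.rank-strict (⊥Q≤ ⊤Q , ≉)) (ℕₚ.≤⇒≯
        (subst₂ ℕ._≤_ (rank-⊤ P.Eq.refl Q.Eq.refl) (rank-⊥ P.Eq.refl Q.Eq.refl) (P.rank-mono u)))

      collapseP : ⊤Q Q.≤ ⊥Q → ⊤P P.≤ ⊥P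
      collapseP u with ⊥P P.≟ ⊤P
      ... | yes e = P.reflexive (P.Eq.sym e)
      ... | no ≉  = contradiction (P.rank-strict (⊥P≤ ⊤P , ≉)) (ℕₚ.≤⇒≯
        (subst₂ ℕ._≤_ (sym (rank-⊤ P.Eq.refl Q.Eq.refl)) (sym (rank-⊥ P.Eq.refl Q.Eq.refl))
          (Q.rank-mono u)))

      infix 4 _≍_
      _≍_ : REL P.Carrier Q.Carrier 0ℓ
      p ≍ q = (p P.≈ ⊥P × q Q.≈ ⊥Q) ⊎ (p P.≈ ⊤P × q Q.≈ ⊤Q)

      monoˡ : ∀ {p p′ q q′} → p ≍ q → p′ ≍ q′ → p P.≤ p′ → q Q.≤ q′
      monoˡ (inj₁ (_ , f)) _                _ = ⊥Q-≤ f
      monoˡ (inj₂ _)       (inj₂ (_ , f′))  _ = Q.trans (≤⊤Q _) (Q.reflexive (Q.Eq.sym f′))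
      monoˡ (inj₂ (e , f)) (inj₁ (e′ , f′)) u = Q.trans (Q.reflexive f) (Q.trans
        (collapseQ (P.≤-respˡ-≈ e (P.≤-respʳ-≈ e′ u))) (Q.reflexive (Q.Eq.sym f′)))

      monoʳ : ∀ {p p′ q q′} → p ≍ q → p′ ≍ q′ → q Q.≤ q′ → p P.≤ p′
      monoʳ (inj₁ (e , _)) _                _ = ⊥P-≤ e
      monoʳ (inj₂ _)       (inj₂ (e′ , _))  _ = P.trans (≤⊤P _) (P.reflexive (P.Eq.sym e′))
      monoʳ (inj₂ (e , f)) (inj₁ (e′ , f′)) u = P.trans (P.reflexive e) (P.trans
        (collapseP (Q.≤-respˡ-≈ f (Q.≤-respʳ-≈ f′ u))) (P.reflexive (P.Eq.sym e′)))

      transˡ : ∀ {p p′ q q′} → p P.≤ p′ → p′ ≍ q → q Q.≤ q′ → (∃ (p ≍_)) ⊎ (∃ (_≍ q′))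
      transˡ u (inj₁ (e , _)) v = inj₁ (⊥Q , inj₁ (below-⊥P u e , Q.Eq.refl))
      transˡ u (inj₂ (_ , f)) v = inj₂ (⊤P , inj₂ (P.Eq.refl , above-⊤Q v f))

      transʳ : ∀ {p p′ q q′} → q Q.≤ q′ → p ≍ q′ → p P.≤ p′ → (∃ (_≍ q)) ⊎ (∃ (p′ ≍_))
      transʳ u (inj₁ (_ , f)) v = inj₁ (⊥P , inj₁ (P.Eq.refl , below-⊥Q u f))
      transʳ u (inj₂ (e , _)) v = inj₂ (⊤Q , inj₂ (above-⊤P v e , Q.Eq.refl))

    diamond : RankedPoset
    diamond = glue {P} {Q} record
      { _≍_    = _≍_
      ; _≍?_   = λ p q → ((p P.≟ ⊥P) ×-dec (q Q.≟ ⊥Q)) ⊎-dec ((p P.≟ ⊤P) ×-dec (q Q.≟ ⊤Q))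
      ; respˡ  = λ p≈p′ → λ { (inj₁ (e , f)) → inj₁ (P.Eq.trans (P.Eq.sym p≈p′) e , f)
                            ; (inj₂ (e , f)) → inj₂ (P.Eq.trans (P.Eq.sym p≈p′) e , f) }
      ; respʳ  = λ q≈q′ → λ { (inj₁ (e , f)) → inj₁ (e , Q.Eq.trans (Q.Eq.sym q≈q′) f)
                            ; (inj₂ (e , f)) → inj₂ (e , Q.Eq.trans (Q.Eq.sym q≈q′) f) }
      ; monoˡ  = monoˡ
      ; monoʳ  = monoʳ
      ; transˡ = transˡ
      ; transʳ = transʳ
      ; rank-≍ = λ { (inj₁ (e , f)) → rank-⊥ e f ; (inj₂ (e , f)) → rank-⊤ e f }
      }

module _ where
  private variable n : ℕ

  Positive : Vec ℕ n → Set
  Positive = All (0 ℕ.<_)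

  Box : Vec ℕ n → Set
  Box {n} d = Σ[ a ∈ Vec ℕ n ] Pointwise ℕ._<_ a d

  module _ {d : Vec ℕ n} where
    infix 4 _≈ᴮ_ _≤ᴮ_

    _≈ᴮ_ : Rel (Box d) 0ℓ
    _≈ᴮ_ = _≡_ on proj₁

    _≤ᴮ_ : Rel (Box d) 0ℓ
    _≤ᴮ_ = Pointwise ℕ._≤_ on proj₁

  boxDecPoset : Vec ℕ n → DecPoset 0ℓ 0ℓ 0ℓ
  boxDecPoset d = record
    { Carrier = Box d ; _≈_ = _≈ᴮ_ ; _≤_ = _≤ᴮ_
    ; isDecPartialOrder = record
      { isPartialOrder = record
        { isPreorder = record
          { isEquivalence = record { refl = refl ; sym = sym ; trans = trans }
          ; reflexive     = λ { refl → PW.refl ℕₚ.≤-refl }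
          ; trans         = PW.trans ℕₚ.≤-trans
          }
        ; antisym = λ u v → PW.Pointwise-≡⇒≡ (antisym u v)
        }
      ; _≟_  = λ a b → Vecₚ.≡-dec ℕₚ._≟_ (proj₁ a) (proj₁ b)
      ; _≤?_ = λ a b → PW.decidable ℕₚ._≤?_ (proj₁ a) (proj₁ b)
      }
    }
    where
    antisym : ∀ {m} {a b : Vec ℕ m} →
              Pointwise ℕ._≤_ a b → Pointwise ℕ._≤_ b a → Pointwise _≡_ a b
    antisym []      []      = []
    antisym (p ∷ u) (q ∷ v) = ℕₚ.≤-antisym p q ∷ antisym u v

  boxElements : (d : Vec ℕ n) → List (Box d)
  boxElements []      = ([] , []) ∷ []
  boxElements (m ∷ d) =
    cartesianProductWith (λ i (a , a<d) → toℕ i ∷ a , toℕ<n i ∷ a<d) (allFin m) (boxElements d)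

  boxElements-all : (d : Vec ℕ n) → IsEnumeration (DecPoset.Eq.setoid (boxDecPoset d)) (boxElements d)
  boxElements-all []      ([] , [])         = here refl
  boxElements-all (m ∷ d) (x ∷ a , p ∷ a<d) =
    AnyLₚ.cartesianProductWith⁺ _ (λ { refl refl → cong (_∷ a) (sym (toℕ-fromℕ< p)) })
      (∈-allFin (fromℕ< p)) (boxElements-all d (a , a<d))

  boxElements-unique : (d : Vec ℕ n) → SetoidUnique.Unique (DecPoset.Eq.setoid (boxDecPoset d)) (boxElements d)
  boxElements-unique []      = AllL.[] ∷ []
  boxElements-unique (m ∷ d) =
    Uniqueₛ.cartesianProductWith⁺ (setoid (Fin m)) (DecPoset.Eq.setoid (boxDecPoset d))
      (DecPoset.Eq.setoid (boxDecPoset (m ∷ d))) _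
      (λ eq → toℕ-injective (Vecₚ.∷-injectiveˡ eq) , Vecₚ.∷-injectiveʳ eq)
      (allFin⁺ m) (boxElements-unique d)

  sum-mono : ∀ {a b : Vec ℕ n} → Pointwise ℕ._≤_ a b → Vec.sum a ℕ.≤ Vec.sum b
  sum-mono []      = z≤n
  sum-mono (p ∷ u) = ℕₚ.+-mono-≤ p (sum-mono u)

  step : ∀ {a b d : Vec ℕ n} → Pointwise ℕ._≤_ a b → ¬ a ≡ b → Pointwise ℕ._<_ b d →
         Σ[ c ∈ Vec ℕ n ] Pointwise ℕ._≤_ a c × Pointwise ℕ._≤_ c b ×
           Pointwise ℕ._<_ c d × Vec.sum c ≡ suc (Vec.sum a)
  step [] a≢b [] = contradiction refl a≢b
  step {a = x ∷ a} {b = y ∷ b} (p ∷ u) a≢b (y<m ∷ b<d) with x ℕₚ.≟ y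
  ... | no x≢y = suc x ∷ a , ℕₚ.n≤1+n x ∷ PW.refl ℕₚ.≤-refl , ℕₚ.≤∧≢⇒< p x≢y ∷ u ,
                 ℕₚ.≤-<-trans (ℕₚ.≤∧≢⇒< p x≢y) y<m ∷ PW.trans ℕₚ.≤-<-trans u b<d , refl
  ... | yes refl with step u (λ a≡b → a≢b (cong (x ∷_) a≡b)) b<d
  ...   | c , a≤c , c≤b , c<d , eq =
    x ∷ c , ℕₚ.≤-refl ∷ a≤c , ℕₚ.≤-refl ∷ c≤b , y<m ∷ c<d ,
    trans (cong (x +_) eq) (ℕₚ.+-suc x _)

  zeros : ∀ {d : Vec ℕ n} → Positive d → Pointwise ℕ._<_ (Vec.replicate n 0) d
  zeros []      = []
  zeros (p ∷ q) = p ∷ zeros q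

  zeros-≤ : (a : Vec ℕ n) → Pointwise ℕ._≤_ (Vec.replicate n 0) a
  zeros-≤ []      = []
  zeros-≤ (_ ∷ a) = z≤n ∷ zeros-≤ a

  sum-zeros : ∀ n → Vec.sum (Vec.replicate n 0) ≡ 0
  sum-zeros zero    = refl
  sum-zeros (suc n) = sum-zeros n

  preds : ∀ {d : Vec ℕ n} → Positive d → Pointwise ℕ._<_ (Vec.map pred d) d
  preds []            = []
  preds (s≤s p ∷ q) = ℕₚ.≤-refl ∷ preds q

  ≤-preds : ∀ {a d : Vec ℕ n} → Pointwise ℕ._<_ a d → Pointwise ℕ._≤_ a (Vec.map pred d)
  ≤-preds []            = []
  ≤-preds (s≤s p ∷ u) = p ∷ ≤-preds u

  CL : (d : Vec ℕ n) → Positive d → RankedPoset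
  CL {n} d d⁺ = record
    { decPoset        = boxDecPoset d
    ; elements        = boxElements d
    ; elements-all    = boxElements-all d
    ; elements-unique = boxElements-unique d
    ; rank            = Vec.sum ∘ proj₁
    ; rank-cong       = cong Vec.sum
    ; rank-strict     = λ {a} {b} → strict {a} {b}
    ; rank-cover      = λ {a} {b} → cover {a} {b}
    ; rank-minimal    = λ min → trans (sym (cong Vec.sum (min (_ , zeros d⁺) (zeros-≤ _)))) (sum-zeros n)
    }
    where
    open ToStrict (_≈ᴮ_ {d = d}) _≤ᴮ_ using (_<_)

    strict : ∀ {a b} → a < b → Vec.sum (proj₁ a) ℕ.< Vec.sum (proj₁ b)
    strict {a} {b} (a≤b , a≢b) with step a≤b a≢b (proj₂ b)
    ... | c , _ , c≤b , _ , eq = ℕₚ.≤-trans (ℕₚ.≤-reflexive (sym eq)) (sum-mono c≤b)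

    cover : ∀ {a b} → a < b × (∀ c → ¬ (a < c × c < b)) →
            Vec.sum (proj₁ b) ≡ suc (Vec.sum (proj₁ a))
    cover {a} {b} ((a≤b , a≢b) , none) with step a≤b a≢b (proj₂ b)
    ... | c , a≤c , c≤b , c<d , eq with Vecₚ.≡-dec ℕₚ._≟_ c (proj₁ b)
    ...   | yes refl = eq
    ...   | no  c≢b  = contradiction
      ((a≤c , λ a≡c → ℕₚ.1+n≢n (trans (sym eq) (cong Vec.sum (sym a≡c)))) , (c≤b , c≢b))
      (none (c , c<d))

  least : {d : Vec ℕ n} (d⁺ : Positive d) → HasLeast (CL d d⁺)
  least d⁺ = (_ , zeros d⁺) , λ a → zeros-≤ (proj₁ a)

  greatest : {d : Vec ℕ n} (d⁺ : Positive d) → HasGreatest (CL d d⁺)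
  greatest d⁺ = (_ , preds d⁺) , λ a → ≤-preds (proj₂ a)

  sides : Vec ℕ n → List ℕ
  sides d = filter (1 ℕₚ.<?_) (toList d)

  IsPath : (d : Vec ℕ n) → Positive d → Set
  IsPath d d⁺ = dimension (CL d d⁺) ≡ 1

rectangle⁺ : ∀ {m n} → 1 ℕ.< m → m ℕ.≤ n → Positive (m ∷ n ∷ [])
rectangle⁺ 1<m m≤n = ℕₚ.<⇒≤ 1<m ∷ ℕₚ.≤-trans (ℕₚ.<⇒≤ 1<m) m≤n ∷ []

{-# OPTIONS --safe #-}

-- Sufficiency. A product with one more chain, the longest and the least
-- significant in the lexicographic order, is cut into slices.  If the shadow of
-- every slice lies in the preceding slice, then replacing the slices by segments
-- shows that no set has a smaller shadow than the segment of its size, because an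
-- element can be raised to the rank of any lexicographically larger one without
-- overtaking it.  Compressing the slices and the planes spanned by the last two
-- coordinates reaches this situation.  Starting from two copies of a point rather
-- than one proves this for two disjoint copies of a box, hence for P ◇ P.  Sums of
-- rectangles, of which a path is one, are compared by explicit shadow sizes.
--
-- Necessity.  The Macaulay property passes to the complemented order.  The
-- multiples of the first atom are segments in all ranks, so nearly all coatoms of
-- its part come first, and dually for the last coatom.  Comparing the shadows of
-- two or three atoms then leaves the exceptional cases, or else one part precedes
-- the other in all ranks; in the latter case the order and its dual force equal
-- Hilbert functions, and these determine the side lengths.  For rectangles with
-- m < m′ ≤ n′ < n the first elements must lie in the m × n rectangle up to the
-- rank where all of the m′ × n′ rectangle has a smaller shadow.

module Submission where

open import Defs
open import Data.Bool.Base using (Bool; true; false; not; _∧_; _∨_)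
import Data.Bool.Properties as Boolₚ
import Data.Empty
open import Data.Fin.Base as Fin using (Fin; zero; suc; toℕ; fromℕ<; fromℕ; inject₁)
import Data.Fin.Properties as Finₚ
open import Data.List.Base as List
  using (List; []; _∷_; _++_; allFin; cartesianProduct; length; take; filter)
import Data.List.Properties as Listₚ
open import Data.List.Membership.Propositional using (_∈_; find; lose)
import Data.List.Membership.Propositional.Properties as ∈ₚ
import Data.List.Membership.Setoid as SetoidMembership
import Data.List.Membership.Setoid.Properties as ∈ₛ
import Data.List.Relation.Binary.Subset.Setoid as SetoidSubset
open import Data.List.Relation.Binary.Permutation.Propositional as Perm
  using (_↭_; ↭-sym; ↭-trans; ↭-refl)
import Data.List.Relation.Binary.Permutation.Propositional.Properties as Permₚ
open import Data.List.Relation.Unary.All as AllL using ([]; _∷_)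
import Data.List.Relation.Unary.All.Properties as AllLₚ
open import Data.List.Relation.Unary.AllPairs as AllPairs using (AllPairs; []; _∷_)
open import Data.List.Relation.Unary.Any as Any using (here; there; any?)
import Data.List.Relation.Unary.Any.Properties as Anyₚ
open import Data.List.Relation.Unary.Linked as Linked using (Linked; []; [-]; _∷_)
import Data.List.Relation.Unary.Linked.Properties as Linkedₚ
open import Data.List.Relation.Unary.Unique.Propositional using (Unique)
import Data.List.Relation.Unary.Unique.Propositional.Properties as Uniqueₚ
import Data.List.Relation.Unary.Unique.Setoid as SetoidUnique
import Data.List.Relation.Unary.Unique.Setoid.Properties as Uniqueₛ
import Data.List.Relation.Binary.Permutation.Setoid.Properties as PermSₚ
import Data.List.Sort as Sort
import Relation.Binary.Construct.Flip.EqAndOrd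
open import Data.List.Extrema.Nat using (v≤max⁺)
open import Data.Nat.Base as ℕ using (ℕ; zero; suc; pred; _+_; _*_; _∸_; _≤_; _<_; z≤n; s≤s; s≤s⁻¹)
open import Data.Nat.Induction using (<-wellFounded)
import Data.Nat.ListAction as ℕL
import Data.Nat.ListAction.Properties as ℕLₚ
import Data.Nat.Properties as ℕₚ
open import Data.Nat.Properties using
  ( ≤-trans; ≤-reflexive; ≤-<-trans; +-identityʳ; +-comm; <-≤-trans; ≤-refl; +-mono-≤; +-suc; +-assoc; +-monoˡ-≤; suc-injective
  ; ≤-antisym; ≮⇒≥; <⇒≤; <⇒≢; +-monoʳ-≤; n≤1+n; <-trans; m≤n+m; +-cancelˡ-≤; <⇒≱
  ; m∸n+n≡m; m≤m+n; n<1+n; <-irrefl; ≰⇒>; n≢0⇒n>0; +-cancelˡ-≡; m+[n∸m]≡n; +-cancelʳ-≡ )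
open import Data.Product.Base using (∃; ∃₂; _×_; _,_; proj₁; proj₂)
open import Data.Product.Properties using (≡-dec)
open import Data.Product.Relation.Binary.Lex.NonStrict as Lex using (×-Lex)
open import Data.Product.Relation.Binary.Pointwise.NonDependent using (≡×≡⇒≡)
open import Data.Sum.Base as Sum using (_⊎_; inj₁; inj₂; [_,_]′)
import Data.Sum.Properties as Sumₚ
open import Data.Sum.Relation.Binary.Pointwise as SumR using (inj₁; inj₂)
open import Data.Unit.Base using (⊤; tt)
open import Data.Vec.Base as Vec using (Vec; []; _∷_; toList)
import Data.Vec.Properties as Vecₚ
open import Data.Vec.Relation.Binary.Pointwise.Inductive as PW using (Pointwise; []; _∷_)
open import Data.Vec.Relation.Unary.All using (All; []; _∷_)
open import Function.Base using (_∘_; id; _on_; case_of_)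
open import Function.Bundles using (_⇔_; mk⇔)
open import Induction.WellFounded using (Acc; acc)
open import Level using (0ℓ)
open import Relation.Binary.Bundles using (Setoid)
open import Relation.Binary.Consequences using (total∧dec⇒dec)
open import Relation.Binary.Construct.Closure.ReflexiveTransitive as Star using (Star; ε; _◅_; _◅◅_)
open import Relation.Binary.Core using (Rel)
open import Relation.Binary.Definitions using (DecidableEquality; Decidable; Total; Transitive; tri<; tri≈; tri>)
open import Relation.Binary.Morphism.Structures using (IsOrderIsomorphism)
open import Relation.Binary.PropositionalEquality
  using (_≡_; _≢_; refl; sym; trans; cong; cong₂; subst; subst₂; setoid; module ≡-Reasoning)
import Relation.Binary.PropositionalEquality.Properties as ≡ₚ
open import Relation.Binary.Structures using (IsTotalOrder)
import Relation.Nullary.Decidable as Dec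
open import Relation.Nullary.Decidable
  using (Dec; yes; no; does; map′; ¬?; _×-dec_; _→-dec_; dec-true; dec-false)
open import Relation.Nullary.Negation using (¬_; contradiction)
import Relation.Unary as U


-- Finite sums and injections

-- Identification is visible only in rank 0 and, for diamonds, in the top rank. There a single point
-- is comparable with everything in the adjacent rank, so the Macaulay conditions hold for every
-- order. All other ranks are those of the disjoint union of the two boxes, and the argument runs in
-- that union, rank by rank. The slices give the exact count behind sufficiency. If A has slices A₀,
-- ..., Aₙ and the shadow of each lies in the preceding one, then |∂A| = |∂A₀| + |A| - |Aₙ|. Only
-- the bottom and the top slice matter, and the lexicographic segment has the smallest bottom and
-- the largest top. Necessity for diamonds rests on three facts about atoms, read as variables:
-- distinct variables have a nonzero product; the square of x vanishes exactly when the side through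
-- x has length two; adding x to a set A of variables creates at most dim - |A| new products. Each
-- exceptional case is an equality case of such an estimate. The comparison of ranks 1 and 2 needs
-- both to be free of identification, hence rank at least three; smaller ranks are listed.

does⁻ : {A : Set} (a? : Dec A) → does a? ≡ true → A
does⁻ (yes a) _ = a

true≢false : ∀ {b} → b ≡ true → b ≡ false → ∀ {A : Set} → A
true≢false refl ()

¬true⇒false : ∀ {b} → ¬ b ≡ true → b ≡ false
¬true⇒false = Boolₚ.¬-not

∨-elim : ∀ {a b} → a ∨ b ≡ true → a ≡ true ⊎ b ≡ true
∨-elim {true}  _ = inj₁ refl
∨-elim {false} e = inj₂ e

∨-introˡ : ∀ {a b} → a ≡ true → a ∨ b ≡ true
∨-introˡ refl = refl

∨-introʳ : ∀ {a b} → b ≡ true → a ∨ b ≡ true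
∨-introʳ {a} refl = Boolₚ.∨-zeroʳ a

𝟙 : Bool → ℕ
𝟙 true  = 1
𝟙 false = 0

𝟙-mono : ∀ {a b} → (a ≡ true → b ≡ true) → 𝟙 a ≤ 𝟙 b
𝟙-mono {false} _ = z≤n
𝟙-mono {true}  h rewrite h refl = ≤-refl

module _ {X : Set} where

  ∑ : List X → (X → ℕ) → ℕ
  ∑ []       f = 0
  ∑ (x ∷ xs) f = f x + ∑ xs f

  ∑-mono : ∀ xs {f g} → (∀ x → f x ≤ g x) → ∑ xs f ≤ ∑ xs g
  ∑-mono []       h = z≤n
  ∑-mono (x ∷ xs) h = +-mono-≤ (h x) (∑-mono xs h)

  ∑-cong : ∀ xs {f g} → (∀ x → f x ≡ g x) → ∑ xs f ≡ ∑ xs g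
  ∑-cong []       h = refl
  ∑-cong (x ∷ xs) h = cong₂ _+_ (h x) (∑-cong xs h)

  ∑-strict : ∀ {xs f g x} → (∀ x → f x ≤ g x) → x ∈ xs → f x < g x → ∑ xs f < ∑ xs g
  ∑-strict {_ ∷ xs} h (here refl) l = ℕₚ.+-mono-<-≤ l (∑-mono xs h)
  ∑-strict {y ∷ _}  h (there p)   l = ℕₚ.+-mono-≤-< (h y) (∑-strict h p l)

  ∑-+ : ∀ xs {f g} → ∑ xs (λ x → f x + g x) ≡ ∑ xs f + ∑ xs g
  ∑-+ []                   = refl
  ∑-+ (x ∷ xs) {f} {g} rewrite ∑-+ xs {f} {g} =
    begin
      f x + g x + (∑ xs f + ∑ xs g)   ≡⟨ +-assoc (f x) _ _ ⟩
      f x + (g x + (∑ xs f + ∑ xs g)) ≡⟨ cong (f x +_) (sym (+-assoc (g x) _ _)) ⟩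
      f x + (g x + ∑ xs f + ∑ xs g)   ≡⟨ cong (λ z → f x + (z + ∑ xs g)) (+-comm (g x) _) ⟩
      f x + (∑ xs f + g x + ∑ xs g)   ≡⟨ cong (f x +_) (+-assoc (∑ xs f) _ _) ⟩
      f x + (∑ xs f + (g x + ∑ xs g)) ≡⟨ sym (+-assoc (f x) _ _) ⟩
      f x + ∑ xs f + (g x + ∑ xs g)   ∎
    where open ≡-Reasoning

  ∑-* : ∀ xs {f} c → ∑ xs (λ x → f x * c) ≡ ∑ xs f * c
  ∑-* []       c = refl
  ∑-* (x ∷ xs) {f} c rewrite ∑-* xs {f} c = sym (ℕₚ.*-distribʳ-+ c (f x) (∑ xs f))

  ∑-0 : ∀ xs → ∑ xs (λ _ → 0) ≡ 0
  ∑-0 []       = refl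
  ∑-0 (_ ∷ xs) = ∑-0 xs

  ∑-++ : ∀ xs ys {f} → ∑ (xs ++ ys) f ≡ ∑ xs f + ∑ ys f
  ∑-++ []       ys     = refl
  ∑-++ (x ∷ xs) ys {f} = trans (cong (f x +_) (∑-++ xs ys)) (sym (+-assoc (f x) _ _))

  ∑-<⇒∃ : ∀ xs {f g} → ∑ xs f < ∑ xs g → ∃ λ x → f x < g x
  ∑-<⇒∃ (x ∷ xs) {f} {g} l with f x ℕₚ.<? g x
  ... | yes p = x , p
  ... | no ¬p = ∑-<⇒∃ xs (ℕₚ.+-cancelˡ-< (g x) _ _
                  (≤-<-trans (+-monoˡ-≤ _ (≮⇒≥ ¬p)) l))

∑-map : ∀ {X Y : Set} (h : X → Y) xs {f} → ∑ (List.map h xs) f ≡ ∑ xs (f ∘ h)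
∑-map h []       = refl
∑-map h (x ∷ xs) = cong (_ +_) (∑-map h xs)

∑-swap : ∀ {X Y : Set} (xs : List X) (ys : List Y) (f : X → Y → ℕ) →
         ∑ xs (λ x → ∑ ys (f x)) ≡ ∑ ys (λ y → ∑ xs (λ x → f x y))
∑-swap []       ys f = sym (∑-0 ys)
∑-swap (x ∷ xs) ys f = trans (cong (∑ ys (f x) +_) (∑-swap xs ys f)) (sym (∑-+ ys))

∑-× : ∀ {X Y : Set} (xs : List X) (ys : List Y) {f : X × Y → ℕ} →
      ∑ (cartesianProduct xs ys) f ≡ ∑ xs (λ x → ∑ ys (λ y → f (x , y)))
∑-× []       ys = refl
∑-× (x ∷ xs) ys = trans (∑-++ (List.map (x ,_) ys) (cartesianProduct xs ys))
                        (cong₂ _+_ (∑-map (x ,_) ys) (∑-× xs ys))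

∑-suc : ∀ n {f : Fin (suc n) → ℕ} → ∑ (allFin (suc n)) f ≡ f zero + ∑ (allFin n) (f ∘ suc)
∑-suc n {f} = cong (f zero +_) (trans (cong (λ xs → ∑ xs f) (sym (Listₚ.map-tabulate id suc)))
                                      (∑-map suc (allFin n)))

∑-last : ∀ n {f : Fin (suc n) → ℕ} → ∑ (allFin (suc n)) f ≡ ∑ (allFin n) (f ∘ inject₁) + f (fromℕ n)
∑-last zero    {f} = +-comm (f zero) 0
∑-last (suc n) {f} = begin
  ∑ (allFin (suc (suc n))) f                                ≡⟨ ∑-suc (suc n) {f} ⟩
  f zero + ∑ (allFin (suc n)) (f ∘ suc)                     ≡⟨ cong (f zero +_) (∑-last n) ⟩
  f zero + (∑ (allFin n) (f ∘ suc ∘ inject₁) + f (fromℕ (suc n))) ≡⟨ sym (+-assoc (f zero) _ _) ⟩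
  f zero + ∑ (allFin n) (f ∘ suc ∘ inject₁) + f (fromℕ (suc n))   ≡⟨ cong (_+ f (fromℕ (suc n))) (sym (∑-suc n {f ∘ inject₁})) ⟩
  ∑ (allFin (suc n)) (f ∘ inject₁) + f (fromℕ (suc n))      ∎
  where open ≡-Reasoning

module Pigeonhole (S : Setoid 0ℓ 0ℓ) where
  open Setoid S using (Carrier; _≈_) renaming (sym to ≈-sym; trans to ≈-trans)
  open SetoidMembership S using () renaming (_∈_ to _∈ˢ_)
  open SetoidSubset S using (_⊆_)
  open SetoidUnique S using () renaming (Unique to Uniqueˢ)

  private
    remove : ∀ {x : Carrier} ys → x ∈ˢ ys →
             ∃ λ zs → length ys ≡ suc (length zs) × (∀ {y} → y ∈ˢ ys → ¬ y ≈ x → y ∈ˢ zs)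
    remove (y ∷ ys) (here x≈y) = ys , refl , λ { (here z≈y) z≉x → contradiction (≈-trans z≈y (≈-sym x≈y)) z≉x
                                               ; (there p) _ → p }
    remove (y ∷ ys) (there p) with remove ys p
    ... | zs , eq , h = y ∷ zs , cong suc eq , λ { (here z≈y) _ → here z≈y ; (there q) z≉x → there (h q z≉x) }

  ⊆⇒length≤ : ∀ {xs ys} → Uniqueˢ xs → xs ⊆ ys → length xs ≤ length ys
  ⊆⇒length≤ {[]}     _        _ = z≤n
  ⊆⇒length≤ {x ∷ xs} (x∉ ∷ u) s with remove _ (s (here (Setoid.refl S)))
  ... | zs , eq , h rewrite eq = s≤s (⊆⇒length≤ u λ {y} p →
    h (s (there p)) λ y≈x → AllLₚ.All¬⇒¬Any x∉ (Any.map (λ y≈z → ≈-trans (≈-sym y≈x) y≈z) p))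


-- Subsets of the levels of a ranked poset

-- Covers are read off from the rank, so that no search for intermediate elements is needed, and
-- equality is propositional. Both are possible because these posets are never glued.
record Po : Set₁ where
  infix 4 _⊑_ _⊑?_ _≟_ _⋖_ _⋖?_
  field
    X        : Set
    els      : List X
    complete : ∀ x → x ∈ els
    unique   : Unique els
    _≟_      : DecidableEquality X
    rk       : X → ℕ
    _⊑_      : Rel X 0ℓ
    _⊑?_     : Decidable _⊑_
    ⊑-refl   : ∀ {x} → x ⊑ x
    ⊑-rk     : ∀ {x y} → x ⊑ y → rk x ≤ rk y
    ⊑-eq     : ∀ {x y} → x ⊑ y → rk x ≡ rk y → x ≡ y

  _⋖_ : Rel X 0ℓ
  x ⋖ y = x ⊑ y × rk y ≡ suc (rk x)

  _⋖?_ : Decidable _⋖_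
  x ⋖? y = (x ⊑? y) ×-dec (rk y ℕₚ.≟ suc (rk x))

  ∃? : {Q : X → Set} → U.Decidable Q → Dec (∃ Q)
  ∃? Q? = map′ Any.satisfied (λ (x , q) → lose (complete x) q) (any? Q? els)

  ∀? : {Q : X → Set} → U.Decidable Q → (∀ x → Q x) ⊎ (∃ λ x → ¬ Q x)
  ∀? Q? with ∃? (¬? ∘ Q?)
  ... | yes e = inj₂ e
  ... | no ¬e = inj₁ λ x → case Q? x of λ { (yes q) → q ; (no ¬q) → contradiction (x , ¬q) ¬e }

module Subsets (P : Po) where
  open Po P

  Subset : Set
  Subset = X → Bool

  infix 4 _∋_ _⊆_

  _∋_ : Subset → X → Set
  A ∋ x = A x ≡ true

  _⊆_ : Rel Subset 0ℓ
  A ⊆ B = ∀ {x} → A ∋ x → B ∋ x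

  _∋?_ : ∀ A → U.Decidable (A ∋_)
  A ∋? x = A x Boolₚ.≟ true

  ⟦_⟧ : {Q : X → Set} → U.Decidable Q → Subset
  ⟦ Q? ⟧ x = does (Q? x)

  card : Subset → ℕ
  card A = ∑ els (𝟙 ∘ A)

  infixr 6 _∪_
  _∪_ : Subset → Subset → Subset
  (A ∪ B) x = A x ∨ B x

  infixr 6 _∖_
  _∖_ : Subset → Subset → Subset
  (A ∖ B) x = A x ∧ not (B x)

  ｛_｝ : X → Subset
  ｛ x ｝ y = does (x ≟ y)

  ∅ : Subset
  ∅ _ = false

  lvl : ℕ → Subset
  lvl e = ⟦ (λ x → rk x ℕₚ.≟ e) ⟧

  ∂-dec : ∀ A y → Dec (∃ λ x → A ∋ x × x ⋖ y)
  ∂-dec A y = ∃? (λ x → (A ∋? x) ×-dec (x ⋖? y))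

  ∂ : Subset → Subset
  ∂ A = ⟦ ∂-dec A ⟧

  ∂⁺ : ∀ {A x y} → A ∋ x → x ⋖ y → ∂ A ∋ y
  ∂⁺ {A} {x} {y} a c = dec-true (∂-dec A y) (x , a , c)

  ∂⁻ : ∀ {A y} → ∂ A ∋ y → ∃ λ x → A ∋ x × x ⋖ y
  ∂⁻ {A} {y} = does⁻ (∂-dec A y)

  ∂-mono : ∀ {A B} → A ⊆ B → ∂ A ⊆ ∂ B
  ∂-mono {A} {B} s {y} p with ∂⁻ {A} {y} p
  ... | x , a , c = ∂⁺ {B} (s a) c

  Hom : ℕ → Subset → Set
  Hom e A = ∀ {x} → A ∋ x → rk x ≡ e

  ∂-hom : ∀ {e A} → Hom e A → Hom (suc e) (∂ A)
  ∂-hom {e} {A} h {y} p with ∂⁻ {A} {y} p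
  ... | x , a , _ , r = trans r (cong suc (h a))

  lvl⁺ : ∀ {e x} → rk x ≡ e → lvl e ∋ x
  lvl⁺ {e} {x} = dec-true (rk x ℕₚ.≟ e)

  lvl-hom : ∀ {e} → Hom e (lvl e)
  lvl-hom {e} {x} = does⁻ (rk x ℕₚ.≟ e)

  hom⇒⊆lvl : ∀ {e A} → Hom e A → A ⊆ lvl e
  hom⇒⊆lvl h = lvl⁺ ∘ h

  ∖⁺ : ∀ {A B x} → A ∋ x → ¬ B ∋ x → (A ∖ B) ∋ x
  ∖⁺ {A} {B} {x} a ¬b rewrite a | ¬true⇒false ¬b = refl

  ∖⁻ : ∀ {A B x} → (A ∖ B) ∋ x → A ∋ x × ¬ B ∋ x
  ∖⁻ {A} {B} {x} e with A x | B x
  ∖⁻ e  | true  | false = refl , λ ()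
  ∖⁻ () | true  | true
  ∖⁻ () | false | _

  ｛｝⁻ : ∀ {x y} → ｛ x ｝ ∋ y → x ≡ y
  ｛｝⁻ {x} {y} = does⁻ (x ≟ y)

  ｛｝⁺ : ∀ {x} → ｛ x ｝ ∋ x
  ｛｝⁺ {x} = dec-true (x ≟ x) refl

  card-mono : ∀ {A B} → A ⊆ B → card A ≤ card B
  card-mono s = ∑-mono els λ x → 𝟙-mono s

  card-cong : ∀ {A B} → A ⊆ B → B ⊆ A → card A ≡ card B
  card-cong s t = ≤-antisym (card-mono s) (card-mono t)

  card-strict : ∀ {A B x} → A ⊆ B → B ∋ x → ¬ A ∋ x → card A < card B
  card-strict {A} {B} {x} s b ¬a = ∑-strict (λ x → 𝟙-mono s) (complete x) lt
    where
    lt : 𝟙 (A x) < 𝟙 (B x)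
    lt rewrite b | ¬true⇒false ¬a = s≤s z≤n

  card<⇒∃ : ∀ {A B} → card A < card B → ∃ λ x → B ∋ x × ¬ A ∋ x
  card<⇒∃ {A} {B} l with ∑-<⇒∃ els l
  ... | x , p with A x in eqA | B x in eqB
  ...   | false | true = x , eqB , λ a → true≢false a eqA
  card<⇒∃ l | x , s≤s () | true | true

  ⊆∧≥⇒⊇ : ∀ {A B} → A ⊆ B → card B ≤ card A → B ⊆ A
  ⊆∧≥⇒⊇ {A} {B} s l {x} b with A x in eq
  ... | true  = refl
  ... | false = contradiction l (<⇒≱ (card-strict {A} {B} s b λ a → true≢false a eq))

  card-disjoint : ∀ {A B} → (∀ {x} → A ∋ x → ¬ B ∋ x) → card (A ∪ B) ≡ card A + card B
  card-disjoint {A} {B} d = trans (∑-cong els eq) (∑-+ els)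
    where
    eq : ∀ x → 𝟙 ((A ∪ B) x) ≡ 𝟙 (A x) + 𝟙 (B x)
    eq x with A x in eqA | B x in eqB
    ... | true  | true  = contradiction eqB (d eqA)
    ... | true  | false = refl
    ... | false | _     = refl

  card-∪ : ∀ {A B} → card (A ∪ B) ≤ card A + card B
  card-∪ {A} {B} = ≤-trans (∑-mono els le) (≤-reflexive (∑-+ els))
    where
    le : ∀ x → 𝟙 ((A ∪ B) x) ≤ 𝟙 (A x) + 𝟙 (B x)
    le x with A x | B x
    ... | true  | b     = s≤s z≤n
    ... | false | _     = ≤-refl

  card-∖ : ∀ {A B} → B ⊆ A → card (A ∖ B) + card B ≡ card A
  card-∖ {A} {B} s = trans (sym (∑-+ els)) (∑-cong els eq)
    where
    eq : ∀ x → 𝟙 ((A ∖ B) x) + 𝟙 (B x) ≡ 𝟙 (A x)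
    eq x with A x in eqA | B x in eqB
    ... | true  | true  = refl
    ... | true  | false = refl
    ... | false | true  = true≢false (s eqB) eqA
    ... | false | false = refl

  card-∅ : ∀ {A} → (∀ {x} → ¬ A ∋ x) → card A ≡ 0
  card-∅ {A} n = trans (∑-cong els λ x → cong 𝟙 (¬true⇒false (n {x}))) (∑-0 els)

  card>0 : ∀ {A x} → A ∋ x → 0 < card A
  card>0 {A} {x} a = ≤-<-trans z≤n (card-strict {∅} {A} (λ ()) a λ ())

  card>0⇒∃ : ∀ {A} → 0 < card A → ∃ (A ∋_)
  card>0⇒∃ {A} l with card<⇒∃ {∅} {A} (subst (_< card A) (sym (card-∅ {∅} λ ())) l)
  ... | x , a , _ = x , a

  card-｛｝ : ∀ {x} → card ｛ x ｝ ≡ 1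
  card-｛｝ {x} = go els unique (complete x)
    where
    zeros′ : ∀ ys → AllL.All (x ≢_) ys → ∑ ys (𝟙 ∘ ｛ x ｝) ≡ 0
    zeros′ []       _        = refl
    zeros′ (y ∷ ys) (n ∷ ns) rewrite dec-false (x ≟ y) n = zeros′ ys ns
    go : ∀ ys → Unique ys → x ∈ ys → ∑ ys (𝟙 ∘ ｛ x ｝) ≡ 1
    go (_ ∷ ys) (n ∷ _) (here refl) rewrite dec-true (x ≟ x) refl = cong suc (zeros′ ys n)
    go (y ∷ ys) (n ∷ u) (there p)
      rewrite dec-false (x ≟ y) (λ x≡y → AllL.lookup n p (sym x≡y)) = go ys u p

  card-∪｛｝ : ∀ {A x} → ¬ A ∋ x → card (A ∪ ｛ x ｝) ≡ suc (card A)
  card-∪｛｝ {A} {x} ¬a = trans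
    (card-disjoint {A} {｛ x ｝} λ {y} a p → ¬a (subst (A ∋_) (sym (｛｝⁻ {x} {y} p)) a))
    (trans (cong (card A +_) (card-｛｝ {x})) (+-comm _ 1))

  ∪-hom : ∀ {e A B} → Hom e A → Hom e B → Hom e (A ∪ B)
  ∪-hom {e} {A} h k {x} p with ∨-elim {A x} p
  ... | inj₁ a = h a
  ... | inj₂ b = k b

  ｛｝-hom : ∀ {x} → Hom (rk x) ｛ x ｝
  ｛｝-hom {x} {y} p = cong rk (sym (｛｝⁻ {x} {y} p))

  ∪⁻ : ∀ {A B x} → (A ∪ B) ∋ x → A ∋ x ⊎ B ∋ x
  ∪⁻ {A} {B} {x} = ∨-elim {A x}

  ∪⁺ˡ : ∀ {A B x} → A ∋ x → (A ∪ B) ∋ x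
  ∪⁺ˡ = ∨-introˡ

  ∪⁺ʳ : ∀ {A B x} → B ∋ x → (A ∪ B) ∋ x
  ∪⁺ʳ {A} {B} {x} = ∨-introʳ {A x}

  module _ (_≲_ : Rel X 0ℓ) where

    Closed : Subset → Set
    Closed S = ∀ {x y} → S ∋ x → x ≲ y → rk y ≡ rk x → S ∋ y

    -- Larger elements come first, so the closed sets of one rank are its segments.
    MacAt : ℕ → Set
    MacAt e = (∀ {A S} → Hom e A → Hom e S → Closed S → card S ≡ card A → card (∂ S) ≤ card (∂ A))
            × (∀ {S} → Hom e S → Closed S → Closed (∂ S))

  lvl-closed : ∀ {_≲_ : Rel X 0ℓ} {e} → Closed _≲_ (lvl e)
  lvl-closed {e = e} p _ r = lvl⁺ (trans r (lvl-hom {e} p))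

  module Segments (_≲_ : Rel X 0ℓ) (total : Total _≲_) (≲-trans : Transitive _≲_) where

    -- An element of `S` outside `T` would lie below every element of `T`, which forces `T` to be a
    -- proper subset of `S`. This is the step by which sizes become inclusions throughout.
    nested : ∀ {e S T} → Hom e S → Hom e T → Closed _≲_ S → Closed _≲_ T → card S ≤ card T → S ⊆ T
    nested {e} {S} {T} hS hT cS cT l {x} s with T x in eq
    ... | true  = refl
    ... | false = contradiction l (<⇒≱ (card-strict {T} {S} T⊆S s λ t → true≢false t eq))
      where
      T⊆S : T ⊆ S
      T⊆S {y} t with total x y
      ... | inj₁ x≲y = cS s x≲y (trans (hT t) (sym (hS s)))
      ... | inj₂ y≲x = true≢false (cT t y≲x (trans (hS s) (sym (hT t)))) eq

    maximum : ∀ {Q : X → Set} → U.Decidable Q → ∃ Q → ∃ λ m → Q m × (∀ {x} → Q x → x ≲ m)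
    maximum {Q} Q? (x₀ , q₀) = go els (complete) 
      where
      best : ∀ ys → ∃ λ m → Q m × (x₀ ≲ m) × (∀ {x} → x ∈ ys → Q x → x ≲ m)
      best [] = x₀ , q₀ , [ id , id ]′ (total x₀ x₀) , λ ()
      best (y ∷ ys) with best ys | Q? y
      ... | m , q , u , h | no ¬q = m , q , u , λ { (here refl) q′ → contradiction q′ ¬q ; (there p) → h p }
      ... | m , q , u , h | yes q′ with total y m
      ...   | inj₁ y≲m = m , q , u , λ { (here refl) _ → y≲m ; (there p) → h p }
      ...   | inj₂ m≲y = y , q′ , ≲-trans u m≲y ,
                         λ { (here refl) _ → [ id , id ]′ (total y y) ; (there p) q″ → ≲-trans (h p q″) m≲y }
      go : ∀ ys → (∀ x → x ∈ ys) → ∃ λ m → Q m × (∀ {x} → Q x → x ≲ m)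
      go ys c with best ys
      ... | m , q , _ , h = m , q , λ {x} → h (c x)

    module _ {e} (antisym : ∀ {x y} → rk x ≡ e → rk y ≡ e → x ≲ y → y ≲ x → x ≡ y) where

      extend : ∀ {S} → Hom e S → Closed _≲_ S → card S < card (lvl e) →
               ∃ λ x → rk x ≡ e × ¬ S ∋ x × (∀ {y} → rk y ≡ e → ¬ S ∋ y → y ≲ x) × Closed _≲_ (S ∪ ｛ x ｝)
      extend {S} h c l with maximum {λ x → lvl e ∋ x × ¬ S ∋ x} (λ x → (lvl e ∋? x) ×-dec ¬? (S ∋? x))
                                    (card<⇒∃ {S} {lvl e} l)
      ... | m , (m∈ , m∉) , top = m , lvl-hom {e} m∈ , m∉ , (λ r ¬s → top (lvl⁺ r , ¬s)) , closed
        where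
        closed : Closed _≲_ (S ∪ ｛ m ｝)
        closed {x} {y} p x≲y r with ∪⁻ {S} {｛ m ｝} {x} p
        ... | inj₁ s = ∪⁺ˡ {S} {｛ m ｝} {y} (c s x≲y r)
        ... | inj₂ q with ｛｝⁻ {m} {x} q
        ...   | refl with S y in eq
        ...     | true  = refl
        ...     | false with antisym (trans r (lvl-hom {e} m∈)) (lvl-hom {e} m∈)
                               (top (lvl⁺ (trans r (lvl-hom {e} m∈)) , λ s → true≢false s eq)) x≲y
        ...       | refl = ｛｝⁺ {y}

      segment : ∀ q → q ≤ card (lvl e) → ∃ λ S → Hom e S × Closed _≲_ S × card S ≡ q
      segment zero    _ = ∅ , (λ ()) , (λ ()) , card-∅ {∅} (λ ())
      segment (suc q) l with segment q (<⇒≤ l)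
      ... | S , h , c , refl with extend h c l
      ...   | x , r , ¬s , _ , c′ = S ∪ ｛ x ｝ ,
              ∪-hom {e} {S} {｛ x ｝} h (λ {y} p → trans (｛｝-hom {x} {y} p) r) , c′ , card-∪｛｝ {S} ¬s

      segmentOf : ∀ {A} → Hom e A → ∃ λ S → Hom e S × Closed _≲_ S × card S ≡ card A
      segmentOf h = segment _ (card-mono (hom⇒⊆lvl h))

      macAt-≤ : MacAt _≲_ e → ∀ {A S} → Hom e A → Hom e S → Closed _≲_ S → card S ≤ card A →
                card (∂ S) ≤ card (∂ A)
      macAt-≤ (mac , _) {A} {S} hA hS cS l with segmentOf hA
      ... | T , hT , cT , eq = ≤-trans
        (card-mono (∂-mono {S} {T} (nested hS hT cS cT (≤-trans l (≤-reflexive (sym eq))))))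
        (mac hA hT cT eq)

module _ (P Q : Po) where
  private
    module P = Po P
    module Q = Po Q
    module SP = Subsets P
    module SQ = Subsets Q

  module _ (f : P.X → Q.X) {A : SP.Subset} {B : SQ.Subset}
           (into : ∀ {x} → A SP.∋ x → B SQ.∋ f x)
           (inj : ∀ {x y} → A SP.∋ x → A SP.∋ y → f x ≡ f y → x ≡ y) where
    private
      A-all : ∀ xs → AllL.All (A SP.∋_) (filter (SP._∋?_ A) xs)
      A-all xs = AllLₚ.all-filter (SP._∋?_ A) xs

      len : ∀ {X : Set} (A : X → Bool) xs → length (filter (λ x → A x Boolₚ.≟ true) xs) ≡ ∑ xs (𝟙 ∘ A)
      len A [] = refl
      len A (x ∷ xs) with A x
      ... | true  = cong suc (len A xs)
      ... | false = len A xs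

      map-unique : ∀ {xs} → AllL.All (A SP.∋_) xs → Unique xs → Unique (List.map f xs)
      map-unique []       []      = []
      map-unique (a ∷ as) (n ∷ u) = AllLₚ.map⁺ (ne as n) ∷ map-unique as u
        where
        ne : ∀ {ys} → AllL.All (A SP.∋_) ys → AllL.All (_ ≢_) ys → AllL.All (λ y → f _ ≢ f y) ys
        ne []       []       = []
        ne (b ∷ bs) (n ∷ ns) = (λ e → n (inj a b e)) ∷ ne bs ns

      fs : List Q.X
      fs = List.map f (filter (SP._∋?_ A) P.els)

      fs-unique : Unique fs
      fs-unique = map-unique (A-all P.els) (Uniqueₚ.filter⁺ (SP._∋?_ A) P.unique)

      fs⊆ : ∀ {y} → y ∈ fs → y ∈ filter (SQ._∋?_ B) Q.els
      fs⊆ p with ∈ₚ.∈-map⁻ f p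
      ... | x , q , refl = ∈ₚ.∈-filter⁺ (SQ._∋?_ B) (Q.complete _)
                             (into (proj₂ (∈ₚ.∈-filter⁻ (SP._∋?_ A) {xs = P.els} q)))

      fs-length : length fs ≡ SP.card A
      fs-length = trans (Listₚ.length-map f (filter (SP._∋?_ A) P.els)) (len A P.els)

    card-inj : SP.card A ≤ SQ.card B
    card-inj = subst₂ _≤_ fs-length (len B Q.els)
                 (Pigeonhole.⊆⇒length≤ (setoid Q.X) fs-unique fs⊆)

    card-inj-< : ∀ {y} → B SQ.∋ y → (∀ {x} → A SP.∋ x → f x ≢ y) → SP.card A < SQ.card B
    card-inj-< {y} b miss = subst₂ _<_ fs-length (len B Q.els)
      (Pigeonhole.⊆⇒length≤ (setoid Q.X) {y ∷ fs} (AllLₚ.¬Any⇒All¬ fs (λ p → missed p) ∷ fs-unique)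
        λ { (here refl) → ∈ₚ.∈-filter⁺ (SQ._∋?_ B) (Q.complete _) b ; (there p) → fs⊆ p })
      where
      missed : ¬ (y ∈ fs)
      missed p with ∈ₚ.∈-map⁻ f p
      ... | x , q , refl = miss (proj₂ (∈ₚ.∈-filter⁻ (SP._∋?_ A) {xs = P.els} q)) refl


-- The Clements–Lindström theorem

+-split : ∀ {a b c d} → a ≤ c → b ≤ d → a + b ≡ c + d → a ≡ c × b ≡ d
+-split {a} {b} {c} {d} p q e with ℕₚ.m≤n⇒m<n∨m≡n p
... | inj₁ a<c  = contradiction e (<⇒≢ (ℕₚ.+-mono-<-≤ a<c q))
... | inj₂ refl = refl , +-cancelˡ-≡ a b d e

infixl 6 _⊗_

_⊗_ : Po → ℕ → Po
P ⊗ m = record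
  { X        = X × Fin m
  ; els      = cartesianProduct els (allFin m)
  ; complete = λ (x , k) → ∈ₚ.∈-cartesianProduct⁺ (complete x) (∈ₚ.∈-allFin k)
  ; unique   = Uniqueₚ.cartesianProduct⁺ unique (Uniqueₚ.allFin⁺ m)
  ; _≟_      = ≡-dec _≟_ Finₚ._≟_
  ; rk       = λ (x , k) → rk x + toℕ k
  ; _⊑_      = λ (x , k) (y , l) → x ⊑ y × toℕ k ≤ toℕ l
  ; _⊑?_     = λ (x , k) (y , l) → (x ⊑? y) ×-dec (toℕ k ℕₚ.≤? toℕ l)
  ; ⊑-refl   = ⊑-refl , ≤-refl
  ; ⊑-rk     = λ (p , q) → +-mono-≤ (⊑-rk p) q
  ; ⊑-eq     = λ (p , q) e → let e₁ , e₂ = +-split (⊑-rk p) q e in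
                 cong₂ _,_ (⊑-eq p e₁) (Finₚ.toℕ-injective e₂)
  }
  where open Po P

module _ (P : Po) {m : ℕ} where
  private
    module P = Po P
    module Z = Po (P ⊗ m)

  ⋖-fst : ∀ {x y} {k : Fin m} → x P.⋖ y → (x , k) Z.⋖ (y , k)
  ⋖-fst {k = k} (p , r) = (p , ≤-refl) , cong (_+ toℕ k) r

  ⋖-snd : ∀ {x} {k l : Fin m} → toℕ l ≡ suc (toℕ k) → (x , k) Z.⋖ (x , l)
  ⋖-snd {x} {k} e = (P.⊑-refl , ≤-trans (n≤1+n _) (≤-reflexive (sym e))) ,
                    trans (cong (P.rk x +_) e) (+-suc (P.rk x) (toℕ k))

  ⋖-split : ∀ {x y} {k l : Fin m} → (x , k) Z.⋖ (y , l) →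
            (x P.⋖ y × k ≡ l) ⊎ (x ≡ y × toℕ l ≡ suc (toℕ k))
  ⋖-split {x} {y} {k} {l} ((p , q) , r) with P.rk x ℕₚ.≟ P.rk y
  ... | yes e with P.⊑-eq p e
  ...   | refl = inj₂ (refl , +-cancelˡ-≡ (P.rk x) _ _ (trans r (sym (+-suc (P.rk x) (toℕ k)))))
  ⋖-split {x} {y} {k} {l} ((p , q) , r) | no ne with +-split (ℕₚ.≤∧≢⇒< (P.⊑-rk p) ne) q (sym r)
  ... | e₁ , e₂ = inj₁ ((p , sym e₁) , Finₚ.toℕ-injective e₂)

-- In `climb` the target rank `D` is left free for the induction over coordinates, where the last
-- coordinate absorbs part of the ascent. The arguments about segments take `D` to be the rank of
-- `l`.
record LexPoset : Set₁ where
  infix 4 _≲_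
  field
    po      : Po
  open Po po public
  field
    _≲_     : Rel X 0ℓ
    isTotal : IsTotalOrder _≡_ _≲_
    ⋖⇒≲     : ∀ {x y} → x ⋖ y → x ≲ y
    climb   : ∀ {z l D} → z ≲ l → rk z ≤ D → D ≤ rk l → ∃ λ c → Star _⋖_ z c × rk c ≡ D × c ≲ l

  open IsTotalOrder isTotal public using (total; antisym)
    renaming (refl to ≲-refl; trans to ≲-trans; reflexive to ≲-reflexive)
  open Subsets po public hiding (Closed; MacAt)
  open Segments _≲_ total ≲-trans public
    using (nested)

  Closed : Subset → Set
  Closed = Subsets.Closed po _≲_

  MacAt : ℕ → Set
  MacAt = Subsets.MacAt po _≲_

  Macaulayᴸ : Set
  Macaulayᴸ = ∀ e → MacAt e

  segmentOf : ∀ {e A} → Hom e A → ∃ λ S → Hom e S × Closed S × card S ≡ card A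
  segmentOf {e} {A} = Segments.segmentOf _≲_ total ≲-trans {e} (λ _ _ → antisym) {A}

  macAt-≤ : ∀ {e} → MacAt e → ∀ {A S} → Hom e A → Hom e S → Closed S → card S ≤ card A →
            card (∂ S) ≤ card (∂ A)
  macAt-≤ = Segments.macAt-≤ _≲_ total ≲-trans (λ _ _ → antisym)

  ⋖⇒≢ : ∀ {x y} → x ⋖ y → x ≢ y
  ⋖⇒≢ (_ , r) refl = ℕₚ.1+n≢n (sym r)

  star-rk : ∀ {x y} → Star _⋖_ x y → rk x ≤ rk y
  star-rk ε = ≤-refl
  star-rk ((_ , r) ◅ s) = ≤-trans (n≤1+n _) (≤-trans (≤-reflexive (sym r)) (star-rk s))

  star-last : ∀ {x y} → Star _⋖_ x y → rk x < rk y → ∃ λ w → Star _⋖_ x w × w ⋖ y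
  star-last ε l = contradiction l (<-irrefl refl)
  star-last {x} (c ◅ ε) _ = x , ε , c
  star-last (c ◅ s@((_ , r) ◅ s′)) _ with star-last s
     (≤-trans (≤-reflexive (sym r)) (star-rk s′))
  ... | w , t , d = w , c ◅ t , d

module Product (L : LexPoset) (n : ℕ) where
  private module L = LexPoset L

  m : ℕ
  m = suc n

  zpo : Po
  zpo = L.po ⊗ m

  open Po zpo
  open Subsets zpo

  _≲_ : Rel X 0ℓ
  _≲_ = ×-Lex _≡_ L._≲_ (λ (k l : Fin m) → toℕ k ≤ toℕ l)

  private
    fin-total : IsTotalOrder _≡_ (λ (k l : Fin m) → toℕ k ≤ toℕ l)
    fin-total = Finₚ.≤-isTotalOrder

  isTotal : IsTotalOrder _≡_ _≲_
  isTotal = record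
    { isPartialOrder = record
      { isPreorder = record
        { isEquivalence = ≡ₚ.isEquivalence
        ; reflexive     = λ { refl → inj₂ (refl , ≤-refl) }
        ; trans         = Lex.×-transitive {_≈₁_ = _≡_} {_≤₁_ = L._≲_} {_≤₂_ = λ (k l : Fin m) → toℕ k ≤ toℕ l}
                            (IsTotalOrder.isPartialOrder L.isTotal) ≤-trans
        }
      ; antisym = λ p q → ≡×≡⇒≡ (Lex.×-antisymmetric {_≈₁_ = _≡_} {_≤₁_ = L._≲_} {_≈₂_ = _≡_}
                            {_≤₂_ = λ (k l : Fin m) → toℕ k ≤ toℕ l}
                            (IsTotalOrder.isPartialOrder L.isTotal) (IsTotalOrder.antisym fin-total) p q)
      }
    ; total = Lex.×-total {_≈₁_ = _≡_} {_≤₁_ = L._≲_} {_≤₂_ = λ (k l : Fin m) → toℕ k ≤ toℕ l}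
                sym L._≟_ L.antisym L.total (IsTotalOrder.total fin-total)
    }

  open IsTotalOrder isTotal using (total) renaming (trans to ≲-trans)
  open Segments _≲_ total ≲-trans using (nested)

  fst-≲ : ∀ {y y′ k k′} → (y , k) ≲ (y′ , k′) → y L.≲ y′
  fst-≲ (inj₁ (p , _))    = p
  fst-≲ (inj₂ (refl , _)) = L.≲-refl

  ⋖⇒≲ : ∀ {x y} → x ⋖ y → x ≲ y
  ⋖⇒≲ c with ⋖-split L.po c
  ... | inj₁ (d , refl) = inj₁ (L.⋖⇒≲ d , L.⋖⇒≢ d)
  ... | inj₂ (refl , e) = inj₂ (refl , ≤-trans (n≤1+n _) (≤-reflexive (sym e)))

  raise : ∀ {y} {k l : Fin m} → toℕ k ≤ toℕ l → Star _⋖_ (y , k) (y , l)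
  raise {y} {k} {l} p = go (toℕ l ∸ toℕ k) k (m∸n+n≡m p)
    where
    go : ∀ j (k : Fin m) → j + toℕ k ≡ toℕ l → Star _⋖_ (y , k) (y , l)
    go zero    k e rewrite Finₚ.toℕ-injective e = ε
    go (suc j) k e = ⋖-snd L.po {k = k} {l = fromℕ< k<m} (Finₚ.toℕ-fromℕ< k<m) ◅
        go j (fromℕ< k<m) (trans (cong (j +_) (Finₚ.toℕ-fromℕ< k<m)) (trans (+-suc j _) e))
      where
      k<m : suc (toℕ k) < m
      k<m = ≤-<-trans (≤-trans (s≤s (m≤n+m (toℕ k) j)) (≤-reflexive e)) (Finₚ.toℕ<n l)

  climb : ∀ {z l D} → z ≲ l → rk z ≤ D → D ≤ rk l → ∃ λ c → Star _⋖_ z c × rk c ≡ D × c ≲ l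
  climb {z , k} {l , k′} {D} p u v = case p of λ
    { (inj₂ (refl , q)) → let w = ≤-<-trans (≤-trans (ℕₚ.∸-monoˡ-≤ (L.rk z) v)
                                      (≤-reflexive (ℕₚ.m+n∸m≡n (L.rk z) (toℕ k′)))) (Finₚ.toℕ<n k′) in
        (z , fromℕ< w) , proj₁ (stay w) , proj₂ (stay w) ,
        inj₂ (refl , ≤-trans (≤-reflexive (Finₚ.toℕ-fromℕ< w))
                       (≤-trans (ℕₚ.∸-monoˡ-≤ (L.rk z) v) (≤-reflexive (ℕₚ.m+n∸m≡n (L.rk z) (toℕ k′)))))
    ; (inj₁ (z≲l , z≢l)) → case D ∸ L.rk z ℕₚ.<? m of λ
      { (yes w) → (z , fromℕ< w) , proj₁ (stay w) , proj₂ (stay w) , inj₁ (z≲l , z≢l)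
      ; (no ¬w) → leave z≲l (≮⇒≥ ¬w) } }
    where
    z≤D : L.rk z ≤ D
    z≤D = ≤-trans (m≤m+n _ _) u

    stay : (w : D ∸ L.rk z < m) → Star _⋖_ (z , k) (z , fromℕ< w) × L.rk z + toℕ (fromℕ< w) ≡ D
    stay w rewrite Finₚ.toℕ-fromℕ< w =
      raise {z} {k} {fromℕ< w} (≤-trans (ℕₚ.m+n≤o⇒m≤o∸n (toℕ k) (≤-trans (≤-reflexive (+-comm (toℕ k) _)) u)) (≤-reflexive (sym (Finₚ.toℕ-fromℕ< w)))) ,
      m+[n∸m]≡n z≤D

    -- The last coordinate goes to its maximum `n`, so rank `D ∸ n` remains to be reached in `L`.
    -- That is at most the rank of `l`, because the last coordinate there is at most `n` too.
    leave : z L.≲ l → m ≤ D ∸ L.rk z → _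
    leave z≲l h with L.climb z≲l
      (ℕₚ.m+n≤o⇒m≤o∸n (L.rk z) (≤-trans (+-monoʳ-≤ (L.rk z) (≤-trans (n≤1+n n) h))
                                            (≤-reflexive (m+[n∸m]≡n z≤D))))
      (ℕₚ.m≤n+o⇒m∸n≤o D n (≤-trans v (≤-trans (+-monoʳ-≤ (L.rk l) (Finₚ.toℕ≤pred[n] k′))
                                                     (≤-reflexive (+-comm (L.rk l) n)))))
    ... | c , path , r , c≲l = (c , fromℕ n) ,
        raise {z} {k} {fromℕ n} (≤-trans (Finₚ.toℕ≤pred[n] k) (≤-reflexive (sym (Finₚ.toℕ-fromℕ n))))
          ◅◅ Star.gmap (λ y → y , fromℕ n) (⋖-fst L.po) path ,
        rank , order
      where
      n≤D : n ≤ D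
      n≤D = ≤-trans (n≤1+n n) (≤-trans h (ℕₚ.m∸n≤m D (L.rk z)))
      rank : L.rk c + toℕ (fromℕ n) ≡ D
      rank rewrite r | Finₚ.toℕ-fromℕ n = m∸n+n≡m n≤D
      order : (c , fromℕ n) ≲ (l , k′)
      order with c L.≟ l
      ... | no c≢l   = inj₁ (c≲l , c≢l)
      ... | yes refl = inj₂ (refl , +-cancelˡ-≤ (L.rk c) _ _ (≤-trans (≤-reflexive rank) v))

  lex : LexPoset
  lex = record { po = zpo ; _≲_ = _≲_ ; isTotal = isTotal ; ⋖⇒≲ = λ {x} {y} → ⋖⇒≲ {x} {y} ; climb = climb }

  slice : Subset → Fin m → L.Subset
  slice A k y = A (y , k)

  card-slices : ∀ A → card A ≡ ∑ (allFin m) (λ k → L.card (slice A k))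
  card-slices A = trans (∑-× L.els (allFin m)) (∑-swap L.els (allFin m) _)

  -- Trading one step of the last coordinate for one step in `L` stays in the set. Covers inside
  -- slice `suc k` then add nothing to slice `suc k` of the shadow, which is just slice `k` of the
  -- set.
  Borel : Subset → Set
  Borel A = ∀ (k : Fin n) → L.∂ (slice A (suc k)) L.⊆ slice A (inject₁ k)

  private
    inject⋖ : ∀ {y} {k : Fin n} → (y , inject₁ k) ⋖ (y , suc k)
    inject⋖ {y} {k} = ⋖-snd L.po {k = inject₁ k} {l = suc k} (cong suc (sym (Finₚ.toℕ-inject₁ k)))

    bottom : ∀ {A} → L.∂ (slice A zero) L.⊆ slice (∂ A) zero
    bottom {A} {y} p with L.∂⁻ {slice A zero} {y} p
    ... | x , a , c = ∂⁺ {A} {x , zero} a (⋖-fst L.po {m} {k = zero} c)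

    shift : ∀ {A} (k : Fin n) → slice A (inject₁ k) L.⊆ slice (∂ A) (suc k)
    shift {A} k {y} a = ∂⁺ {A} a (inject⋖ {y} {k})

    bottom⁻ : ∀ {A} → slice (∂ A) zero L.⊆ L.∂ (slice A zero)
    bottom⁻ {A} {y} p with ∂⁻ {A} {y , zero} p
    ... | (x , i) , a , c with ⋖-split L.po c
    ...   | inj₁ (d , refl) = L.∂⁺ {slice A zero} a d

    shift⁻ : ∀ {A} → Borel A → (k : Fin n) → slice (∂ A) (suc k) L.⊆ slice A (inject₁ k)
    shift⁻ {A} borel k {y} p with ∂⁻ {A} {y , suc k} p
    ... | (x , i) , a , c with ⋖-split L.po c
    ...   | inj₁ (d , refl) = borel k (L.∂⁺ {slice A (suc k)} a d)
    ...   | inj₂ (refl , e) = subst (λ j → A (y , j) ≡ true)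
              (Finₚ.toℕ-injective (trans (sym (suc-injective e)) (sym (Finₚ.toℕ-inject₁ k)))) a

    sums : ∀ A → card A ≡ ∑ (allFin n) (λ k → L.card (slice A (inject₁ k))) + L.card (slice A (fromℕ n))
    sums A = trans (card-slices A) (∑-last n)

    sums-∂ : ∀ A → card (∂ A) ≡ L.card (slice (∂ A) zero) + ∑ (allFin n) (λ k → L.card (slice (∂ A) (suc k)))
    sums-∂ A = trans (card-slices (∂ A)) (∑-suc n)

  -- Slice zero of the shadow contains the shadow of slice zero, and every slice but the last
  -- reappears one step higher. The form with sums on both sides avoids truncated subtraction;
  -- `card-∂-≤` is the converse for Borel sets.
  card-∂-≥ : ∀ A → L.card (L.∂ (slice A zero)) + card A ≤ card (∂ A) + L.card (slice A (fromℕ n))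
  card-∂-≥ A rewrite sums A | sums-∂ A = ≤-trans (≤-reflexive (sym (+-assoc (L.card (L.∂ (slice A zero))) _ _)))
    (+-monoˡ-≤ _ (+-mono-≤ (L.card-mono {L.∂ (slice A zero)} {slice (∂ A) zero} (bottom {A}))
      (∑-mono (allFin n) λ k → L.card-mono {slice A (inject₁ k)} {slice (∂ A) (suc k)} (shift {A} k))))

  card-∂-≤ : ∀ {A} → Borel A → card (∂ A) + L.card (slice A (fromℕ n)) ≤ L.card (L.∂ (slice A zero)) + card A
  card-∂-≤ {A} borel rewrite sums A | sums-∂ A = ≤-trans
    (+-monoˡ-≤ _ (+-mono-≤ (L.card-mono {slice (∂ A) zero} {L.∂ (slice A zero)} (bottom⁻ {A}))
      (∑-mono (allFin n) λ k → L.card-mono {slice (∂ A) (suc k)} {slice A (inject₁ k)} (shift⁻ {A} borel k))))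
    (≤-reflexive (+-assoc (L.card (L.∂ (slice A zero))) _ _))

  slice-hom : ∀ {e A} → Hom e A → ∀ k → L.Hom (e ∸ toℕ k) (slice A k)
  slice-hom h k {y} a = trans (sym (ℕₚ.m+n∸n≡m (L.rk y) (toℕ k))) (cong (_∸ toℕ k) (h a))

  slice-closed : ∀ {S} → Closed _≲_ S → ∀ k → L.Closed (slice S k)
  slice-closed c k {x} {y} s x≲y r with x L.≟ y
  ... | yes refl = s
  ... | no  x≢y  = c s (inj₁ (x≲y , x≢y)) (cong (_+ toℕ k) r)

  closed⇒borel : ∀ {S} → Closed _≲_ S → Borel S
  closed⇒borel {S} c k {y} p with L.∂⁻ {slice S (suc k)} {y} p
  ... | x , s , d = c s (inj₁ (L.⋖⇒≲ d , L.⋖⇒≢ d))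
    (trans (cong₂ _+_ (proj₂ d) (Finₚ.toℕ-inject₁ k)) (sym (+-suc (L.rk x) (toℕ k))))

  -- Every cover on the path is paid for by lowering the last coordinate by one. Running out of
  -- height before the end of the path would make the rank of `c` exceed `e`.
  borel-path : ∀ {e A} → Hom e A → Borel A → ∀ {z c k k′} → A ∋ (z , k) → Star L._⋖_ z c →
               L.rk c + toℕ k′ ≡ e → A ∋ (c , k′)
  borel-path {e} {A} h b {z} {c} {k} {k′} a ε r =
    subst (λ j → A (z , j) ≡ true) (Finₚ.toℕ-injective (+-cancelˡ-≡ (L.rk z) _ _ (trans (h a) (sym r)))) a
  borel-path {e} {A} h b {z} {c} {zero} {k′} a (d ◅ s) r = contradiction (sym r) (<⇒≢
    (≤-trans (≤-reflexive (trans (cong suc (trans (sym (h a)) (+-identityʳ _))) (sym (proj₂ d))))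
      (≤-trans (L.star-rk s) (m≤m+n _ _))))
  borel-path {e} {A} h b {k = suc k} a (d ◅ s) r =
    borel-path {e} {A} h b (b k (L.∂⁺ {slice A (suc k)} a d)) s r

  -- If the last coordinate of the larger element is positive, its lower neighbour in that direction
  -- is compared with `(x , i)`: it lies in `S`, or the first coordinates all agree. Last coordinate
  -- zero leaves no such neighbour and needs the hypothesis on `L`.
  ∂-closed : ∀ {e} → L.MacAt e → ∀ {S} → Hom e S → Closed _≲_ S → Closed _≲_ (∂ S)
  ∂-closed {e} (_ , mac) {S} h c {y , k} {y′ , k′} p y≲y′ r with ∂⁻ {S} {y , k} p
  ... | (x , i) , s , d = go k′ y≲y′ r
    where
    x≲y : x L.≲ y
    x≲y = fst-≲ (⋖⇒≲ {x , i} {y , k} d)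

    go : ∀ k′ → (y , k) ≲ (y′ , k′) → L.rk y′ + toℕ k′ ≡ L.rk y + toℕ k → ∂ S ∋ (y′ , k′)
    go (suc j) q r with total (x , i) (y′ , inject₁ j)
    ... | inj₁ u = ∂⁺ {S} (c s u (suc-injective (trans (trans (sym (proj₂ (inject⋖ {y′} {j}))) r) (proj₂ d)))) (inject⋖ {y′} {j})
    ... | inj₂ u with ⋖-split L.po d
    ...   | inj₁ (f , _) = contradiction (L.antisym x≲y (L.≲-trans (fst-≲ q) (fst-≲ u))) (L.⋖⇒≢ f)
    ...   | inj₂ (refl , f) with L.antisym (fst-≲ q) (fst-≲ u)
    ...     | refl = ∂⁺ {S} s (⋖-snd L.po {k = i} {l = suc j} (trans (+-cancelˡ-≡ (L.rk y) _ _ r) f))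
    -- Climbing from `x` to the rank of `y′` without overtaking it ends with a cover whose lower end
    -- lies in slice zero, by `borel-path`. The shadow of that slice is a segment of `L` and so
    -- contains `y′`.
    go zero q r with L.climb (L.≲-trans x≲y (fst-≲ q)) (ℕₚ.m+n≤o⇒m≤o (L.rk x) (≤-trans (≤-reflexive (h s)) (n≤1+n e)))
                            (≤-reflexive (sym rk-y′))
      where
      rk-y′ : L.rk y′ ≡ suc e
      rk-y′ = trans (sym (+-identityʳ _)) (trans r (trans (proj₂ d) (cong suc (h s))))
    ... | w , path , rw , w≲y′ with L.star-last path (≤-<-trans (ℕₚ.m+n≤o⇒m≤o (L.rk x) (≤-reflexive (h s)))
                                      (≤-reflexive (sym rw)))
    ...   | v , path′ , f = bottom {S} {y′} (mac {slice S zero} (slice-hom {e} {S} h zero) (slice-closed {S} c zero)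
              (L.∂⁺ {slice S zero} (borel-path {e} {S} h (closed⇒borel {S} c) s path′
                   (trans (+-identityʳ _) (suc-injective (trans (sym (proj₂ f)) rw)))) f)
              w≲y′ (trans (trans (sym (+-identityʳ _)) (trans r (trans (proj₂ d) (cong suc (h s))))) (sym rw)))

  module _ (mac : L.Macaulayᴸ) {e : ℕ} {A S : Subset} (hA : Hom e A) (bA : Borel A)
           (hS : Hom e S) (cS : Closed _≲_ S) (eq : card S ≡ card A) where
    private
      seg : ∀ k → ∃ λ T → L.Hom (e ∸ toℕ k) T × L.Closed T × L.card T ≡ L.card (slice A k)
      seg k = L.segmentOf {A = slice A k} (slice-hom {e} {A} hA k)

      B : Subset
      B (y , k) = proj₁ (seg k) y

      hB : Hom e B
      hB {y , k} b with L.card>0⇒∃ {slice A k} (subst (0 <_) (proj₂ (proj₂ (proj₂ (seg k)))) (L.card>0 {slice B k} b))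
      ... | x , a = trans (cong (_+ toℕ k) (proj₁ (proj₂ (seg k)) b))
                          (m∸n+n≡m (≤-trans (m≤n+m (toℕ k) (L.rk x)) (≤-reflexive (hA a))))

      closedB : ∀ k → L.Closed (slice B k)
      closedB k = proj₁ (proj₂ (proj₂ (seg k)))

      cardB : ∀ k → L.card (slice B k) ≡ L.card (slice A k)
      cardB k = proj₂ (proj₂ (proj₂ (seg k)))

      -- The shadow of slice `suc k` of `B` and slice `k` of `B` are segments of one rank. Hence
      -- inclusion reduces to sizes, and these are inherited from `A` by minimality of segments in
      -- `L`.
      bB : Borel B
      bB k = L.nested {e ∸ toℕ (inject₁ k)} {L.∂ (slice B (suc k))} {slice B (inject₁ k)}
        (λ {y} p → trans (sym (ℕₚ.m+n∸n≡m (L.rk y) (toℕ (inject₁ k)))) (cong (_∸ toℕ (inject₁ k)) (hom∂ p)))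
        (slice-hom {e} {B} hB (inject₁ k))
        (proj₂ (mac (e ∸ suc (toℕ k))) {slice B (suc k)} (slice-hom {e} {B} hB (suc k)) (closedB (suc k)))
        (closedB (inject₁ k))
        (≤-trans (proj₁ (mac (e ∸ suc (toℕ k))) {slice A (suc k)} {slice B (suc k)}
                        (slice-hom {e} {A} hA (suc k)) (slice-hom {e} {B} hB (suc k)) (closedB (suc k)) (cardB (suc k)))
          (≤-trans (L.card-mono {L.∂ (slice A (suc k))} {slice A (inject₁ k)} (bA k))
                      (≤-reflexive (sym (cardB (inject₁ k))))))
        where
        hom∂ : ∀ {y} → L.∂ (slice B (suc k)) L.∋ y → L.rk y + toℕ (inject₁ k) ≡ e
        hom∂ {y} p with L.∂⁻ {slice B (suc k)} {y} p
        ... | x , b , d = trans (cong₂ _+_ (proj₂ d) (Finₚ.toℕ-inject₁ k)) (trans (sym (+-suc (L.rk x) (toℕ k))) (hB b))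

      cardB≡S : card B ≡ card S
      cardB≡S = trans (card-slices B) (trans (∑-cong (allFin m) cardB) (trans (sym (card-slices A)) (sym eq)))

      -- Suppose `(z , zero)` is in `S` but not in `B`. Elements of `B` above it are in `S`; an
      -- element of `B` below it would climb inside `B` to slice zero without overtaking `z`,
      -- putting `z` into `B`. So `B` would be a proper subset of `S`, against equal sizes.
      first-≥ : L.card (slice S zero) ≤ L.card (slice B zero)
      first-≥ with L.card (slice B zero) ℕₚ.<? L.card (slice S zero)
      ... | no ¬l = ≮⇒≥ ¬l
      ... | yes l with L.card<⇒∃ {slice B zero} {slice S zero} l
      ...   | z , s , ¬b = contradiction cardB≡S (<⇒≢ (card-strict {B} {S} B⊆S s ¬b))
        where
        B⊆S : B ⊆ S
        B⊆S {b , k} p with total (z , zero) (b , k)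
        ... | inj₁ u = cS s u (trans (hB p) (sym (hS s)))
        ... | inj₂ u with L.climb (fst-≲ u)
              (ℕₚ.m+n≤o⇒m≤o (L.rk b) (≤-reflexive (trans (hB p) (trans (sym (hS s)) (+-identityʳ _))))) ≤-refl
        ...   | c , path , r , c≲z = contradiction (closedB zero
                (borel-path {e} {B} hB bB p path (trans (cong (_+ 0) r) (hS s))) c≲z (sym r)) ¬b

      -- The argument of `first-≥` with `S` and `B` exchanged: from `(z , fromℕ n)` in the highest
      -- slice of `B`, a path leads down the last coordinate to any slice that an element of `S`
      -- occupies.
      last-≤ : L.card (slice B (fromℕ n)) ≤ L.card (slice S (fromℕ n))
      last-≤ with L.card (slice S (fromℕ n)) ℕₚ.<? L.card (slice B (fromℕ n))
      ... | no ¬l = ≮⇒≥ ¬l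
      ... | yes l with L.card<⇒∃ {slice S (fromℕ n)} {slice B (fromℕ n)} l
      ...   | z , b , ¬s = contradiction (sym cardB≡S) (<⇒≢ (card-strict {S} {B} S⊆B b ¬s))
        where
        S⊆B : S ⊆ B
        S⊆B {l , k} p with total (l , k) (z , fromℕ n)
        ... | inj₁ u = contradiction (cS p u (trans (hB b) (sym (hS p)))) ¬s
        ... | inj₂ u with L.climb (fst-≲ u) (ℕₚ.+-cancelʳ-≤ (toℕ (fromℕ n)) _ _ (≤-trans
              (≤-reflexive (trans (hB b) (sym (hS p))))
              (+-monoʳ-≤ (L.rk l) (≤-trans (Finₚ.toℕ≤pred[n] k) (≤-reflexive (sym (Finₚ.toℕ-fromℕ n))))))) ≤-refl
        ...   | c , path , r , c≲l = closedB k
                (borel-path {e} {B} hB bB b path (trans (cong (_+ toℕ k) r) (hS p))) c≲l (sym r)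

    -- Both slice counts have the same size of set, so only the shadow of the bottom slice and the
    -- size of the top slice are compared. `first-≥` and `last-≤` settle these for the rearrangement
    -- `B` of `A`.
    borel-min : card (∂ S) ≤ card (∂ A)
    borel-min = ℕₚ.+-cancelʳ-≤ (L.card (slice S (fromℕ n))) _ _ (begin
      card (∂ S) + L.card (slice S (fromℕ n))  ≤⟨ card-∂-≤ {S} (closed⇒borel {S} cS) ⟩
      L.card (L.∂ (slice S zero)) + card S     ≤⟨ +-mono-≤ (L.macAt-≤ (mac e) {slice A zero} {slice S zero}
                                                     (slice-hom {e} {A} hA zero) (slice-hom {e} {S} hS zero)
                                                     (slice-closed {S} cS zero)
                                                     (≤-trans first-≥ (≤-reflexive (cardB zero))))
                                                   (≤-reflexive eq) ⟩
      L.card (L.∂ (slice A zero)) + card A     ≤⟨ card-∂-≥ A ⟩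
      card (∂ A) + L.card (slice A (fromℕ n))  ≡⟨ cong (card (∂ A) +_) (sym (cardB (fromℕ n))) ⟩
      card (∂ A) + L.card (slice B (fromℕ n))  ≤⟨ +-monoʳ-≤ (card (∂ A)) last-≤ ⟩
      card (∂ A) + L.card (slice S (fromℕ n))  ∎)
      where open ℕₚ.≤-Reasoning


-- Weights and compression

module _ (L : LexPoset) where
  open LexPoset L

  private
    _≲?_ : Decidable _≲_
    _≲?_ = total∧dec⇒dec ≲-reflexive antisym total _≟_

  -- The position of `z` counted from the largest element. Moving a set towards a segment lowers its
  -- total weight, which serves as the termination measure for repeated compression.
  weight : X → ℕ
  weight z = card ⟦ (z ≲?_) ⟧

  weight-anti : ∀ {x y} → x ≲ y → x ≢ y → weight y < weight x
  weight-anti {x} {y} x≲y x≢y = card-strict {⟦ y ≲?_ ⟧} {⟦ x ≲?_ ⟧} {x}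
    (λ {z} p → dec-true (x ≲? z) (≲-trans x≲y (does⁻ (y ≲? z) p)))
    (dec-true (x ≲? x) ≲-refl)
    (λ p → x≢y (antisym x≲y (does⁻ (y ≲? x) p)))

  mass : (X → ℕ) → Subset → ℕ
  mass h A = ∑ els (λ x → 𝟙 (A x) * h x)

  module _ {h : X → ℕ} (anti : ∀ {x y} → x ≲ y → x ≢ y → h y < h x)
           {e S B} (hS : Hom e S) (hB : Hom e B) (cS : Closed S) (eq : card S ≡ card B) where

    -- Exchanging the elements of S ∖ B, all above the largest b in B ∖ S, for
    -- those of B ∖ S, all below b, compares every weight with that of b.
    mass-strict : ∀ {x} → B ∋ x → ¬ S ∋ x → mass h S < mass h B
    mass-strict {x} bx ¬sx with Segments.maximum _≲_ total ≲-trans {λ x → B ∋ x × ¬ S ∋ x}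
                               (λ x → (B ∋? x) ×-dec ¬? (S ∋? x)) (x , bx , ¬sx)
    ... | b , (Bb , ¬Sb) , top = ℕₚ.+-cancelʳ-< (card B * h b) _ _ (<-≤-trans
          (subst₂ _<_ (trans (∑-+ els) (cong (mass h S +_) (∑-* els (h b))))
                      (trans (∑-+ els) (cong (mass h B +_) (∑-* els (h b))))
                      (∑-strict pointwise (complete s) at-s))
          (≤-reflexive (cong (λ c → mass h B + c * h b) eq)))
      where
      S-above : ∀ {y} → S ∋ y → h y < h b
      S-above {y} s with total y b
      ... | inj₁ y≲b = contradiction (cS s y≲b (trans (hB Bb) (sym (hS s)))) ¬Sb
      ... | inj₂ b≲y = anti b≲y λ { refl → ¬Sb s }
      B-below : ∀ {y} → B ∋ y → ¬ S ∋ y → h b ≤ h y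
      B-below {y} p ¬s with y ≟ b
      ... | yes refl = ≤-refl
      ... | no  y≢b  = <⇒≤ (anti (top (p , ¬s)) y≢b)
      pointwise : ∀ y → 𝟙 (S y) * h y + 𝟙 (B y) * h b ≤ 𝟙 (B y) * h y + 𝟙 (S y) * h b
      pointwise y with S y in eqS | B y in eqB
      ... | true  | true  = ≤-refl
      ... | true  | false = ≤-trans (≤-reflexive (+-identityʳ _)) (ℕₚ.*-monoʳ-≤ 1 (<⇒≤ (S-above eqS)))
      ... | false | true  = ≤-trans (ℕₚ.*-monoʳ-≤ 1 (B-below eqB λ s → true≢false s eqS)) (≤-reflexive (sym (+-identityʳ _)))
      ... | false | false = z≤n
      missing : ∃ λ s → S ∋ s × ¬ B ∋ s
      missing with ∀? (λ y → (S ∋? y) →-dec (B ∋? y))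
      ... | inj₁ S⊆B     = contradiction (⊆∧≥⇒⊇ {S} {B} (λ {y} → S⊆B y) (≤-reflexive (sym eq)) Bb) ¬Sb
      ... | inj₂ (y , n) = y , Boolₚ.¬-not (λ e → n λ s → true≢false s e) , λ b′ → n λ _ → b′
      s : X
      s = proj₁ missing
      at-s : 𝟙 (S s) * h s + 𝟙 (B s) * h b < 𝟙 (B s) * h s + 𝟙 (S s) * h b
      at-s rewrite proj₁ (proj₂ missing) | ¬true⇒false (proj₂ (proj₂ missing)) =
        subst (_< 1 * h b) (sym (+-identityʳ _)) (ℕₚ.*-monoʳ-< 1 (S-above (proj₁ (proj₂ missing))))

    mass-≤ : mass h S ≤ mass h B
    mass-≤ with ∀? (λ y → (B ∋? y) →-dec (S ∋? y))
    ... | inj₂ (y , n) = <⇒≤ (mass-strict {y} (Boolₚ.¬-not (λ e → n λ s → true≢false s e)) λ b′ → n λ _ → b′)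
    ... | inj₁ B⊆S = ∑-mono els λ y → ℕₚ.*-monoˡ-≤ (h y)
          (𝟙-mono (⊆∧≥⇒⊇ {B} {S} (λ {y} → B⊆S y) (≤-reflexive eq) {y}))

-- A product of `X` with an index poset `I`, in whatever order the coordinates of `Z` are nested;
-- `J` is the cover relation of `I`. One compression argument then serves for slices (`I` the last
-- chain) and for planes (`I` everything but the last two chains).
record Fibration (Z X : LexPoset) : Set₁ where
  private
    module Z = LexPoset Z
    module X = LexPoset X
  field
    I    : Set
    is   : List I
    ∈is  : ∀ i → i ∈ is
    ι    : X.X → I → Z.X
    πx   : Z.X → X.X
    πi   : Z.X → I
    ι-π  : ∀ z → ι (πx z) (πi z) ≡ z
    πx-ι : ∀ x i → πx (ι x i) ≡ x
    πi-ι : ∀ x i → πi (ι x i) ≡ i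
    ∑-ι  : ∀ f → ∑ Z.els f ≡ ∑ is (λ i → ∑ X.els (λ x → f (ι x i)))
    r    : I → ℕ
    J    : I → I → Set
    rk-ι : ∀ x i → Z.rk (ι x i) ≡ X.rk x + r i
    up-X : ∀ {x y i} → x X.⋖ y → ι x i Z.⋖ ι y i
    up-J : ∀ {x i j} → J i j → ι x i Z.⋖ ι x j
    ⋖-ι  : ∀ {x y i j} → ι x i Z.⋖ ι y j → (x X.⋖ y × i ≡ j) ⊎ (x ≡ y × J i j)
    ≲-ι  : ∀ {x y i} → x X.≲ y → ι x i Z.≲ ι y i

  fibre : Z.Subset → I → X.Subset
  fibre A i x = A (ι x i)

module Compression {Z X : LexPoset} (F : Fibration Z X) (mac : LexPoset.Macaulayᴸ X) where
  open Fibration F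
  private
    module Z = LexPoset Z
    module X = LexPoset X

  module _ {e A} (hA : Z.Hom e A) where
    private
      fibre-hom : ∀ {e B} → Z.Hom e B → ∀ i → X.Hom (e ∸ r i) (fibre B i)
      fibre-hom h i {x} a = trans (sym (ℕₚ.m+n∸n≡m (X.rk x) (r i))) (cong (_∸ r i) (trans (sym (rk-ι x i)) (h a)))

      seg : ∀ i → ∃ λ T → X.Hom (e ∸ r i) T × X.Closed T × X.card T ≡ X.card (fibre A i)
      seg i = X.segmentOf {A = fibre A i} (fibre-hom {e} {A} hA i)

      S : I → X.Subset
      S i = proj₁ (seg i)

      A′ : Z.Subset
      A′ z = S (πi z) (πx z)

      A′-ι : ∀ x i → A′ (ι x i) ≡ S i x
      A′-ι x i rewrite πx-ι x i | πi-ι x i = refl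

      cardS : ∀ i → X.card (S i) ≡ X.card (fibre A i)
      cardS i = proj₂ (proj₂ (proj₂ (seg i)))

      closedS : ∀ i → X.Closed (S i)
      closedS i = proj₁ (proj₂ (proj₂ (seg i)))

      homS : ∀ i → X.Hom (e ∸ r i) (S i)
      homS i = proj₁ (proj₂ (seg i))

      homS+ : ∀ i {x} → S i X.∋ x → X.rk x + r i ≡ e
      homS+ i {x} s with X.card>0⇒∃ {fibre A i} (subst (0 <_) (cardS i) (X.card>0 {S i} s))
      ... | y , a = trans (cong (_+ r i) (homS i s))
        (m∸n+n≡m (≤-trans (m≤n+m (r i) (X.rk y)) (≤-reflexive (trans (sym (rk-ι y i)) (hA a)))))

      homA′ : Z.Hom e A′
      homA′ {z} a = trans (cong Z.rk (sym (ι-π z))) (trans (rk-ι (πx z) (πi z)) (homS+ (πi z) a))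

      cardA′ : Z.card A′ ≡ Z.card A
      cardA′ = trans (∑-ι _) (trans (∑-cong is λ i → trans (∑-cong X.els λ x → cong 𝟙 (A′-ι x i)) (cardS i))
                                    (sym (∑-ι _)))

      -- The fibre of the new shadow is a union of segments of one rank: the shadow of `S i` and
      -- those `S j` with `j` covered by `i`. None is larger than the fibre of the old shadow, so
      -- all lie in the one segment `W` of that size.
      fibre-∂ : ∀ i → X.card (fibre (Z.∂ A′) i) ≤ X.card (fibre (Z.∂ A) i)
      fibre-∂ i with X.segmentOf {A = fibre (Z.∂ A) i} (fibre-hom {suc e} {Z.∂ A} (Z.∂-hom {e} {A} hA) i)
      ... | W , hW , cW , eqW = ≤-trans (X.card-mono {fibre (Z.∂ A′) i} {W} sub) (≤-reflexive eqW)
        where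
        level+ : ∀ {T : X.Subset} → (∀ {x} → T X.∋ x → X.rk x + r i ≡ suc e) → X.Hom (suc e ∸ r i) T
        level+ h {x} t = trans (sym (ℕₚ.m+n∸n≡m (X.rk x) (r i))) (cong (_∸ r i) (h t))
        sub : fibre (Z.∂ A′) i X.⊆ W
        sub {y} p with Z.∂⁻ {A′} p
        ... | z , a , d with ⋖-ι (subst (Z._⋖ ι y i) (sym (ι-π z)) d)
        ...   | inj₁ (f , eq) = X.nested {S = X.∂ (S i)} {T = W}
                (level+ λ {x} q → let w , s , g = X.∂⁻ {S i} {x} q in trans (cong (_+ r i) (proj₂ g)) (cong suc (homS+ i s)))
                hW (proj₂ (mac (e ∸ r i)) {S i} (homS i) (closedS i)) cW
                (≤-trans (proj₁ (mac (e ∸ r i)) {fibre A i} {S i} (fibre-hom {e} {A} hA i) (homS i) (closedS i) (cardS i))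
                  (≤-trans (X.card-mono {X.∂ (fibre A i)} {fibre (Z.∂ A) i} (λ {x} q → let w , s , g = X.∂⁻ {fibre A i} {x} q in
                                 Z.∂⁺ {A} s (up-X g)))
                              (≤-reflexive (sym eqW))))
                (X.∂⁺ {S i} (subst (λ j → S j (πx z) ≡ true) eq a) f)
        ...   | inj₂ (refl , j) = X.nested {S = S (πi z)} {T = W}
                (level+ λ {x} s → trans (sym (rk-ι x i)) (trans (proj₂ (up-J {x} j)) (cong suc (trans (rk-ι x (πi z)) (homS+ (πi z) s)))))
                hW (closedS (πi z)) cW
                (≤-trans (≤-reflexive (cardS (πi z)))
                  (≤-trans (X.card-mono {fibre A (πi z)} {fibre (Z.∂ A) i} (λ {x} s → Z.∂⁺ {A} s (up-J j)))
                              (≤-reflexive (sym eqW))))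
                a

      card-∂ : Z.card (Z.∂ A′) ≤ Z.card (Z.∂ A)
      card-∂ = subst₂ _≤_ (sym (∑-ι _)) (sym (∑-ι _)) (∑-mono is fibre-∂)

      h : I → X.X → ℕ
      h i x = weight Z (ι x i)

      anti : ∀ i {x y} → x X.≲ y → x ≢ y → h i y < h i x
      anti i {x} {y} p ne = weight-anti Z (≲-ι p) λ e → ne (trans (sym (πx-ι x i)) (trans (cong πx e) (πx-ι y i)))

      massA′ : mass Z (weight Z) A′ ≡ ∑ is (λ i → mass X (h i) (S i))
      massA′ = trans (∑-ι _) (∑-cong is λ i → ∑-cong X.els λ x → cong (λ b → 𝟙 b * h i x) (A′-ι x i))

    -- Fibrewise the segment has the least weight among sets of its size, and strictly less than a
    -- fibre it fails to contain. Either nothing moves or the total weight drops.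
    compress : (∀ i → X.Closed (fibre A i)) ⊎
               (∃ λ B → Z.Hom e B × Z.card B ≡ Z.card A × Z.card (Z.∂ B) ≤ Z.card (Z.∂ A) ×
                        mass Z (weight Z) B < mass Z (weight Z) A)
    compress with Z.∀? (λ z → (A Z.∋? z) →-dec (A′ Z.∋? z))
    ... | inj₁ A⊆A′ = inj₁ λ i {x} {y} a x≲y r → Z.⊆∧≥⇒⊇ {A} {A′} (λ {z} → A⊆A′ z) (≤-reflexive cardA′)
            (trans (A′-ι y i) (closedS i (trans (sym (A′-ι x i)) (A⊆A′ _ a)) x≲y r))
    ... | inj₂ (z , n) = inj₂ (A′ , homA′ , cardA′ , card-∂ , subst₂ _<_ (sym massA′) (sym (∑-ι _))
            (∑-strict (λ i → mass-≤ X (anti i) {B = fibre A i} (homS i) (fibre-hom {e} {A} hA i) (closedS i) (cardS i))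
              (∈is (πi z))
              (mass-strict X (anti (πi z)) {B = fibre A (πi z)} (homS (πi z)) (fibre-hom {e} {A} hA (πi z))
                (closedS (πi z)) (cardS (πi z)) {πx z}
                (subst (A Z.∋_) (sym (ι-π z)) (Boolₚ.¬-not (λ e → n λ s → true≢false s e)))
                (λ s → n λ _ → s))))


-- Antichains, chains and rectangles

discrete : ℕ → Po
discrete c = record
  { X = Fin c ; els = allFin c ; complete = ∈ₚ.∈-allFin ; unique = Uniqueₚ.allFin⁺ c ; _≟_ = Finₚ._≟_
  ; rk = λ _ → 0 ; _⊑_ = _≡_ ; _⊑?_ = Finₚ._≟_ ; ⊑-refl = refl ; ⊑-rk = λ _ → z≤n ; ⊑-eq = λ e _ → e
  }

-- The index of the copy becomes the most significant coordinate, so within each rank one copy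
-- precedes the other. With all ranks zero, `climb` has nothing to climb.
copies : ℕ → LexPoset
copies c = record
  { po = discrete c
  ; _≲_ = λ k l → toℕ k ≤ toℕ l
  ; isTotal = Finₚ.≤-isTotalOrder
  ; ⋖⇒≲ = λ { (refl , _) → ≤-refl }
  ; climb = λ {z} p _ q → z , ε , sym (ℕₚ.n≤0⇒n≡0 q) , p
  }

infixl 6 _⊗ᴸ_

-- The new chain has n + 1 elements, and its coordinate is the least significant.
_⊗ᴸ_ : LexPoset → ℕ → LexPoset
L ⊗ᴸ n = Product.lex L n

copies-macaulay : ∀ c → LexPoset.Macaulayᴸ (copies c)
copies-macaulay c e =
  (λ {A} {S} _ _ _ _ → ≤-trans (≤-reflexive (card-∅ {∂ S} (λ {y} → no-∂ {S} {y}))) z≤n) ,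
  (λ {S} _ _ {x} p → contradiction p (no-∂ {S} {x}))
  where
  open LexPoset (copies c)
  no-∂ : ∀ {A y} → ¬ ∂ A ∋ y
  no-∂ {A} {y} p with ∂⁻ {A} {y} p
  ... | _ , _ , _ , ()

line-macaulay : ∀ c n → LexPoset.Macaulayᴸ (copies c ⊗ᴸ n)
line-macaulay c n e = (λ {A} {S} hA hS cS eq → borel-min (copies-macaulay c) {e} {A} {S} hA
                          (λ k {y} p → contradiction p (no-∂ {λ z → A (z , suc k)} {y})) hS cS eq) ,
                      (λ {S} → ∂-closed {e} (copies-macaulay c e) {S})
  where
  open Product (copies c) n
  module C = LexPoset (copies c)
  no-∂ : ∀ {A y} → ¬ C.∂ A C.∋ y
  no-∂ {A} {y} p with C.∂⁻ {A} {y} p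
  ... | _ , _ , _ , ()

module Rectangle (a b : ℕ) where
  private
    module Y = LexPoset (copies 1 ⊗ᴸ a)
    module R = LexPoset ((copies 1 ⊗ᴸ a) ⊗ᴸ b)
    module Pr = Product (copies 1 ⊗ᴸ a) b
  open LexPoset ((copies 1 ⊗ᴸ a) ⊗ᴸ b)

  -- The last element is fixed as a default value; a bound excludes it wherever `inc` serves to
  -- produce a cover.
  inc : ∀ {n} → Fin (suc n) → Fin (suc n)
  inc {n} k with suc (toℕ k) ℕₚ.<? suc n
  ... | yes p = fromℕ< p
  ... | no _  = k

  toℕ-inc : ∀ {n} {k : Fin (suc n)} → toℕ k < n → toℕ (inc k) ≡ suc (toℕ k)
  toℕ-inc {n} {k} l with suc (toℕ k) ℕₚ.<? suc n
  ... | yes p = Finₚ.toℕ-fromℕ< p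
  ... | no ¬p = contradiction (s≤s l) ¬p

  inc-injective : ∀ {n} {k l : Fin (suc n)} → toℕ k < n → toℕ l < n → inc k ≡ inc l → k ≡ l
  inc-injective p q e = Finₚ.toℕ-injective (suc-injective (trans (sym (toℕ-inc p)) (trans (cong toℕ e) (toℕ-inc q))))

  right : ∀ {y} {k : Fin (suc b)} → toℕ k < b → (y , k) ⋖ (y , inc k)
  right {y} {k} l = ⋖-snd Y.po {k = k} {l = inc k} (toℕ-inc l)

  up : ∀ {t : Fin 1} {j : Fin (suc a)} {k : Fin (suc b)} → toℕ j < a → ((t , j) , k) ⋖ ((t , inc j) , k)
  up {t} {j} {k} l = ⋖-fst Y.po {suc b} {k = k} (⋖-snd (discrete 1) {x = t} {k = j} {l = inc j} (toℕ-inc l))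

  fst-≤ : ∀ {e A t j k} → Hom e A → A ∋ ((t , j) , k) → toℕ j ≤ e
  fst-≤ {j = j} h p = ≤-trans (m≤m+n (toℕ j) _) (≤-reflexive (h p))

  snd-≤ : ∀ {e A t j k} → Hom e A → A ∋ ((t , j) , k) → toℕ k ≤ e
  snd-≤ {j = j} {k} h p = ≤-trans (m≤n+m (toℕ k) (toℕ j)) (≤-reflexive (h p))

  private
    rightmost : X → X
    rightmost (y , k) = y , inc k

    rightmost-∂ : ∀ {e A} → Hom e A → e < b → ∀ {x} → A ∋ x → ∂ A ∋ rightmost x
    rightmost-∂ {A = A} h l {y , k} p = ∂⁺ {A} p (right {y} (≤-<-trans (snd-≤ {A = A} h p) l))

    rightmost-inj : ∀ {e A} → Hom e A → e < b → ∀ {x y} → A ∋ x → A ∋ y → rightmost x ≡ rightmost y → x ≡ y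
    rightmost-inj {A = A} h l {x , k} {y , k′} p q e = cong₂ _,_ (cong proj₁ e)
      (inc-injective (≤-<-trans (snd-≤ {A = A} h p) l) (≤-<-trans (snd-≤ {A = A} h q) l) (cong proj₂ e))

  ∂-≥-wide : ∀ {e A} → Hom e A → e < b → card A ≤ card (∂ A)
  ∂-≥-wide {e} {A} h l = card-inj po po rightmost {A} {∂ A} (rightmost-∂ {A = A} h l) (rightmost-inj {A = A} h l)

  -- Moving right keeps the first coordinate. Raising the element with the largest first coordinate
  -- therefore gives a member of the shadow that no move to the right reaches.
  ∂->-triangle : ∀ {e A} → Hom e A → e < a → e < b → 0 < card A → card A < card (∂ A)
  ∂->-triangle {e} {A} h l l′ ne with Segments.maximum _≲_ total ≲-trans {λ x → A ∋ x} (A ∋?_) (card>0⇒∃ {A} ne)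
  ... | ((t , j) , k) , p , top = card-inj-< po po rightmost {A} {∂ A} (rightmost-∂ {A = A} h l′) (rightmost-inj {A = A} h l′)
        {(t , inc j) , k} (∂⁺ {A} p (up (≤-<-trans (fst-≤ {A = A} h p) l)))
        λ { {(t′ , j′) , k′} q e → <⇒≱ (≤-reflexive (trans (sym (toℕ-inc (≤-<-trans (fst-≤ {A = A} h p) l)))
                 (cong (toℕ ∘ proj₂ ∘ proj₁) (sym e)))) (j-max t j t′ j′ (Pr.fst-≲ (top q))) }
    where
    j-max : ∀ t j t′ j′ → (t′ , j′) Y.≲ (t , j) → toℕ j′ ≤ toℕ j
    j-max zero j zero j′ (inj₁ (_ , ne))   = contradiction refl ne
    j-max zero j zero j′ (inj₂ (_ , p)) = p

  -- The elements of A on either side of a missing one move away from each other.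
  ∂-≥-gap : ∀ {e A x₀} → Hom e A → rk x₀ ≡ e → ¬ A ∋ x₀ → card A ≤ card (∂ A)
  ∂-≥-gap {e} {A} {(t₀ , j₀) , k₀} h r ¬a = card-inj po po f {A} {∂ A} into (λ {x} {y} → inj {x} {y})
    where
    f : X → X
    f ((t , j) , k) with toℕ j ℕₚ.<? toℕ j₀
    ... | yes _ = (t , inc j) , k
    ... | no  _ = (t , j) , inc k

    beyond : ∀ {t j k} → A ∋ ((t , j) , k) → ¬ toℕ j < toℕ j₀ → toℕ j₀ < toℕ j × toℕ k < b
    beyond {zero} {j} {k} p ¬l with ℕₚ.m≤n⇒m<n∨m≡n (≮⇒≥ ¬l)
    ... | inj₁ l = l , <-≤-trans (ℕₚ.+-cancelˡ-< (toℕ j₀) _ _ (<-≤-trans (ℕₚ.+-monoˡ-< (toℕ k) l)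
                           (≤-reflexive (trans (h p) (sym r))))) (Finₚ.toℕ≤pred[n] k₀)
    ... | inj₂ e with Finₚ.toℕ-injective e
    ...   | refl with Finₚ.toℕ-injective (+-cancelˡ-≡ (toℕ j₀) _ _ (trans (h p) (sym r)))
    beyond {zero} {j} {k} p ¬l | inj₂ e | refl | refl = contradiction (subst (λ t → A ((t , j) , k) ≡ true) (sym (t≡ t₀)) p) ¬a
      where
      t≡ : (t : Fin 1) → t ≡ zero
      t≡ zero = refl

    j<a : ∀ {j : Fin (suc a)} → toℕ j < toℕ j₀ → toℕ j < a
    j<a l = <-≤-trans l (Finₚ.toℕ≤pred[n] j₀)

    into : ∀ {x} → A ∋ x → ∂ A ∋ f x
    into {(t , j) , k} p with toℕ j ℕₚ.<? toℕ j₀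
    ... | yes l = ∂⁺ {A} p (up (j<a l))
    ... | no ¬l = ∂⁺ {A} p (right {t , j} (proj₂ (beyond p ¬l)))

    crossing : ∀ {j k l j′ : Fin (suc a)} → toℕ j < toℕ j₀ → toℕ j₀ < toℕ j′ → inc j ≡ j′ → ∀ {A : Set} → A
    crossing {j} p q e = contradiction (≤-trans (≤-trans q (≤-reflexive (trans (cong toℕ (sym e)) (toℕ-inc (j<a p))))) p)
                               (<-irrefl refl)

    inj : ∀ {x y} → A ∋ x → A ∋ y → f x ≡ f y → x ≡ y
    inj {(t , j) , k} {(t′ , j′) , k′} p q e with toℕ j ℕₚ.<? toℕ j₀ | toℕ j′ ℕₚ.<? toℕ j₀
    ... | yes l | yes l′ = cong₂ _,_ (cong₂ _,_ (cong (proj₁ ∘ proj₁) e)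
                             (inc-injective (j<a l) (j<a l′) (cong (proj₂ ∘ proj₁) e))) (cong proj₂ e)
    ... | yes l | no ¬l′ = crossing {j} {j} {j} l (proj₁ (beyond q ¬l′)) (cong (proj₂ ∘ proj₁) e)
    ... | no ¬l | yes l′ = crossing {j′} {j} {j} l′ (proj₁ (beyond p ¬l)) (sym (cong (proj₂ ∘ proj₁) e))
    ... | no ¬l | no ¬l′ = cong₂ _,_ (cong proj₁ e)
                             (inc-injective (proj₂ (beyond p ¬l)) (proj₂ (beyond q ¬l′)) (cong proj₂ e))

  private
    module _ {e S} (h : Hom e S) (c : Closed S) where
      -- By the slice count, a segment gains at most the shadow of its bottom slice. That is a set
      -- of one rank in a chain: at most one element, and none once `e` has reached the length `a`
      -- of the chain.
      bottom-∂ : Y.Subset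
      bottom-∂ = Y.∂ (Pr.slice S zero)

      bottom-hom : Y.Hom (suc e) bottom-∂
      bottom-hom = Y.∂-hom {e} {Pr.slice S zero} (Pr.slice-hom {e} {S} h zero)

      bottom-card : Y.card bottom-∂ ≤ 1
      bottom-card = card-inj Y.po (discrete 1) proj₁ {bottom-∂} {λ _ → true} (λ _ → refl)
        λ { {t , j} {t′ , j′} p q refl → cong (t ,_) (Finₚ.toℕ-injective (trans (bottom-hom p) (sym (bottom-hom q)))) }

      bottom-empty : a ≤ e → Y.card bottom-∂ ≡ 0
      bottom-empty l = Y.card-∅ {bottom-∂} λ { {t , j} p → <⇒≱ (≤-reflexive (sym (bottom-hom p)))
                          (≤-trans (Finₚ.toℕ≤pred[n] j) l) }

      closed-∂ : card (∂ S) + Y.card (Pr.slice S (fromℕ b)) ≤ Y.card bottom-∂ + card S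
      closed-∂ = Pr.card-∂-≤ {S} (Pr.closed⇒borel {S} c)

  ∂-≤-suc : ∀ {e S} → Hom e S → Closed S → card (∂ S) ≤ suc (card S)
  ∂-≤-suc {S = S} h c = ≤-trans (m≤m+n _ _) (≤-trans (closed-∂ {S = S} h c) (+-monoˡ-≤ (card S) (bottom-card {S = S} h c)))

  ∂-≤ : ∀ {e S} → Hom e S → Closed S → a ≤ e → card (∂ S) ≤ card S
  ∂-≤ {S = S} h c l = ≤-trans (m≤m+n _ _) (≤-trans (closed-∂ {S = S} h c)
                (≤-reflexive (cong (_+ card S) (bottom-empty {S = S} h c l))))

  -- The level is itself a segment, gains nothing from its bottom slice as `a ≤ e`, and loses its
  -- last slice. That slice is nonempty: it contains the element with coordinates `e ∸ b` and `b`.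
  lvl-shrinks : ∀ {e x} → rk x ≡ e → a ≤ e → b ≤ e → card (∂ (lvl e)) < card (lvl e)
  lvl-shrinks {e} {(t , j) , k} r l l′ = <-≤-trans (≤-trans
      (≤-reflexive (+-comm 1 _)) (+-monoʳ-≤ (card (∂ (lvl e))) (Y.card>0 {Pr.slice (lvl e) (fromℕ b)} {t , j′} (lvl⁺ {e} {(t , j′) , fromℕ b} rank))))
      (≤-trans (closed-∂ {S = lvl e} (λ {x} → lvl-hom {e} {x}) (λ {x} {y} → closed {x} {y})) (≤-reflexive (cong (_+ card (lvl e)) (bottom-empty {S = lvl e} (λ {x} → lvl-hom {e} {x}) (λ {x} {y} → closed {x} {y}) l))))
    where
    closed : Closed (lvl e)
    closed {x} {y} = lvl-closed {_≲_ = _≲_} {e} {x} {y}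
    e≤a+b : e ∸ b < suc a
    e≤a+b = s≤s (ℕₚ.m≤n+o⇒m∸n≤o e b (≤-trans (≤-reflexive (sym r)) (≤-trans
              (+-mono-≤ (Finₚ.toℕ≤pred[n] j) (Finₚ.toℕ≤pred[n] k)) (≤-reflexive (+-comm a b)))))
    j′ : Fin (suc a)
    j′ = fromℕ< e≤a+b
    rank : toℕ j′ + toℕ (fromℕ b) ≡ e
    rank = trans (cong₂ _+_ (Finₚ.toℕ-fromℕ< e≤a+b) (Finₚ.toℕ-fromℕ b)) (m∸n+n≡m l′)

  -- Below rank `a` every nonempty set gains at least one element and a segment gains at most one.
  -- From `a` to `b` sets do not lose and segments do not gain. From `b` on only the full level can
  -- lose, and there `S` lies in `A`.
  rectangle-macaulay : a ≤ b → Macaulayᴸ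
  rectangle-macaulay a≤b e = (λ {A} {S} → minimal {A} {S}) , (λ {S} → Pr.∂-closed {e} (line-macaulay 1 a e) {S})
    where
    minimal : ∀ {A S} → Hom e A → Hom e S → Closed S → card S ≡ card A → card (∂ S) ≤ card (∂ A)
    minimal {A} {S} hA hS cS eq with e ℕₚ.<? a | e ℕₚ.<? b | card A ℕₚ.≟ 0
    ... | _ | _ | yes z = ≤-trans (≤-reflexive (card-∅ {∂ S} none)) z≤n
      where
      none : ∀ {x} → ¬ ∂ S ∋ x
      none {x} p with ∂⁻ {S} {x} p
      ... | y , s , _ = <⇒≢ (card>0 {S} s) (sym (trans eq z))
    ... | yes l | _ | no ne = ≤-trans (∂-≤-suc {S = S} hS cS) (≤-trans (s≤s (≤-reflexive eq))
                    (∂->-triangle {A = A} hA l (<-≤-trans l a≤b) (n≢0⇒n>0 ne)))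
    ... | no ¬l | yes l′ | _ = ≤-trans (∂-≤ {S = S} hS cS (≮⇒≥ ¬l)) (≤-trans (≤-reflexive eq) (∂-≥-wide {A = A} hA l′))
    ... | no ¬l | no ¬l′ | _ with ∃? (λ x → (lvl e ∋? x) ×-dec ¬? (A ∋? x))
    ...   | yes (x , p , ¬a) = ≤-trans (∂-≤ {S = S} hS cS (≮⇒≥ ¬l)) (≤-trans (≤-reflexive eq)
                (∂-≥-gap {A = A} {x} hA (lvl-hom {e} {x} p) ¬a))
    ...   | no none = card-mono {∂ S} {∂ A} (λ {x} → ∂-mono {S} {A} (λ {y} s →
                Boolₚ.¬-not (λ f → none (y , lvl⁺ {e} {y} (hS s) , λ t → true≢false t f))) {x})

module _ (L : LexPoset) (a b : ℕ) where
  private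
    module L = LexPoset L
    module K = LexPoset (L ⊗ᴸ a)
    module Z = LexPoset ((L ⊗ᴸ a) ⊗ᴸ b)
    module R = LexPoset ((copies 1 ⊗ᴸ a) ⊗ᴸ b)
    module Pr = Product (L ⊗ᴸ a) b

    slices : Fibration ((L ⊗ᴸ a) ⊗ᴸ b) (L ⊗ᴸ a)
    slices = record
      { I = Fin (suc b) ; is = allFin (suc b) ; ∈is = ∈ₚ.∈-allFin
      ; ι = _,_ ; πx = proj₁ ; πi = proj₂
      ; ι-π = λ _ → refl ; πx-ι = λ _ _ → refl ; πi-ι = λ _ _ → refl
      ; ∑-ι = λ f → trans (∑-× K.els (allFin (suc b))) (∑-swap K.els (allFin (suc b)) _)
      ; r = toℕ ; J = λ k l → toℕ l ≡ suc (toℕ k)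
      ; rk-ι = λ _ _ → refl
      ; up-X = λ {_} {_} {k} → ⋖-fst K.po {k = k}
      ; up-J = λ {_} {k} {l} → ⋖-snd K.po {k = k} {l = l}
      ; ⋖-ι = ⋖-split K.po
      ; ≲-ι = λ {x} {y} {k} p → case x K.≟ y of λ { (yes refl) → inj₂ (refl , ≤-refl) ; (no ne) → inj₁ (p , ne) }
      }

    planes : Fibration ((L ⊗ᴸ a) ⊗ᴸ b) ((copies 1 ⊗ᴸ a) ⊗ᴸ b)
    planes = record
      { I = L.X ; is = L.els ; ∈is = L.complete
      ; ι = λ ((_ , j) , k) w → (w , j) , k ; πx = λ ((_ , j) , k) → (zero , j) , k ; πi = λ ((w , _) , _) → w
      ; ι-π = λ _ → refl ; πx-ι = λ { ((zero , _) , _) _ → refl } ; πi-ι = λ _ _ → refl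
      ; ∑-ι = λ f → trans (trans (∑-× K.els (allFin (suc b))) (∑-× L.els (allFin (suc a))))
                  (∑-cong L.els λ w → sym (trans (∑-× (LexPoset.els (copies 1 ⊗ᴸ a)) (allFin (suc b)))
                     (trans (∑-× (allFin 1) (allFin (suc a))) (+-identityʳ _))))
      ; r = L.rk ; J = L._⋖_
      ; rk-ι = λ ((_ , j) , k) w → trans (+-assoc (L.rk w) (toℕ j) (toℕ k)) (+-comm (L.rk w) _)
      ; up-X = λ { {(zero , j) , k} {(zero , j′) , k′} {w} c → up {w} c }
      ; up-J = λ { {(_ , j) , k} c → ⋖-fst K.po {k = k} (⋖-fst L.po {k = j} c) }
      ; ⋖-ι = λ { {(zero , j) , k} {(zero , j′) , k′} c → split c }
      ; ≲-ι = λ { {(zero , j) , k} {(zero , j′) , k′} → mono }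
      }
      where
      up : ∀ {w j k j′ k′} → ((zero , j) , k) R.⋖ ((zero , j′) , k′) → ((w , j) , k) Z.⋖ ((w , j′) , k′)
      up {w} {j} {k} {j′} {k′} c with ⋖-split (LexPoset.po (copies 1 ⊗ᴸ a)) c
      ... | inj₂ (refl , e) = ⋖-snd K.po {k = k} {l = k′} e
      ... | inj₁ (d , refl) with ⋖-split (discrete 1) d
      ...   | inj₂ (refl , e) = ⋖-fst K.po {k = k} (⋖-snd L.po {k = j} {l = j′} e)
      split : ∀ {w w′ j k j′ k′} → ((w , j) , k) Z.⋖ ((w′ , j′) , k′) →
              (((zero , j) , k) R.⋖ ((zero , j′) , k′) × w ≡ w′) ⊎ (((zero , j) , k) ≡ ((zero , j′) , k′) × w L.⋖ w′)
      split {w} {w′} {j} {k} {j′} {k′} c with ⋖-split K.po c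
      ... | inj₂ (refl , e) = inj₁ (⋖-snd (LexPoset.po (copies 1 ⊗ᴸ a)) {x = zero , j} {k = k} {l = k′} e , refl)
      ... | inj₁ (d , refl) with ⋖-split L.po d
      ...   | inj₂ (refl , e) = inj₁ (⋖-fst (LexPoset.po (copies 1 ⊗ᴸ a)) {k = k} (⋖-snd (discrete 1) {x = zero} {k = j} {l = j′} e) , refl)
      ...   | inj₁ (d′ , refl) = inj₂ (refl , d′)
      mono : ∀ {w j k j′ k′} → ((zero , j) , k) R.≲ ((zero , j′) , k′) → ((w , j) , k) Z.≲ ((w , j′) , k′)
      mono (inj₁ (inj₁ (_ , ne) , _)) = contradiction refl ne
      mono (inj₁ (inj₂ (_ , p) , ne)) = inj₁ (inj₂ (refl , p) , λ { refl → ne refl })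
      mono (inj₂ (refl , p)) = inj₂ (refl , p)

  -- Segments in all slices and in all planes spanned by the last two
  -- coordinates; as a ≥ 1, a cover in another direction can be routed through
  -- the next-to-last coordinate.
  closed-fibres⇒borel : 1 ≤ a → ∀ {A} → (∀ k → K.Closed (λ y → A (y , k))) →
    (∀ w → R.Closed (λ ((_ , j) , k) → A ((w , j) , k))) → Pr.Borel A
  closed-fibres⇒borel (s≤s {n = a′} _) {A} slice plane k {w′ , j′} p with K.∂⁻ {λ y → A (y , suc k)} {w′ , j′} p
  ... | (w , j) , s , d with ⋖-split L.po d
  ...   | inj₂ (refl , e) = plane w {(zero , j) , suc k} {(zero , j′) , inject₁ k} s
            (inj₁ (inj₂ (refl , ≤-trans (n≤1+n _) (≤-reflexive (sym e))) ,
                   λ { refl → ℕₚ.1+n≢n (sym e) }))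
            (trans (cong₂ _+_ e (Finₚ.toℕ-inject₁ k)) (sym (+-suc (toℕ j) (toℕ k))))
  ...   | inj₁ (c , refl) with j
  -- With next-to-last coordinate zero, one step is first moved into it from the last coordinate,
  -- inside a plane, and then spent on the cover in `L`, inside a slice. If it is positive, as in
  -- the next case, it pays for the cover first and is restored afterwards.
  ...     | zero = slice (inject₁ k)
              (plane w {(zero , zero) , suc k} {(zero , suc zero) , inject₁ k} s (inj₁ (inj₂ (refl , z≤n) , λ ()))
                 (cong suc (Finₚ.toℕ-inject₁ k)))
              (inj₁ (L.⋖⇒≲ c , L.⋖⇒≢ c)) (trans (+-identityʳ _) (trans (proj₂ c) (+-comm 1 _)))
  ...     | suc i = plane w′ {(zero , inject₁ i) , suc k} {(zero , suc i) , inject₁ k}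
              (slice (suc k) s (inj₁ (L.⋖⇒≲ c , L.⋖⇒≢ c))
                (trans (cong₂ _+_ (proj₂ c) (Finₚ.toℕ-inject₁ i)) (sym (+-suc (L.rk w) (toℕ i)))))
              (inj₁ (inj₂ (refl , ≤-trans (≤-reflexive (Finₚ.toℕ-inject₁ i)) (n≤1+n _)) ,
                     λ e → ℕₚ.1+n≢n (trans (cong (toℕ ∘ proj₂) (sym e)) (Finₚ.toℕ-inject₁ i))))
              (trans (cong (suc (toℕ i) +_) (Finₚ.toℕ-inject₁ k))
                (trans (sym (+-suc (toℕ i) (toℕ k))) (cong (_+ suc (toℕ k)) (sym (Finₚ.toℕ-inject₁ i)))))

  step-macaulay : 1 ≤ a → a ≤ b → K.Macaulayᴸ → Z.Macaulayᴸ
  step-macaulay 1≤a a≤b mac e = (λ {A} {S} → minimal {A} {S} (<-wellFounded _)) , (λ {S} → Pr.∂-closed {e} (mac e) {S})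
    where
    minimal : ∀ {A S} → Acc _<_ (mass ((L ⊗ᴸ a) ⊗ᴸ b) (weight ((L ⊗ᴸ a) ⊗ᴸ b)) A) →
              Z.Hom e A → Z.Hom e S → Z.Closed S → Z.card S ≡ Z.card A → Z.card (Z.∂ S) ≤ Z.card (Z.∂ A)
    minimal {A} {S} (acc rec) hA hS cS eq with Compression.compress slices mac {e} {A} hA
    ... | inj₂ (B , hB , cB , ∂B , l) = ≤-trans (minimal {B} {S} (rec l) hB hS cS (trans eq (sym cB))) ∂B
    ... | inj₁ slice with Compression.compress planes (Rectangle.rectangle-macaulay a b a≤b) {e} {A} hA
    ...   | inj₂ (B , hB , cB , ∂B , l) = ≤-trans (minimal {B} {S} (rec l) hB hS cS (trans eq (sym cB))) ∂B
    ...   | inj₁ plane = Pr.borel-min mac {e} {A} {S} hA (closed-fibres⇒borel 1≤a {A} slice plane) hS cS eq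

nest : ℕ → List ℕ → LexPoset
nest c []       = copies c
nest c (a ∷ as) = nest c as ⊗ᴸ a

nest-macaulay : ∀ c {as} → Linked ℕ._≥_ as → AllL.All (1 ≤_) as → LexPoset.Macaulayᴸ (nest c as)
nest-macaulay c []                       _             = copies-macaulay c
nest-macaulay c {a ∷ []}     [-]         _             = line-macaulay c a
nest-macaulay c {a ∷ b ∷ as} (p ∷ l) (_ ∷ q@(1≤b ∷ _)) = step-macaulay (nest c as) b a 1≤b p (nest-macaulay c l q)


-- Isomorphisms

record Iso (P Q : Po) : Set where
  private
    module P = Po P
    module Q = Po Q
  field
    to      : P.X → Q.X
    from    : Q.X → P.X
    to-from : ∀ y → to (from y) ≡ y
    from-to : ∀ x → from (to x) ≡ x
    ⊑-to    : ∀ {x y} → x P.⊑ y → to x Q.⊑ to y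
    ⊑-from  : ∀ {x y} → x Q.⊑ y → from x P.⊑ from y
    rk-to   : ∀ x → Q.rk (to x) ≡ P.rk x

  to-injective : ∀ {x y} → to x ≡ to y → x ≡ y
  to-injective e = trans (sym (from-to _)) (trans (cong from e) (from-to _))

  rk-from : ∀ y → P.rk (from y) ≡ Q.rk y
  rk-from y = trans (sym (rk-to (from y))) (cong Q.rk (to-from y))

  ⋖-to : ∀ {x y} → x P.⋖ y → to x Q.⋖ to y
  ⋖-to (p , r) = ⊑-to p , trans (rk-to _) (trans r (cong suc (sym (rk-to _))))

  ⋖-from : ∀ {x y} → x Q.⋖ y → from x P.⋖ from y
  ⋖-from (p , r) = ⊑-from p , trans (rk-from _) (trans r (cong suc (sym (rk-from _))))

iso-refl : ∀ {P} → Iso P P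
iso-refl = record { to = id ; from = id ; to-from = λ _ → refl ; from-to = λ _ → refl
                  ; ⊑-to = id ; ⊑-from = id ; rk-to = λ _ → refl }

iso-sym : ∀ {P Q} → Iso P Q → Iso Q P
iso-sym f = record { to = from ; from = to ; to-from = from-to ; from-to = to-from
                   ; ⊑-to = ⊑-from ; ⊑-from = ⊑-to ; rk-to = rk-from }
  where open Iso f

infixr 5 _⨾_
_⨾_ : ∀ {P Q R} → Iso P Q → Iso Q R → Iso P R
f ⨾ g = record
  { to = G.to ∘ F.to ; from = F.from ∘ G.from
  ; to-from = λ y → trans (cong G.to (F.to-from _)) (G.to-from y)
  ; from-to = λ x → trans (cong F.from (G.from-to _)) (F.from-to x)
  ; ⊑-to = G.⊑-to ∘ F.⊑-to ; ⊑-from = F.⊑-from ∘ G.⊑-from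
  ; rk-to = λ x → trans (G.rk-to _) (F.rk-to x)
  }
  where
  module F = Iso f
  module G = Iso g

⊗-cong : ∀ {P Q m} → Iso P Q → Iso (P ⊗ m) (Q ⊗ m)
⊗-cong f = record
  { to = λ (x , k) → to x , k ; from = λ (y , k) → from y , k
  ; to-from = λ (y , k) → cong (_, k) (to-from y) ; from-to = λ (x , k) → cong (_, k) (from-to x)
  ; ⊑-to = λ (p , q) → ⊑-to p , q ; ⊑-from = λ (p , q) → ⊑-from p , q
  ; rk-to = λ (x , k) → cong (_+ toℕ k) (rk-to x)
  }
  where open Iso f

⊗-swap : ∀ P {m n} → Iso ((P ⊗ m) ⊗ n) ((P ⊗ n) ⊗ m)
⊗-swap P = record
  { to = λ ((x , k) , l) → (x , l) , k ; from = λ ((x , k) , l) → (x , l) , k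
  ; to-from = λ _ → refl ; from-to = λ _ → refl
  ; ⊑-to = λ ((p , q) , r) → (p , r) , q ; ⊑-from = λ ((p , q) , r) → (p , r) , q
  ; rk-to = λ ((x , k) , l) → trans (+-assoc (rk x) _ _) (trans (cong (rk x +_) (+-comm (toℕ l) _))
                                (sym (+-assoc (rk x) _ _)))
  }
  where open Po P

⊗-one : ∀ {P} → Iso (P ⊗ 1) P
⊗-one = record
  { to = proj₁ ; from = _, zero
  ; to-from = λ _ → refl ; from-to = λ { (_ , zero) → refl }
  ; ⊑-to = proj₁ ; ⊑-from = _, z≤n
  ; rk-to = λ { (_ , zero) → sym (+-identityʳ _) }
  }

infixl 5 _⊎ᴾ_

_⊎ᴾ_ : Po → Po → Po
P ⊎ᴾ Q = record
  { X = P.X ⊎ Q.X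
  ; els = List.map inj₁ P.els ++ List.map inj₂ Q.els
  ; complete = [ (λ p → ∈ₚ.∈-++⁺ˡ (∈ₚ.∈-map⁺ inj₁ (P.complete p)))
               , (λ q → ∈ₚ.∈-++⁺ʳ (List.map inj₁ P.els) (∈ₚ.∈-map⁺ inj₂ (Q.complete q))) ]
  ; unique = Uniqueₚ.++⁺ (Uniqueₚ.map⁺ Sumₚ.inj₁-injective P.unique) (Uniqueₚ.map⁺ Sumₚ.inj₂-injective Q.unique)
      λ (p , q) → apart (proj₂ (proj₂ (∈ₚ.∈-map⁻ inj₁ p))) (proj₂ (proj₂ (∈ₚ.∈-map⁻ inj₂ q)))
  ; _≟_ = Sumₚ.≡-dec P._≟_ Q._≟_
  ; rk = [ P.rk , Q.rk ]
  ; _⊑_ = SumR.Pointwise P._⊑_ Q._⊑_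
  ; _⊑?_ = SumR.⊎-decidable P._⊑?_ Q._⊑?_
  ; ⊑-refl = λ { {inj₁ _} → inj₁ P.⊑-refl ; {inj₂ _} → inj₂ Q.⊑-refl }
  ; ⊑-rk = λ { (inj₁ p) → P.⊑-rk p ; (inj₂ q) → Q.⊑-rk q }
  ; ⊑-eq = λ { (inj₁ p) e → cong inj₁ (P.⊑-eq p e) ; (inj₂ q) e → cong inj₂ (Q.⊑-eq q e) }
  }
  where
  open Sum using ([_,_])
  module P = Po P
  module Q = Po Q
  apart : ∀ {x : P.X ⊎ Q.X} {p q} → x ≡ inj₁ p → x ≡ inj₂ q → ∀ {A : Set} → A
  apart refl ()

⊎-cong : ∀ {P P′ Q Q′} → Iso P P′ → Iso Q Q′ → Iso (P ⊎ᴾ Q) (P′ ⊎ᴾ Q′)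
⊎-cong f g = record
  { to = Sum.map F.to G.to ; from = Sum.map F.from G.from
  ; to-from = λ { (inj₁ x) → cong inj₁ (F.to-from x) ; (inj₂ x) → cong inj₂ (G.to-from x) }
  ; from-to = λ { (inj₁ x) → cong inj₁ (F.from-to x) ; (inj₂ x) → cong inj₂ (G.from-to x) }
  ; ⊑-to = λ { (inj₁ p) → inj₁ (F.⊑-to p) ; (inj₂ p) → inj₂ (G.⊑-to p) }
  ; ⊑-from = λ { (inj₁ p) → inj₁ (F.⊑-from p) ; (inj₂ p) → inj₂ (G.⊑-from p) }
  ; rk-to = λ { (inj₁ x) → F.rk-to x ; (inj₂ x) → G.rk-to x }
  }
  where
  module F = Iso f
  module G = Iso g

⊎-⊗ : ∀ P Q {m} → Iso ((P ⊎ᴾ Q) ⊗ m) ((P ⊗ m) ⊎ᴾ (Q ⊗ m))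
⊎-⊗ P Q = record
  { to = λ { (inj₁ x , k) → inj₁ (x , k) ; (inj₂ x , k) → inj₂ (x , k) }
  ; from = λ { (inj₁ (x , k)) → inj₁ x , k ; (inj₂ (x , k)) → inj₂ x , k }
  ; to-from = λ { (inj₁ _) → refl ; (inj₂ _) → refl }
  ; from-to = λ { (inj₁ _ , _) → refl ; (inj₂ _ , _) → refl }
  ; ⊑-to = λ { (inj₁ p , q) → inj₁ (p , q) ; (inj₂ p , q) → inj₂ (p , q) }
  ; ⊑-from = λ { (inj₁ (p , q)) → inj₁ p , q ; (inj₂ (p , q)) → inj₂ p , q }
  ; rk-to = λ { (inj₁ _ , _) → refl ; (inj₂ _ , _) → refl }
  }

nest-perm : ∀ c {as bs} → as ↭ bs → Iso (LexPoset.po (nest c as)) (LexPoset.po (nest c bs))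
nest-perm c Perm.refl         = iso-refl
nest-perm c (Perm.prep a p)   = ⊗-cong (nest-perm c p)
nest-perm c {_ ∷ _ ∷ as} (Perm.swap a b p) = ⊗-swap (LexPoset.po (nest c as)) ⨾ ⊗-cong (⊗-cong (nest-perm c p))
nest-perm c (Perm.trans p q)  = nest-perm c p ⨾ nest-perm c q

nest-two : ∀ as → Iso (LexPoset.po (nest 2 as)) (LexPoset.po (nest 1 as) ⊎ᴾ LexPoset.po (nest 1 as))
nest-two [] = record
  { to = λ { zero → inj₁ zero ; (suc _) → inj₂ zero }
  ; from = λ { (inj₁ _) → zero ; (inj₂ _) → suc zero }
  ; to-from = λ { (inj₁ zero) → refl ; (inj₂ zero) → refl }
  ; from-to = λ { zero → refl ; (suc zero) → refl }
  ; ⊑-to = λ { {zero} refl → inj₁ refl ; {suc zero} refl → inj₂ refl }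
  ; ⊑-from = λ { (inj₁ _) → refl ; (inj₂ _) → refl }
  ; rk-to = λ { zero → refl ; (suc zero) → refl }
  }
nest-two (a ∷ as) = ⊗-cong (nest-two as) ⨾ ⊎-⊗ (LexPoset.po (nest 1 as)) (LexPoset.po (nest 1 as))

pointwise-<-irrelevant : ∀ {n} {a d : Vec ℕ n} (p q : Pointwise _<_ a d) → p ≡ q
pointwise-<-irrelevant []      []      = refl
pointwise-<-irrelevant (p ∷ u) (q ∷ v) = cong₂ _∷_ (ℕₚ.<-irrelevant p q) (pointwise-<-irrelevant u v)

box-≡ : ∀ {n} {d : Vec ℕ n} {a b : Box d} → proj₁ a ≡ proj₁ b → a ≡ b
box-≡ {a = a , p} {_ , q} refl = cong (a ,_) (pointwise-<-irrelevant p q)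

sum-rigid : ∀ {n} {a b : Vec ℕ n} → Pointwise _≤_ a b → Vec.sum a ≡ Vec.sum b → a ≡ b
sum-rigid []      _ = refl
sum-rigid (p ∷ u) e with +-split p (sum-mono u) e
... | refl , e′ = cong (_ ∷_) (sum-rigid u e′)

boxPo : ∀ {n} → Vec ℕ n → Po
boxPo d = record
  { X = Box d ; els = boxElements d
  ; complete = λ a → Any.map box-≡ (boxElements-all d a)
  ; unique = AllPairs.map (λ ne e → ne (cong proj₁ e)) (boxElements-unique d)
  ; _≟_ = λ a b → map′ box-≡ (cong proj₁) (Vecₚ.≡-dec ℕₚ._≟_ (proj₁ a) (proj₁ b))
  ; rk = Vec.sum ∘ proj₁
  ; _⊑_ = _≤ᴮ_
  ; _⊑?_ = λ a b → PW.decidable ℕₚ._≤?_ (proj₁ a) (proj₁ b)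
  ; ⊑-refl = PW.refl ≤-refl
  ; ⊑-rk = sum-mono
  ; ⊑-eq = λ p e → box-≡ (sum-rigid p e)
  }

box-[] : Iso (boxPo []) (discrete 1)
box-[] = record
  { to = λ _ → zero ; from = λ _ → [] , [] ; to-from = λ { zero → refl } ; from-to = λ { ([] , []) → refl }
  ; ⊑-to = λ _ → refl ; ⊑-from = λ _ → [] ; rk-to = λ { ([] , []) → refl }
  }

box-∷ : ∀ {n} m (d : Vec ℕ n) → Iso (boxPo (m ∷ d)) (boxPo d ⊗ m)
box-∷ m d = record
  { to = λ { (x ∷ a , p ∷ u) → (a , u) , fromℕ< p }
  ; from = λ ((a , u) , k) → toℕ k ∷ a , Finₚ.toℕ<n k ∷ u
  ; to-from = λ ((a , u) , k) → cong ((a , u) ,_) (Finₚ.toℕ-injective (Finₚ.toℕ-fromℕ< (Finₚ.toℕ<n k)))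
  ; from-to = λ { (x ∷ a , p ∷ u) → box-≡ (cong (_∷ a) (Finₚ.toℕ-fromℕ< p)) }
  ; ⊑-to = λ { {_ ∷ _ , p ∷ _} {_ ∷ _ , q ∷ _} (r ∷ s) → s , subst₂ _≤_ (sym (Finₚ.toℕ-fromℕ< p)) (sym (Finₚ.toℕ-fromℕ< q)) r }
  ; ⊑-from = λ (r , s) → s ∷ r
  ; rk-to = λ { (x ∷ a , p ∷ u) → trans (cong (Vec.sum a +_) (Finₚ.toℕ-fromℕ< p)) (+-comm (Vec.sum a) x) }
  }

-- Chains of one element are dropped and the others recorded by their number of steps, so that the
-- entries add up to the height and their number is the dimension.
shape : ∀ {n} → Vec ℕ n → List ℕ
shape d = List.map pred (sides d)

box-nest : ∀ {n} {d : Vec ℕ n} → Positive d → Iso (boxPo d) (LexPoset.po (nest 1 (shape d)))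
box-nest []                                   = box-[]
box-nest {d = suc zero    ∷ d} (_ ∷ d⁺) = box-∷ 1 d ⨾ ⊗-one ⨾ box-nest d⁺
box-nest {d = suc (suc n) ∷ d} (_ ∷ d⁺) = box-∷ (suc (suc n)) d ⨾ ⊗-cong (box-nest d⁺)

module Transfer {P Q : Po} (f : Iso P Q) where
  open Iso f
  private
    module P = Po P
    module Q = Po Q
    module SP = Subsets P
    module SQ = Subsets Q

  card-to : ∀ (A : SQ.Subset) → SP.card (A ∘ to) ≡ SQ.card A
  card-to A = ≤-antisym
    (card-inj P Q to {A ∘ to} {A} id (λ _ _ → to-injective))
    (card-inj Q P from {A} {A ∘ to} (λ {y} a → trans (cong A (to-from y)) a)
       (λ {x} {y} _ _ e → trans (sym (to-from x)) (trans (cong to e) (to-from y))))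

  ∂-to : ∀ {A : SQ.Subset} → SP.∂ (A ∘ to) SP.⊆ (SQ.∂ A ∘ to)
  ∂-to {A} {y} p with SP.∂⁻ {A ∘ to} {y} p
  ... | x , a , c = SQ.∂⁺ {A} a (⋖-to c)

  ∂-to⁻ : ∀ {A : SQ.Subset} → (SQ.∂ A ∘ to) SP.⊆ SP.∂ (A ∘ to)
  ∂-to⁻ {A} {y} p with SQ.∂⁻ {A} {to y} p
  ... | x , a , c = SP.∂⁺ {A ∘ to} {from x} (trans (cong A (to-from x)) a)
                      (subst (from x P.⋖_) (from-to y) (⋖-from c))

  card-∂-to : ∀ (A : SQ.Subset) → SP.card (SP.∂ (A ∘ to)) ≡ SQ.card (SQ.∂ A)
  card-∂-to A = trans (SP.card-cong {SP.∂ (A ∘ to)} {SQ.∂ A ∘ to} (∂-to {A}) (∂-to⁻ {A})) (card-to (SQ.∂ A))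

  hom-to : ∀ {e} {A : SQ.Subset} → SQ.Hom e A → SP.Hom e (A ∘ to)
  hom-to h {x} a = trans (sym (rk-to x)) (h a)

  module _ {_≲_ : Rel P.X 0ℓ} where

    _≲′_ : Rel Q.X 0ℓ
    x ≲′ y = from x ≲ from y

    closed-to : ∀ {A : SQ.Subset} → SQ.Closed _≲′_ A → SP.Closed _≲_ (A ∘ to)
    closed-to c {x} {y} a p r = c a (subst₂ _≲_ (sym (from-to x)) (sym (from-to y)) p)
                                  (trans (rk-to y) (trans r (sym (rk-to x))))

    macAt-to : ∀ {e} → SP.MacAt _≲_ e → SQ.MacAt _≲′_ e
    macAt-to {e} (min , cl) =
      (λ {A} {S} hA hS cS eq → subst₂ _≤_ (card-∂-to S) (card-∂-to A)
         (min {A ∘ to} {S ∘ to} (hom-to {A = A} hA) (hom-to {A = S} hS) (closed-to {S} cS)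
            (trans (card-to S) (trans eq (sym (card-to A)))))) ,
      λ {S} hS cS {x} {y} p x≲y r → subst (λ z → SQ.∂ S z ≡ true) (to-from y)
         (∂-to {S} {from y} (cl {S ∘ to} (hom-to {A = S} hS) (closed-to {S} cS)
            (∂-to⁻ {S} {from x} (trans (cong (SQ.∂ S) (to-from x)) p)) x≲y
            (trans (rk-from y) (trans r (sym (rk-from x))))))


-- Segments as lists

⋖-intro : (R : RankedPoset) → let open RankedPoset R using (_⋖_; rank) renaming (_≤_ to _≤ᴿ_) in
          ∀ {a b} → a ≤ᴿ b → rank b ≡ suc (rank a) → a ⋖ b
⋖-intro R {a} {b} p r =
  (p , λ e → ℕₚ.1+n≢n (trans (sym r) (sym (rank-cong e)))) ,
  λ c (a<c , c<b) → <⇒≱ (rank-strict c<b) (≤-trans (≤-reflexive r) (rank-strict a<c))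
  where open RankedPoset R using (rank-cong; rank-strict)

module Listed (R : RankedPoset) where
  open RankedPoset R hiding (_≤_; _<_; trans; refl; reflexive; antisym; _≟_)
    renaming (Unique to Uniqueᴿ)
  open SetoidMembership Eq.setoid public using () renaming (_∈_ to _∈ˢ_)
  open SetoidSubset Eq.setoid public using () renaming (_⊆_ to _⊆ˢ_)
  open Pigeonhole Eq.setoid public

  ∈-level⁺ : ∀ {e a} → rank a ≡ e → a ∈ˢ level R e
  ∈-level⁺ {e} {a} r = ∈ₛ.∈-filter⁺ Eq.setoid (λ a → rank a ℕₚ.≟ e) (λ x≈y p → trans (sym (rank-cong x≈y)) p)
                      (elements-all a) r

  ∈-level⁻ : ∀ {e a} → a ∈ˢ level R e → rank a ≡ e
  ∈-level⁻ {e} {a} p = proj₂ (∈ₛ.∈-filter⁻ Eq.setoid (λ a → rank a ℕₚ.≟ e) (λ x≈y q → trans (sym (rank-cong x≈y)) q) {a} {elements} p)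

  level-unique : ∀ e → Uniqueᴿ (level R e)
  level-unique e = Uniqueₛ.filter⁺ Eq.setoid (λ a → rank a ℕₚ.≟ e) elements-unique

  private
    covers : ∀ A b → Dec (Any.Any (_⋖ b) A)
    covers A b = any? (_⋖? b) A

    ⋖-resp : ∀ {a b c} → b ≈ c → a ⋖ b → a ⋖ c
    ⋖-resp {a} {b} {c} e p = ⋖-intro R (≤-respʳ-≈ e (proj₁ (proj₁ p))) (trans (sym (rank-cong e)) (rank-cover p))

    ⋖-respˡ : ∀ {a b c} → a ≈ b → a ⋖ c → b ⋖ c
    ⋖-respˡ e p = ⋖-intro R (≤-respˡ-≈ e (proj₁ (proj₁ p))) (trans (rank-cover p) (cong suc (rank-cong e)))

  ∈-∇⁺ : ∀ {A a b} → a ∈ˢ A → a ⋖ b → b ∈ˢ ∇ R A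
  ∈-∇⁺ {A} {a} {b} p c = ∈ₛ.∈-filter⁺ Eq.setoid (covers A) (λ e → Any.map (⋖-resp e)) (elements-all b)
                          (Any.map (λ e → ⋖-respˡ e c) p)

  ∈-∇⁻ : ∀ {A b} → b ∈ˢ ∇ R A → ∃ λ a → a ∈ A × a ⋖ b
  ∈-∇⁻ {A} {b} p with find (proj₂ (∈ₛ.∈-filter⁻ Eq.setoid (covers A) (λ e → Any.map (⋖-resp e)) {b} {elements} p))
  ... | a , q , c = a , q , c

  ∇-unique : ∀ A → Uniqueᴿ (∇ R A)
  ∇-unique A = Uniqueₛ.filter⁺ Eq.setoid (covers A) elements-unique

  ∇-rank : ∀ {e A} → AllL.All (λ a → rank a ≡ e) A → AllL.All (λ b → rank b ≡ suc e) (∇ R A)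
  ∇-rank {e} {A} h = AllL.tabulate λ {b} p → let a , q , c = ∈-∇⁻ {A} (Any.map Eq.reflexive p) in
    trans (rank-cover c) (cong suc (AllL.lookup h q))

  module Sorted (_≼_ : Rel Carrier 0ℓ) (tot : IsTotalOrder _≈_ _≼_) where
    open IsTotalOrder tot using () renaming (antisym to ≼-antisym; trans to ≼-trans)
    open Sort (Relation.Binary.Construct.Flip.EqAndOrd.decTotalOrder (decTotalOrder R _≼_ tot)) using (sort; sort-↭; sort-↗)

    seg : ℕ → ℕ → List Carrier
    seg = Seg R _≼_ tot

    MacList : ℕ → Set
    MacList e = ∀ (A : List Carrier) → Uniqueᴿ A → AllL.All (λ a → rank a ≡ e) A →
      let S = seg e (length A) ; S′ = seg (suc e) (length (∇ R S)) in
      length (∇ R S) ℕ.≤ length (∇ R A) × (∇ R S ⊆ˢ S′ × S′ ⊆ˢ ∇ R S)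

    private
      sorted : ∀ e → AllPairs (λ a b → b ≼ a) (sort (level R e))
      sorted e = Linkedₚ.Linked⇒AllPairs (λ p q → ≼-trans q p) (sort-↗ (level R e))

      ∈-sort⁺ : ∀ {e a} → rank a ≡ e → a ∈ˢ sort (level R e)
      ∈-sort⁺ {e} r = Permₚ.Any-resp-↭ (↭-sym (sort-↭ (level R e))) (∈-level⁺ r)

      ∈-sort⁻ : ∀ {e a} → a ∈ˢ sort (level R e) → rank a ≡ e
      ∈-sort⁻ {e} p = ∈-level⁻ (Permₚ.Any-resp-↭ (sort-↭ (level R e)) p)

      sort-unique : ∀ e → Uniqueᴿ (sort (level R e))
      sort-unique e = PermSₚ.AllPairs-resp-↭ (setoid Carrier) (λ ne e → ne (Eq.sym e)) ((λ { refl ne → ne }) , (λ { refl ne → ne }))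
                        (Perm.↭⇒↭ₛ (↭-sym (sort-↭ (level R e)))) (level-unique e)

      take-closed : ∀ q {xs x y} → AllPairs (λ a b → b ≼ a) xs → x ∈ˢ take q xs → x ≼ y → y ∈ˢ xs → y ∈ˢ take q xs
      take-closed (suc q) {z ∷ xs} {x} {y} (_ ∷ s) p x≼y (here y≈z) = here y≈z
      take-closed (suc q) {z ∷ xs} {x} {y} (h ∷ s) (there p) x≼y (there r) = there (take-closed q s p x≼y r)
      take-closed (suc q) {z ∷ xs} {x} {y} (h ∷ s) (here x≈z) x≼y (there r) with find r
      ... | w , w∈ , y≈w = here (≼-antisym (≼-trans (IsTotalOrder.reflexive tot y≈w)
              (AllL.lookup h w∈)) (≼-trans (IsTotalOrder.reflexive tot (Eq.sym x≈z)) x≼y))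

      take⊆ : ∀ q {xs x} → x ∈ˢ take q xs → x ∈ˢ xs
      take⊆ (suc q) {_ ∷ _} (here p)  = here p
      take⊆ (suc q) {_ ∷ _} (there p) = there (take⊆ q p)

    seg-rank : ∀ e q → AllL.All (λ a → rank a ≡ e) (seg e q)
    seg-rank e q = AllL.tabulate λ p → ∈-sort⁻ (take⊆ q (Any.map Eq.reflexive p))

    seg-unique : ∀ e q → Uniqueᴿ (seg e q)
    seg-unique e q = Uniqueₛ.take⁺ Eq.setoid q (sort-unique e)

    seg-closed : ∀ e q {a b} → a ∈ˢ seg e q → a ≼ b → rank b ≡ e → b ∈ˢ seg e q
    seg-closed e q p a≼b r = take-closed q (sorted e) p a≼b (∈-sort⁺ r)

    seg-length : ∀ e {q} → q ≤ length (level R e) → length (seg e q) ≡ q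
    seg-length e {q} l = trans (Listₚ.length-take q _) (ℕₚ.m≤n⇒m⊓n≡m (≤-trans l
      (≤-reflexive (sym (Permₚ.↭-length (sort-↭ (level R e)))))))

    seg-all : ∀ e {q a} → length (level R e) ≤ q → rank a ≡ e → a ∈ˢ seg e q
    seg-all e {q} l r rewrite Listₚ.take-all q (sort (level R e))
      (≤-trans (≤-reflexive (Permₚ.↭-length (sort-↭ (level R e)))) l) = ∈-sort⁺ r

  ≤-level : ∀ {e A} → Uniqueᴿ A → AllL.All (λ a → rank a ≡ e) A → length A ≤ length (level R e)
  ≤-level u h = ⊆⇒length≤ u λ p → let a , q , x≈a = find p in ∈-level⁺ (trans (rank-cong x≈a) (AllL.lookup h q))

  module _ (_≼_ : Rel Carrier 0ℓ) (tot : IsTotalOrder _≈_ _≼_) where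
    open Sorted _≼_ tot

    -- Takes care of the ranks next to an identified point: every nonempty set has the whole next
    -- level as its shadow, whatever the order.
    macList-complete : ∀ {e} → (∀ {a b} → rank a ≡ e → rank b ≡ suc e → a ⋖ b) → MacList e
    macList-complete {e} c [] u h = ≤-refl ,
      (λ p → contradiction (∈-∇⁻ {S₀} p) λ { (_ , () , _) }) ,
      λ {x} p → contradiction (subst (λ n → x ∈ˢ seg (suc e) n) len₀ p) λ ()
      where
      S₀ : List Carrier
      S₀ = []
      len₀ : length (∇ R S₀) ≡ 0
      len₀ = ℕₚ.n≤0⇒n≡0 (⊆⇒length≤ {∇ R S₀} {[]} (∇-unique S₀) (λ p → contradiction (∈-∇⁻ {S₀} p) λ { (_ , () , _) }))
    macList-complete {e} c A@(a ∷ as) u h@(r ∷ _) =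
      ⊆⇒length≤ (∇-unique S) (λ p → ∈-∇⁺ {A} (here Eq.refl) (c r (rank∇ p))) ,
      (λ p → seg-all (suc e) (⊆⇒length≤ (level-unique (suc e)) all∇) (rank∇ p)) ,
      λ p → all∇ (∈-level⁺ (let b , q , x≈b = find p in trans (rank-cong x≈b) (AllL.lookup (seg-rank (suc e) _) q)))
      where
      S : List Carrier
      S = seg e (length A)
      rank∇ : ∀ {b} → b ∈ˢ ∇ R S → rank b ≡ suc e
      rank∇ p = let b , q , x≈b = find p in trans (rank-cong x≈b) (AllL.lookup (∇-rank (seg-rank e (length A))) q)
      first : ∃ λ s → s ∈ S
      first with S | seg-length e {length A} (≤-level u h)
      ... | s ∷ _ | _ = s , here refl
      all∇ : level R (suc e) ⊆ˢ ∇ R S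
      all∇ p = ∈-∇⁺ {S} (Any.map Eq.reflexive (proj₂ first))
                 (c (AllL.lookup (seg-rank e (length A)) (proj₂ first)) (∈-level⁻ p))

module Bridge {k l} (d : Vec ℕ k) (e : Vec ℕ l) (d⁺ : Positive d) (e⁺ : Positive e)
              (G : Gluing (CL d d⁺) (CL e e⁺)) where
  open Gluing G using (_≍_; rank-≍)

  R : RankedPoset
  R = glue G

  W : Po
  W = boxPo d ⊎ᴾ boxPo e

  open RankedPoset R using (Carrier; _≈_; rank; rank-cong; elements-all; elements-unique; module Eq)
  private
    module R = RankedPoset R
  open Po W using (_⋖_; els; complete; rk)
  open Subsets W
  open Listed R

  Unglued : ℕ → Set
  Unglued n = ∀ {p q} → Vec.sum (proj₁ p) ≡ n → ¬ (p ≍ q)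

  ≈⇒≡ : ∀ {n a b} → Unglued n → rk a ≡ n → a ≈ b → a ≡ b
  ≈⇒≡ {a = inj₁ _} {inj₁ _} g r e = cong inj₁ (box-≡ e)
  ≈⇒≡ {a = inj₁ _} {inj₂ _} g r e = contradiction e (g r)
  ≈⇒≡ {a = inj₂ _} {inj₁ _} g r e = contradiction e (g (trans (rank-≍ e) r))
  ≈⇒≡ {a = inj₂ _} {inj₂ _} g r e = cong inj₂ (box-≡ e)

  ⋖-toR : ∀ {a b} → a ⋖ b → a R.⋖ b
  ⋖-toR {a@(inj₁ x)} {b@(inj₁ y)} (inj₁ p , r) = ⋖-intro R {a} {b} (inj₁ (x , refl , y , refl , p)) r
  ⋖-toR {a@(inj₂ x)} {b@(inj₂ y)} (inj₂ p , r) = ⋖-intro R {a} {b} (inj₂ (x , refl , y , refl , p)) r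

  ⋖-fromR : ∀ {n a b} → Unglued n → Unglued (suc n) → rk a ≡ n → a R.⋖ b → a ⋖ b
  ⋖-fromR {n} {a} {b} g g′ r c with proj₁ (proj₁ c)
  ... | inj₁ (p , a≈p , p′ , b≈p′ , p≤p′) = subst₂ _⋖_ (sym a≡) (sym b≡)
          (inj₁ p≤p′ , trans (cong rk (sym b≡)) (trans (R.rank-cover {a} {b} c) (cong (suc ∘ rk) a≡)))
    where
    a≡ : a ≡ inj₁ p
    a≡ = ≈⇒≡ {a = a} g r a≈p
    b≡ : b ≡ inj₁ p′
    b≡ = ≈⇒≡ {a = b} g′ (trans (R.rank-cover {a} {b} c) (cong suc r)) b≈p′
  ... | inj₂ (p , a≈p , p′ , b≈p′ , p≤p′) = subst₂ _⋖_ (sym a≡) (sym b≡)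
          (inj₂ p≤p′ , trans (cong rk (sym b≡)) (trans (R.rank-cover {a} {b} c) (cong (suc ∘ rk) a≡)))
    where
    a≡ : a ≡ inj₂ p
    a≡ = ≈⇒≡ {a = a} g r a≈p
    b≡ : b ≡ inj₂ p′
    b≡ = ≈⇒≡ {a = b} g′ (trans (R.rank-cover {a} {b} c) (cong suc r)) b≈p′

  χ : List Carrier → Subset
  χ B = ⟦ (λ x → any? (x R.≟_) B) ⟧

  χ⁺ : ∀ {B x} → x ∈ˢ B → χ B ∋ x
  χ⁺ {B} {x} = dec-true (any? (x R.≟_) B)

  χ⁻ : ∀ {B x} → χ B ∋ x → x ∈ˢ B
  χ⁻ {B} {x} = does⁻ (any? (x R.≟_) B)

  χ-hom : ∀ {n B} → AllL.All (λ a → rank a ≡ n) B → Hom n (χ B)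
  χ-hom {n} {B} h {x} p with find (χ⁻ {B} {x} p)
  ... | a , q , x≈a = trans (rank-cong {x} {a} x≈a) (AllL.lookup h q)

  listing : Subset → List Carrier
  listing A = filter (A ∋?_) els

  ∈-listing⁻ : ∀ {A x} → x ∈ listing A → A ∋ x
  ∈-listing⁻ {A} p = proj₂ (∈ₚ.∈-filter⁻ (A ∋?_) {xs = els} p)

  listing-rank : ∀ {n A} → Hom n A → AllL.All (λ a → rank a ≡ n) (listing A)
  listing-rank {n} {A} h = AllL.tabulate λ p → h (∈-listing⁻ {A} p)

  listing-length : ∀ A → length (listing A) ≡ card A
  listing-length A = go els
    where
    go : ∀ xs → length (filter (A ∋?_) xs) ≡ ∑ xs (𝟙 ∘ A)
    go [] = refl
    go (x ∷ xs) with A x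
    ... | true  = cong suc (go xs)
    ... | false = go xs

  listing-unique : ∀ {n A} → Unglued n → Hom n A → R.Unique (listing A)
  listing-unique {n} {A} g h = go (listing-rank {n} {A} h) (Uniqueₚ.filter⁺ (A ∋?_) (Po.unique W))
    where
    go : ∀ {xs} → AllL.All (λ a → rank a ≡ n) xs → Unique xs → R.Unique xs
    go [] [] = []
    go {x ∷ xs} (r ∷ rs) (ne ∷ u) = AllL.map (λ {y} ne e → ne (≈⇒≡ {a = x} {y} g r e)) ne ∷ go rs u

  module _ {n} (g : Unglued n) where

    χ-listing : ∀ {A} → Hom n A → χ (listing A) ⊆ A
    χ-listing {A} h {x} p with find (χ⁻ {listing A} {x} p)
    ... | a , q , x≈a with ≈⇒≡ {a = a} {x} g (h (∈-listing⁻ {A} q)) (R.Eq.sym {x} {a} x≈a)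
    ...   | refl = ∈-listing⁻ {A} q

    listing-χ : ∀ {A} → A ⊆ χ (listing A)
    listing-χ {A} {x} a = χ⁺ {listing A} {x} (Any.map (λ { refl → R.Eq.refl {x} }) (∈ₚ.∈-filter⁺ (A ∋?_) (complete x) a))

    card-χ : ∀ {B} → R.Unique B → AllL.All (λ a → rank a ≡ n) B → card (χ B) ≡ length B
    card-χ {B} u h = trans (sym (listing-length (χ B))) (≤-antisym
      (⊆⇒length≤ (listing-unique {n} {χ B} g (λ {x} → χ-hom h {x})) λ {x} p → let a , q , x≈a = find p in
         ∈ₛ.∈-resp-≈ Eq.setoid {B} {a} {x} (R.Eq.sym {x} {a} x≈a) (χ⁻ {B} {a} (∈-listing⁻ {χ B} q)))
      (⊆⇒length≤ u λ {x} p → χ⁻ {listing (χ B)} {x} (listing-χ {χ B} {x} (χ⁺ {B} {x} p))))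

    module _ (g′ : Unglued (suc n)) where

      ∂χ⊆ : ∀ {B} → AllL.All (λ a → rank a ≡ n) B → ∂ (χ B) ⊆ χ (∇ R B)
      ∂χ⊆ {B} h {y} p with ∂⁻ {χ B} {y} p
      ... | x , a , c = χ⁺ {∇ R B} {y} (∈-∇⁺ {B} {x} {y} (χ⁻ {B} {x} a) (⋖-toR c))

      ⊆∂χ : ∀ {B} → AllL.All (λ a → rank a ≡ n) B → χ (∇ R B) ⊆ ∂ (χ B)
      ⊆∂χ {B} h {y} p with ∈-∇⁻ {B} {y} (χ⁻ {∇ R B} {y} p)
      ... | x , q , c = ∂⁺ {χ B} {x} (χ⁺ {B} {x} (Any.map (λ { refl → R.Eq.refl {x} }) q))
                          (⋖-fromR {n} {x} {y} g g′ (AllL.lookup h q) c)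

      card-∂χ : ∀ {B} → AllL.All (λ a → rank a ≡ n) B → card (∂ (χ B)) ≡ card (χ (∇ R B))
      card-∂χ {B} h = card-cong {∂ (χ B)} {χ (∇ R B)} (∂χ⊆ h) (⊆∂χ h)

  module Ordered (_≼_ : Rel Carrier 0ℓ) (tot : IsTotalOrder _≈_ _≼_) where
    open Sorted _≼_ tot
    open IsTotalOrder tot using () renaming (total to ≼-total; trans to ≼-trans)
    open Segments _≼_ ≼-total (λ {a} {b} {c} → ≼-trans {a} {b} {c}) using (nested)

    seg-χ-closed : ∀ n q → Closed _≼_ (χ (seg n q))
    seg-χ-closed n q {x} {y} p x≼y r = χ⁺ {seg n q} {y} (seg-closed n q {x} {y} (χ⁻ {seg n q} {x} p) x≼y
      (trans r (χ-hom {n} {seg n q} (seg-rank n q) {x} p)))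

    module _ {n} (g : Unglued n) (g′ : Unglued (suc n)) where

      private
        card-seg : ∀ {n} → Unglued n → ∀ {B} → R.Unique B → AllL.All (λ a → rank a ≡ n) B →
                   card (χ (seg n (length B))) ≡ length B
        card-seg {n} g {B} u h = trans (card-χ g (seg-unique n (length B)) (seg-rank n (length B))) (seg-length n (≤-level u h))

        ∇-length : ∀ {B} → AllL.All (λ a → rank a ≡ n) B → card (∂ (χ B)) ≡ length (∇ R B)
        ∇-length {B} h = trans (card-∂χ g g′ h) (card-χ g′ (∇-unique B) (∇-rank h))

      macAt⇒macList : MacAt _≼_ n → MacList n
      macAt⇒macList (min , cl) A u h =
        subst₂ _≤_ (∇-length (seg-rank n (length A))) (∇-length h)
          (min {χ A} {χ S} (λ {x} → χ-hom h {x}) (λ {x} → χ-hom (seg-rank n (length A)) {x}) (λ {x} {y} → seg-χ-closed n (length A) {x} {y})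
             (trans (card-seg g u h) (sym (card-χ g u h)))) ,
        (λ {x} p → χ⁻ {S′} {x} (nested (λ {x} → hom∂ {x}) (λ {x} → χ-hom (seg-rank (suc n) (length (∇ R S))) {x}) (λ {x} {y} → closed∂ {x} {y}) (λ {x} {y} → seg-χ-closed (suc n) (length (∇ R S)) {x} {y})
                       (≤-reflexive (sym same)) {x} (⊆∂χ g g′ (seg-rank n (length A)) {x} (χ⁺ {∇ R S} {x} p)))) ,
        (λ {x} p → χ⁻ {∇ R S} {x} (∂χ⊆ g g′ (seg-rank n (length A)) {x}
                       (nested (λ {x} → χ-hom (seg-rank (suc n) (length (∇ R S))) {x}) (λ {x} → hom∂ {x}) (λ {x} {y} → seg-χ-closed (suc n) (length (∇ R S)) {x} {y}) (λ {x} {y} → closed∂ {x} {y})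
                         (≤-reflexive same) {x} (χ⁺ {S′} {x} p))))
        where
        S S′ : List Carrier
        S  = seg n (length A)
        S′ = seg (suc n) (length (∇ R S))
        hom∂ : Hom (suc n) (∂ (χ S))
        hom∂ = ∂-hom {n} {χ S} (λ {x} → χ-hom (seg-rank n (length A)) {x})
        closed∂ : Closed _≼_ (∂ (χ S))
        closed∂ = cl {χ S} (λ {x} → χ-hom (seg-rank n (length A)) {x}) (λ {x} {y} → seg-χ-closed n (length A) {x} {y})
        same : card (χ S′) ≡ card (∂ (χ S))
        same = trans (card-seg g′ (∇-unique S) (∇-rank (seg-rank n (length A)))) (sym (∇-length (seg-rank n (length A))))

      macList⇒macAt : MacList n → MacAt _≼_ n
      macList⇒macAt mac = (λ {A} {S} → min {A} {S}) , λ {S} → cl {S}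
        where
        module _ {A S} (hA : Hom n A) (hS : Hom n S) (cS : Closed _≼_ S) (eq : card S ≡ card A) where
          LA T T′ : List Carrier
          LA = listing A
          T  = seg n (length LA)
          T′ = seg (suc n) (length (∇ R T))
          cardT : card (χ T) ≡ card S
          cardT = trans (card-seg g (listing-unique {n} {A} g hA) (listing-rank {n} {A} hA)) (trans (listing-length A) (sym eq))
          T⊆S : χ T ⊆ S
          T⊆S = nested (λ {x} → χ-hom (seg-rank n (length LA)) {x}) hS (λ {x} {y} → seg-χ-closed n (length LA) {x} {y}) cS (≤-reflexive cardT)
          S⊆T : S ⊆ χ T
          S⊆T = nested hS (λ {x} → χ-hom (seg-rank n (length LA)) {x}) cS (λ {x} {y} → seg-χ-closed n (length LA) {x} {y}) (≤-reflexive (sym cardT))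
          mac-A : _
          mac-A = mac LA (listing-unique {n} {A} g hA) (listing-rank {n} {A} hA)

          min : card (∂ S) ≤ card (∂ A)
          min = ≤-trans (card-mono {∂ S} {∂ (χ T)} (∂-mono {S} {χ T} S⊆T)) (≤-trans
            (subst₂ _≤_ (sym (∇-length (seg-rank n (length LA)))) (sym (∇-length (listing-rank {n} {A} hA))) (proj₁ mac-A))
            (card-mono {∂ (χ LA)} {∂ A} (∂-mono {χ LA} {A} (χ-listing g {A} hA))))

          cl′ : Closed _≼_ (∂ S)
          cl′ {x} {y} p x≼y r = ∂-mono {χ T} {S} T⊆S {y} (⊆∂χ g g′ (seg-rank n (length LA)) {y} (χ⁺ {∇ R T} {y}
            (proj₂ (proj₂ mac-A) {y} (χ⁻ {T′} {y} (seg-χ-closed (suc n) (length (∇ R T)) {x} {y}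
               (χ⁺ {T′} {x} (proj₁ (proj₂ mac-A) {x} (χ⁻ {∇ R T} {x} (∂χ⊆ g g′ (seg-rank n (length LA)) {x} (∂-mono {S} {χ T} S⊆T {x} p)))))
               x≼y r)))))

        cl : ∀ {S} → Hom n S → Closed _≼_ S → Closed _≼_ (∂ S)
        cl {S} hS cS = cl′ {S} {S} hS hS cS refl


-- Glued posets and orders on disjoint unions

boxes : ∀ {k l} → Vec ℕ k → Vec ℕ l → Po
boxes d e = boxPo d ⊎ᴾ boxPo e

-- What a Macaulay order of the glued poset amounts to on the disjoint union. In an identified rank
-- distinct elements may compare both ways, so antisymmetry and the two conditions are asked for in
-- the other ranks alone.
record Ordering (W : Po) (Good : ℕ → Set) : Set₁ where
  open Po W
  field
    _≼_     : Rel X 0ℓ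
    total   : Total _≼_
    ≼-trans : Transitive _≼_
    antisym : ∀ {n} → Good n → ∀ {a b} → rk a ≡ n → rk b ≡ n → a ≼ b → b ≼ a → a ≡ b
    macAt   : ∀ {n} → Good n → Good (suc n) → Subsets.MacAt W _≼_ n

module Gluings {k l} {d : Vec ℕ k} {e : Vec ℕ l} (d⁺ : Positive d) (e⁺ : Positive e)
               (G : Gluing (CL d d⁺) (CL e e⁺)) where
  open Bridge d e d⁺ e⁺ G public using (R; W; Unglued)
  open Bridge d e d⁺ e⁺ G hiding (R; W; Unglued)
  open Po W using (X; rk)
  open Subsets W
  private module R = RankedPoset R

  -- Each rank is either untouched by the identification or collapsed to one point, and a step
  -- between ranks that are not both untouched has all possible covers. Wedges and diamonds differ
  -- only in which ranks are untouched.
  record Separation : Set₁ where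
    field
      Good     : ℕ → Set
      Good?    : U.Decidable Good
      unglued  : ∀ {n} → Good n → Unglued n
      collapse : ∀ {a b} → ¬ Good (rk a) → rk a ≡ rk b → a R.≈ b
      complete : ∀ n → (Good n × Good (suc n)) ⊎ (∀ {a b} → rk a ≡ n → rk b ≡ suc n → a R.⋖ b)

  module _ (S : Separation) where
    open Separation S

    macaulay⇒ordering : Macaulay (glue G) → Ordering (boxes d e) Good
    macaulay⇒ordering (_≼_ , tot , mac) = record
      { _≼_ = _≼_ ; total = IsTotalOrder.total tot
      ; ≼-trans = λ {a} {b} {c} → IsTotalOrder.trans tot {a} {b} {c}
      ; antisym = λ g {a} {b} r _ p q → ≈⇒≡ {a = a} {b} (unglued g) r (IsTotalOrder.antisym tot {a} {b} p q)
      ; macAt = λ {n} g g′ → Ordered.macList⇒macAt _≼_ tot (unglued g) (unglued g′) (mac n)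
      }

    module _ (_≲_ : Rel X 0ℓ) (tot : IsTotalOrder _≡_ _≲_)
             (mac : ∀ {n} → Good n → Good (suc n) → MacAt _≲_ n) where
      private
        module T = IsTotalOrder tot

        -- Comparing by rank first confines `≲` to single ranks. In a collapsed rank it can then be
        -- ignored, as it must be: identified elements have to compare both ways.
        _≼_ : Rel X 0ℓ
        a ≼ b = rk a < rk b ⊎ (rk a ≡ rk b × (Good (rk a) → a ≲ b))

        ≼-reflexive : ∀ {a b} → a R.≈ b → a ≼ b
        ≼-reflexive {a} {b} p = inj₂ (R.rank-cong {a} {b} p , λ g → T.reflexive (≈⇒≡ {a = a} {b} (unglued g) refl p))

        ≼-trans : ∀ {a b c} → a ≼ b → b ≼ c → a ≼ c
        ≼-trans (inj₁ p) (inj₁ q) = inj₁ (<-trans p q)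
        ≼-trans (inj₁ p) (inj₂ (q , _)) = inj₁ (<-≤-trans p (≤-reflexive q))
        ≼-trans (inj₂ (p , _)) (inj₁ q) = inj₁ (≤-<-trans (≤-reflexive p) q)
        ≼-trans (inj₂ (p , u)) (inj₂ (q , v)) = inj₂ (trans p q , λ g → T.trans (u g) (v (subst Good p g)))

        ≼-antisym : ∀ {a b} → a ≼ b → b ≼ a → a R.≈ b
        ≼-antisym (inj₁ p) (inj₁ q) = contradiction p (ℕₚ.<-asym q)
        ≼-antisym (inj₁ p) (inj₂ (q , _)) = contradiction p (<-irrefl (sym q))
        ≼-antisym (inj₂ (p , _)) (inj₁ q) = contradiction q (<-irrefl (sym p))
        ≼-antisym {a} {b} (inj₂ (p , u)) (inj₂ (q , v)) with Good? (rk a)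
        ... | yes g = R.Eq.reflexive {a} {b} (T.antisym (u g) (v (subst Good p g)))
        ... | no ¬g = collapse {a} {b} ¬g p

        ≼-total : ∀ a b → a ≼ b ⊎ b ≼ a
        ≼-total a b with ℕₚ.<-cmp (rk a) (rk b)
        ... | tri< p _ _ = inj₁ (inj₁ p)
        ... | tri> _ _ p = inj₂ (inj₁ p)
        ... | tri≈ _ e _ with T.total a b
        ...   | inj₁ p = inj₁ (inj₂ (e , λ _ → p))
        ...   | inj₂ p = inj₂ (inj₂ (sym e , λ _ → p))

        ≼-isTotal : IsTotalOrder R._≈_ _≼_
        ≼-isTotal = record
          { isPartialOrder = record
            { isPreorder = record
              { isEquivalence = R.isEquivalence
              ; reflexive = λ {a} {b} → ≼-reflexive {a} {b}
              ; trans = λ {a} {b} {c} → ≼-trans {a} {b} {c} }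
            ; antisym = λ {a} {b} → ≼-antisym {a} {b} }
          ; total = ≼-total }

        closed-≲ : ∀ {A} → Closed _≼_ A → Closed _≲_ A
        closed-≲ c {x} {y} a p r = c a (inj₂ (sym r , λ _ → p)) r

        closed-≼ : ∀ {n A} → Good n → Hom n A → Closed _≲_ A → Closed _≼_ A
        closed-≼ g h c {x} {y} a (inj₁ p) r = contradiction p (<-irrefl (sym r))
        closed-≼ g h c {x} {y} a (inj₂ (_ , p)) r = c a (p (subst Good (sym (h a)) g)) r

      ordering⇒macaulay : Macaulay (glue G)
      ordering⇒macaulay = _≼_ , ≼-isTotal , λ n → at n (complete n)
        where
        open Listed R using (module Sorted; macList-complete)
        at : ∀ n → (Good n × Good (suc n)) ⊎ (∀ {a b} → rk a ≡ n → rk b ≡ suc n → a R.⋖ b) → Sorted.MacList _≼_ ≼-isTotal n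
        at n (inj₂ c) = macList-complete _≼_ ≼-isTotal {n} (λ {a} {b} → c {a} {b})
        at n (inj₁ (g , g′)) = Ordered.macAt⇒macList _≼_ ≼-isTotal {n} (unglued g) (unglued g′)
          ((λ {A} {S} hA hS cS → proj₁ (mac g g′) {A} {S} hA hS (closed-≲ {S} cS)) ,
           λ {S} hS cS → closed-≼ {suc n} {∂ S} g′ (∂-hom {n} {S} hS) (proj₂ (mac g g′) {S} hS (closed-≲ {S} cS)))

sum≡0⇒zeros : ∀ {n} (a : Vec ℕ n) → Vec.sum a ≡ 0 → a ≡ Vec.replicate n 0
sum≡0⇒zeros []      _ = refl
sum≡0⇒zeros (zero ∷ a) e = cong (0 ∷_) (sum≡0⇒zeros a e)

module _ {k l} {d : Vec ℕ k} {e : Vec ℕ l} (d⁺ : Positive d) (e⁺ : Positive e) where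
  Wedge : RankedPoset
  Wedge = wedge (CL d d⁺) (CL e e⁺) (least d⁺) (least e⁺)

  Diamond : height (CL d d⁺) ≡ height (CL e e⁺) → RankedPoset
  Diamond = diamond (CL d d⁺) (CL e e⁺) (least d⁺) (least e⁺) (greatest d⁺) (greatest e⁺)

  -- Transporting along `refl` compares the posets rather than the much larger
  -- unfolded statements.
  fold-Wedge : Macaulay (wedge (CL d d⁺) (CL e e⁺) (least d⁺) (least e⁺)) → Macaulay Wedge
  fold-Wedge = subst Macaulay {x = wedge (CL d d⁺) (CL e e⁺) (least d⁺) (least e⁺)} {y = Wedge} refl

  unfold-Wedge : Macaulay Wedge → Macaulay (wedge (CL d d⁺) (CL e e⁺) (least d⁺) (least e⁺))
  unfold-Wedge = subst Macaulay {x = Wedge} {y = wedge (CL d d⁺) (CL e e⁺) (least d⁺) (least e⁺)} refl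

  fold-Diamond : ∀ same → Macaulay (diamond (CL d d⁺) (CL e e⁺) (least d⁺) (least e⁺) (greatest d⁺) (greatest e⁺) same) → Macaulay (Diamond same)
  fold-Diamond same = subst Macaulay {x = diamond (CL d d⁺) (CL e e⁺) (least d⁺) (least e⁺) (greatest d⁺) (greatest e⁺) same} {y = Diamond same} refl

  unfold-Diamond : ∀ same → Macaulay (Diamond same) → Macaulay (diamond (CL d d⁺) (CL e e⁺) (least d⁺) (least e⁺) (greatest d⁺) (greatest e⁺) same)
  unfold-Diamond same = subst Macaulay {x = Diamond same} {y = diamond (CL d d⁺) (CL e e⁺) (least d⁺) (least e⁺) (greatest d⁺) (greatest e⁺) same} refl

  private
    zero-⊥ : ∀ {n} {c : Vec ℕ n} (c⁺ : Positive c) (p : Box c) → Vec.sum (proj₁ p) ≡ 0 → proj₁ p ≡ proj₁ (proj₁ (least c⁺))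
    zero-⊥ c⁺ p = sum≡0⇒zeros (proj₁ p)

  -- The identification inside the wedge enters the proof only through these properties, so that the
  -- glued order never has to be unfolded; likewise for `DiamondGluing`.
  WedgeGluing : Set₁
  WedgeGluing = ∃ λ (G : Gluing (CL d d⁺) (CL e e⁺)) → glue G ≡ Wedge ×
    (∀ {p q} → Gluing._≍_ G p q → Vec.sum (proj₁ p) ≡ 0) ×
    (∀ {p q} → Vec.sum (proj₁ p) ≡ 0 → Vec.sum (proj₁ q) ≡ 0 → Gluing._≍_ G p q)

  abstract
    wedge-gluing : WedgeGluing
    wedge-gluing = _ , refl ,
      (λ {p} (u , _) → trans (cong Vec.sum u) (sum-zeros k)) ,
      λ {p} {q} u v → zero-⊥ d⁺ p u , zero-⊥ e⁺ q v

  module _ (same : height (CL d d⁺) ≡ height (CL e e⁺)) where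
    private
      top-rank : ∀ {n} {c : Vec ℕ n} (c⁺ : Positive c) (p : Box c) → Vec.sum (proj₁ p) ≡ height (CL c c⁺) →
                 proj₁ p ≡ proj₁ (proj₁ (greatest c⁺))
      top-rank c⁺ p u = sum-rigid (proj₂ (greatest c⁺) p) (trans u (sym (rank-greatest (CL _ c⁺) (greatest c⁺))))

    DiamondGluing : Set₁
    DiamondGluing = ∃ λ (G : Gluing (CL d d⁺) (CL e e⁺)) → glue G ≡ Diamond same ×
      (∀ {p q} → Gluing._≍_ G p q → Vec.sum (proj₁ p) ≡ 0 ⊎ Vec.sum (proj₁ p) ≡ height (CL d d⁺)) ×
      (∀ {p q} → Vec.sum (proj₁ p) ≡ 0 → Vec.sum (proj₁ q) ≡ 0 → Gluing._≍_ G p q) ×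
      (∀ {p q} → Vec.sum (proj₁ p) ≡ height (CL d d⁺) → Vec.sum (proj₁ q) ≡ height (CL d d⁺) → Gluing._≍_ G p q)

    abstract
      diamond-gluing : DiamondGluing
      diamond-gluing = _ , refl ,
        (λ { (inj₁ (u , _)) → inj₁ (trans (cong Vec.sum u) (sum-zeros k))
           ; (inj₂ (u , _)) → inj₂ (trans (cong Vec.sum u) (rank-greatest (CL d d⁺) (greatest d⁺))) }) ,
        (λ {p} {q} u v → inj₁ (zero-⊥ d⁺ p u , zero-⊥ e⁺ q v)) ,
        λ {p} {q} u v → inj₂ (top-rank d⁺ p u , top-rank e⁺ q (trans v same))


zeros-⊑ : ∀ {n} {a b : Vec ℕ n} → Vec.sum a ≡ 0 → Pointwise _≤_ a b
zeros-⊑ {a = a} {b} e = subst (λ z → Pointwise _≤_ z b) (sym (sum≡0⇒zeros a e)) (zeros-≤ b)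

top-⊑ : ∀ {n} {d : Vec ℕ n} (d⁺ : Positive d) (a b : Box d) → Vec.sum (proj₁ b) ≡ height (CL d d⁺) → a ≤ᴮ b
top-⊑ d⁺ a b r = subst (Pointwise _≤_ (proj₁ a)) (sym (sum-rigid (proj₂ (greatest d⁺) b)
  (trans r (sym (rank-greatest (CL _ d⁺) (greatest d⁺)))))) (proj₂ (greatest d⁺) a)

rank≤height : ∀ {n} {d : Vec ℕ n} (d⁺ : Positive d) (a : Box d) → Vec.sum (proj₁ a) ≤ height (CL d d⁺)
rank≤height {d = d} d⁺ a = v≤max⁺ 0 (List.map R.rank R.elements)
  (inj₂ (Anyₚ.map⁺ (Any.map (≤-reflexive ∘ cong Vec.sum) (R.elements-all a))))
  where module R = RankedPoset (CL d d⁺)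

module _ {k l} {d : Vec ℕ k} {e : Vec ℕ l} (d⁺ : Positive d) (e⁺ : Positive e)
         (G : Gluing (CL d d⁺) (CL e e⁺)) where
  open Gluings d⁺ e⁺ G
  open Gluing G using (_≍_; rank-≍)
  private
    module R = RankedPoset R
  open Po W using (rk)

  module _ (bottom : ∀ {p q} → Vec.sum (proj₁ p) ≡ 0 → Vec.sum (proj₁ q) ≡ 0 → p ≍ q) where

    least-≤ : ∀ {a b} → rk a ≡ 0 → a R.≤ b
    least-≤ {inj₁ p} {inj₁ q} r = inj₁ (p , refl , q , refl , zeros-⊑ r)
    least-≤ {inj₁ p} {inj₂ q} r = inj₂ (proj₁ (least e⁺) , bottom r (sum-zeros l) , q , refl , zeros-≤ (proj₁ q))
    least-≤ {inj₂ p} {inj₁ q} r = inj₁ (proj₁ (least d⁺) , bottom (sum-zeros k) r , q , refl , zeros-≤ (proj₁ q))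
    least-≤ {inj₂ p} {inj₂ q} r = inj₂ (p , refl , q , refl , zeros-⊑ r)

    least-≈ : ∀ {a b} → rk a ≡ 0 → rk b ≡ 0 → a R.≈ b
    least-≈ {a} {b} r s = R.antisym {a} {b} (least-≤ {a} {b} r) (least-≤ {b} {a} s)

    least-⋖ : ∀ {a b} → rk a ≡ 0 → rk b ≡ 1 → a R.⋖ b
    least-⋖ {a} {b} r s = ⋖-intro R {a} {b} (least-≤ {a} {b} r) (trans s (cong suc (sym r)))

  wedge-separation : (∀ {p q} → p ≍ q → Vec.sum (proj₁ p) ≡ 0) →
    (∀ {p q} → Vec.sum (proj₁ p) ≡ 0 → Vec.sum (proj₁ q) ≡ 0 → p ≍ q) → Separation
  wedge-separation glued bottom = record
    { Good = 1 ≤_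
    ; Good? = 1 ℕₚ.≤?_
    ; unglued = λ { g r p≍q → <⇒≢ g (trans (sym (glued p≍q)) r) }
    ; collapse = λ {a} {b} ¬g r → least-≈ bottom {a} {b} (ℕₚ.n<1⇒n≡0 (≰⇒> ¬g)) (trans (sym r) (ℕₚ.n<1⇒n≡0 (≰⇒> ¬g)))
    ; complete = λ { zero → inj₂ λ {a} {b} → least-⋖ bottom {a} {b} ; (suc n) → inj₁ (s≤s z≤n , s≤s z≤n) }
    }

  module _ (same : height (CL d d⁺) ≡ height (CL e e⁺)) where
    private
      r : ℕ
      r = height (CL d d⁺)

      rk≤r : ∀ a → rk a ≤ r
      rk≤r (inj₁ p) = rank≤height d⁺ p
      rk≤r (inj₂ q) = ≤-trans (rank≤height e⁺ q) (≤-reflexive (sym same))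

    module _ (top : ∀ {p q} → Vec.sum (proj₁ p) ≡ r → Vec.sum (proj₁ q) ≡ r → p ≍ q) where

      ≤-greatest : ∀ {a b} → rk b ≡ r → a R.≤ b
      ≤-greatest {inj₁ p} {inj₁ q} s = inj₁ (p , refl , q , refl , top-⊑ d⁺ p q s)
      ≤-greatest {inj₁ p} {inj₂ q} s = inj₁ (p , refl , proj₁ (greatest d⁺) ,
        top (rank-greatest (CL d d⁺) (greatest d⁺)) s , proj₂ (greatest d⁺) p)
      ≤-greatest {inj₂ p} {inj₁ q} s = inj₂ (p , refl , proj₁ (greatest e⁺) ,
        top s (trans (rank-greatest (CL e e⁺) (greatest e⁺)) (sym same)) , proj₂ (greatest e⁺) p)
      ≤-greatest {inj₂ p} {inj₂ q} s = inj₂ (p , refl , q , refl , top-⊑ e⁺ p q (trans s same))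

      diamond-separation : (∀ {p q} → p ≍ q → Vec.sum (proj₁ p) ≡ 0 ⊎ Vec.sum (proj₁ p) ≡ r) →
        (∀ {p q} → Vec.sum (proj₁ p) ≡ 0 → Vec.sum (proj₁ q) ≡ 0 → p ≍ q) → Separation
      diamond-separation glued bottom = record
        { Good = λ n → 1 ≤ n × n < r
        ; Good? = λ n → (1 ℕₚ.≤? n) ×-dec (n ℕₚ.<? r)
        ; unglued = λ { (g , g′) s p≍q → case glued p≍q of λ
            { (inj₁ z) → <⇒≢ g (trans (sym z) s) ; (inj₂ z) → <⇒≢ g′ (trans (sym s) z) } }
        ; collapse = λ {a} {b} ¬g s → collapse {a} {b} ¬g s
        ; complete = complete
        }
        where
        collapse : ∀ {a b} → ¬ (1 ≤ rk a × rk a < r) → rk a ≡ rk b → a R.≈ b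
        collapse {a} {b} ¬g s with 1 ℕₚ.≤? rk a
        ... | no n = least-≈ bottom {a} {b} (ℕₚ.n<1⇒n≡0 (≰⇒> n)) (trans (sym s) (ℕₚ.n<1⇒n≡0 (≰⇒> n)))
        ... | yes y = R.antisym {a} {b} (≤-greatest {a} {b} (trans (sym s) rk≡r)) (≤-greatest {b} {a} rk≡r)
          where
          rk≡r : rk a ≡ r
          rk≡r = ≤-antisym (rk≤r a) (≮⇒≥ λ l → ¬g (y , l))
        complete : ∀ n → ((1 ≤ n × n < r) × (1 ≤ suc n × suc n < r)) ⊎ (∀ {a b} → rk a ≡ n → rk b ≡ suc n → a R.⋖ b)
        complete zero = inj₂ λ {a} {b} → least-⋖ bottom {a} {b}
        complete (suc n) with suc (suc n) ℕₚ.<? r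
        ... | yes l = inj₁ ((s≤s z≤n , <-trans (n<1+n _) l) , (s≤s z≤n , l))
        ... | no ¬l = inj₂ λ {a} {b} s t → ⋖-intro R {a} {b} (≤-greatest {a} {b}
                (≤-antisym (rk≤r b) (≤-trans (≮⇒≥ ¬l) (≤-reflexive (sym t))))) (trans t (cong suc (sym s)))

module _ {k l} {d : Vec ℕ k} {e : Vec ℕ l} (d⁺ : Positive d) (e⁺ : Positive e) where
  module _ {Y : Po} (f : Iso Y (boxes d e)) (_≲_ : Rel (Po.X Y) 0ℓ) (tot : IsTotalOrder _≡_ _≲_) where
    open Iso f

    pulled : IsTotalOrder _≡_ (λ a b → from a ≲ from b)
    pulled = record
      { isPartialOrder = record
        { isPreorder = record { isEquivalence = ≡ₚ.isEquivalence ; reflexive = λ { refl → T.refl } ; trans = T.trans }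
        ; antisym = λ p q → Iso.to-injective (iso-sym f) (T.antisym p q) }
      ; total = λ a b → T.total (from a) (from b) }
      where module T = IsTotalOrder tot

    wedge⇐ : (∀ {n} → 1 ≤ n → Subsets.MacAt Y _≲_ n) → Macaulay (Wedge d⁺ e⁺)
    wedge⇐ mac = go (wedge-gluing d⁺ e⁺)
      where
      go : WedgeGluing d⁺ e⁺ → Macaulay (Wedge d⁺ e⁺)
      go (G , eq , glued , bottom) = subst Macaulay {x = glue G} eq (Gluings.ordering⇒macaulay d⁺ e⁺ G
        (wedge-separation d⁺ e⁺ G glued bottom) _ pulled λ g _ → Transfer.macAt-to f (mac g))

    diamond⇐ : (same : height (CL d d⁺) ≡ height (CL e e⁺)) → (∀ {n} → 1 ≤ n → suc n < height (CL d d⁺) → Subsets.MacAt Y _≲_ n) →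
               Macaulay (Diamond d⁺ e⁺ same)
    diamond⇐ same mac = go (diamond-gluing d⁺ e⁺ same)
      where
      go : DiamondGluing d⁺ e⁺ same → Macaulay (Diamond d⁺ e⁺ same)
      go (G , eq , glued , bottom , top) = subst Macaulay {x = glue G} eq (Gluings.ordering⇒macaulay d⁺ e⁺ G
        (diamond-separation d⁺ e⁺ G same top glued bottom) _ pulled λ (g , _) (_ , g′) → Transfer.macAt-to f (mac g g′))

  wedge⇒ : Macaulay (Wedge d⁺ e⁺) → Ordering (boxes d e) (1 ≤_)
  wedge⇒ mac = go (wedge-gluing d⁺ e⁺)
    where
    go : WedgeGluing d⁺ e⁺ → Ordering (boxes d e) (1 ≤_)
    go (G , eq , glued , bottom) = Gluings.macaulay⇒ordering d⁺ e⁺ G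
      (wedge-separation d⁺ e⁺ G glued bottom) (subst Macaulay {y = glue G} (sym eq) mac)

  diamond⇒ : (same : height (CL d d⁺) ≡ height (CL e e⁺)) →
             Macaulay (Diamond d⁺ e⁺ same) →
             Ordering (boxes d e) (λ n → 1 ≤ n × n < height (CL d d⁺))
  diamond⇒ same mac = go (diamond-gluing d⁺ e⁺ same)
    where
    go : DiamondGluing d⁺ e⁺ same → Ordering (boxes d e) (λ n → 1 ≤ n × n < height (CL d d⁺))
    go (G , eq , glued , bottom , top) = Gluings.macaulay⇒ordering d⁺ e⁺ G
      (diamond-separation d⁺ e⁺ G same top glued bottom) (subst Macaulay {y = glue G} (sym eq) mac)


-- Hilbert functions, dimension, height and isomorphisms of boxes

chain-sum : ℕ → (ℕ → ℕ) → ℕ → ℕ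
chain-sum zero    f e       = 0
chain-sum (suc m) f zero    = f 0
chain-sum (suc m) f (suc e) = f (suc e) + chain-sum m f e

-- The coefficient of tᵉ in the product of the polynomials 1 + t + ... + tᵃ over the entries a;
-- `chain-sum` multiplies by one factor.
hilbert : List ℕ → ℕ → ℕ
hilbert []       zero    = 1
hilbert []       (suc _) = 0
hilbert (a ∷ as) e       = chain-sum (suc a) (hilbert as) e

chain-sum-cong : ∀ m {f g} e → (∀ i → i ≤ e → f i ≡ g i) → chain-sum m f e ≡ chain-sum m g e
chain-sum-cong zero    e       h = refl
chain-sum-cong (suc m) zero    h = h 0 z≤n
chain-sum-cong (suc m) (suc e) h = cong₂ _+_ (h (suc e) ≤-refl) (chain-sum-cong m e λ i p → h i (≤-trans p (n≤1+n e)))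

does-≟ : ∀ {a b c d} → (a ≡ b → c ≡ d) → (c ≡ d → a ≡ b) → does (a ℕₚ.≟ b) ≡ does (c ℕₚ.≟ d)
does-≟ {a} {b} {c} {d} f g = Dec.does-⇔ (mk⇔ f g) (a ℕₚ.≟ b) (c ℕₚ.≟ d)

module _ (P : Po) where
  open Po P
  open Subsets P

  card-lvl-⊗ : ∀ m e → Subsets.card (P ⊗ m) (Subsets.lvl (P ⊗ m) e) ≡ chain-sum m (λ i → card (lvl i)) e
  card-lvl-⊗ m e = trans (∑-× els (allFin m)) (trans (∑-swap els (allFin m) _) (go m e))
    where
    at : ℕ → ℕ → X → Bool
    at k e y = does (rk y + k ℕₚ.≟ e)
    go : ∀ m e → ∑ (allFin m) (λ k → ∑ els (λ y → 𝟙 (at (toℕ k) e y))) ≡ chain-sum m (λ i → card (lvl i)) e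
    go zero    e       = refl
    go (suc m) e       with trans (∑-suc m {λ k → ∑ els (λ y → 𝟙 (at (toℕ k) e y))})
                              (cong (_+ ∑ (allFin m) (λ k → ∑ els (λ y → 𝟙 (at (suc (toℕ k)) e y))))
                                (∑-cong els λ y → cong 𝟙 (does-≟ {d = e} (trans (sym (+-identityʳ (rk y)))) (trans (+-identityʳ (rk y))))))
    go (suc m) zero    | q = trans q (trans (cong (card (lvl 0) +_) (trans (∑-cong (allFin m) λ k →
                               trans (∑-cong els λ y → cong 𝟙 (dec-false (rk y + suc (toℕ k) ℕₚ.≟ 0)
                                 λ z → ℕₚ.1+n≢0 (trans (sym (+-suc (rk y) (toℕ k))) z))) (∑-0 els)) (∑-0 (allFin m))))
                               (+-identityʳ _))
    go (suc m) (suc e) | q = trans q (cong (card (lvl (suc e)) +_) (trans (∑-cong (allFin m) λ k → ∑-cong els λ y → cong 𝟙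
                               (does-≟ {c = rk y + toℕ k} (λ z → suc-injective (trans (sym (+-suc (rk y) (toℕ k))) z))
                                       (λ z → trans (+-suc (rk y) (toℕ k)) (cong suc z)))) (go m e)))

card-lvl-nest : ∀ as e → LexPoset.card (nest 1 as) (LexPoset.lvl (nest 1 as) e) ≡ hilbert as e
card-lvl-nest []       zero    = refl
card-lvl-nest []       (suc e) = refl
card-lvl-nest (a ∷ as) e       = trans (card-lvl-⊗ (LexPoset.po (nest 1 as)) (suc a) e)
                                       (chain-sum-cong (suc a) e λ i _ → card-lvl-nest as i)

card-lvl-iso : ∀ {P Q} → Iso P Q → ∀ e → Subsets.card P (Subsets.lvl P e) ≡ Subsets.card Q (Subsets.lvl Q e)
card-lvl-iso {P} {Q} f e = trans (∑-cong (Po.els P) λ x → cong (λ r → 𝟙 (does (r ℕₚ.≟ e))) (sym (Iso.rk-to f x)))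
                                 (Transfer.card-to f (Subsets.lvl Q e))

card-lvl-box : ∀ {n} {d : Vec ℕ n} → Positive d → ∀ e → Subsets.card (boxPo d) (Subsets.lvl (boxPo d) e) ≡ hilbert (shape d) e
card-lvl-box {d = d} d⁺ e = trans (card-lvl-iso (box-nest d⁺) e) (card-lvl-nest (shape d) e)

hilbert-0 : ∀ as → hilbert as 0 ≡ 1
hilbert-0 []       = refl
hilbert-0 (a ∷ as) = hilbert-0 as

hilbert-1 : ∀ {as} → AllL.All (1 ≤_) as → hilbert as 1 ≡ length as
hilbert-1 []                  = refl
hilbert-1 {suc a ∷ as} (_ ∷ p) = trans (cong₂ _+_ (hilbert-1 p) (hilbert-0 as)) (+-comm _ 1)

shape-≥1 : ∀ {n} (d : Vec ℕ n) → AllL.All (1 ≤_) (shape d)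
shape-≥1 d = AllLₚ.map⁺ (AllL.map ℕₚ.pred-mono-≤ (AllLₚ.all-filter (1 ℕₚ.<?_) (toList d)))

card-atoms : ∀ {n} {d : Vec ℕ n} → Positive d → Subsets.card (boxPo d) (Subsets.lvl (boxPo d) 1) ≡ length (shape d)
card-atoms {d = d} d⁺ = trans (card-lvl-box d⁺ 1) (hilbert-1 (shape-≥1 d))

dimension-shape : ∀ {n} {d : Vec ℕ n} (d⁺ : Positive d) → dimension (CL d d⁺) ≡ length (shape d)
dimension-shape {d = d} d⁺ = trans (go (boxElements d)) (card-atoms d⁺)
  where
  go : ∀ xs → length (filter (λ a → Vec.sum (proj₁ a) ℕₚ.≟ 1) xs) ≡ ∑ xs (λ a → 𝟙 (does (Vec.sum (proj₁ a) ℕₚ.≟ 1)))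
  go [] = refl
  go (x ∷ xs) with does (Vec.sum (proj₁ x) ℕₚ.≟ 1)
  ... | true  = cong suc (go xs)
  ... | false = go xs

height-shape : ∀ {n} {d : Vec ℕ n} (d⁺ : Positive d) → height (CL d d⁺) ≡ ℕL.sum (shape d)
height-shape d⁺ = trans (sym (rank-greatest (CL _ d⁺) (greatest d⁺))) (go d⁺)
  where
  go : ∀ {n} {d : Vec ℕ n} → Positive d → Vec.sum (Vec.map pred d) ≡ ℕL.sum (shape d)
  go []                            = refl
  go {d = suc zero    ∷ d} (_ ∷ d⁺) = go d⁺
  go {d = suc (suc m) ∷ d} (_ ∷ d⁺) = cong (suc m +_) (go d⁺)

2∈sides⇒1∈shape : ∀ {n} {d : Vec ℕ n} → 2 ∈ sides d → 1 ∈ shape d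
2∈sides⇒1∈shape = ∈ₚ.∈-map⁺ pred

1∈shape⇒2∈sides : ∀ {n} (d : Vec ℕ n) → 1 ∈ shape d → 2 ∈ sides d
1∈shape⇒2∈sides d p with ∈ₚ.∈-map⁻ pred p
... | suc (suc zero) , q , refl = q

step-down : ∀ {n} {a b : Vec ℕ n} → Pointwise _≤_ a b → Vec.sum a < Vec.sum b →
            ∃ λ (c : Vec ℕ n) → Pointwise _≤_ a c × Pointwise _≤_ c b × Vec.sum b ≡ suc (Vec.sum c)
step-down [] ()
step-down {a = x ∷ a} {y ∷ b} (p ∷ u) l with ℕₚ.m≤n⇒m<n∨m≡n p
... | inj₁ (s≤s q) = _ ∷ b , q ∷ u , n≤1+n _ ∷ PW.refl ≤-refl , refl
... | inj₂ refl with step-down u (ℕₚ.+-cancelˡ-< x _ _ l)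
...   | c , a≤c , c≤b , e = x ∷ c , ≤-refl ∷ a≤c , ≤-refl ∷ c≤b , trans (cong (x +_) e) (+-suc x _)

box-below : ∀ {n} {d : Vec ℕ n} {a b : Box d} → a ≤ᴮ b → Vec.sum (proj₁ a) < Vec.sum (proj₁ b) →
            ∃ λ (c : Box d) → a ≤ᴮ c × Po._⋖_ (boxPo d) c b
box-below {b = b} p l with step-down p l
... | c , a≤c , c≤b , e = (c , PW.trans ≤-<-trans c≤b (proj₂ b)) , a≤c , c≤b , e

private
  -- An order isomorphism is not assumed to respect ranks. An injective monotone map turns each
  -- cover into a strict inequality, so along a chain from the bottom it cannot lower ranks; applied
  -- in both directions this gives equality.
  mono⇒rank≤ : ∀ {k l} {d : Vec ℕ k} {e : Vec ℕ l} → Positive d → (f : Box d → Box e) → (∀ {a b} → a ≤ᴮ b → f a ≤ᴮ f b) →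
               (∀ {a b} → f a ≡ f b → a ≡ b) → ∀ a → Vec.sum (proj₁ a) ≤ Vec.sum (proj₁ (f a))
  mono⇒rank≤ {k} {d = d} d⁺ f mono inj a = go (Vec.sum (proj₁ a)) a refl
    where
    go : ∀ n a → Vec.sum (proj₁ a) ≡ n → n ≤ Vec.sum (proj₁ (f a))
    go zero    a _ = z≤n
    go (suc n) a r with box-below {a = proj₁ (least d⁺)} {a} (zeros-≤ (proj₁ a))
                          (≤-<-trans (≤-reflexive (sum-zeros k)) (<-≤-trans (s≤s z≤n) (≤-reflexive (sym r))))
    ... | c , _ , c≤a , e = ≤-<-trans (go n c (suc-injective (trans (sym e) r)))
      (ℕₚ.≤∧≢⇒< (sum-mono (mono c≤a)) λ s → ℕₚ.1+n≢n (trans (sym e) (cong (Vec.sum ∘ proj₁)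
          (sym (inj (box-≡ (sum-rigid (mono c≤a) s)))))))

≅⇒iso : ∀ {k l} {d : Vec ℕ k} {e : Vec ℕ l} {d⁺ : Positive d} {e⁺ : Positive e} → CL d d⁺ ≅ CL e e⁺ → Iso (boxPo d) (boxPo e)
≅⇒iso {d = d} {e} {d⁺} {e⁺} (f , f-iso) = record
  { to = f ; from = g ; to-from = fg ; from-to = gf
  ; ⊑-to = λ {a} {b} → mono {a} {b} ; ⊑-from = λ {a} {b} → g-mono {a} {b}
  ; rk-to = λ a → ≤-antisym
      (≤-trans (mono⇒rank≤ e⁺ g (λ {a} {b} → g-mono {a} {b}) (λ {a} {b} q → trans (sym (fg a)) (trans (cong f q) (fg b))) (f a))
                  (≤-reflexive (cong (Vec.sum ∘ proj₁) (gf a))))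
      (mono⇒rank≤ d⁺ f (λ {a} {b} → mono {a} {b}) (λ {a} {b} q → trans (sym (gf a)) (trans (cong g q) (gf b))) a)
  }
  where
  open IsOrderIsomorphism f-iso using (mono; cancel; injective; surjective)
  g : Box e → Box d
  g b = proj₁ (surjective b)
  fg : ∀ b → f (g b) ≡ b
  fg b = box-≡ (proj₂ (surjective b) refl)
  gf : ∀ a → g (f a) ≡ a
  gf a = box-≡ (injective {g (f a)} {a} (cong proj₁ (fg (f a))))
  g-mono : ∀ {a b} → a ≤ᴮ b → g a ≤ᴮ g b
  g-mono {a} {b} p = cancel {g a} {g b} (subst₂ _≤ᴮ_ (sym (fg a)) (sym (fg b)) p)

iso⇒≅ : ∀ {k l} {d : Vec ℕ k} {e : Vec ℕ l} {d⁺ : Positive d} {e⁺ : Positive e} → Iso (boxPo d) (boxPo e) → CL d d⁺ ≅ CL e e⁺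
iso⇒≅ f = to , record
  { isOrderMonomorphism = record
    { isOrderHomomorphism = record { cong = λ p → cong (proj₁ ∘ to) (box-≡ p) ; mono = ⊑-to }
    ; injective = λ p → cong proj₁ (to-injective (box-≡ p))
    ; cancel = λ {x} {y} p → subst₂ _≤ᴮ_ (from-to x) (from-to y) (⊑-from p) }
  ; surjective = λ y → from y , λ {z} p → trans (cong (proj₁ ∘ to) (box-≡ p)) (cong proj₁ (to-from y))
  }
  where open Iso f

↭⇒≅ : ∀ {k l} {d : Vec ℕ k} {e : Vec ℕ l} (d⁺ : Positive d) (e⁺ : Positive e) → shape d ↭ shape e → CL d d⁺ ≅ CL e e⁺
↭⇒≅ d⁺ e⁺ p = iso⇒≅ {d⁺ = d⁺} {e⁺} (box-nest d⁺ ⨾ nest-perm 1 p ⨾ iso-sym (box-nest e⁺))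

module Descending = Sort (Relation.Binary.Construct.Flip.EqAndOrd.decTotalOrder ℕₚ.≤-decTotalOrder)

diamond-of-≅ : ∀ {k l} {d : Vec ℕ k} {e : Vec ℕ l} {d⁺ : Positive d} {e⁺ : Positive e}
  (same : height (CL d d⁺) ≡ height (CL e e⁺)) → CL d d⁺ ≅ CL e e⁺ → Macaulay (Diamond d⁺ e⁺ same)
diamond-of-≅ {d = d} {e} {d⁺} {e⁺} same iso =
  diamond⇐ d⁺ e⁺ (nest-two as ⨾ ⊎-cong f (f ⨾ ≅⇒iso {d⁺ = d⁺} {e⁺} iso)) (LexPoset._≲_ (nest 2 as)) (LexPoset.isTotal (nest 2 as)) same
    λ {n} _ _ → nest-macaulay 2 (Descending.sort-↗ (shape d)) (Permₚ.All-resp-↭ (↭-sym (Descending.sort-↭ (shape d))) (shape-≥1 d)) n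
  where
  as : List ℕ
  as = Descending.sort (shape d)
  f : Iso (LexPoset.po (nest 1 as)) (boxPo d)
  f = nest-perm 1 (Descending.sort-↭ (shape d)) ⨾ iso-sym (box-nest d⁺)


-- Sums of rectangles

module Halves (P Q : Po) where
  private
    module P = Po P
    module Q = Po Q
    module SP = Subsets P
    module SQ = Subsets Q
  open Po (P ⊎ᴾ Q)
  open Subsets (P ⊎ᴾ Q)

  card-⊎ : ∀ A → card A ≡ SP.card (A ∘ inj₁) + SQ.card (A ∘ inj₂)
  card-⊎ A = trans (∑-++ (List.map inj₁ P.els) (List.map inj₂ Q.els))
                   (cong₂ _+_ (∑-map inj₁ P.els) (∑-map inj₂ Q.els))

  ∂-inj₁ : ∀ {A} → (∂ A ∘ inj₁) SP.⊆ SP.∂ (A ∘ inj₁)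
  ∂-inj₁ {A} {y} p with ∂⁻ {A} {inj₁ y} p
  ... | inj₁ x , a , (inj₁ q , r) = SP.∂⁺ {A ∘ inj₁} a (q , r)

  ∂-inj₁⁺ : ∀ {A} → SP.∂ (A ∘ inj₁) SP.⊆ (∂ A ∘ inj₁)
  ∂-inj₁⁺ {A} {y} p with SP.∂⁻ {A ∘ inj₁} {y} p
  ... | x , a , (q , r) = ∂⁺ {A} {inj₁ x} a (inj₁ q , r)

  ∂-inj₂ : ∀ {A} → (∂ A ∘ inj₂) SQ.⊆ SQ.∂ (A ∘ inj₂)
  ∂-inj₂ {A} {y} p with ∂⁻ {A} {inj₂ y} p
  ... | inj₂ x , a , (inj₂ q , r) = SQ.∂⁺ {A ∘ inj₂} a (q , r)

  ∂-inj₂⁺ : ∀ {A} → SQ.∂ (A ∘ inj₂) SQ.⊆ (∂ A ∘ inj₂)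
  ∂-inj₂⁺ {A} {y} p with SQ.∂⁻ {A ∘ inj₂} {y} p
  ... | x , a , (q , r) = ∂⁺ {A} {inj₂ x} a (inj₂ q , r)

  card-∂-⊎ : ∀ A → card (∂ A) ≡ SP.card (SP.∂ (A ∘ inj₁)) + SQ.card (SQ.∂ (A ∘ inj₂))
  card-∂-⊎ A = trans (card-⊎ (∂ A)) (cong₂ _+_
    (SP.card-cong {∂ A ∘ inj₁} {SP.∂ (A ∘ inj₁)} (∂-inj₁ {A}) (∂-inj₁⁺ {A}))
    (SQ.card-cong {∂ A ∘ inj₂} {SQ.∂ (A ∘ inj₂)} (∂-inj₂ {A}) (∂-inj₂⁺ {A})))

⊎-comm : ∀ P Q → Iso (P ⊎ᴾ Q) (Q ⊎ᴾ P)
⊎-comm P Q = record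
  { to = Sum.swap ; from = Sum.swap
  ; to-from = λ { (inj₁ _) → refl ; (inj₂ _) → refl } ; from-to = λ { (inj₁ _) → refl ; (inj₂ _) → refl }
  ; ⊑-to = λ { (inj₁ p) → inj₂ p ; (inj₂ p) → inj₁ p } ; ⊑-from = λ { (inj₁ p) → inj₂ p ; (inj₂ p) → inj₁ p }
  ; rk-to = λ { (inj₁ _) → refl ; (inj₂ _) → refl }
  }

module OrderedSum (L₁ L₂ : LexPoset) where
  private
    module L₁ = LexPoset L₁
    module L₂ = LexPoset L₂

  po : Po
  po = L₁.po ⊎ᴾ L₂.po

  open Po po
  open Subsets po
  open Halves L₁.po L₂.po public

  -- Larger elements come first, so the first summand precedes the second.
  infix 4 _≲_
  _≲_ : Rel X 0ℓ
  inj₁ x ≲ inj₁ y = x L₁.≲ y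
  inj₁ x ≲ inj₂ y = Data.Empty.⊥
  inj₂ x ≲ inj₁ y = ⊤
  inj₂ x ≲ inj₂ y = x L₂.≲ y

  isTotal : IsTotalOrder _≡_ _≲_
  isTotal = record
    { isPartialOrder = record
      { isPreorder = record
        { isEquivalence = ≡ₚ.isEquivalence
        ; reflexive = λ { {inj₁ _} refl → L₁.≲-refl ; {inj₂ _} refl → L₂.≲-refl }
        ; trans = λ {x} {y} {z} → ≲-trans x y z }
      ; antisym = λ {x} {y} → ≲-antisym x y }
    ; total = λ { (inj₁ x) (inj₁ y) → L₁.total x y ; (inj₁ _) (inj₂ _) → inj₂ tt
                ; (inj₂ _) (inj₁ _) → inj₁ tt ; (inj₂ x) (inj₂ y) → L₂.total x y }
    }
    where
    ≲-trans : ∀ x y z → x ≲ y → y ≲ z → x ≲ z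
    ≲-trans (inj₁ _) (inj₁ _) (inj₁ _) p q = L₁.≲-trans p q
    ≲-trans (inj₂ _) (inj₁ _) (inj₁ _) p q = tt
    ≲-trans (inj₂ _) (inj₂ _) (inj₁ _) p q = tt
    ≲-trans (inj₂ _) (inj₂ _) (inj₂ _) p q = L₂.≲-trans p q
    ≲-antisym : ∀ x y → x ≲ y → y ≲ x → x ≡ y
    ≲-antisym (inj₁ _) (inj₁ _) p q = cong inj₁ (L₁.antisym p q)
    ≲-antisym (inj₂ _) (inj₂ _) p q = cong inj₂ (L₂.antisym p q)

  module _ {S} (c : Closed _≲_ S) where

    closed₁ : L₁.Closed (S ∘ inj₁)
    closed₁ = c

    closed₂ : L₂.Closed (S ∘ inj₂)
    closed₂ = c

    before : ∀ {x y} → S ∋ inj₂ y → L₁.rk x ≡ L₂.rk y → S ∋ inj₁ x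
    before s r = c {inj₂ _} {inj₁ _} s tt r

  sum-∂-closed : (∀ {x} → 0 < L₁.rk x → ∃ λ w → w L₁.⋖ x) →
    ∀ {n} → L₁.MacAt n → L₂.MacAt n → ∀ {S} → Hom n S → Closed _≲_ S → Closed _≲_ (∂ S)
  sum-∂-closed below (_ , m₁) (_ , m₂) {S} h c {inj₁ x} {inj₁ y} p q r = ∂-inj₁⁺ {S} {y} (m₁ {S ∘ inj₁} h (closed₁ {S} c) {x} (∂-inj₁ {S} {x} p) q r)
  sum-∂-closed below (_ , m₁) (_ , m₂) {S} h c {inj₂ x} {inj₂ y} p q r = ∂-inj₂⁺ {S} {y} (m₂ {S ∘ inj₂} h (closed₂ {S} c) {x} (∂-inj₂ {S} {x} p) q r)
  -- As `S` contains an element of the second summand, it contains the whole level of the first, in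
  -- particular any lower cover of `y`.
  sum-∂-closed below _ _ {S} h c {inj₂ x} {inj₁ y} p q r with ∂⁻ {S} {inj₂ x} p
  ... | inj₂ w , s , d with below {y} (≤-trans (s≤s z≤n) (≤-reflexive (sym (trans r (proj₂ d)))))
  ...   | v , f = ∂⁺ {S} {inj₁ v} (before {S} c {v} {w} s (suc-injective (trans (sym (proj₂ f)) (trans r (proj₂ d))))) (inj₁ (proj₁ f) , proj₂ f)

rect : ℕ → ℕ → LexPoset
rect a b = (copies 1 ⊗ᴸ a) ⊗ᴸ b

module _ (a b : ℕ) where
  open LexPoset (rect a b)
  open Rectangle a b

  rect-below : ∀ {x} → 0 < rk x → ∃ λ w → w ⋖ x
  rect-below {(t , j) , suc k} _ = ((t , j) , inject₁ k) ,
    ⋖-snd (LexPoset.po (copies 1 ⊗ᴸ a)) {k = inject₁ k} {l = suc k} (cong suc (sym (Finₚ.toℕ-inject₁ k)))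
  rect-below {(t , suc j) , zero} _ = ((t , inject₁ j) , zero) ,
    ⋖-fst (LexPoset.po (copies 1 ⊗ᴸ a)) {suc b} {k = zero} (⋖-snd (discrete 1) {x = t} {k = inject₁ j} {l = suc j} (cong suc (sym (Finₚ.toℕ-inject₁ j))))

  -- After one element is removed the set has a gap, and a set with a gap does not shrink. So at
  -- most the removed element is lost.
  ∂-≥-pred : ∀ {e A} → Hom e A → card A ≤ suc (card (∂ A))
  ∂-≥-pred {e} {A} h with ∃? (A ∋?_)
  ... | no  n = ≤-trans (≤-reflexive (card-∅ {A} λ {x} p → n (x , p))) z≤n
  ... | yes (x , p) = ≤-trans (≤-reflexive (trans (sym (card-∖ {A} {｛ x ｝} λ {y} q → subst (A ∋_) (｛｝⁻ {x} {y} q) p))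
                        (trans (cong (card (A ∖ ｛ x ｝) +_) (card-｛｝ {x})) (+-comm _ 1))))
      (s≤s (≤-trans (∂-≥-gap {A = A ∖ ｛ x ｝} {x} (λ {y} q → h (proj₁ (∖⁻ {A} {｛ x ｝} {y} q))) (h p)
                          (λ q → proj₂ (∖⁻ {A} {｛ x ｝} {x} q) (｛｝⁺ {x})))
                       (card-mono {∂ (A ∖ ｛ x ｝)} {∂ A} (∂-mono {A ∖ ｛ x ｝} {A} (λ {y} q → proj₁ (∖⁻ {A} {｛ x ｝} {y} q))))))

  full? : ∀ e A → (lvl e ⊆ A) ⊎ (∃ λ x → rk x ≡ e × ¬ A ∋ x)
  full? e A with ∃? (λ x → (rk x ℕₚ.≟ e) ×-dec ¬? (A ∋? x))
  ... | yes p = inj₂ p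
  ... | no ¬p = inj₁ λ {x} l → Boolₚ.¬-not λ f → ¬p (x , lvl-hom {e} {x} l , λ t → true≢false t f)

  gap-of-size : ∀ {e A} → Hom e A → card A < card (lvl e) → card A ≤ card (∂ A)
  gap-of-size {e} {A} h l with card<⇒∃ {A} {lvl e} l
  ... | x , p , n = ∂-≥-gap {A = A} {x} h (lvl-hom {e} {x} p) n

  ∂-size-0 : ∀ {A} → card A ≡ 0 → card (∂ A) ≡ 0
  ∂-size-0 {A} z = card-∅ {∂ A} λ {x} p → let y , q , _ = ∂⁻ {A} {x} p in <⇒≢ (card>0 {A} {y} q) (sym z)

clip : ∀ {m} n → Fin m → Fin (suc n)
clip n k with toℕ k ℕₚ.<? suc n
... | yes p = fromℕ< p
... | no _  = zero

toℕ-clip : ∀ {m n} {k : Fin m} → toℕ k ≤ n → toℕ (clip n k) ≡ toℕ k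
toℕ-clip {n = n} {k} l with toℕ k ℕₚ.<? suc n
... | yes p = Finₚ.toℕ-fromℕ< p
... | no ¬p = contradiction (s≤s l) ¬p

clip-injective : ∀ {m n} {k l : Fin m} → toℕ k ≤ n → toℕ l ≤ n → clip n k ≡ clip n l → k ≡ l
clip-injective p q e = Finₚ.toℕ-injective (trans (sym (toℕ-clip p)) (trans (cong toℕ e) (toℕ-clip q)))

-- The side conditions matter only for coordinates up to `e`. Below the shortest side the comparison
-- therefore works in both directions, and the levels have equal size.
lvl-≤ : ∀ a b a′ b′ e → (∀ {j} → j ≤ a → j ≤ e → j ≤ a′) → (∀ {k} → k ≤ b → k ≤ e → k ≤ b′) →
        LexPoset.card (rect a b) (LexPoset.lvl (rect a b) e) ≤ LexPoset.card (rect a′ b′) (LexPoset.lvl (rect a′ b′) e)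
lvl-≤ a b a′ b′ e f g = card-inj (LexPoset.po (rect a b)) (LexPoset.po (rect a′ b′))
  (λ ((t , j) , k) → (t , clip a′ j) , clip b′ k) {R.lvl e} {R′.lvl e}
  (λ { {(t , j) , k} p → R′.lvl⁺ {e} {(t , clip a′ j) , clip b′ k} (trans (cong₂ _+_ (toℕ-clip (j≤ {t} {j} {k} p)) (toℕ-clip (k≤ {t} {j} {k} p))) (R.lvl-hom {e} {(t , j) , k} p)) })
  λ { {(t , j) , k} {(t′ , j′) , k′} p q eq → cong₂ _,_ (cong₂ _,_ (cong (proj₁ ∘ proj₁) eq)
        (clip-injective (j≤ {t} {j} {k} p) (j≤ {t′} {j′} {k′} q) (cong (proj₂ ∘ proj₁) eq)))
        (clip-injective (k≤ {t} {j} {k} p) (k≤ {t′} {j′} {k′} q) (cong proj₂ eq)) }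
  where
  module R = LexPoset (rect a b)
  module R′ = LexPoset (rect a′ b′)
  j≤ : ∀ {t j k} → R.lvl e R.∋ ((t , j) , k) → toℕ j ≤ a′
  j≤ {t} {j} {k} p = f (Finₚ.toℕ≤pred[n] j) (Rectangle.fst-≤ a b {A = R.lvl e} {t} {j} {k} (λ {x} → R.lvl-hom {e} {x}) p)
  k≤ : ∀ {t j k} → R.lvl e R.∋ ((t , j) , k) → toℕ k ≤ b′
  k≤ {t} {j} {k} p = g (Finₚ.toℕ≤pred[n] k) (Rectangle.snd-≤ a b {A = R.lvl e} {t} {j} {k} (λ {x} → R.lvl-hom {e} {x}) p)

module _ {a b a′ b′ : ℕ} (a≤b : a ≤ b) (a′≤b′ : a′ ≤ b′) where
  private
    module L₁ = LexPoset (rect a b)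
    module L₂ = LexPoset (rect a′ b′)
    module B₁ = Rectangle a b
    module B₂ = Rectangle a′ b′
  open OrderedSum (rect a b) (rect a′ b′)
  open Subsets (OrderedSum.po (rect a b) (rect a′ b′))

  sum-macAt : ∀ {n} → (∀ {A S} → Hom n A → Hom n S → Closed _≲_ S →
      L₁.card (S ∘ inj₁) + L₂.card (S ∘ inj₂) ≡ L₁.card (A ∘ inj₁) + L₂.card (A ∘ inj₂) →
      L₁.card (L₁.∂ (S ∘ inj₁)) + L₂.card (L₂.∂ (S ∘ inj₂)) ≤ L₁.card (L₁.∂ (A ∘ inj₁)) + L₂.card (L₂.∂ (A ∘ inj₂))) →
    MacAt _≲_ n
  sum-macAt {n} min =
    (λ {A} {S} hA hS cS eq → subst₂ _≤_ (sym (card-∂-⊎ S)) (sym (card-∂-⊎ A))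
      (min {A} {S} hA hS cS (trans (sym (card-⊎ S)) (trans eq (card-⊎ A))))) ,
    (λ {S} → sum-∂-closed (rect-below a b) (B₁.rectangle-macaulay a≤b n) (B₂.rectangle-macaulay a′≤b′ n) {S})

  -- In these ranks, in either summand, a segment gains nothing and no set loses anything. For a
  -- path and a strip of width two this covers every rank that has to be checked.
  macAt-wide : ∀ {n} → a ≤ n → n < b → a′ ≤ n → n < b′ → MacAt _≲_ n
  macAt-wide p q p′ q′ = sum-macAt λ {A} {S} hA hS cS eq → ≤-trans
    (+-mono-≤ (B₁.∂-≤ {S = S ∘ inj₁} hS (closed₁ {S} cS) p) (B₂.∂-≤ {S = S ∘ inj₂} hS (closed₂ {S} cS) p′))
    (≤-trans (≤-reflexive eq)
      (+-mono-≤ (B₁.∂-≥-wide {A = A ∘ inj₁} hA q) (B₂.∂-≥-wide {A = A ∘ inj₂} hA q′)))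

  module _ (a≤a′ : a ≤ a′) (b≤b′ : b ≤ b′) {n : ℕ} where

    private
     module _ {A S} (hA : Hom n A) (hS : Hom n S) (cS : Closed _≲_ S)
           (eq : L₁.card (S ∘ inj₁) + L₂.card (S ∘ inj₂) ≡ L₁.card (A ∘ inj₁) + L₂.card (A ∘ inj₂)) where
      A₁ S₁ : L₁.Subset
      A₁ = A ∘ inj₁
      S₁ = S ∘ inj₁
      A₂ S₂ : L₂.Subset
      A₂ = A ∘ inj₂
      S₂ = S ∘ inj₂

      h₁ : L₁.Hom n A₁
      h₁ = hA
      h₂ : L₂.Hom n A₂
      h₂ = hA
      k₁ : L₁.Hom n S₁
      k₁ = hS
      k₂ : L₂.Hom n S₂
      k₂ = hS

      N₁ N₂ : ℕ
      N₁ = L₁.card (L₁.lvl n)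
      N₂ = L₂.card (L₂.lvl n)

      Goal : Set
      Goal = L₁.card (L₁.∂ S₁) + L₂.card (L₂.∂ S₂) ≤ L₁.card (L₁.∂ A₁) + L₂.card (L₂.∂ A₂)

      A₁≤N₁ : L₁.card A₁ ≤ N₁
      A₁≤N₁ = L₁.card-mono {A₁} {L₁.lvl n} (L₁.hom⇒⊆lvl {n} {A₁} h₁)

      A₂≤N₂ : L₂.card A₂ ≤ N₂
      A₂≤N₂ = L₂.card-mono {A₂} {L₂.lvl n} (L₂.hom⇒⊆lvl {n} {A₂} h₂)

      N₁≤N₂ : N₁ ≤ N₂
      N₁≤N₂ = lvl-≤ a b a′ b′ n (λ p _ → ≤-trans p a≤a′) (λ p _ → ≤-trans p b≤b′)

      -- The first summand precedes the second, so `S` reaches the second only after filling the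
      -- level of the first. Then `A`, being of the same size, must reach the second as well.
      data Second : Set where
        empty    : L₂.card (L₂.∂ S₂) ≡ 0 → L₁.card S₁ ≡ L₁.card A₁ + L₂.card A₂ → Second
        nonempty : L₁.card S₁ ≡ N₁ → 0 < L₂.card S₂ → 0 < L₂.card A₂ → Second

      second : Second
      second with L₂.card S₂ ℕₚ.≟ 0
      ... | yes z = empty (∂-size-0 a′ b′ {S₂} z) (trans (sym (+-identityʳ _)) (trans (cong (L₁.card S₁ +_) (sym z)) eq))
      ... | no nz with L₂.card>0⇒∃ {S₂} (n≢0⇒n>0 nz)
      ...   | y , s = nonempty full (n≢0⇒n>0 nz) (≤-trans (n≢0⇒n>0 nz) (+-cancelˡ-≤ N₁ _ _ (≤-trans
                (≤-reflexive (trans (cong (_+ L₂.card S₂) (sym full)) eq)) (+-monoˡ-≤ (L₂.card A₂) A₁≤N₁))))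
        where
        full : L₁.card S₁ ≡ N₁
        full = L₁.card-cong {S₁} {L₁.lvl n} (L₁.hom⇒⊆lvl {n} {S₁} k₁)
                 (λ {x} p → before {S} cS {x} {y} s (trans (L₁.lvl-hom {n} {x} p) (sym (k₂ s))))

      -- Each nonempty half of `A` gains at least one and each half of `S` at most one, so `A` has
      -- to meet as many halves as `S`. The levels have equal size here; if `S` meets both halves,
      -- then `A` is larger than one level and meets both too.
      triangle : n < a → Goal
      triangle l with second
      ... | nonempty full s>0 a>0 = begin
          L₁.card (L₁.∂ S₁) + L₂.card (L₂.∂ S₂)  ≤⟨ +-mono-≤ (B₁.∂-≤-suc {S = S₁} k₁ (closed₁ {S} cS)) (B₂.∂-≤-suc {S = S₂} k₂ (closed₂ {S} cS)) ⟩
          suc (L₁.card S₁) + suc (L₂.card S₂)    ≡⟨ cong suc (+-suc _ _) ⟩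
          suc (suc (L₁.card S₁ + L₂.card S₂))    ≡⟨ cong (λ z → suc (suc z)) eq ⟩
          suc (suc (L₁.card A₁ + L₂.card A₂))    ≡⟨ cong suc (sym (+-suc _ _)) ⟩
          suc (L₁.card A₁) + suc (L₂.card A₂)    ≤⟨ +-mono-≤ (B₁.∂->-triangle {A = A₁} h₁ l (<-≤-trans l a≤b) A₁>0)
                                                     (B₂.∂->-triangle {A = A₂} h₂ (<-≤-trans l a≤a′) (<-≤-trans l (≤-trans a≤a′ a′≤b′)) a>0) ⟩
          L₁.card (L₁.∂ A₁) + L₂.card (L₂.∂ A₂)  ∎
        where
        open ℕₚ.≤-Reasoning
        N₂≤N₁ : N₂ ≤ N₁
        N₂≤N₁ = lvl-≤ a′ b′ a b n (λ _ p → ≤-trans p (<⇒≤ l)) (λ _ p → ≤-trans p (≤-trans (<⇒≤ l) a≤b))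
        A₁>0 : 0 < L₁.card A₁
        A₁>0 = ℕₚ.+-cancelʳ-< (L₂.card A₂) 0 _ (≤-<-trans (≤-trans A₂≤N₂ N₂≤N₁)
                 (<-≤-trans (<-≤-trans (ℕₚ.m<m+n N₁ s>0) (≤-reflexive (cong (_+ L₂.card S₂) (sym full)))) (≤-reflexive eq)))
      ... | empty z e with L₁.card S₁ ℕₚ.≟ 0
      ...   | yes s≡0 = ≤-trans (≤-reflexive (cong₂ _+_ (∂-size-0 a b {S₁} s≡0) z)) z≤n
      ...   | no  s≢0 = ≤-trans (≤-reflexive (trans (cong (L₁.card (L₁.∂ S₁) +_) z) (+-identityʳ _)))
                (≤-trans (≤-trans (B₁.∂-≤-suc {S = S₁} k₁ (closed₁ {S} cS)) (≤-reflexive (cong suc e))) grow)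
        where
        grow : suc (L₁.card A₁ + L₂.card A₂) ≤ L₁.card (L₁.∂ A₁) + L₂.card (L₂.∂ A₂)
        grow with L₁.card A₁ ℕₚ.≟ 0 | L₂.card A₂ ℕₚ.≟ 0
        ... | no p | _ = +-mono-≤ (B₁.∂->-triangle {A = A₁} h₁ l (<-≤-trans l a≤b) (n≢0⇒n>0 p))
                           (B₂.∂-≥-wide {A = A₂} h₂ (<-≤-trans l (≤-trans a≤a′ a′≤b′)))
        ... | yes _ | no q = ≤-trans (≤-reflexive (sym (+-suc _ _))) (+-mono-≤ (B₁.∂-≥-wide {A = A₁} h₁ (<-≤-trans l a≤b))
                           (B₂.∂->-triangle {A = A₂} h₂ (<-≤-trans l a≤a′) (<-≤-trans l (≤-trans a≤a′ a′≤b′)) (n≢0⇒n>0 q)))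
        ... | yes p | yes q = contradiction (trans e (cong₂ _+_ p q)) s≢0

      -- Only below rank `a′` can the second half of `S` gain, by one at most; the second half of
      -- `A` is then nonempty and gains one as well. The first halves are left as sizes, to be
      -- compared with their shadows separately.
      grow₂ : n < b′ → L₁.card S₁ + L₂.card (L₂.∂ S₂) ≤ L₁.card A₁ + L₂.card (L₂.∂ A₂)
      grow₂ l with second
      ... | empty z e = ≤-trans (≤-reflexive (cong₂ _+_ e z)) (≤-trans (≤-reflexive (+-identityʳ _))
                          (+-monoʳ-≤ (L₁.card A₁) (B₂.∂-≥-wide {A = A₂} h₂ l)))
      ... | nonempty _ _ a>0 with n ℕₚ.<? a′
      ...   | yes l′ = ≤-trans (+-monoʳ-≤ (L₁.card S₁) (B₂.∂-≤-suc {S = S₂} k₂ (closed₂ {S} cS)))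
                (≤-trans (≤-reflexive (trans (+-suc _ _) (trans (cong suc eq) (sym (+-suc _ _)))))
                  (+-monoʳ-≤ (L₁.card A₁) (B₂.∂->-triangle {A = A₂} h₂ l′ l a>0)))
      ...   | no ¬l′ = ≤-trans (+-monoʳ-≤ (L₁.card S₁) (B₂.∂-≤ {S = S₂} k₂ (closed₂ {S} cS) (≮⇒≥ ¬l′)))
                (≤-trans (≤-reflexive eq) (+-monoʳ-≤ (L₁.card A₁) (B₂.∂-≥-wide {A = A₂} h₂ l)))

      middle : a ≤ n → n < b → Goal
      middle p l = ≤-trans (+-monoˡ-≤ _ (B₁.∂-≤ {S = S₁} k₁ (closed₁ {S} cS) p))
        (≤-trans (grow₂ (<-≤-trans l b≤b′)) (+-monoˡ-≤ _ (B₁.∂-≥-wide {A = A₁} h₁ l)))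

      -- If `S` does not fill the first level, `A` is smaller than both levels, since `N₁ ≤ N₂`; it
      -- has a gap in each and loses nothing. If `S` fills a nonempty first level, it loses at least
      -- one there, while `A` can lose more than one only if both of its halves are full.
      top : b ≤ n → Goal
      top p with L₁.card S₁ ℕₚ.<? N₁
      top p | yes l with second
      ... | nonempty full _ _ = contradiction l (<-irrefl full)
      ... | empty z e = ≤-trans (+-mono-≤ (B₁.∂-≤ {S = S₁} k₁ (closed₁ {S} cS) (≤-trans a≤b p)) (≤-reflexive z))
            (≤-trans (≤-reflexive (trans (+-identityʳ _) e)) (+-mono-≤
              (gap-of-size a b {A = A₁} h₁ (≤-<-trans (≤-trans (m≤m+n _ _) (≤-reflexive (sym e))) l))
              (gap-of-size a′ b′ {A = A₂} h₂ (<-≤-trans (≤-<-trans (≤-trans (m≤n+m _ (L₁.card A₁)) (≤-reflexive (sym e))) l) N₁≤N₂))))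
      top p | no ¬l with N₁ ℕₚ.≟ 0
      top p | no ¬l | yes z = ≤-trans (+-mono-≤ (≤-reflexive (∂-size-0 a b {S₁} s≡0))
              (proj₁ (B₂.rectangle-macaulay a′≤b′ n) {A₂} {S₂} h₂ k₂ (closed₂ {S} cS)
                (trans (cong (_+ L₂.card S₂) (sym s≡0)) (trans eq (cong (_+ L₂.card A₂) (ℕₚ.n≤0⇒n≡0 (≤-trans A₁≤N₁ (≤-reflexive z))))))))
              (m≤n+m _ (L₁.card (L₁.∂ A₁)))
        where
        s≡0 : L₁.card S₁ ≡ 0
        s≡0 = ℕₚ.n≤0⇒n≡0 (≤-trans (L₁.card-mono {S₁} {L₁.lvl n} (L₁.hom⇒⊆lvl {n} {S₁} k₁)) (≤-reflexive z))
      -- One is added on both sides to absorb the element that the full first half of `S` loses.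
      top p | no ¬l | no nz = s≤s⁻¹ (lossy (L₁.card>0⇒∃ {L₁.lvl n} (n≢0⇒n>0 nz)))
        where
        lossy : ∃ (L₁.lvl n L₁.∋_) → suc (L₁.card (L₁.∂ S₁) + L₂.card (L₂.∂ S₂)) ≤ suc (L₁.card (L₁.∂ A₁) + L₂.card (L₂.∂ A₂))
        lossy (x , x∈) = cases (n ℕₚ.<? b′) (full? a b n A₁) (full? a′ b′ n A₂)
          where
          shrink : suc (L₁.card (L₁.∂ S₁)) ≤ L₁.card S₁
          shrink = ≤-trans (s≤s (L₁.card-mono {L₁.∂ S₁} {L₁.∂ (L₁.lvl n)} (L₁.∂-mono {S₁} {L₁.lvl n} (L₁.hom⇒⊆lvl {n} {S₁} k₁))))
                     (≤-trans (B₁.lvl-shrinks {n} {x} (L₁.lvl-hom {n} {x} x∈) (≤-trans a≤b p) p) (≮⇒≥ ¬l))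
          cases : Dec (n < b′) → _ → _ → suc (L₁.card (L₁.∂ S₁) + L₂.card (L₂.∂ S₂)) ≤ suc (L₁.card (L₁.∂ A₁) + L₂.card (L₂.∂ A₂))
          cases (yes l) _ _ = ≤-trans (+-monoˡ-≤ (L₂.card (L₂.∂ S₂)) shrink) (≤-trans (grow₂ l) (+-monoˡ-≤ _ (∂-≥-pred a b {A = A₁} h₁)))
          cases (no ¬l) (inj₂ (y , r , m)) _ = ≤-trans (+-mono-≤ shrink (B₂.∂-≤ {S = S₂} k₂ (closed₂ {S} cS) (≤-trans a′≤b′ (≮⇒≥ ¬l))))
            (≤-trans (≤-reflexive eq) (≤-trans (+-mono-≤ (B₁.∂-≥-gap {A = A₁} {y} h₁ r m) (∂-≥-pred a′ b′ {A = A₂} h₂)) (≤-reflexive (+-suc _ _))))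
          cases (no ¬l) _ (inj₂ (y , r , m)) = ≤-trans (+-mono-≤ shrink (B₂.∂-≤ {S = S₂} k₂ (closed₂ {S} cS) (≤-trans a′≤b′ (≮⇒≥ ¬l))))
            (≤-trans (≤-reflexive eq) (+-mono-≤ (∂-≥-pred a b {A = A₁} h₁) (B₂.∂-≥-gap {A = A₂} {y} h₂ r m)))
          cases (no ¬l) (inj₁ f₁) (inj₁ f₂) = s≤s (+-mono-≤
            (L₁.card-mono {L₁.∂ S₁} {L₁.∂ A₁} (L₁.∂-mono {S₁} {A₁} (λ {x} s → f₁ {x} (L₁.hom⇒⊆lvl {n} {S₁} k₁ {x} s))))
            (L₂.card-mono {L₂.∂ S₂} {L₂.∂ A₂} (L₂.∂-mono {S₂} {A₂} (λ {x} s → f₂ {x} (L₂.hom⇒⊆lvl {n} {S₂} k₂ {x} s)))))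

      goal : Goal
      goal with n ℕₚ.<? a | n ℕₚ.<? b
      ... | yes l | _      = triangle l
      ... | no ¬l | yes l′ = middle (≮⇒≥ ¬l) l′
      ... | no ¬l | no ¬l′ = top (≮⇒≥ ¬l′)

    nested-rectangles-macAt : MacAt _≲_ n
    nested-rectangles-macAt = sum-macAt λ {A} {S} hA hS cS eq → goal {A} {S} hA hS cS eq


rect-nest : ∀ a b → Iso (LexPoset.po (rect a b)) (LexPoset.po (nest 1 (b ∷ a ∷ [])))
rect-nest a b = record { to = id ; from = id ; to-from = λ _ → refl ; from-to = λ _ → refl ; ⊑-to = id ; ⊑-from = id ; rk-to = λ _ → refl }

path-nest : ∀ a → Iso (LexPoset.po (rect 0 a)) (LexPoset.po (nest 1 (a ∷ [])))
path-nest a = ⊗-cong {P = discrete 1 ⊗ 1} {Q = discrete 1} ⊗-one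

box-nest-≡ : ∀ {n} {d : Vec ℕ n} {as} → Positive d → shape d ≡ as → Iso (LexPoset.po (nest 1 as)) (boxPo d)
box-nest-≡ d⁺ refl = iso-sym (box-nest d⁺)

sum-boxes : ∀ {k l} {d : Vec ℕ k} {e : Vec ℕ l} (L₁ L₂ : LexPoset) → Iso (LexPoset.po L₁) (boxPo d) → Iso (LexPoset.po L₂) (boxPo e) →
            Iso (OrderedSum.po L₁ L₂) (boxes d e)
sum-boxes L₁ L₂ f g = ⊎-cong f g

sum-boxes-swap : ∀ {k l} {d : Vec ℕ k} {e : Vec ℕ l} (L₁ L₂ : LexPoset) → Iso (LexPoset.po L₁) (boxPo e) → Iso (LexPoset.po L₂) (boxPo d) →
            Iso (OrderedSum.po L₁ L₂) (boxes d e)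
sum-boxes-swap L₁ L₂ f g = ⊎-comm (LexPoset.po L₁) (LexPoset.po L₂) ⨾ ⊎-cong g f

rect-box : ∀ {a b} → Positive (suc (suc a) ∷ suc (suc b) ∷ []) →
           Iso (LexPoset.po (rect (suc a) (suc b))) (boxPo (suc (suc a) ∷ suc (suc b) ∷ []))
rect-box {a} {b} d⁺ = rect-nest (suc a) (suc b) ⨾ nest-perm 1 {suc b ∷ suc a ∷ []} {suc a ∷ suc b ∷ []} (Perm.swap (suc b) (suc a) Perm.refl) ⨾
                      box-nest-≡ d⁺ refl

wedge-of-nested : ∀ {m n m′ n′} (d⁺ : Positive (m ∷ n ∷ [])) (e⁺ : Positive (m′ ∷ n′ ∷ [])) →
  1 < m → 1 < n → 1 < m′ → 1 < n′ → m ≤ n → m′ ≤ n′ → (m ≤ m′ × n ≤ n′) ⊎ (m′ ≤ m × n′ ≤ n) → Macaulay (Wedge d⁺ e⁺)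
wedge-of-nested {suc m@(suc _)} {suc n@(suc _)} {suc m′@(suc _)} {suc n′@(suc _)} d⁺ e⁺ _ _ _ _ (s≤s p) (s≤s p′) (inj₁ (s≤s u , s≤s v)) =
  wedge⇐ d⁺ e⁺ (sum-boxes (rect m n) (rect m′ n′) (rect-box d⁺) (rect-box e⁺))
    (OrderedSum._≲_ (rect m n) (rect m′ n′)) (OrderedSum.isTotal (rect m n) (rect m′ n′))
    λ {k} _ → nested-rectangles-macAt {m} {n} {m′} {n′} p p′ u v {k}
wedge-of-nested {suc m@(suc _)} {suc n@(suc _)} {suc m′@(suc _)} {suc n′@(suc _)} d⁺ e⁺ _ _ _ _ (s≤s p) (s≤s p′) (inj₂ (s≤s u , s≤s v)) =
  wedge⇐ d⁺ e⁺ (sum-boxes-swap (rect m′ n′) (rect m n) (rect-box e⁺) (rect-box d⁺))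
    (OrderedSum._≲_ (rect m′ n′) (rect m n)) (OrderedSum.isTotal (rect m′ n′) (rect m n))
    λ {k} _ → nested-rectangles-macAt {m′} {n′} {m} {n} p′ p u v {k}
wedge-of-nested {suc zero} _ _ (s≤s ())
wedge-of-nested {suc (suc _)} {suc zero} _ _ _ (s≤s ())
wedge-of-nested {suc (suc _)} {suc (suc _)} {suc zero} _ _ _ _ (s≤s ())
wedge-of-nested {suc (suc _)} {suc (suc _)} {suc (suc _)} {suc zero} _ _ _ _ _ (s≤s ())

-- A path is a rectangle with one side of length one, so that both posets below
-- are rectangles in which segments and their shadows have the same size.
path-rectangles : ∀ {k l} {d : Vec ℕ k} {e : Vec ℕ l} {d⁺ : Positive d} {e⁺ : Positive e}
  (same : height (CL d d⁺) ≡ height (CL e e⁺)) → IsPath d d⁺ → dimension (CL e e⁺) ≡ 2 → 2 ∈ sides e →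
  ∃₂ λ r b → Iso (LexPoset.po (rect 0 r)) (boxPo d) × Iso (LexPoset.po (rect 1 b)) (boxPo e) × height (CL d d⁺) ≡ r × r ≡ suc b
path-rectangles {d = d} {e} {d⁺} {e⁺} same path dim side =
  go (shape d) (shape e) (box-nest-≡ d⁺ refl) (box-nest-≡ e⁺ refl) (trans (sym (dimension-shape d⁺)) path) (trans (sym (dimension-shape e⁺)) dim)
     (2∈sides⇒1∈shape {d = e} side) (height-shape d⁺) (trans same (height-shape e⁺))
  where
  go : ∀ as bs → Iso (LexPoset.po (nest 1 as)) (boxPo d) → Iso (LexPoset.po (nest 1 bs)) (boxPo e) → length as ≡ 1 → length bs ≡ 2 →
       1 ∈ bs → height (CL d d⁺) ≡ ℕL.sum as → height (CL d d⁺) ≡ ℕL.sum bs →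
       ∃₂ λ r b → Iso (LexPoset.po (rect 0 r)) (boxPo d) × Iso (LexPoset.po (rect 1 b)) (boxPo e) × height (CL d d⁺) ≡ r × r ≡ suc b
  go (r ∷ []) (_ ∷ b ∷ []) f g _ _ (here refl) h h′ = r , b ,
    path-nest r ⨾ f , rect-nest 1 b ⨾ nest-perm 1 {b ∷ 1 ∷ []} {1 ∷ b ∷ []} (Perm.swap b 1 Perm.refl) ⨾ g ,
    trans h (+-identityʳ r) , trans (trans (sym (+-identityʳ r)) (sym h)) (trans h′ (cong suc (+-identityʳ b)))
  go (r ∷ []) (b ∷ _ ∷ []) f g _ _ (there (here refl)) h h′ = r , b ,
    path-nest r ⨾ f , rect-nest 1 b ⨾ g ,
    trans h (+-identityʳ r) , trans (trans (sym (+-identityʳ r)) (sym h)) (trans h′ (+-comm b 1))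

diamond-path-first : ∀ {k l} {d : Vec ℕ k} {e : Vec ℕ l} {d⁺ : Positive d} {e⁺ : Positive e}
  (same : height (CL d d⁺) ≡ height (CL e e⁺)) → IsPath d d⁺ × dimension (CL e e⁺) ≡ 2 × 2 ∈ sides e → Macaulay (Diamond d⁺ e⁺ same)
diamond-path-first {d = d} {e} {d⁺} {e⁺} same (path , dim , side) = go (path-rectangles {d⁺ = d⁺} {e⁺} same path dim side)
  where
  go : (∃₂ λ r b → Iso (LexPoset.po (rect 0 r)) (boxPo d) × Iso (LexPoset.po (rect 1 b)) (boxPo e) × height (CL d d⁺) ≡ r × r ≡ suc b) →
       Macaulay (Diamond d⁺ e⁺ same)
  go (r , b , f , g , h , refl) = diamond⇐ d⁺ e⁺ (sum-boxes (rect 0 (suc b)) (rect 1 b) f g)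
    (OrderedSum._≲_ (rect 0 (suc b)) (rect 1 b)) (OrderedSum.isTotal (rect 0 (suc b)) (rect 1 b)) same
    λ {n} p q → let q′ = <-≤-trans q (≤-reflexive h) in
      -- The path has height `suc b`, so a rank `n` whose successor is still below the top satisfies
      -- `n < b`.
      macAt-wide {0} {suc b} {1} {b} z≤n (≤-trans p (<⇒≤ (s≤s⁻¹ q′))) {n} z≤n (<-trans (n<1+n n) q′) p (s≤s⁻¹ q′)

diamond-path-second : ∀ {k l} {d : Vec ℕ k} {e : Vec ℕ l} {d⁺ : Positive d} {e⁺ : Positive e}
  (same : height (CL d d⁺) ≡ height (CL e e⁺)) → IsPath e e⁺ × dimension (CL d d⁺) ≡ 2 × 2 ∈ sides d → Macaulay (Diamond d⁺ e⁺ same)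
diamond-path-second {d = d} {e} {d⁺} {e⁺} same (path , dim , side) = go (path-rectangles {d⁺ = e⁺} {d⁺} (sym same) path dim side)
  where
  go : (∃₂ λ r b → Iso (LexPoset.po (rect 0 r)) (boxPo e) × Iso (LexPoset.po (rect 1 b)) (boxPo d) × height (CL e e⁺) ≡ r × r ≡ suc b) →
       Macaulay (Diamond d⁺ e⁺ same)
  go (r , b , f , g , h , refl) = diamond⇐ d⁺ e⁺ (sum-boxes (rect 1 b) (rect 0 (suc b)) g f)
    (OrderedSum._≲_ (rect 1 b) (rect 0 (suc b))) (OrderedSum.isTotal (rect 1 b) (rect 0 (suc b))) same
    λ {n} p q → let q′ = <-≤-trans q (≤-reflexive (trans same h)) in
      macAt-wide {1} {b} {0} {suc b} (≤-trans p (<⇒≤ (s≤s⁻¹ q′))) z≤n {n} p (s≤s⁻¹ q′) z≤n (<-trans (n<1+n n) q′)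


-- Necessity for wedges of rectangles

ordering-iso : ∀ {P Q Good} → Iso P Q → Ordering P Good → Ordering Q Good
ordering-iso f O = record
  { _≼_ = λ x y → from x ≼ from y
  ; total = λ x y → total (from x) (from y)
  ; ≼-trans = ≼-trans
  ; antisym = λ g r s p q → Iso.to-injective (iso-sym f) (antisym g (trans (rk-from _) r) (trans (rk-from _) s) p q)
  ; macAt = λ g g′ → Transfer.macAt-to f (macAt g g′)
  }
  where
  open Iso f
  open Ordering O

-- The first element of rank a lies in the rectangle with the shorter side, hence
-- so does some first element of rank b′; but there the other rectangle shrinks.
crossing-rectangles : ∀ a b a′ b′ → 1 ≤ a → a < a′ → a′ ≤ b′ → b′ < b →
  ¬ Ordering (LexPoset.po (rect a b) ⊎ᴾ LexPoset.po (rect a′ b′)) (1 ≤_)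
crossing-rectangles a b a′ b′ 1≤a a<a′ a′≤b′ b′<b O = contradiction (final (climb-to (b′ ∸ a))) (<-irrefl refl)
  where
  module L₁ = LexPoset (rect a b)
  module L₂ = LexPoset (rect a′ b′)
  module B₁ = Rectangle a b
  module B₂ = Rectangle a′ b′
  W : Po
  W = L₁.po ⊎ᴾ L₂.po
  open Po W
  open Subsets W
  open Halves L₁.po L₂.po
  open Ordering O
  open Segments _≼_ total ≼-trans using (maximum; nested; segment)

  a≤b′ : a ≤ b′
  a≤b′ = ≤-trans (<⇒≤ a<a′) a′≤b′

  -- A witness of rank `a` with at most one cover. In the second rectangle every element of that
  -- rank has at least two covers, because `a < a′` and `a < b′`; hence the first element of rank
  -- `a` cannot lie there.
  corner : ∃ λ T → L₁.Hom a T × L₁.card T ≡ 1 × L₁.card (L₁.∂ T) ≤ 1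
  corner with L₁.segmentOf {a} {L₁.｛ c ｝} (λ {x} p → trans (cong L₁.rk (sym (L₁.｛｝⁻ {c} {x} p))) rk-c)
    where
    c : L₁.X
    c = (zero , fromℕ a) , zero
    rk-c : L₁.rk c ≡ a
    rk-c = trans (+-identityʳ _) (Finₚ.toℕ-fromℕ a)
  ... | T , h , cl , eq = T , h , trans eq (L₁.card-｛｝ {c}) , ≤-trans (B₁.∂-≤ {S = T} h cl ≤-refl) (≤-reflexive (trans eq (L₁.card-｛｝ {c})))
    where
    c : L₁.X
    c = (zero , fromℕ a) , zero

  first-rank : ∃ λ x → rk x ≡ a × (∀ {y} → rk y ≡ a → y ≼ x)
  first-rank = maximum {λ x → rk x ≡ a} (λ x → rk x ℕₚ.≟ a)
    (inj₁ ((zero , fromℕ a) , zero) , trans (+-identityʳ _) (Finₚ.toℕ-fromℕ a))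

  ｛｝-closed : ∀ {x} → rk x ≡ a → (∀ {y} → rk y ≡ a → y ≼ x) → Closed _≼_ ｛ x ｝
  ｛｝-closed {x} r top {y} {z} p y≼z s with ｛｝⁻ {x} {y} p
  ... | refl with antisym 1≤a r (trans s r) y≼z (top (trans s r))
  ...   | refl = ｛｝⁺ {x}

  Initial : ℕ → Set
  Initial e = ∃ λ S → Hom e S × Closed _≼_ S × (∃ λ p → S ∋ inj₁ p) × (∀ {q} → ¬ S ∋ inj₂ q)

  start : Initial a
  start with first-rank
  ... | inj₁ p , r , top = ｛ inj₁ p ｝ , (λ {y} q → trans (cong rk (sym (｛｝⁻ {inj₁ p} {y} q))) r) , ｛｝-closed {inj₁ p} r top ,
        (p , ｛｝⁺ {inj₁ p}) , λ {q} z → case ｛｝⁻ {inj₁ p} {inj₂ q} z of λ ()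
  ... | inj₂ q , r , top = contradiction (≤-trans (subst (suc (L₂.card L₂.｛ q ｝) ≤_) refl
          (B₂.∂->-triangle {A = L₂.｛ q ｝} (λ {y} z → trans (cong L₂.rk (sym (L₂.｛｝⁻ {q} {y} z))) r) a<a′ (<-≤-trans a<a′ a′≤b′)
             (L₂.card>0 {L₂.｛ q ｝} {q} (L₂.｛｝⁺ {q}))))
          small) (<⇒≱ (≤-reflexive (cong suc (sym (L₂.card-｛｝ {q})))))
    where
    T : L₁.Subset
    T = proj₁ corner
    A : Subset
    A (inj₁ x) = T x
    A (inj₂ _) = false
    none : L₂.card (A ∘ inj₂) ≡ 0
    none = L₂.card-∅ {A ∘ inj₂} λ ()
    card-A : card A ≡ 1
    card-A = trans (card-⊎ A) (trans (cong (L₁.card T +_) none) (trans (+-identityʳ _) (proj₁ (proj₂ (proj₂ corner)))))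
    small : L₂.card (L₂.∂ L₂.｛ q ｝) ≤ 1
    small = begin
      L₂.card (L₂.∂ L₂.｛ q ｝)     ≤⟨ L₂.card-mono {L₂.∂ L₂.｛ q ｝} {L₂.∂ (｛ inj₂ q ｝ ∘ inj₂)} (L₂.∂-mono {L₂.｛ q ｝} {｛ inj₂ q ｝ ∘ inj₂}
                                       (λ {x} z → subst (λ y → ｛ inj₂ q ｝ (inj₂ y) ≡ true) (L₂.｛｝⁻ {q} {x} z) (｛｝⁺ {inj₂ q}))) ⟩
      L₂.card (L₂.∂ (｛ inj₂ q ｝ ∘ inj₂)) ≤⟨ m≤n+m _ (L₁.card (L₁.∂ (｛ inj₂ q ｝ ∘ inj₁))) ⟩
      L₁.card (L₁.∂ (｛ inj₂ q ｝ ∘ inj₁)) + L₂.card (L₂.∂ (｛ inj₂ q ｝ ∘ inj₂)) ≡⟨ sym (card-∂-⊎ ｛ inj₂ q ｝) ⟩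
      card (∂ ｛ inj₂ q ｝)         ≤⟨ proj₁ (macAt 1≤a (s≤s z≤n)) {A} {｛ inj₂ q ｝}
                                       (λ { {inj₁ x} t → proj₁ (proj₂ corner) {x} t }) (λ {y} z → trans (cong rk (sym (｛｝⁻ {inj₂ q} {y} z))) r)
                                       (｛｝-closed {inj₂ q} r top) (trans (card-｛｝ {inj₂ q}) (sym card-A)) ⟩
      card (∂ A)                    ≡⟨ card-∂-⊎ A ⟩
      L₁.card (L₁.∂ T) + L₂.card (L₂.∂ (A ∘ inj₂)) ≡⟨ cong (L₁.card (L₁.∂ T) +_) (∂-size-0 a′ b′ {A ∘ inj₂} none) ⟩
      L₁.card (L₁.∂ T) + 0          ≡⟨ +-identityʳ _ ⟩
      L₁.card (L₁.∂ T)              ≤⟨ proj₂ (proj₂ (proj₂ corner)) ⟩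
      1                             ∎
      where open ℕₚ.≤-Reasoning

  -- The shadow of a segment inside the first rectangle is again a segment inside it. It stays
  -- nonempty because a move to the right is possible below rank `b`.
  next : ∀ {e} → 1 ≤ e → e < b → Initial e → Initial (suc e)
  next {e} 1≤e e<b (S , h , c , ((y , k) , s) , none) = ∂ S , ∂-hom {e} {S} h , proj₂ (macAt 1≤e (s≤s z≤n)) {S} h c ,
    ((y , B₁.inc k) , ∂⁺ {S} {inj₁ (y , k)} s (inj₁ (proj₁ cov) , proj₂ cov)) ,
    λ {q} p → case ∂⁻ {S} {inj₂ q} p of λ { (inj₂ w , t , _) → none t }
    where
    cov : (y , k) L₁.⋖ (y , B₁.inc k)
    cov = B₁.right {y} (≤-<-trans (≤-trans (m≤n+m (toℕ k) (LexPoset.rk (copies 1 ⊗ᴸ a) y)) (≤-reflexive (h s))) e<b)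

  climb-to : ∀ t → t + a ≤ b′ → Initial (t + a)
  climb-to zero    _ = start
  climb-to (suc t) l = next (≤-trans 1≤a (m≤n+m a t)) (<-trans l b′<b) (climb-to t (<⇒≤ l))

  N : ℕ
  N = L₂.card (L₂.lvl b′)

  -- In rank `b′` the full level of the second rectangle has size `N` and a smaller shadow. The
  -- segment `G` of size `N` is comparable with one inside the first rectangle, so its second half
  -- is not the full level. Neither half of `G` then loses anything.
  final : ((b′ ∸ a) + a ≤ b′ → Initial ((b′ ∸ a) + a)) → N < N
  final init = go (subst Initial (m∸n+n≡m a≤b′) (init (≤-reflexive (m∸n+n≡m a≤b′))))
                  (segment {b′} (antisym (≤-trans 1≤a a≤b′)) N
                    (≤-trans (≤-reflexive (sym card-A)) (card-mono {A} {lvl b′} (λ {x} z → hom⇒⊆lvl {b′} {A} (λ {x} → hom-A {x}) {x} z))))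
    where
    A : Subset
    A (inj₁ _) = false
    A (inj₂ x) = L₂.lvl b′ x
    none : L₁.card (A ∘ inj₁) ≡ 0
    none = L₁.card-∅ {A ∘ inj₁} λ ()
    card-A : card A ≡ N
    card-A = trans (card-⊎ A) (cong (_+ N) none)
    hom-A : Hom b′ A
    hom-A {inj₂ x} = L₂.lvl-hom {b′} {x}
    card-∂A : card (∂ A) < N
    card-∂A = ≤-<-trans (≤-reflexive (trans (card-∂-⊎ A) (cong (_+ L₂.card (L₂.∂ (L₂.lvl b′))) (∂-size-0 a b {A ∘ inj₁} none))))
                (B₂.lvl-shrinks {b′} {(zero , zero) , fromℕ b′} (Finₚ.toℕ-fromℕ b′) a′≤b′ ≤-refl)
    go : Initial b′ → (∃ λ G → Hom b′ G × Closed _≼_ G × card G ≡ N) → N < N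
    go (S , hS , cS , (p , s) , no₂) (G , hG , cG , eq) = ≤-<-trans (begin
        N                                               ≡⟨ sym eq ⟩
        card G                                          ≡⟨ card-⊎ G ⟩
        L₁.card (G ∘ inj₁) + L₂.card (G ∘ inj₂)         ≤⟨ +-mono-≤ (B₁.∂-≥-wide {A = G ∘ inj₁} (λ {x} → hG {inj₁ x}) b′<b)
                                                            (gap-of-size a′ b′ {A = G ∘ inj₂} (λ {x} → hG {inj₂ x}) G₂<N) ⟩
        L₁.card (L₁.∂ (G ∘ inj₁)) + L₂.card (L₂.∂ (G ∘ inj₂)) ≡⟨ sym (card-∂-⊎ G) ⟩
        card (∂ G)                                      ≤⟨ proj₁ (macAt (≤-trans 1≤a a≤b′) (s≤s z≤n)) {A} {G} (λ {x} → hom-A {x}) hG cG (trans eq (sym card-A)) ⟩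
        card (∂ A)                                      ∎) card-∂A
      where
      open ℕₚ.≤-Reasoning
      N>0 : 0 < N
      N>0 = ≤-<-trans z≤n card-∂A
      sum-N : L₁.card (G ∘ inj₁) + L₂.card (G ∘ inj₂) ≡ N
      sum-N = trans (sym (card-⊎ G)) eq
      G₂<N : L₂.card (G ∘ inj₂) < N
      G₂<N with ℕₚ.≤-total (card S) (card G)
      ... | inj₁ l = <-≤-trans (ℕₚ.m<n+m _ (L₁.card>0 {G ∘ inj₁} {p} (nested hS hG cS cG l {inj₁ p} s))) (≤-reflexive sum-N)
      ... | inj₂ l = ≤-<-trans (≤-reflexive (L₂.card-∅ {G ∘ inj₂} (λ {q} g → no₂ {q} (nested hG hS cG cS l {inj₂ q} g)))) N>0

wedge-nested : ∀ {m n m′ n′} (d⁺ : Positive (m ∷ n ∷ [])) (e⁺ : Positive (m′ ∷ n′ ∷ [])) →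
  1 < m → 1 < n → 1 < m′ → 1 < n′ → m ≤ n → m′ ≤ n′ → Ordering (boxes (m ∷ n ∷ []) (m′ ∷ n′ ∷ [])) (1 ≤_) →
  (m ≤ m′ × n ≤ n′) ⊎ (m′ ≤ m × n′ ≤ n)
wedge-nested {suc zero} _ _ (s≤s ())
wedge-nested {suc (suc _)} {suc zero} _ _ _ (s≤s ())
wedge-nested {suc (suc _)} {suc (suc _)} {suc zero} _ _ _ _ (s≤s ())
wedge-nested {suc (suc _)} {suc (suc _)} {suc (suc _)} {suc zero} _ _ _ _ _ (s≤s ())
wedge-nested {suc m@(suc _)} {suc n@(suc _)} {suc m′@(suc _)} {suc n′@(suc _)} d⁺ e⁺ _ _ _ _ (s≤s p) (s≤s p′) O
  with m ℕₚ.≤? m′ | n ℕₚ.≤? n′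
... | yes u | yes v = inj₁ (s≤s u , s≤s v)
... | no  u | no  v = inj₂ (s≤s (ℕₚ.≰⇒≥ u) , s≤s (ℕₚ.≰⇒≥ v))
... | yes u | no  v with ℕₚ.m≤n⇒m<n∨m≡n u
...   | inj₂ refl = inj₂ (≤-refl , s≤s (ℕₚ.≰⇒≥ v))
...   | inj₁ m<m′ = contradiction (ordering-iso (iso-sym (sum-boxes (rect m n) (rect m′ n′) (rect-box d⁺) (rect-box e⁺))) O)
                      (crossing-rectangles m n m′ n′ (s≤s z≤n) m<m′ p′ (≰⇒> v))
wedge-nested {suc m@(suc _)} {suc n@(suc _)} {suc m′@(suc _)} {suc n′@(suc _)} d⁺ e⁺ _ _ _ _ (s≤s p) (s≤s p′) O
    | no  u | yes v with ℕₚ.m≤n⇒m<n∨m≡n v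
...   | inj₂ refl = inj₂ (s≤s (ℕₚ.≰⇒≥ u) , ≤-refl)
...   | inj₁ n<n′ = contradiction (ordering-iso (iso-sym (sum-boxes-swap (rect m′ n′) (rect m n) (rect-box e⁺) (rect-box d⁺))) O)
                      (crossing-rectangles m′ n′ m n (s≤s z≤n) (≰⇒> u) p n<n′)


-- Necessity for diamonds

-- A poset made of two disjoint parts, each with an order-reversing complement
-- and with the covering structure of a box next to its atoms.
record TwoSided (W : Po) : Set₁ where
  open Po W
  open Subsets W
  field
    side    : X → Bool
    ⊑-side  : ∀ {x y} → x ⊑ y → side x ≡ side y
    ⊑-trans : ∀ {x y z} → x ⊑ y → y ⊑ z → x ⊑ z
    below   : ∀ {x y} → x ⊑ y → rk x < rk y → ∃ λ z → x ⊑ z × z ⋖ y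
    r       : ℕ
    comp    : X → X
    comp²   : ∀ x → comp (comp x) ≡ x
    comp-rk : ∀ x → rk (comp x) + rk x ≡ r
    comp-⊑  : ∀ {x y} → x ⊑ y → comp y ⊑ comp x
    comp-side : ∀ x → side (comp x) ≡ side x
    above   : ∀ {x} → rk x < r → ∃ (x ⋖_)

  part : Bool → ℕ → Subset
  part b e = ⟦ (λ x → (rk x ℕₚ.≟ e) ×-dec (side x Boolₚ.≟ b)) ⟧

  dim : Bool → ℕ
  dim b = card (part b 1)

  field
    atom-below : ∀ {x} → 1 ≤ rk x → ∃ λ a → rk a ≡ 1 × a ⊑ x
    inhabited  : 1 ≤ r → ∀ b → ∃ λ a → part b 1 ∋ a
    -- 2x is missing, so the side through the atom x has length two.
    Two        : X → Set
    Two?       : U.Decidable Two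
    dim≤       : ∀ {x b} → part b 1 ∋ x → dim b ≤ suc (card (∂ ｛ x ｝))
    dim≤-long  : ∀ {x b} → part b 1 ∋ x → ¬ Two x → dim b ≤ card (∂ ｛ x ｝)
    dim>-two   : ∀ {x b} → part b 1 ∋ x → Two x → suc (card (∂ ｛ x ｝)) ≤ dim b
    ∂-grow     : ∀ {A x b} → A ⊆ part b 1 → part b 1 ∋ x → card (∂ (A ∪ ｛ x ｝)) + card A ≤ card (∂ A) + dim b
    coatom     : ∀ {x c b} → part b 1 ∋ x → side c ≡ b → suc (rk c) ≡ r → x ⊑ c ⊎ (Two x × c ≡ comp x)

-- Only `path` is an exceptional diamond. In the case `twos` both posets are rectangles with a side
-- of length two, and equal height makes them isomorphic; in `same-counts` the Hilbert functions do.
data Outcome {W : Po} (T : TwoSided W) : Set where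
  same-counts : (∀ {e} → 1 ≤ e → e < TwoSided.r T →
                 Subsets.card W (TwoSided.part T false e) ≡ Subsets.card W (TwoSided.part T true e)) → Outcome T
  path        : ∀ b {y} → TwoSided.dim T b ≡ 1 → TwoSided.dim T (not b) ≡ 2 →
                TwoSided.part T (not b) 1 y ≡ true → TwoSided.Two T y → Outcome T
  twos        : (∀ b → TwoSided.dim T b ≡ 2 × ∃ λ y → TwoSided.part T b 1 y ≡ true × TwoSided.Two T y) → Outcome T

-- Duality

module TwoSidedMacaulay {W : Po} (T : TwoSided W) (3≤r : 3 ≤ TwoSided.r T) where
  open Po W
  open Subsets W
  open TwoSided T

  Good : ℕ → Set
  Good n = 1 ≤ n × n < r

  good₁ : Good 1
  good₁ = s≤s z≤n , ≤-trans (s≤s (s≤s z≤n)) 3≤r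

  good₂ : Good 2
  good₂ = s≤s z≤n , 3≤r

  part⁺ : ∀ {b e x} → rk x ≡ e → side x ≡ b → part b e ∋ x
  part⁺ {b} {e} {x} p q = dec-true ((rk x ℕₚ.≟ e) ×-dec (side x Boolₚ.≟ b)) (p , q)

  part-rk : ∀ {b e x} → part b e ∋ x → rk x ≡ e
  part-rk {b} {e} {x} p = proj₁ (does⁻ ((rk x ℕₚ.≟ e) ×-dec (side x Boolₚ.≟ b)) p)

  part-side : ∀ {b e x} → part b e ∋ x → side x ≡ b
  part-side {b} {e} {x} p = proj₂ (does⁻ ((rk x ℕₚ.≟ e) ×-dec (side x Boolₚ.≟ b)) p)

  apart : ∀ {x y b} → side x ≡ b → side y ≡ not b → x ≢ y
  apart {b = b} p q refl = Boolₚ.not-¬ {b} refl (trans (sym p) q)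

  other : ∀ {x b} → ¬ side x ≡ b → side x ≡ not b
  other {x} {b} n = Boolₚ.¬-not n

  ∂-part : ∀ {b e A} → A ⊆ part b e → ∀ {y} → ∂ A ∋ y → side y ≡ b
  ∂-part {b} {e} {A} s {y} p with ∂⁻ {A} {y} p
  ... | x , a , c = trans (sym (⊑-side (proj₁ c))) (part-side {b} {e} {x} (s a))

  ∂-disjoint : ∀ {b A B} → A ⊆ part b 1 → B ⊆ part (not b) 1 → card (∂ A) + card (∂ B) ≤ card (∂ (A ∪ B))
  ∂-disjoint {b} {A} {B} s t = ≤-trans
    (≤-reflexive (sym (card-disjoint {∂ A} {∂ B} λ {y} p q →
      apart {y} {y} (∂-part {b} {1} {A} s {y} p) (∂-part {not b} {1} {B} t {y} q) refl)))
    (card-mono {∂ A ∪ ∂ B} {∂ (A ∪ B)} λ {y} p → case ∪⁻ {∂ A} {∂ B} {y} p of λ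
      { (inj₁ q) → ∂-mono {A} {A ∪ B} (λ {x} → ∪⁺ˡ {A} {B} {x}) {y} q
      ; (inj₂ q) → ∂-mono {B} {A ∪ B} (λ {x} → ∪⁺ʳ {A} {B} {x}) {y} q })

  ∂>0 : ∀ {b x} → part b 1 ∋ x → 0 < card (∂ ｛ x ｝)
  ∂>0 {b} {x} p with above {x} (≤-<-trans (≤-reflexive (part-rk {b} {1} {x} p)) (proj₂ good₁))
  ... | y , c = card>0 {∂ ｛ x ｝} {y} (∂⁺ {｛ x ｝} {x} (｛｝⁺ {x}) c)

  ｛｝⊆ : ∀ {A x} → A ∋ x → ｛ x ｝ ⊆ A
  ｛｝⊆ {A} {x} a {y} p = subst (A ∋_) (｛｝⁻ {x} {y} p) a

  ∪⊆ : ∀ {A B C : Subset} → A ⊆ C → B ⊆ C → (A ∪ B) ⊆ C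
  ∪⊆ {A} {B} s t {x} p with ∪⁻ {A} {B} {x} p
  ... | inj₁ a = s a
  ... | inj₂ b = t b

  part-hom : ∀ {b e A} → A ⊆ part b e → Hom e A
  part-hom {b} {e} s {x} a = part-rk {b} {e} {x} (s a)

  card-pair : ∀ {x y} → x ≢ y → card (｛ x ｝ ∪ ｛ y ｝) ≡ 2
  card-pair {x} {y} n = trans (card-∪｛｝ {｛ x ｝} {y} (λ p → n (｛｝⁻ {x} {y} p))) (cong suc (card-｛｝ {x}))

  ∂｛｝≤dim : ∀ {x b} → part b 1 ∋ x → card (∂ ｛ x ｝) ≤ dim b
  ∂｛｝≤dim {x} {b} p = ≤-trans (card-mono {∂ ｛ x ｝} {∂ (∅ ∪ ｛ x ｝)} (∂-mono {｛ x ｝} {∅ ∪ ｛ x ｝} (λ {y} q → q)))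
    (≤-trans (m≤m+n _ _) (≤-trans (∂-grow {∅} {x} {b} (λ ()) p) (≤-reflexive
      (cong (_+ dim b) (card-∅ {∂ ∅} λ {y} q → case ∂⁻ {∅} {y} q of λ ())))))

  comp-injective : ∀ {x y} → comp x ≡ comp y → x ≡ y
  comp-injective {x} {y} e = trans (sym (comp² x)) (trans (cong comp e) (comp² y))

  comp-level : ∀ {n m} → n + m ≡ r → ∀ {x} → rk x ≡ n → rk (comp x) ≡ m
  comp-level {n} {m} e {x} p = +-cancelʳ-≡ n _ _ (trans (trans (cong (rk (comp x) +_) (sym p)) (comp-rk x)) (trans (sym e) (+-comm n m)))

  comp-⋖ : ∀ {x y} → x ⋖ y → comp y ⋖ comp x
  comp-⋖ {x} {y} (p , q) = comp-⊑ p , +-cancelʳ-≡ (rk x) _ _ (trans (comp-rk x) (trans (sym (comp-rk y))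
     (trans (cong (rk (comp y) +_) q) (+-suc _ _))))

  card-comp : ∀ A → card (A ∘ comp) ≡ card A
  card-comp A = ≤-antisym (card-inj W W comp {A ∘ comp} {A} id (λ _ _ → comp-injective))
    (card-inj W W comp {A} {A ∘ comp} (λ {x} a → trans (cong A (comp² x)) a) (λ _ _ → comp-injective))

  -- The complement image of `A` is avoided by the shadow of `U`, the level minus the complement
  -- image of `∂ A`, so small shadows of `A` mean large `U`. A segment `G` of the size of `U` has
  -- its shadow, again a segment, inside what the complement image of `S` leaves free. So `G` avoids
  -- the complement image of `∂ S`, which bounds the size of `∂ S`.
  module Dual (O : Ordering W Good) where
    open Ordering O
    open Segments _≼_ total ≼-trans using (nested; segment)

    _≼′_ : Rel X 0ℓ
    x ≼′ y = comp y ≼ comp x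

    -- Complementation takes ranks `n` and `suc n` to `suc m` and `m`, so the step upwards from `n`
    -- is controlled by the original step from `m`.
    module _ {n m} (e : suc n + m ≡ r) (1≤n : 1 ≤ n) (gm : Good m) where
      private
        suc-m : n + suc m ≡ r
        suc-m = trans (+-suc n m) e

        gm′ : Good (suc m)
        gm′ = s≤s z≤n , <-≤-trans (ℕₚ.+-monoˡ-< (suc m) {0} {n} 1≤n) (≤-reflexive suc-m)

        back-n : ∀ {x} → rk x ≡ suc m → rk (comp x) ≡ n
        back-n = comp-level (trans (+-comm (suc m) n) suc-m)

        module _ {A S} (hA : Hom n A) (hS : Hom n S) (cS : Closed _≼′_ S) (eq : card S ≡ card A) where

          A* S* ∂A* ∂S* U : Subset
          A*  = A ∘ comp
          S*  = S ∘ comp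
          ∂A* = ∂ A ∘ comp
          ∂S* = ∂ S ∘ comp
          U   = lvl m ∖ ∂A*

          hom* : ∀ {B} → Hom n B → Hom (suc m) (B ∘ comp)
          hom* {B} h {x} p = trans (cong rk (sym (comp² x))) (comp-level suc-m {comp x} (h p))

          hom∂* : ∀ {B} → Hom n B → Hom m (∂ B ∘ comp)
          hom∂* {B} h {x} p = trans (cong rk (sym (comp² x))) (comp-level e {comp x} (∂-hom {n} {B} h {comp x} p))

          U-card : card U + card (∂ A) ≡ card (lvl m)
          U-card = trans (cong (card U +_) (sym (card-comp (∂ A)))) (card-∖ {lvl m} {∂A*} (hom⇒⊆lvl {m} {∂A*} (hom∂* {A} hA)))

          rest : Subset
          rest = lvl (suc m) ∖ S*

          rest-closed : Closed _≼_ rest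
          rest-closed {x} {y} p x≼y s with ∖⁻ {lvl (suc m)} {S*} {x} p
          ... | l , ¬s = ∖⁺ {lvl (suc m)} {S*} {y} (lvl⁺ {suc m} {y} (trans s (lvl-hom {suc m} {x} l)))
                (λ t → ¬s (cS {comp y} {comp x} t (subst₂ _≼_ (sym (comp² x)) (sym (comp² y)) x≼y)
                  (trans (back-n (lvl-hom {suc m} {x} l)) (sym (back-n (trans s (lvl-hom {suc m} {x} l)))))))

          ∂U-misses : ∀ {y} → ∂ U ∋ y → ¬ A* ∋ y
          ∂U-misses {y} p a with ∂⁻ {U} {y} p
          ... | u , q , c = proj₂ (∖⁻ {lvl m} {∂A*} {u} q) (∂⁺ {A} a (comp-⋖ c))

          ∂U-size : card (∂ U) ≤ card rest
          ∂U-size = ℕₚ.+-cancelʳ-≤ (card S*) _ _ (≤-trans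
            (≤-trans (≤-reflexive (trans (cong (card (∂ U) +_) (trans (card-comp S) (trans eq (sym (card-comp A)))))
               (sym (card-disjoint {∂ U} {A*} (λ {y} → ∂U-misses {y})))))
               (card-mono {∂ U ∪ A*} {lvl (suc m)} (hom⇒⊆lvl {suc m} {∂ U ∪ A*} (∪-hom {suc m} {∂ U} {A*}
                  (∂-hom {m} {U} (λ {x} q → lvl-hom {m} {x} (proj₁ (∖⁻ {lvl m} {∂A*} {x} q)))) (hom* {A} hA)))))
            (≤-reflexive (sym (card-∖ {lvl (suc m)} {S*} (hom⇒⊆lvl {suc m} {S*} (hom* {S} hS))))))

          Gap : Set
          Gap = ∃ λ G → Hom m G × Closed _≼_ G × card G ≡ card U × (∀ {g} → G ∋ g → ¬ ∂S* ∋ g)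

          gap : Gap
          gap with segment {m} (antisym gm) (card U) (card-mono {U} {lvl m} (λ {x} q → proj₁ (∖⁻ {lvl m} {∂A*} {x} q)))
          ... | G , hG , cG , eqG = G , hG , cG , eqG , miss
            where
            inside : ∂ G ⊆ rest
            inside = nested {suc m} {∂ G} {rest} (∂-hom {m} {G} hG)
              (λ {x} q → lvl-hom {suc m} {x} (proj₁ (∖⁻ {lvl (suc m)} {S*} {x} q))) (proj₂ (macAt gm gm′) {G} hG cG) rest-closed
              (≤-trans (proj₁ (macAt gm gm′) {U} {G} (λ {x} q → lvl-hom {m} {x} (proj₁ (∖⁻ {lvl m} {∂A*} {x} q))) hG cG eqG) ∂U-size)
            miss : ∀ {g} → G ∋ g → ¬ ∂S* ∋ g
            miss {g} p q with ∂⁻ {S} {comp g} q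
            ... | s , t , c = proj₂ (∖⁻ {lvl (suc m)} {S*} {comp s} (inside {comp s} (∂⁺ {G} {g} p
                    (subst (_⋖ comp s) (comp² g) (comp-⋖ c))))) (trans (cong S (comp² s)) t)

          G+∂S : (g : Gap) → card (proj₁ g) + card (∂ S) ≤ card (lvl m)
          G+∂S (G , hG , _ , _ , miss) = ≤-trans (≤-reflexive (trans (cong (card G +_) (sym (card-comp (∂ S))))
              (sym (card-disjoint {G} {∂S*} (λ {x} → miss {x})))))
            (card-mono {G ∪ ∂S*} {lvl m} (hom⇒⊆lvl {m} {G ∪ ∂S*} (∪-hom {m} {G} {∂S*} hG (hom∂* {S} hS))))

          dual-min : card (∂ S) ≤ card (∂ A)
          dual-min with gap
          ... | g@(G , _ , _ , eqG , _) = +-cancelˡ-≤ (card U) _ _ (≤-trans (≤-reflexive (cong (_+ card (∂ S)) (sym eqG)))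
                (≤-trans (G+∂S g) (≤-reflexive (sym U-card))))

      -- For `A = S` the segment `G` has the same size as the complement of the image of `∂ S` and
      -- lies in it. That complement is therefore a segment, and `∂ S` is one for the reversed
      -- order.
      dual-closed : ∀ {S} → Hom n S → Closed _≼′_ S → Closed _≼′_ (∂ S)
      dual-closed {S} h c {x} {y} p y≼x s with gap {S} {S} h h c refl
      ... | G , hG , cG , eqG , miss with ∂ S y in eqy
      ...   | true  = refl
      ...   | false = contradiction (trans (cong (∂ S) (comp² x)) p) (miss {comp x} (cG {comp y} {comp x} y∈G y≼x
                        (trans (comp-level e rx) (sym (comp-level e (trans s rx))))))
        where
        rx : rk x ≡ suc n
        rx = ∂-hom {n} {S} h {x} p
        full : U {S} {S} h h c refl ⊆ G
        full = ⊆∧≥⇒⊇ {G} {U {S} {S} h h c refl} (λ {g} q → ∖⁺ {lvl m} {∂ S ∘ comp} {g} (lvl⁺ {m} {g} (hG q)) (miss {g} q)) (≤-reflexive (sym eqG))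
        y∈G : G ∋ comp y
        y∈G = full (∖⁺ {lvl m} {∂ S ∘ comp} {comp y} (lvl⁺ {m} {comp y} (comp-level e (trans s rx)))
                      (λ q → true≢false (trans (cong (∂ S) (sym (comp² y))) q) eqy))

      dual-macAt : MacAt _≼′_ n
      dual-macAt = (λ {A} {S} hA hS cS eq → dual-min {A} {S} hA hS cS eq) , (λ {S} → dual-closed {S})

    dual : Ordering W Good
    dual = record
      { _≼_ = _≼′_
      ; total = λ x y → total (comp y) (comp x)
      ; ≼-trans = λ p q → ≼-trans q p
      ; antisym = λ {n} (g , g′) {x} {y} p q u v → let m = r ∸ n ; e = m+[n∸m]≡n (<⇒≤ g′) in
          comp-injective (antisym {r ∸ n} (ℕₚ.m<n⇒0<n∸m g′ , ℕₚ.∸-monoʳ-< g (<⇒≤ g′))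
            (comp-level e p) (comp-level e q) v u)
      ; macAt = λ {n} (g , _) (_ , g′) → dual-macAt {n} {r ∸ suc n} (m+[n∸m]≡n (<⇒≤ g′)) g
          (ℕₚ.m<n⇒0<n∸m g′ , ℕₚ.∸-monoʳ-< (s≤s z≤n) (<⇒≤ g′))
      }


-- The order of the atoms

triple-suc : ∀ p → suc (p + suc p + suc p) ≡ p + (p + p) + 2 + 1
triple-suc p rewrite +-suc p p | +-suc (p + p) p | +-assoc p p p | +-comm (p + (p + p) + 2) 1 | +-comm (p + (p + p)) 2 = refl

module AtomOrder {W : Po} (T : TwoSided W) (3≤r : 3 ≤ TwoSided.r T) (O : Ordering W (TwoSidedMacaulay.Good T 3≤r)) where
  open Po W
  open Subsets W
  open TwoSided T
  open TwoSidedMacaulay T 3≤r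
  open Ordering O
  open Segments _≼_ total ≼-trans

  ≼-refl : ∀ {x} → x ≼ x
  ≼-refl {x} = [ id , id ]′ (total x x)

  antisym₁ : ∀ {x y} → rk x ≡ 1 → rk y ≡ 1 → x ≼ y → y ≼ x → x ≡ y
  antisym₁ = antisym good₁

  minimal₁ : ∀ {A S} → Hom 1 A → Hom 1 S → Closed _≼_ S → card S ≡ card A → card (∂ S) ≤ card (∂ A)
  minimal₁ {A} {S} = proj₁ (macAt good₁ good₂) {A} {S}

  First : X → Set
  First x = rk x ≡ 1 × (∀ {y} → rk y ≡ 1 → y ≼ x)

  first : ∃ First
  first with maximum {λ x → rk x ≡ 1} (λ x → rk x ℕₚ.≟ 1)
    (let a , p = inhabited (≤-trans (s≤s z≤n) 3≤r) true in a , part-rk {true} {1} {a} p)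
  ... | x , p , top = x , p , top

  first-closed : ∀ {x} → First x → Closed _≼_ ｛ x ｝
  first-closed {x} (r , top) {y} {z} p y≼z s with ｛｝⁻ {x} {y} p
  ... | refl with antisym₁ r (trans s r) y≼z (top (trans s r))
  ...   | refl = ｛｝⁺ {x}

  first-minimal : ∀ {x y} → First x → rk y ≡ 1 → card (∂ ｛ x ｝) ≤ card (∂ ｛ y ｝)
  first-minimal {x} {y} f s = minimal₁ {｛ y ｝} {｛ x ｝} (λ {z} p → trans (｛｝-hom {y} {z} p) s) (λ {z} p → trans (｛｝-hom {x} {z} p) (proj₁ f))
    (first-closed f) (trans (card-｛｝ {x}) (sym (card-｛｝ {y})))

  ｛｝-≡ : ∀ {x y} → x ≡ y → ｛ x ｝ ∋ y
  ｛｝-≡ {x} {y} = dec-true (x ≟ y)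

  closed-∪｛｝ : ∀ {S v} → rk v ≡ 1 → Closed _≼_ S → (∀ {u} → rk u ≡ 1 → v ≼ u → (S ∪ ｛ v ｝) ∋ u) → Closed _≼_ (S ∪ ｛ v ｝)
  closed-∪｛｝ {S} {v} rv c h {z} {u} p z≼u s = case ∪⁻ {S} {｛ v ｝} {z} p of λ
    { (inj₁ q) → ∪⁺ˡ {S} {｛ v ｝} {u} (c q z≼u s)
    ; (inj₂ q) → let e = ｛｝⁻ {v} {z} q in h {u} (trans s (trans (cong rk (sym e)) rv)) (subst (_≼ u) (sym e) z≼u) }

  module _ {I : Subset} (hI : Hom 1 I) (cI : Closed _≼_ I) where

    upset : ℕ → Subset
    upset e = ⟦ (λ v → (rk v ℕₚ.≟ e) ×-dec ∃? (λ a → (I ∋? a) ×-dec (a ⊑? v))) ⟧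

    upset⁺ : ∀ {e v a} → rk v ≡ e → I ∋ a → a ⊑ v → upset e ∋ v
    upset⁺ {e} {v} {a} p q s = dec-true ((rk v ℕₚ.≟ e) ×-dec ∃? (λ a → (I ∋? a) ×-dec (a ⊑? v))) (p , a , q , s)

    upset⁻ : ∀ {e v} → upset e ∋ v → rk v ≡ e × ∃ λ a → I ∋ a × a ⊑ v
    upset⁻ {e} {v} = does⁻ ((rk v ℕₚ.≟ e) ×-dec ∃? (λ a → (I ∋? a) ×-dec (a ⊑? v)))

    -- The multiples of `I` in one rank are the shadow of those in the rank before, so condition
    -- (ii) carries the segment property upwards from rank one.
    upset-step : ∀ e → suc (suc e) < r → Closed _≼_ (upset (suc e)) → Closed _≼_ (upset (suc (suc e)))
    upset-step e l c {x} {y} p x≼y s with upset⁻ {suc (suc e)} {x} p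
    ... | rx , a , a∈ , a⊑x with below a⊑x (≤-trans (s≤s (≤-reflexive (hI a∈))) (≤-trans (s≤s (s≤s z≤n)) (≤-reflexive (sym rx))))
    ...   | z , a⊑z , z⋖x with ∂⁻ {upset (suc e)} {y} (proj₂ (macAt {suc e} (s≤s z≤n , <-trans (n<1+n _) l) (s≤s z≤n , l)) {upset (suc e)}
              (λ {v} q → proj₁ (upset⁻ {suc e} {v} q)) c
              (∂⁺ {upset (suc e)} {z} (upset⁺ {suc e} {z} {a} (suc-injective (trans (sym (proj₂ z⋖x)) rx)) a∈ a⊑z) z⋖x) x≼y s)
    ...     | w , q , w⋖y with upset⁻ {suc e} {w} q
    ...       | rw , c , c∈ , c⊑w = upset⁺ {suc (suc e)} {y} {c} (trans s rx) c∈ (⊑-trans c⊑w (proj₁ w⋖y))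

    upset-closed : ∀ e → 1 ≤ e → e < r → Closed _≼_ (upset e)
    upset-closed (suc zero) _ _ {x} {y} p x≼y s with upset⁻ {1} {x} p
    ... | rx , a , a∈ , a⊑x with ⊑-eq a⊑x (trans (hI a∈) (sym rx))
    ...   | refl = upset⁺ {1} {y} {y} (trans s rx) (cI a∈ x≼y s) ⊑-refl
    upset-closed (suc (suc e)) _ l = upset-step e l (upset-closed (suc e) (s≤s z≤n) (<-trans (n<1+n _) l))

    before : ∀ {u v a} → 1 ≤ rk v → rk v < r → rk u ≡ rk v → I ∋ a → a ⊑ v → (∀ {c} → I ∋ c → ¬ c ⊑ u) → u ≼ v
    before {u} {v} {a} p q s a∈ a⊑v miss with total u v
    ... | inj₁ u≼v = u≼v
    ... | inj₂ v≼u with upset⁻ {rk v} {u} (upset-closed (rk v) p q (upset⁺ {rk v} {v} {a} refl a∈ a⊑v) v≼u s)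
    ...   | _ , c , c∈ , c⊑u = contradiction c⊑u (miss c∈)

  suc-pred-r : suc (pred r) ≡ r
  suc-pred-r = m+[n∸m]≡n (≤-trans (s≤s z≤n) 3≤r)

  comp-atom : ∀ {x} → rk x ≡ 1 → rk (comp x) ≡ pred r
  comp-atom = comp-level suc-pred-r

  pred-r>0 : 1 ≤ pred r
  pred-r>0 = s≤s⁻¹ (≤-trans (s≤s (s≤s z≤n)) (≤-trans 3≤r (≤-reflexive (sym suc-pred-r))))

  pred-r<r : pred r < r
  pred-r<r = ≤-reflexive suc-pred-r

  private
    coatom-before : ∀ {I b} → I ⊆ part b 1 → Closed _≼_ I → ∀ {a y y′} → I ∋ a → part b 1 ∋ y → part (not b) 1 ∋ y′ → a ⊑ comp y → comp y′ ≼ comp y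
    coatom-before {I} {b} s c {a} {y} {y′} a∈ py py′ a⊑ = before {I} (part-hom {b} {1} {I} s) c {comp y′} {comp y} {a}
      (≤-trans pred-r>0 (≤-reflexive (sym ry))) (≤-<-trans (≤-reflexive ry) pred-r<r)
      (trans (comp-atom (part-rk {not b} {1} {y′} py′)) (sym ry)) a∈ a⊑
      λ {x} x∈ x⊑ → apart {x} {comp y′} {b} (part-side {b} {1} {x} (s x∈)) (trans (comp-side y′) (part-side {not b} {1} {y′} py′))
                      (contradiction (trans (sym (part-side {b} {1} {x} (s x∈))) (trans (⊑-side x⊑) (trans (comp-side y′) (part-side {not b} {1} {y′} py′)))) (Boolₚ.not-¬ refl))
      where
      ry : rk (comp y) ≡ pred r
      ry = comp-atom (part-rk {b} {1} {y} py)

  -- A coatom on the side of `x` is a multiple of `x`, unless it is the complement of `x` and `x`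
  -- squares to zero; multiples of `x` precede the whole other side. For the dual order this says
  -- that the atoms beside `x`, with `x` as the only possible exception, come after those of the
  -- other side.
  first-dominates : ∀ {x b} → First x → part b 1 ∋ x → ∀ {y y′} → part b 1 ∋ y → part (not b) 1 ∋ y′ → comp y′ ≼ comp y ⊎ (Two x × y ≡ x)
  first-dominates {x} {b} f px {y} {y′} py py′ with coatom {x} {comp y} {b} px (trans (comp-side y) (part-side {b} {1} {y} py))
                                        (trans (cong suc (comp-atom (part-rk {b} {1} {y} py))) suc-pred-r)
  ... | inj₂ (t , e) = inj₂ (t , comp-injective e)
  ... | inj₁ x⊑ = inj₁ (coatom-before {｛ x ｝} {b} (｛｝⊆ {part b 1} {x} px) (first-closed f) {x} {y} {y′} (｛｝⁺ {x}) py py′ x⊑)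

  module Leading {b} (lead : Closed _≼_ (part b 1)) where

    leading-dual : ∀ {y y′} → part b 1 ∋ y → part (not b) 1 ∋ y′ → comp y′ ≼ comp y
    leading-dual {y} {y′} py py′ with atom-below {comp y} (≤-trans pred-r>0 (≤-reflexive (sym (comp-atom (part-rk {b} {1} {y} py)))))
    ... | a , ra , a⊑ = coatom-before {part b 1} {b} id lead {a} {y} {y′} (part⁺ {b} {1} {a} ra
            (trans (⊑-side a⊑) (trans (comp-side y) (part-side {b} {1} {y} py)))) py py′ a⊑

    part-closed : ∀ {e} → 1 ≤ e → e < r → Closed _≼_ (part b e)
    part-closed {e} p q {x} {y} px x≼y s with atom-below {x} (≤-trans p (≤-reflexive (sym rx)))
      where
      rx : rk x ≡ e
      rx = part-rk {b} {e} {x} px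
    ... | a , ra , a⊑x with upset⁻ {part b 1} (λ {v} → part-rk {b} {1} {v}) lead {e} {y}
            (upset-closed {part b 1} (λ {v} → part-rk {b} {1} {v}) lead e p q {x} {y}
              (upset⁺ {part b 1} (λ {v} → part-rk {b} {1} {v}) lead {e} {x} {a} (part-rk {b} {e} {x} px)
                 (part⁺ {b} {1} {a} ra (trans (⊑-side a⊑x) (part-side {b} {e} {x} px))) a⊑x) x≼y s)
    ...   | ry , c , c∈ , c⊑y = part⁺ {b} {e} {y} ry (trans (sym (⊑-side c⊑y)) (part-side {b} {1} {c} c∈))

    -- A level of the leading side is a segment whose shadow is the entire next level of that side.
    -- It cannot exceed the shadow of the equally large level of the other side.
    counts-≤ : ∀ {e} → 1 ≤ e → suc e < r → card (part b e) ≡ card (part (not b) e) → card (part b (suc e)) ≤ card (part (not b) (suc e))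
    counts-≤ {e} p q eq = ≤-trans (card-mono {part b (suc e)} {∂ (part b e)} up)
      (≤-trans (proj₁ (macAt (p , <-trans (n<1+n e) q) (s≤s z≤n , q)) {part (not b) e} {part b e}
         (λ {x} → part-rk {not b} {e} {x}) (λ {x} → part-rk {b} {e} {x}) (part-closed p (<-trans (n<1+n e) q)) eq)
        (card-mono {∂ (part (not b) e)} {part (not b) (suc e)} λ {y} z → part⁺ {not b} {suc e} {y}
           (∂-hom {e} {part (not b) e} (λ {x} → part-rk {not b} {e} {x}) {y} z) (∂-part {not b} {e} {part (not b) e} id {y} z)))
      where
      up : part b (suc e) ⊆ ∂ (part b e)
      up {y} py with atom-below {y} (≤-trans (s≤s z≤n) (≤-reflexive (sym (part-rk {b} {suc e} {y} py))))
      ... | a , ra , a⊑y with below a⊑y (≤-trans (s≤s (≤-trans (≤-reflexive ra) p)) (≤-reflexive (sym (part-rk {b} {suc e} {y} py))))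
      ...   | z , _ , z⋖y = ∂⁺ {part b e} {z} (part⁺ {b} {e} {z} (suc-injective (trans (sym (proj₂ z⋖y)) (part-rk {b} {suc e} {y} py)))
                (trans (⊑-side (proj₁ z⋖y)) (part-side {b} {suc e} {y} py))) z⋖y

  leading⁺ : ∀ {b} → (∀ {y y′} → part b 1 ∋ y → part (not b) 1 ∋ y′ → y′ ≼ y) → Closed _≼_ (part b 1)
  leading⁺ {b} h {x} {y} px x≼y s = case side y Boolₚ.≟ b of λ
    { (yes p) → part⁺ {b} {1} {y} ry p
    ; (no ¬p) → subst (part b 1 ∋_) (antisym₁ (part-rk {b} {1} {x} px) ry x≼y
                  (h {x} {y} px (part⁺ {not b} {1} {y} ry (other {y} ¬p)))) px }
    where
    ry : rk y ≡ 1
    ry = trans s (part-rk {b} {1} {x} px)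

  -- The case where the first atom x is followed by the atoms of the other side.
  second-other : ∀ {b x} → First x → part b 1 ∋ x → (∀ {y y′} → part b 1 ∋ y → part (not b) 1 ∋ y′ → y ≼ y′ ⊎ y ≡ x) →
    Two x → dim b ≡ 2 × dim (not b) ≡ 1 ⊎ (∀ c → dim c ≡ 2 × ∃ λ y → part c 1 ∋ y × Two y)
  second-other {b} {x} f px D two-x = conclude
    where
    rx : rk x ≡ 1
    rx = part-rk {b} {1} {x} px

    top₁ : ∃ λ y → part (not b) 1 ∋ y × (∀ {z} → part (not b) 1 ∋ z → z ≼ y)
    top₁ = maximum {λ z → part (not b) 1 ∋ z} (part (not b) 1 ∋?_) (inhabited (≤-trans (s≤s z≤n) 3≤r) (not b))

    y : X
    y = proj₁ top₁
    py : part (not b) 1 ∋ y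
    py = proj₁ (proj₂ top₁)
    ry : rk y ≡ 1
    ry = part-rk {not b} {1} {y} py
    top-y : ∀ {z} → part (not b) 1 ∋ z → z ≼ y
    top-y = proj₂ (proj₂ top₁)

    diff : ∀ {u v} → part b 1 ∋ u → part (not b) 1 ∋ v → u ≢ v
    diff {u} {v} p q = apart {u} {v} {b} (part-side {b} {1} {u} p) (part-side {not b} {1} {v} q)

    after : ∀ {z u} → part (not b) 1 ∋ z → z ≼ u → rk u ≡ 1 → u ≡ x ⊎ part (not b) 1 ∋ u
    after {z} {u} pz z≼u ru = case side u Boolₚ.≟ b of λ
      { (no ¬p) → inj₂ (part⁺ {not b} {1} {u} ru (other {u} ¬p))
      ; (yes p) → case D {u} {z} (part⁺ {b} {1} {u} ru p) pz of λ
          { (inj₂ e) → inj₁ e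
          ; (inj₁ u≼z) → contradiction (antisym₁ ru (part-rk {not b} {1} {z} pz) u≼z z≼u) (diff {u} {z} (part⁺ {b} {1} {u} ru p) pz) } }

    S₂ : Subset
    S₂ = ｛ x ｝ ∪ ｛ y ｝

    S₂-closed : Closed _≼_ S₂
    S₂-closed = closed-∪｛｝ {｛ x ｝} {y} ry (first-closed f) λ {u} ru y≼u → case after {y} {u} py y≼u ru of λ
      { (inj₁ e)  → ∪⁺ˡ {｛ x ｝} {｛ y ｝} {u} (｛｝-≡ {x} {u} (sym e))
      ; (inj₂ pu) → ∪⁺ʳ {｛ x ｝} {｛ y ｝} {u} (｛｝-≡ {y} {u} (antisym₁ ry ru y≼u (top-y {u} pu))) }

    hom-∪ : ∀ {u v} → rk u ≡ 1 → rk v ≡ 1 → Hom 1 (｛ u ｝ ∪ ｛ v ｝)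
    hom-∪ {u} {v} p q = ∪-hom {1} {｛ u ｝} {｛ v ｝} (λ {z} t → trans (｛｝-hom {u} {z} t) p) (λ {z} t → trans (｛｝-hom {v} {z} t) q)

    ∂x ∂y : ℕ
    ∂x = card (∂ ｛ x ｝)
    ∂y = card (∂ ｛ y ｝)

    ∂x+∂y : ∂x + ∂y ≤ card (∂ S₂)
    ∂x+∂y = ∂-disjoint {b} {｛ x ｝} {｛ y ｝} (｛｝⊆ {part b 1} {x} px) (｛｝⊆ {part (not b) 1} {y} py)

    ∂x≤∂y : ∂x ≤ ∂y
    ∂x≤∂y = first-minimal f ry

    two-b : 1 < dim b
    two-b = ≤-trans (s≤s (∂>0 {b} {x} px)) (dim>-two {x} {b} px two-x)

    another : ∀ {A} → card A < dim b → ∃ λ z → part b 1 ∋ z × ¬ A ∋ z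
    another {A} l = card<⇒∃ {A} {part b 1} l

    x₂-ex : ∃ λ z → part b 1 ∋ z × ¬ ｛ x ｝ ∋ z
    x₂-ex = another {｛ x ｝} (≤-<-trans (≤-reflexive (card-｛｝ {x})) two-b)

    x₂ : X
    x₂ = proj₁ x₂-ex
    px₂ : part b 1 ∋ x₂
    px₂ = proj₁ (proj₂ x₂-ex)
    x≢x₂ : x ≢ x₂
    x≢x₂ e = proj₂ (proj₂ x₂-ex) (subst (λ v → ｛ x ｝ v ≡ true) e (｛｝⁺ {x}))

    X₂ : Subset
    X₂ = ｛ x ｝ ∪ ｛ x₂ ｝

    X₂-size : card (∂ X₂) + 1 ≤ ∂x + dim b
    X₂-size = ≤-trans (≤-reflexive (cong (card (∂ X₂) +_) (sym (card-｛｝ {x})))) (∂-grow {｛ x ｝} {x₂} {b} (｛｝⊆ {part b 1} {x} px) px₂)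

    S₂≤ : ∀ {u v} → rk u ≡ 1 → rk v ≡ 1 → u ≢ v → card (∂ S₂) ≤ card (∂ (｛ u ｝ ∪ ｛ v ｝))
    S₂≤ {u} {v} p q n = minimal₁ {｛ u ｝ ∪ ｛ v ｝} {S₂} (hom-∪ p q) (hom-∪ rx ry) S₂-closed (trans (card-pair {x} {y} (diff {x} {y} px py)) (sym (card-pair {u} {v} n)))

    -- The shadows of `x` and `y` are disjoint, whereas those of `x` and `x₂` share the product of
    -- the two atoms. Minimality of `S₂` against `X₂` leaves room for one cover less than `dim b` at
    -- `y`.
    suc-∂y≤ : suc ∂y ≤ dim b
    suc-∂y≤ = +-cancelˡ-≤ ∂x _ _ (≤-trans (≤-reflexive (trans (+-suc ∂x ∂y) (+-comm 1 _)))
      (≤-trans (+-monoˡ-≤ 1 (≤-trans ∂x+∂y (S₂≤ {x} {x₂} rx (part-rk {b} {1} {x₂} px₂) x≢x₂))) X₂-size))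

    dim≡ : dim b ≡ suc ∂y
    dim≡ = ≤-antisym (≤-trans (dim≤ {x} {b} px) (s≤s ∂x≤∂y)) suc-∂y≤

    ∂x≡∂y : ∂x ≡ ∂y
    ∂x≡∂y = ≤-antisym ∂x≤∂y (s≤s⁻¹ (≤-trans suc-∂y≤ (dim≤ {x} {b} px)))

    -- Write p for the common value of `∂x` and `∂y`; then `dim b` is p + 1. The segment `S₃` has
    -- shadow at least p + 2p, since two atoms of the other side have at least the shadow of `S₂`.
    -- Three atoms of side `b` have at most p + (p + 1 - 1) + (p + 1 - 2). So 3p ≤ 3p - 1.
    no-third : 2 < dim b → ∀ {A : Set} → A
    no-third l = contradiction bound (<⇒≱ (≤-reflexive (triple-suc ∂y)))
      where
      dim-other : 1 < dim (not b)
      dim-other = ≤-trans (s≤s⁻¹ (≤-trans l (≤-reflexive dim≡))) (∂｛｝≤dim {y} {not b} py)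

      top₂ : ∃ λ v → (part (not b) 1 ∋ v × ¬ ｛ y ｝ ∋ v) × (∀ {z} → part (not b) 1 ∋ z × ¬ ｛ y ｝ ∋ z → z ≼ v)
      top₂ = maximum {λ z → part (not b) 1 ∋ z × ¬ ｛ y ｝ ∋ z} (λ z → (part (not b) 1 ∋? z) ×-dec ¬? (｛ y ｝ ∋? z))
             (card<⇒∃ {｛ y ｝} {part (not b) 1} (≤-<-trans (≤-reflexive (card-｛｝ {y})) dim-other))

      y₂ : X
      y₂ = proj₁ top₂
      py₂ : part (not b) 1 ∋ y₂
      py₂ = proj₁ (proj₁ (proj₂ top₂))
      ry₂ : rk y₂ ≡ 1
      ry₂ = part-rk {not b} {1} {y₂} py₂
      y≢y₂ : y ≢ y₂
      y≢y₂ e = proj₂ (proj₁ (proj₂ top₂)) (subst (λ v → ｛ y ｝ v ≡ true) e (｛｝⁺ {y}))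

      x₃-ex : ∃ λ z → part b 1 ∋ z × ¬ X₂ ∋ z
      x₃-ex = another {X₂} (≤-<-trans (≤-reflexive (card-pair {x} {x₂} x≢x₂)) l)
      x₃ : X
      x₃ = proj₁ x₃-ex

      Y₂ S₃ X₃ : Subset
      Y₂ = ｛ y ｝ ∪ ｛ y₂ ｝
      S₃ = S₂ ∪ ｛ y₂ ｝
      X₃ = X₂ ∪ ｛ x₃ ｝

      S₃-closed : Closed _≼_ S₃
      S₃-closed = closed-∪｛｝ {S₂} {y₂} ry₂ S₂-closed λ {u} ru y₂≼u → case after {y₂} {u} py₂ y₂≼u ru of λ
        { (inj₁ e)  → ∪⁺ˡ {S₂} {｛ y₂ ｝} {u} (∪⁺ˡ {｛ x ｝} {｛ y ｝} {u} (｛｝-≡ {x} {u} (sym e)))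
        ; (inj₂ pu) → case y ≟ u of λ
            { (yes e) → ∪⁺ˡ {S₂} {｛ y₂ ｝} {u} (∪⁺ʳ {｛ x ｝} {｛ y ｝} {u} (｛｝-≡ {y} {u} e))
            ; (no y≢u) → ∪⁺ʳ {S₂} {｛ y₂ ｝} {u} (｛｝-≡ {y₂} {u} (antisym₁ ry₂ ru y₂≼u
                           (proj₂ (proj₂ top₂) {u} (pu , λ t → y≢u (｛｝⁻ {y} {u} t))))) } }

      S₃-card : card S₃ ≡ card X₃
      S₃-card = trans (card-∪｛｝ {S₂} {y₂} (λ p → case ∪⁻ {｛ x ｝} {｛ y ｝} {y₂} p of λ
                          { (inj₁ q) → diff {x} {y₂} px py₂ (｛｝⁻ {x} {y₂} q) ; (inj₂ q) → y≢y₂ (｛｝⁻ {y} {y₂} q) }))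
        (trans (cong suc (trans (card-pair {x} {y} (diff {x} {y} px py)) (sym (card-pair {x} {x₂} x≢x₂))))
          (sym (card-∪｛｝ {X₂} {x₃} (proj₂ (proj₂ x₃-ex)))))

      split : ∂x + card (∂ Y₂) ≤ card (∂ S₃)
      split = ≤-trans (∂-disjoint {b} {｛ x ｝} {Y₂} (｛｝⊆ {part b 1} {x} px)
                (∪⊆ {｛ y ｝} {｛ y₂ ｝} {part (not b) 1} (｛｝⊆ {part (not b) 1} {y} py) (｛｝⊆ {part (not b) 1} {y₂} py₂)))
        (card-mono {∂ (｛ x ｝ ∪ Y₂)} {∂ S₃} (∂-mono {｛ x ｝ ∪ Y₂} {S₃} λ {z} p → case ∪⁻ {｛ x ｝} {Y₂} {z} p of λ
          { (inj₁ q) → ∪⁺ˡ {S₂} {｛ y₂ ｝} {z} (∪⁺ˡ {｛ x ｝} {｛ y ｝} {z} q)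
          ; (inj₂ q) → case ∪⁻ {｛ y ｝} {｛ y₂ ｝} {z} q of λ
              { (inj₁ t) → ∪⁺ˡ {S₂} {｛ y₂ ｝} {z} (∪⁺ʳ {｛ x ｝} {｛ y ｝} {z} t) ; (inj₂ t) → ∪⁺ʳ {S₂} {｛ y₂ ｝} {z} t } }))

      X₃-size : card (∂ X₃) + 2 ≤ card (∂ X₂) + dim b
      X₃-size = ≤-trans (≤-reflexive (cong (card (∂ X₃) +_) (sym (card-pair {x} {x₂} x≢x₂))))
        (∂-grow {X₂} {x₃} {b} (∪⊆ {｛ x ｝} {｛ x₂ ｝} {part b 1} (｛｝⊆ {part b 1} {x} px) (｛｝⊆ {part b 1} {x₂} px₂)) (proj₁ (proj₂ x₃-ex)))

      bound : ∂y + (∂y + ∂y) + 2 + 1 ≤ ∂y + suc ∂y + suc ∂y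
      bound = begin
        ∂y + (∂y + ∂y) + 2 + 1   ≡⟨ cong (λ z → z + (z + ∂y) + 2 + 1) (sym ∂x≡∂y) ⟩
        ∂x + (∂x + ∂y) + 2 + 1   ≤⟨ +-monoˡ-≤ 1 (+-monoˡ-≤ 2 (+-monoʳ-≤ ∂x (≤-trans ∂x+∂y (S₂≤ {y} {y₂} ry ry₂ y≢y₂)))) ⟩
        ∂x + card (∂ Y₂) + 2 + 1 ≤⟨ +-monoˡ-≤ 1 (+-monoˡ-≤ 2 (≤-trans split (minimal₁ {X₃} {S₃}
                                      (∪-hom {1} {X₂} {｛ x₃ ｝} (hom-∪ rx (part-rk {b} {1} {x₂} px₂)) (λ {z} t → trans (｛｝-hom {x₃} {z} t) (part-rk {b} {1} {x₃} (proj₁ (proj₂ x₃-ex)))))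
                                      (∪-hom {1} {S₂} {｛ y₂ ｝} (hom-∪ rx ry) (λ {z} t → trans (｛｝-hom {y₂} {z} t) ry₂))
                                      S₃-closed S₃-card))) ⟩
        card (∂ X₃) + 2 + 1      ≤⟨ +-monoˡ-≤ 1 X₃-size ⟩
        card (∂ X₂) + dim b + 1  ≡⟨ trans (+-assoc (card (∂ X₂)) _ _) (trans (cong (card (∂ X₂) +_) (+-comm (dim b) 1)) (sym (+-assoc (card (∂ X₂)) 1 _))) ⟩
        card (∂ X₂) + 1 + dim b  ≤⟨ +-monoˡ-≤ (dim b) X₂-size ⟩
        ∂x + dim b + dim b       ≡⟨ cong₂ (λ u v → u + v + v) ∂x≡∂y dim≡ ⟩
        ∂y + suc ∂y + suc ∂y     ∎
        where open ℕₚ.≤-Reasoning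

    two-y : dim (not b) ≡ 2 → ∂y ≡ 1 → Two y
    two-y e′ ∂y≡1 = case Two? y of λ
      { (yes t) → t
      ; (no ¬t) → contradiction (≤-trans (≤-reflexive (sym e′)) (≤-trans (dim≤-long {y} {not b} py ¬t) (≤-reflexive ∂y≡1))) λ { (s≤s ()) } }

    twos-of : dim b ≡ 2 → dim (not b) ≢ 1 → ∀ c → dim c ≡ 2 × ∃ λ y → part c 1 ∋ y × Two y
    twos-of e n c = case c Boolₚ.≟ b of λ
      { (yes refl) → e , x , px , two-x
      ; (no c≢b) → subst (λ c → dim c ≡ 2 × ∃ λ y → part c 1 ∋ y × Two y) (sym (Boolₚ.¬-not c≢b)) (e′ , y , py , two-y e′ ∂y≡1) }
      where
      ∂y≡1 : ∂y ≡ 1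
      ∂y≡1 = suc-injective (trans (sym dim≡) e)
      e′ : dim (not b) ≡ 2
      e′ = ≤-antisym (≤-trans (dim≤ {y} {not b} py) (≤-reflexive (cong suc ∂y≡1)))
             (ℕₚ.≤∧≢⇒< (≤-trans (≤-reflexive (sym ∂y≡1)) (∂｛｝≤dim {y} {not b} py)) (n ∘ sym))

    conclude : dim b ≡ 2 × dim (not b) ≡ 1 ⊎ (∀ c → dim c ≡ 2 × ∃ λ y → part c 1 ∋ y × Two y)
    conclude = case dim b ℕₚ.≟ 2 of λ
      { (no n)  → no-third (ℕₚ.≤∧≢⇒< two-b (n ∘ sym))
      ; (yes e) → case dim (not b) ℕₚ.≟ 1 of λ { (yes e′) → inj₁ (e , e′) ; (no n) → inj₂ (twos-of e n) } }


module LateStart {W : Po} (T : TwoSided W) (3≤r : 3 ≤ TwoSided.r T) (O : Ordering W (TwoSidedMacaulay.Good T 3≤r)) where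
  open Po W
  open Subsets W
  open TwoSided T
  open TwoSidedMacaulay T 3≤r
  open Ordering O
  open Segments _≼_ total ≼-trans
  open AtomOrder T 3≤r O

  -- The branch that `total` takes serves as the Boolean test, so each answer yields a weak
  -- inequality; antisymmetry later excludes the ambiguous case.
  below-of : X → Subset
  below-of w u = [ (λ _ → false) , (λ _ → true) ]′ (total w u)

  below-of⁻ : ∀ {w u} → below-of w ∋ u → u ≼ w
  below-of⁻ {w} {u} p with total w u
  ... | inj₂ q = q

  below-of-¬ : ∀ {w u} → ¬ below-of w ∋ u → w ≼ u
  below-of-¬ {w} {u} n with total w u
  ... | inj₁ q = q
  ... | inj₂ _ = contradiction refl n

  module _ {b x w} (f : First x) (px : part b 1 ∋ x) (pw : part (not b) 1 ∋ w) (two-w : Two w)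
           (D : ∀ {y y′} → part (not b) 1 ∋ y → part b 1 ∋ y′ → y ≼ y′ ⊎ y ≡ w)
           {y′} (py′ : part b 1 ∋ y′) (y′≼w : y′ ≼ w) where
    private
      rx : rk x ≡ 1
      rx = part-rk {b} {1} {x} px
      rw : rk w ≡ 1
      rw = part-rk {not b} {1} {w} pw

      diff : ∀ {u v} → part b 1 ∋ u → part (not b) 1 ∋ v → u ≢ v
      diff {u} {v} p q = apart {u} {v} {b} (part-side {b} {1} {u} p) (part-side {not b} {1} {v} q)

      A S : Subset
      A = part b 1 ∖ below-of w
      S = A ∪ ｛ w ｝

      A⊆ : A ⊆ part b 1
      A⊆ {u} p = proj₁ (∖⁻ {part b 1} {below-of w} {u} p)

      A-after : ∀ {u} → A ∋ u → w ≼ u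
      A-after {u} p = below-of-¬ {w} {u} (proj₂ (∖⁻ {part b 1} {below-of w} {u} p))

      x∈A : A ∋ x
      x∈A = ∖⁺ {part b 1} {below-of w} {x} px λ q →
        diff {x} {w} px pw (antisym₁ rx rw (below-of⁻ {w} {x} q) (proj₂ f rw))

      member : ∀ {u} → rk u ≡ 1 → w ≼ u → S ∋ u
      member {u} ru w≼u = case side u Boolₚ.≟ b of λ
        { (yes p) → ∪⁺ˡ {A} {｛ w ｝} {u} (∖⁺ {part b 1} {below-of w} {u} (part⁺ {b} {1} {u} ru p) λ q →
                      diff {u} {w} (part⁺ {b} {1} {u} ru p) pw (antisym₁ ru rw (below-of⁻ {w} {u} q) w≼u))
        ; (no ¬p) → ∪⁺ʳ {A} {｛ w ｝} {u} (｛｝-≡ {w} {u} (case D {u} {y′} (part⁺ {not b} {1} {u} ru (other {u} ¬p)) py′ of λ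
            { (inj₂ e) → sym e ; (inj₁ u≼y′) → antisym₁ rw ru w≼u (≼-trans u≼y′ y′≼w) })) }

      S-hom : Hom 1 S
      S-hom = ∪-hom {1} {A} {｛ w ｝} (part-hom {b} {1} {A} A⊆) (λ {z} t → trans (｛｝-hom {w} {z} t) rw)

      S-closed : Closed _≼_ S
      S-closed {z} {u} p z≼u s = member {u} (trans s (S-hom {z} p)) (≼-trans (case ∪⁻ {A} {｛ w ｝} {z} p of λ
        { (inj₁ q) → A-after {z} q ; (inj₂ q) → subst (w ≼_) (｛｝⁻ {w} {z} q) ≼-refl }) z≼u)

      y′∉A : ¬ A ∋ y′
      y′∉A q = diff {y′} {w} py′ pw (antisym₁ (part-rk {b} {1} {y′} py′) rw y′≼w (A-after {y′} q))

      w∉A : ¬ A ∋ w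
      w∉A q = diff {w} {w} (A⊆ {w} q) pw refl

      ∂x ∂w : ℕ
      ∂x = card (∂ ｛ x ｝)
      ∂w = card (∂ ｛ w ｝)

      -- `A` collects the atoms of side `b` before `w`. Replacing `w` by `y′` after them trades the
      -- shadow of `w`, disjoint from that of `A`, for at most `dim b` minus |A| new multiples of
      -- `y′`. As `dim b` is at most `∂w` plus one, only `x` can come before `w`.
      ∂w-bound : ∂w + card A ≤ dim b
      ∂w-bound = +-cancelˡ-≤ (card (∂ A)) _ _ (begin
        card (∂ A) + (∂w + card A)        ≡⟨ sym (+-assoc (card (∂ A)) _ _) ⟩
        card (∂ A) + ∂w + card A          ≤⟨ +-monoˡ-≤ (card A) (∂-disjoint {b} {A} {｛ w ｝} A⊆ (｛｝⊆ {part (not b) 1} {w} pw)) ⟩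
        card (∂ S) + card A               ≤⟨ +-monoˡ-≤ (card A) (minimal₁ {A ∪ ｛ y′ ｝} {S}
                                               (∪-hom {1} {A} {｛ y′ ｝} (part-hom {b} {1} {A} A⊆) (λ {z} t → trans (｛｝-hom {y′} {z} t) (part-rk {b} {1} {y′} py′)))
                                               S-hom S-closed (trans (card-∪｛｝ {A} {w} w∉A) (sym (card-∪｛｝ {A} {y′} y′∉A)))) ⟩
        card (∂ (A ∪ ｛ y′ ｝)) + card A  ≤⟨ ∂-grow {A} {y′} {b} A⊆ py′ ⟩
        card (∂ A) + dim b                ∎)
        where open ℕₚ.≤-Reasoning

      ∂x≤∂w : ∂x ≤ ∂w
      ∂x≤∂w = first-minimal f rw

      card-A : card A ≡ 1
      card-A = ≤-antisym (+-cancelˡ-≤ ∂w _ _ (≤-trans ∂w-bound (≤-trans (dim≤ {x} {b} px)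
        (≤-trans (s≤s ∂x≤∂w) (≤-reflexive (+-comm 1 ∂w)))))) (card>0 {A} {x} x∈A)

      dim-b : dim b ≡ suc ∂w
      dim-b = ≤-antisym (≤-trans (dim≤ {x} {b} px) (s≤s ∂x≤∂w))
        (≤-trans (≤-reflexive (trans (+-comm 1 ∂w) (cong (∂w +_) (sym card-A)))) ∂w-bound)

      two-x : Two x
      two-x = case Two? x of λ
        { (yes t) → t
        ; (no ¬t) → contradiction (≤-trans (≤-reflexive (sym dim-b)) (≤-trans (dim≤-long {x} {b} px ¬t) ∂x≤∂w)) ℕₚ.1+n≰n }

      dim-other : dim (not b) ≡ suc ∂w
      dim-other = ≤-antisym (dim≤ {w} {not b} pw) (dim>-two {w} {not b} pw two-w)

      two-b : 1 < dim b
      two-b = ≤-trans (s≤s (∂>0 {not b} {w} pw)) (≤-reflexive (sym dim-b))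

      A-only : A ⊆ ｛ x ｝
      A-only = ⊆∧≥⇒⊇ {｛ x ｝} {A} (｛｝⊆ {A} {x} x∈A) (≤-reflexive (trans card-A (sym (card-｛｝ {x}))))

      top₂ : ∃ λ v → (part b 1 ∋ v × ¬ ｛ x ｝ ∋ v) × (∀ {z} → part b 1 ∋ z × ¬ ｛ x ｝ ∋ z → z ≼ v)
      top₂ = maximum {λ z → part b 1 ∋ z × ¬ ｛ x ｝ ∋ z} (λ z → (part b 1 ∋? z) ×-dec ¬? (｛ x ｝ ∋? z))
               (card<⇒∃ {｛ x ｝} {part b 1} (≤-<-trans (≤-reflexive (card-｛｝ {x})) two-b))

      x₂ : X
      x₂ = proj₁ top₂
      px₂ : part b 1 ∋ x₂
      px₂ = proj₁ (proj₁ (proj₂ top₂))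
      rx₂ : rk x₂ ≡ 1
      rx₂ = part-rk {b} {1} {x₂} px₂
      x≢x₂ : x ≢ x₂
      x≢x₂ e = proj₂ (proj₁ (proj₂ top₂)) (｛｝-≡ {x} {x₂} e)

      X₂ V S₃ : Subset
      X₂ = ｛ x ｝ ∪ ｛ x₂ ｝
      V  = ｛ x ｝ ∪ ｛ w ｝
      S₃ = V ∪ ｛ x₂ ｝

      V-closed : Closed _≼_ V
      V-closed = closed-∪｛｝ {｛ x ｝} {w} rw (first-closed f) λ {u} ru w≼u → case ∪⁻ {A} {｛ w ｝} {u} (member {u} ru w≼u) of λ
        { (inj₁ q) → ∪⁺ˡ {｛ x ｝} {｛ w ｝} {u} (A-only {u} q) ; (inj₂ q) → ∪⁺ʳ {｛ x ｝} {｛ w ｝} {u} q }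

      S₃-closed : Closed _≼_ S₃
      S₃-closed = closed-∪｛｝ {V} {x₂} rx₂ V-closed λ {u} ru x₂≼u → case side u Boolₚ.≟ b of λ
        { (yes p) → case x ≟ u of λ
            { (yes e) → ∪⁺ˡ {V} {｛ x₂ ｝} {u} (∪⁺ˡ {｛ x ｝} {｛ w ｝} {u} (｛｝-≡ {x} {u} e))
            ; (no n)  → ∪⁺ʳ {V} {｛ x₂ ｝} {u} (｛｝-≡ {x₂} {u} (antisym₁ rx₂ ru x₂≼u
                          (proj₂ (proj₂ top₂) {u} (part⁺ {b} {1} {u} ru p , λ t → n (｛｝⁻ {x} {u} t))))) }
        ; (no ¬p) → case D {u} {x₂} (part⁺ {not b} {1} {u} ru (other {u} ¬p)) px₂ of λ
            { (inj₂ e) → ∪⁺ˡ {V} {｛ x₂ ｝} {u} (∪⁺ʳ {｛ x ｝} {｛ w ｝} {u} (｛｝-≡ {w} {u} (sym e)))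
            ; (inj₁ q) → contradiction (antisym₁ rx₂ ru x₂≼u q) (diff {x₂} {u} px₂ (part⁺ {not b} {1} {u} ru (other {u} ¬p))) } }

      single-hom : ∀ {u} → rk u ≡ 1 → Hom 1 ｛ u ｝
      single-hom {u} ru {z} t = trans (｛｝-hom {u} {z} t) ru

      -- The order begins with `x`, `w`, `x₂`. A third atom `x₃` in place of `w` shares a product
      -- with each of `x` and `x₂`, so `∂w` would be at most `dim b` minus two, but it is `dim b`
      -- minus one.
      no-third : ¬ 2 < dim b
      no-third l = <⇒≱ (≤-reflexive (sym (trans (+-comm ∂w 2) (cong suc (sym dim-b))))) bound
        where
        x₃-ex : ∃ λ z → part b 1 ∋ z × ¬ X₂ ∋ z
        x₃-ex = card<⇒∃ {X₂} {part b 1} (≤-<-trans (≤-reflexive (card-pair {x} {x₂} x≢x₂)) l)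
        x₃ : X
        x₃ = proj₁ x₃-ex
        px₃ : part b 1 ∋ x₃
        px₃ = proj₁ (proj₂ x₃-ex)

        X₂⊆ : X₂ ⊆ part b 1
        X₂⊆ = ∪⊆ {｛ x ｝} {｛ x₂ ｝} {part b 1} (｛｝⊆ {part b 1} {x} px) (｛｝⊆ {part b 1} {x₂} px₂)

        split : card (∂ X₂) + ∂w ≤ card (∂ S₃)
        split = ≤-trans (∂-disjoint {b} {X₂} {｛ w ｝} X₂⊆ (｛｝⊆ {part (not b) 1} {w} pw))
          (card-mono {∂ (X₂ ∪ ｛ w ｝)} {∂ S₃} (∂-mono {X₂ ∪ ｛ w ｝} {S₃} λ {z} p → case ∪⁻ {X₂} {｛ w ｝} {z} p of λ
            { (inj₂ q) → ∪⁺ˡ {V} {｛ x₂ ｝} {z} (∪⁺ʳ {｛ x ｝} {｛ w ｝} {z} q)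
            ; (inj₁ q) → case ∪⁻ {｛ x ｝} {｛ x₂ ｝} {z} q of λ
                { (inj₁ t) → ∪⁺ˡ {V} {｛ x₂ ｝} {z} (∪⁺ˡ {｛ x ｝} {｛ w ｝} {z} t) ; (inj₂ t) → ∪⁺ʳ {V} {｛ x₂ ｝} {z} t } }))

        S₃-card : card S₃ ≡ card (X₂ ∪ ｛ x₃ ｝)
        S₃-card = trans (card-∪｛｝ {V} {x₂} (λ p → case ∪⁻ {｛ x ｝} {｛ w ｝} {x₂} p of λ
                            { (inj₁ q) → x≢x₂ (｛｝⁻ {x} {x₂} q) ; (inj₂ q) → diff {x₂} {w} px₂ pw (sym (｛｝⁻ {w} {x₂} q)) }))
          (trans (cong suc (trans (card-pair {x} {w} (diff {x} {w} px pw)) (sym (card-pair {x} {x₂} x≢x₂))))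
            (sym (card-∪｛｝ {X₂} {x₃} (proj₂ (proj₂ x₃-ex)))))

        bound : ∂w + 2 ≤ dim b
        bound = +-cancelˡ-≤ (card (∂ X₂)) _ _ (begin
          card (∂ X₂) + (∂w + 2)             ≡⟨ sym (+-assoc (card (∂ X₂)) _ _) ⟩
          card (∂ X₂) + ∂w + 2               ≤⟨ +-monoˡ-≤ 2 (≤-trans split (minimal₁ {X₂ ∪ ｛ x₃ ｝} {S₃}
                                                  (∪-hom {1} {X₂} {｛ x₃ ｝} (part-hom {b} {1} {X₂} X₂⊆) (single-hom {x₃} (part-rk {b} {1} {x₃} px₃)))
                                                  (∪-hom {1} {V} {｛ x₂ ｝} (∪-hom {1} {｛ x ｝} {｛ w ｝} (single-hom {x} rx) (single-hom {w} rw)) (single-hom {x₂} rx₂))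
                                                  S₃-closed S₃-card)) ⟩
          card (∂ (X₂ ∪ ｛ x₃ ｝)) + 2       ≡⟨ cong (card (∂ (X₂ ∪ ｛ x₃ ｝)) +_) (sym (card-pair {x} {x₂} x≢x₂)) ⟩
          card (∂ (X₂ ∪ ｛ x₃ ｝)) + card X₂ ≤⟨ ∂-grow {X₂} {x₃} {b} X₂⊆ px₃ ⟩
          card (∂ X₂) + dim b                ∎)
          where open ℕₚ.≤-Reasoning

    late-start : ∀ c → dim c ≡ 2 × ∃ λ y → part c 1 ∋ y × Two y
    late-start c = case c Boolₚ.≟ b of λ
      { (yes e) → subst (λ c → dim c ≡ 2 × ∃ λ y → part c 1 ∋ y × Two y) (sym e) (dim-2 , x , px , two-x)
      ; (no c≢b) → subst (λ c → dim c ≡ 2 × ∃ λ y → part c 1 ∋ y × Two y) (sym (Boolₚ.¬-not c≢b))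
                     (trans dim-other (trans (sym dim-b) dim-2) , w , pw , two-w) }
      where
      dim-2 : dim b ≡ 2
      dim-2 = ≤-antisym (≮⇒≥ no-third) two-b

module Shorter {W : Po} (T : TwoSided W) (3≤r : 3 ≤ TwoSided.r T) (O O′ : Ordering W (TwoSidedMacaulay.Good T 3≤r)) where
  open Po W
  open Subsets W
  open TwoSided T
  open TwoSidedMacaulay T 3≤r
  private
    module O = Ordering O
    module O′ = Ordering O′
    module A = AtomOrder T 3≤r O
    module A′ = AtomOrder T 3≤r O′
    module S = Segments O._≼_ O.total O.≼-trans
    module S′ = Segments O′._≼_ O′.total O′.≼-trans

  module _ {b} (lead : Closed O._≼_ (part b 1)) (lead′ : Closed O′._≼_ (part (not b) 1)) (short : dim b < dim (not b)) where
    private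
      part-hom₁ : ∀ {c} → Hom 1 (part c 1)
      part-hom₁ {c} {x} = part-rk {c} {1} {x}

      top : ∃ λ y → part (not b) 1 ∋ y × (∀ {z} → part (not b) 1 ∋ z → z O.≼ y)
      top = S.maximum {λ z → part (not b) 1 ∋ z} (part (not b) 1 ∋?_) (inhabited (≤-trans (s≤s z≤n) 3≤r) (not b))

      y : X
      y = proj₁ top
      py : part (not b) 1 ∋ y
      py = proj₁ (proj₂ top)
      ry : rk y ≡ 1
      ry = part-rk {not b} {1} {y} py

      S₁ : Subset
      S₁ = part b 1 ∪ ｛ y ｝

      S₁-closed : Closed O._≼_ S₁
      S₁-closed = A.closed-∪｛｝ {part b 1} {y} ry lead λ {u} ru y≼u → case side u Boolₚ.≟ b of λ
        { (yes p) → ∪⁺ˡ {part b 1} {｛ y ｝} {u} (part⁺ {b} {1} {u} ru p)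
        ; (no ¬p) → ∪⁺ʳ {part b 1} {｛ y ｝} {u} (A.｛｝-≡ {y} {u} (A.antisym₁ ry ru y≼u
                      (proj₂ (proj₂ top) {u} (part⁺ {not b} {1} {u} ru (other {u} ¬p))))) }

      seg : ∃ λ B → Hom 1 B × Closed O′._≼_ B × card B ≡ dim b
      seg = S′.segment {1} (O′.antisym good₁) (dim b) (card-mono {part b 1} {lvl 1} (hom⇒⊆lvl {1} {part b 1} part-hom₁))

      B : Subset
      B = proj₁ seg
      hB : Hom 1 B
      hB = proj₁ (proj₂ seg)
      cardB : card B ≡ dim b
      cardB = proj₂ (proj₂ (proj₂ seg))

      B⊆ : B ⊆ part (not b) 1
      B⊆ = S′.nested {1} {B} {part (not b) 1} hB part-hom₁ (proj₁ (proj₂ (proj₂ seg))) lead′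
             (≤-trans (≤-reflexive cardB) (<⇒≤ short))

      ∂B≤ : card (∂ B) ≤ card (∂ (part b 1))
      ∂B≤ = A′.minimal₁ {part b 1} {B} part-hom₁ hB (proj₁ (proj₂ (proj₂ seg))) cardB

      extra : ∃ λ z → part (not b) 1 ∋ z × ¬ B ∋ z
      extra = card<⇒∃ {B} {part (not b) 1} (≤-<-trans (≤-reflexive cardB) short)
      z : X
      z = proj₁ extra
      pz : part (not b) 1 ∋ z
      pz = proj₁ (proj₂ extra)

      ∂y : ℕ
      ∂y = card (∂ ｛ y ｝)

      -- In the order `O′` the segment `B` as large as the shorter side lies in the longer one, with
      -- no larger shadow than that side. Adding one atom to each and comparing in the order `O`
      -- bounds the disjoint shadow of `y`. Since `dim (not b)` is at most `∂y` plus one, the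
      -- shorter side has a single atom.
      ∂y-bound : ∂y + dim b ≤ dim (not b)
      ∂y-bound = +-cancelˡ-≤ (card (∂ (part b 1))) _ _ (begin
        card (∂ (part b 1)) + (∂y + dim b)     ≡⟨ sym (+-assoc (card (∂ (part b 1))) _ _) ⟩
        card (∂ (part b 1)) + ∂y + dim b       ≤⟨ +-monoˡ-≤ (dim b) (∂-disjoint {b} {part b 1} {｛ y ｝} id (｛｝⊆ {part (not b) 1} {y} py)) ⟩
        card (∂ S₁) + dim b                    ≤⟨ +-mono-≤ (A.minimal₁ {B ∪ ｛ z ｝} {S₁}
                                                    (∪-hom {1} {B} {｛ z ｝} hB (λ {u} t → trans (｛｝-hom {z} {u} t) (part-rk {not b} {1} {z} pz)))
                                                    (∪-hom {1} {part b 1} {｛ y ｝} part-hom₁ (λ {u} t → trans (｛｝-hom {y} {u} t) ry)) S₁-closed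
                                                    (trans (card-∪｛｝ {part b 1} {y} (λ q → apart {y} {y} {b} (part-side {b} {1} {y} q) (part-side {not b} {1} {y} py) refl))
                                                      (trans (cong suc (sym cardB)) (sym (card-∪｛｝ {B} {z} (proj₂ (proj₂ extra)))))))
                                                    (≤-reflexive (sym cardB)) ⟩
        card (∂ (B ∪ ｛ z ｝)) + card B        ≤⟨ ∂-grow {B} {z} {not b} B⊆ pz ⟩
        card (∂ B) + dim (not b)               ≤⟨ +-monoˡ-≤ (dim (not b)) ∂B≤ ⟩
        card (∂ (part b 1)) + dim (not b)      ∎)
        where open ℕₚ.≤-Reasoning

      member : ∃ (part b 1 ∋_)
      member = inhabited (≤-trans (s≤s z≤n) 3≤r) b

      dim-1 : dim b ≡ 1
      dim-1 = ≤-antisym (+-cancelˡ-≤ ∂y _ _ (≤-trans ∂y-bound (≤-trans (dim≤ {y} {not b} py) (≤-reflexive (+-comm 1 ∂y)))))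
                (card>0 {part b 1} {proj₁ member} (proj₂ member))

      suc-∂y≤ : suc ∂y ≤ dim (not b)
      suc-∂y≤ = ≤-trans (≤-reflexive (trans (+-comm 1 ∂y) (cong (∂y +_) (sym dim-1)))) ∂y-bound

      two-y : Two y
      two-y = case Two? y of λ
        { (yes t) → t ; (no ¬t) → contradiction (≤-trans suc-∂y≤ (dim≤-long {y} {not b} py ¬t)) ℕₚ.1+n≰n }

      p : X
      p = proj₁ member

      only : part b 1 ⊆ ｛ p ｝
      only = ⊆∧≥⇒⊇ {｛ p ｝} {part b 1} (｛｝⊆ {part b 1} {p} (proj₂ member)) (≤-reflexive (trans dim-1 (sym (card-｛｝ {p}))))

      ∂-part≤1 : card (∂ (part b 1)) ≤ 1
      ∂-part≤1 = ≤-trans (card-mono {∂ (part b 1)} {∂ ｛ p ｝} (∂-mono {part b 1} {｛ p ｝} only))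
                   (≤-trans (∂｛｝≤dim {p} {b} (proj₂ member)) (≤-reflexive dim-1))

      q-ex : ∃ (B ∋_)
      q-ex = card>0⇒∃ {B} (≤-reflexive (sym (trans cardB dim-1)))

      dim-2 : dim (not b) ≡ 2
      dim-2 = ≤-antisym (≤-trans (dim≤ {proj₁ q-ex} {not b} (B⊆ {proj₁ q-ex} (proj₂ q-ex)))
          (s≤s (≤-trans (card-mono {∂ ｛ proj₁ q-ex ｝} {∂ B} (∂-mono {｛ proj₁ q-ex ｝} {B} (｛｝⊆ {B} {proj₁ q-ex} (proj₂ q-ex)))) (≤-trans ∂B≤ ∂-part≤1))))
        (≤-trans (≤-reflexive (cong suc (sym dim-1))) short)

    shorter : Outcome T
    shorter = path b {y} dim-1 dim-2 py two-y

  module _ {b} (lead : Closed O._≼_ (part b 1)) (lead′ : Closed O′._≼_ (part (not b) 1)) (same : dim b ≡ dim (not b)) where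

    private
      equal-step : ∀ {e} → suc (suc e) < r → card (part b (suc e)) ≡ card (part (not b) (suc e)) →
                   card (part b (suc (suc e))) ≡ card (part (not b) (suc (suc e)))
      equal-step {e} l previous = ≤-antisym (A.Leading.counts-≤ {b} lead (s≤s z≤n) l previous)
        (≤-trans (A′.Leading.counts-≤ {not b} lead′ (s≤s z≤n) l (trans (sym previous) (cong (λ c → card (part c (suc e))) (sym (Boolₚ.not-involutive b)))))
          (≤-reflexive (cong (λ c → card (part c (suc (suc e)))) (Boolₚ.not-involutive b))))

    -- Each of the two orders bounds the next level of the side that it puts first by that of the
    -- other. They put different sides first, so the bounds meet.
    equal-counts : ∀ {e} → 1 ≤ e → e < r → card (part b e) ≡ card (part (not b) e)
    equal-counts {suc zero}    _ _ = same
    equal-counts {suc (suc e)} _ l = equal-step l (equal-counts {suc e} (s≤s z≤n) (<-trans (n<1+n _) l))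

module Outcomes {W : Po} (T : TwoSided W) (3≤r : 3 ≤ TwoSided.r T) (O : Ordering W (TwoSidedMacaulay.Good T 3≤r)) where
  open Po W
  open Subsets W
  open TwoSided T
  open TwoSidedMacaulay T 3≤r
  open Ordering O
  private
    O′ : Ordering W Good
    O′ = Dual.dual O
    module A = AtomOrder T 3≤r O
    module A′ = AtomOrder T 3≤r O′
    module L = LateStart T 3≤r O

    not² : ∀ {b e} {x} → part b e ∋ x → part (not (not b)) e ∋ x
    not² {b} {e} {x} = subst (λ c → part c e ∋ x) (sym (Boolₚ.not-involutive b))

    not²⁻ : ∀ {b e} {x} → part (not (not b)) e ∋ x → part b e ∋ x
    not²⁻ {b} {e} {x} = subst (λ c → part c e ∋ x) (Boolₚ.not-involutive b)

    dominated : ∀ {w b} → A′.First w → part b 1 ∋ w → ∀ {y y′} → part b 1 ∋ y → part (not b) 1 ∋ y′ → y ≼ y′ ⊎ (Two w × y ≡ w)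
    dominated {w} {b} f pw {y} {y′} py py′ = Sum.map₁ (subst₂ _≼_ (comp² y) (comp² y′)) (A′.first-dominates {w} {b} f pw {y} {y′} py py′)

    leads : ∀ {b} → Closed _≼_ (part b 1) → Closed (Ordering._≼_ O′) (part (not b) 1) → Outcome T
    leads {b} lead lead′ with ℕₚ.<-cmp (dim b) (dim (not b))
    ... | tri< l _ _ = Shorter.shorter T 3≤r O O′ {b} lead lead′ l
    ... | tri> _ _ l = Shorter.shorter T 3≤r O′ O {not b} lead′ (λ {x} {y} p q s → not² {b} {1} {y} (lead {x} {y} (not²⁻ {b} {1} {x} p) q s))
                         (<-≤-trans l (≤-reflexive (cong dim (sym (Boolₚ.not-involutive b)))))
    ... | tri≈ _ e _ = same-counts λ {k} p q → counts b (Shorter.equal-counts T 3≤r O O′ {b} lead lead′ e {k} p q)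
      where
      counts : ∀ b {k} → card (part b k) ≡ card (part (not b) k) → card (part false k) ≡ card (part true k)
      counts false e = e
      counts true  e = sym e

    -- `first-dominates` would push `w` behind the other side in the dual order, although it is
    -- first there. The only escape is `w = x` with vanishing square, and `second-other` applies.
    same-side : ∀ {b x w} → A.First x → A′.First w → part b 1 ∋ x → part b 1 ∋ w → Outcome T
    same-side {b} {x} {w} f g px pw = case A.first-dominates {x} {b} f px {w} {proj₁ o} pw (proj₂ o) of λ
      { (inj₁ q) → contradiction (A′.antisym₁ (part-rk {b} {1} {w} pw) (part-rk {not b} {1} {proj₁ o} (proj₂ o)) q (proj₂ g (part-rk {not b} {1} {proj₁ o} (proj₂ o))))
                     (apart {w} {proj₁ o} {b} (part-side {b} {1} {w} pw) (part-side {not b} {1} {proj₁ o} (proj₂ o)))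
      ; (inj₂ (two-x , w≡x)) → case A.second-other {b} {x} f px
            (λ {y} {y′} py py′ → Sum.map₂ (λ t → trans (proj₂ t) w≡x) (dominated {w} {b} g pw {y} {y′} py py′)) two-x of λ
          { (inj₁ (e , e′)) → path (not b) {x} e′ (trans (cong dim (Boolₚ.not-involutive b)) e) (not² {b} {1} {x} px) two-x
          ; (inj₂ h) → twos h } }
      where
      o : ∃ λ a → part (not b) 1 ∋ a
      o = inhabited (≤-trans (s≤s z≤n) 3≤r) (not b)

    -- By duality all atoms beside `w`, except possibly `w`, come after those of side `b`. If `w`
    -- precedes some atom of side `b`, this is a late start; otherwise side `b` leads, and its
    -- opposite leads in the dual order.
    opposite : ∀ {b x w} → A.First x → A′.First w → part b 1 ∋ x → part (not b) 1 ∋ w → Outcome T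
    opposite {b} {x} {w} f g px pw = case ∃? (λ u → (part b 1 ∋? u) ×-dec (L.below-of w ∋? u)) of λ
      { (yes (y′ , py′ , q)) → case D {w} {y′} pw py′ of λ
          { (inj₁ w≼y′) → contradiction (A.antisym₁ (part-rk {not b} {1} {w} pw) (part-rk {b} {1} {y′} py′) w≼y′ (L.below-of⁻ {w} {y′} q))
              (λ e → apart {y′} {w} {b} (part-side {b} {1} {y′} py′) (part-side {not b} {1} {w} pw) (sym e))
          ; (inj₂ (two-w , _)) → twos (L.late-start {b} {x} {w} f px pw two-w (λ {y} {y″} p p′ → Sum.map₂ proj₂ (D {y} {y″} p p′)) {y′} py′ (L.below-of⁻ {w} {y′} q)) }
      ; (no none) → let lead = A.leading⁺ {b} (λ {y} {y′} py py′ → case D {y′} {y} py′ py of λ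
                            { (inj₁ p) → p
                            ; (inj₂ (_ , e)) → subst (_≼ y) (sym e) (L.below-of-¬ {w} {y} λ q → none (y , py , q)) }) in
          leads {b} lead (A′.leading⁺ {not b} λ {y} {y′} py py′ → A.Leading.leading-dual {b} lead {y′} {y} (not²⁻ {b} {1} {y′} py′) py) }
      where
      D : ∀ {y y′} → part (not b) 1 ∋ y → part b 1 ∋ y′ → y ≼ y′ ⊎ (Two w × y ≡ w)
      D {y} {y′} py py′ = dominated {w} {not b} g pw {y} {y′} py (not² {b} {1} {y′} py′)

  outcome : Outcome T
  outcome = go A.first A′.first
    where
    go : ∃ A.First → ∃ A′.First → Outcome T
    go (x , f) (w , g) = case side w Boolₚ.≟ side x of λ
      { (yes e) → same-side {side x} f g (part⁺ {side x} {1} {x} (proj₁ f) refl) (part⁺ {side x} {1} {w} (proj₁ g) e)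
      ; (no n)  → opposite {side x} f g (part⁺ {side x} {1} {x} (proj₁ f) refl) (part⁺ {not (side x)} {1} {w} (proj₁ g) (other {w} n)) }


-- Boxes as one-sided and paired as two-sided posets

module _ where
  private variable n : ℕ

  infixl 6 _+ᵛ_ _∸ᵛ_
  _+ᵛ_ _∸ᵛ_ : Vec ℕ n → Vec ℕ n → Vec ℕ n
  _+ᵛ_ = Vec.zipWith _+_
  _∸ᵛ_ = Vec.zipWith _∸_

  co : Vec ℕ n → Vec ℕ n → Vec ℕ n
  co d a = Vec.map pred d ∸ᵛ a

  co-< : ∀ {a d : Vec ℕ n} → Pointwise _<_ a d → Pointwise _<_ (co d a) d
  co-< []                       = []
  co-< {a = x ∷ _} (s≤s p ∷ u) = s≤s (ℕₚ.m∸n≤m _ x) ∷ co-< u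

  co-involutive : ∀ {a d : Vec ℕ n} → Pointwise _<_ a d → co d (co d a) ≡ a
  co-involutive []          = refl
  co-involutive (s≤s p ∷ u) = cong₂ _∷_ (ℕₚ.m∸[m∸n]≡n p) (co-involutive u)

  interchange : ∀ a b c d → (a + b) + (c + d) ≡ (a + c) + (b + d)
  interchange a b c d = trans (+-assoc a b _) (trans (cong (a +_) (trans (sym (+-assoc b c d))
    (trans (cong (_+ d) (+-comm b c)) (+-assoc c b d)))) (sym (+-assoc a c _)))

  ∸ᵛ-sum : ∀ {a b : Vec ℕ n} → Pointwise _≤_ a b → Vec.sum (b ∸ᵛ a) + Vec.sum a ≡ Vec.sum b
  ∸ᵛ-sum []                               = refl
  ∸ᵛ-sum {a = x ∷ a} {y ∷ b} (p ∷ u) = trans (interchange (y ∸ x) (Vec.sum (b ∸ᵛ a)) x (Vec.sum a)) (cong₂ _+_ (m∸n+n≡m p) (∸ᵛ-sum u))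

  co-antitone : ∀ {a b d : Vec ℕ n} → Pointwise _≤_ a b → Pointwise _≤_ (co d b) (co d a)
  co-antitone {d = []}    []      = []
  co-antitone {d = m ∷ d} (p ∷ u) = ℕₚ.∸-monoʳ-≤ (pred m) p ∷ co-antitone u

  ∸ᵛ-≤ : ∀ (a b : Vec ℕ n) → Pointwise _≤_ (b ∸ᵛ a) b
  ∸ᵛ-≤ []      []      = []
  ∸ᵛ-≤ (x ∷ a) (y ∷ b) = ℕₚ.m∸n≤m y x ∷ ∸ᵛ-≤ a b

  +ᵛ-∸ᵛ : ∀ {a b : Vec ℕ n} → Pointwise _≤_ a b → a +ᵛ (b ∸ᵛ a) ≡ b
  +ᵛ-∸ᵛ []      = refl
  +ᵛ-∸ᵛ (p ∷ u) = cong₂ _∷_ (m+[n∸m]≡n p) (+ᵛ-∸ᵛ u)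

  +ᵛ-sum : ∀ (a b : Vec ℕ n) → Vec.sum (a +ᵛ b) ≡ Vec.sum a + Vec.sum b
  +ᵛ-sum []      []      = refl
  +ᵛ-sum (x ∷ a) (y ∷ b) = trans (cong (x + y +_) (+ᵛ-sum a b)) (interchange x y (Vec.sum a) (Vec.sum b))

  +ᵛ-≤ : ∀ (a b : Vec ℕ n) → Pointwise _≤_ a (a +ᵛ b)
  +ᵛ-≤ []      []      = []
  +ᵛ-≤ (x ∷ a) (y ∷ b) = m≤m+n x y ∷ +ᵛ-≤ a b

  +ᵛ-injective : ∀ (a : Vec ℕ n) {b c} → a +ᵛ b ≡ a +ᵛ c → b ≡ c
  +ᵛ-injective []      {[]}    {[]}    _ = refl
  +ᵛ-injective (x ∷ a) {y ∷ b} {z ∷ c} e = cong₂ _∷_ (+-cancelˡ-≡ x y z (Vecₚ.∷-injectiveˡ e)) (+ᵛ-injective a (Vecₚ.∷-injectiveʳ e))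

  +ᵛ<⇒≤co : ∀ {a b d : Vec ℕ n} → Pointwise _<_ (a +ᵛ b) d → Pointwise _≤_ a (co d b)
  +ᵛ<⇒≤co {a = []}    {[]}    []          = []
  +ᵛ<⇒≤co {a = x ∷ a} {y ∷ b} (s≤s p ∷ u) = ℕₚ.m+n≤o⇒m≤o∸n x p ∷ +ᵛ<⇒≤co u

  +ᵛ-zeroʳ : ∀ {a b : Vec ℕ n} → Vec.sum b ≡ 0 → a +ᵛ b ≡ a
  +ᵛ-zeroʳ {a = []}    {[]}        _ = refl
  +ᵛ-zeroʳ {a = x ∷ a} {zero ∷ b} e = cong₂ _∷_ (+-identityʳ x) (+ᵛ-zeroʳ e)

  +ᵛ-zeroˡ : ∀ {a b : Vec ℕ n} → Vec.sum a ≡ 0 → a +ᵛ b ≡ b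
  +ᵛ-zeroˡ {a = []}       {[]}    _ = refl
  +ᵛ-zeroˡ {a = zero ∷ a} {y ∷ b} e = cong (y ∷_) (+ᵛ-zeroˡ e)

  zero-unique : ∀ {a b : Vec ℕ n} → Vec.sum a ≡ 0 → Vec.sum b ≡ 0 → a ≡ b
  zero-unique {a = a} {b} p q = trans (sum≡0⇒zeros a p) (sym (sum≡0⇒zeros b q))

  atoms-add : ∀ {a b d : Vec ℕ n} → Vec.sum a ≡ 1 → Vec.sum b ≡ 1 → a ≢ b → Pointwise _<_ a d → Pointwise _<_ b d → Pointwise _<_ (a +ᵛ b) d
  atoms-add {a = zero ∷ a} {zero ∷ b} p q n (l ∷ u) (_ ∷ v) = l ∷ atoms-add p q (n ∘ cong (0 ∷_)) u v
  atoms-add {a = zero ∷ a} {suc y ∷ b} {_ ∷ d} p q n (_ ∷ u) (l ∷ v) =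
    l ∷ subst (λ z → Pointwise _<_ z d) (sym (+ᵛ-zeroʳ (ℕₚ.m+n≡0⇒n≡0 y (suc-injective q)))) u
  atoms-add {a = suc x ∷ a} {zero ∷ b} {m ∷ d} p q n (l ∷ u) (_ ∷ v) =
    subst (_< m) (sym (+-identityʳ (suc x))) l ∷ subst (λ z → Pointwise _<_ z d) (sym (+ᵛ-zeroˡ (ℕₚ.m+n≡0⇒n≡0 x (suc-injective p)))) v
  atoms-add {a = suc x ∷ a} {suc y ∷ b} p q n _ _ = contradiction
    (cong₂ _∷_ (cong suc (trans (ℕₚ.m+n≡0⇒m≡0 x (suc-injective p)) (sym (ℕₚ.m+n≡0⇒m≡0 y (suc-injective q)))))
      (zero-unique (ℕₚ.m+n≡0⇒n≡0 x (suc-injective p)) (ℕₚ.m+n≡0⇒n≡0 y (suc-injective q)))) n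

  atom-≤ : ∀ (a : Vec ℕ n) → 1 ≤ Vec.sum a → ∃ λ (x : Vec ℕ n) → Vec.sum x ≡ 1 × Pointwise _≤_ x a
  atom-≤ {suc n} (zero ∷ a) l with atom-≤ a l
  ... | x , r , p = 0 ∷ x , r , z≤n ∷ p
  atom-≤ {suc n} (suc y ∷ a) _ = 1 ∷ Vec.replicate n 0 , cong suc (sum-zeros n) , s≤s z≤n ∷ zeros-≤ a

  double-atom : ∀ {a d : Vec ℕ n} → Vec.sum a ≡ 1 → Pointwise _<_ a d → ¬ Pointwise _<_ (a +ᵛ a) d → 2 ∈ sides d
  double-atom {a = zero ∷ a} {suc zero    ∷ d} p (l ∷ u) n = double-atom p u (λ v → n (l ∷ v))
  double-atom {a = zero ∷ a} {suc (suc m) ∷ d} p (l ∷ u) n = there (double-atom p u (λ v → n (l ∷ v)))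
  double-atom {a = suc x ∷ a} {suc zero ∷ d} p (s≤s () ∷ u) n
  double-atom {a = suc x ∷ a} {suc (suc zero) ∷ d} p (l ∷ u) n = here refl
  double-atom {a = suc x ∷ a} {suc (suc (suc m)) ∷ d} p (l ∷ u) n = contradiction
    (subst (λ z → suc z + suc z < suc (suc (suc m))) (sym (ℕₚ.m+n≡0⇒m≡0 x (suc-injective p))) (s≤s (s≤s (s≤s z≤n)))
       ∷ subst (λ z → Pointwise _<_ z d) (sym (+ᵛ-zeroʳ (ℕₚ.m+n≡0⇒n≡0 x (suc-injective p)))) u) n

record OneSided (r : ℕ) (P : Po) : Set₁ where
  open Po P
  open Subsets P
  field
    ⊑-trans : ∀ {x y z} → x ⊑ y → y ⊑ z → x ⊑ z
    below   : ∀ {x y} → x ⊑ y → rk x < rk y → ∃ λ z → x ⊑ z × z ⋖ y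
    comp    : X → X
    comp²   : ∀ x → comp (comp x) ≡ x
    comp-rk : ∀ x → rk (comp x) + rk x ≡ r
    comp-⊑  : ∀ {x y} → x ⊑ y → comp y ⊑ comp x
    above   : ∀ {x} → rk x < r → ∃ (x ⋖_)
    atom-below : ∀ {x} → 1 ≤ rk x → ∃ λ a → rk a ≡ 1 × a ⊑ x
    inhabited  : 1 ≤ r → ∃ λ a → rk a ≡ 1
    Two        : X → Set
    Two?       : U.Decidable Two
    dim≤       : ∀ {x} → rk x ≡ 1 → card (lvl 1) ≤ suc (card (∂ ｛ x ｝))
    dim≤-long  : ∀ {x} → rk x ≡ 1 → ¬ Two x → card (lvl 1) ≤ card (∂ ｛ x ｝)
    dim>-two   : ∀ {x} → rk x ≡ 1 → Two x → suc (card (∂ ｛ x ｝)) ≤ card (lvl 1)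
    ∂-grow     : ∀ {A x} → Hom 1 A → rk x ≡ 1 → card (∂ (A ∪ ｛ x ｝)) + card A ≤ card (∂ A) + card (lvl 1)
    coatom     : ∀ {x c} → rk x ≡ 1 → suc (rk c) ≡ r → x ⊑ c ⊎ (Two x × c ≡ comp x)

box-oneSided : ∀ {n} {d : Vec ℕ n} (d⁺ : Positive d) → OneSided (height (CL d d⁺)) (boxPo d)
box-oneSided {n} {d} d⁺ = record
  { ⊑-trans = PW.trans ≤-trans
  ; below = λ {x} {y} → box-below {a = x} {y}
  ; comp = comp
  ; comp² = comp²
  ; comp-rk = comp-rk
  ; comp-⊑ = λ {x} {y} → co-antitone {a = proj₁ x} {proj₁ y}
  ; above = λ {x} l → above x l
  ; atom-below = λ {x} → atom-below x
  ; inhabited = λ l → let a , p , _ = atom-below (proj₁ (greatest d⁺)) (≤-trans l (≤-reflexive (sym top-rk))) in a , p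
  ; Two = λ x → ¬ fits x x
  ; Two? = λ x → ¬? (fits? x x)
  ; dim≤ = λ {x} → dim≤ x
  ; dim≤-long = λ {x} r t → dim≤-long x r (Dec.decidable-stable (fits? x x) t)
  ; dim>-two = λ {x} → dim>-two x
  ; ∂-grow = λ {A} {x} → ∂-grow A x
  ; coatom = λ {x} {c} → coatom x c
  }
  where
  open Po (boxPo d)
  open Subsets (boxPo d)

  top-rk : Vec.sum (Vec.map pred d) ≡ height (CL d d⁺)
  top-rk = rank-greatest (CL d d⁺) (greatest d⁺)

  comp : Box d → Box d
  comp (a , p) = co d a , co-< p

  comp² : ∀ x → comp (comp x) ≡ x
  comp² (a , p) = box-≡ (co-involutive p)

  comp-rk : ∀ x → rk (comp x) + rk x ≡ height (CL d d⁺)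
  comp-rk x = trans (∸ᵛ-sum (proj₂ (greatest d⁺) x)) top-rk

  above : ∀ x → rk x < height (CL d d⁺) → ∃ (x ⋖_)
  above x l with step (proj₂ (greatest d⁺) x) (λ e → <⇒≢ l (trans (cong Vec.sum e) top-rk)) (proj₂ (proj₁ (greatest d⁺)))
  ... | c , x≤c , _ , c<d , e = (c , c<d) , x≤c , e

  atom-below : ∀ x → 1 ≤ rk x → ∃ λ a → rk a ≡ 1 × a ⊑ x
  atom-below (a , p) l with atom-≤ a l
  ... | x , r , q = (x , PW.trans ≤-<-trans q p) , r , q

  -- The product of the two monomials is nonzero.
  fits : Box d → Box d → Set
  fits x y = Pointwise _<_ (proj₁ x +ᵛ proj₁ y) d

  fits? : ∀ x y → Dec (fits x y)
  fits? x y = PW.decidable ℕₚ._<?_ _ _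

  distinct-fit : ∀ {x y} → rk x ≡ 1 → rk y ≡ 1 → x ≢ y → fits x y
  distinct-fit {x} {y} p q ne = atoms-add p q (λ e → ne (box-≡ e)) (proj₂ x) (proj₂ y)

  -- The value `y` is a default for a vanishing product.
  plus : Box d → Box d → Box d
  plus x y with fits? x y
  ... | yes p = proj₁ x +ᵛ proj₁ y , p
  ... | no _  = y

  plus-≡ : ∀ {x y} → fits x y → proj₁ (plus x y) ≡ proj₁ x +ᵛ proj₁ y
  plus-≡ {x} {y} f with fits? x y
  ... | yes _ = refl
  ... | no ¬f = contradiction f ¬f

  plus-⋖ : ∀ {x y} → rk y ≡ 1 → fits x y → x ⋖ plus x y
  plus-⋖ {x} {y} r f = subst (Pointwise _≤_ (proj₁ x)) (sym (plus-≡ {x} {y} f)) (+ᵛ-≤ (proj₁ x) (proj₁ y)) ,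
    trans (cong Vec.sum (plus-≡ {x} {y} f)) (trans (+ᵛ-sum (proj₁ x) (proj₁ y)) (trans (cong (rk x +_) r) (+-comm (rk x) 1)))

  plus-injective : ∀ {x y z} → fits x y → fits x z → plus x y ≡ plus x z → y ≡ z
  plus-injective {x} {y} {z} f g e = box-≡ (+ᵛ-injective (proj₁ x) (trans (sym (plus-≡ {x} {y} f)) (trans (cong proj₁ e) (plus-≡ {x} {z} g))))

  minus : Box d → Box d → Box d
  minus x (v , p) = v ∸ᵛ proj₁ x , PW.trans ≤-<-trans (∸ᵛ-≤ (proj₁ x) v) p

  minus-rk : ∀ {x v} → x ⋖ v → rk (minus x v) ≡ 1
  minus-rk {x} {v} (p , q) = +-cancelʳ-≡ (rk x) _ _ (trans (∸ᵛ-sum p) q)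

  minus-⋖ : ∀ {x v} → rk x ≡ 1 → x ⋖ v → minus x v ⋖ v
  minus-⋖ {x} {v} r c = ∸ᵛ-≤ (proj₁ x) (proj₁ v) , trans (proj₂ c) (cong suc (trans r (sym (minus-rk {x} {v} c))))

  minus-injective : ∀ {x u v} → x ⋖ u → x ⋖ v → minus x u ≡ minus x v → u ≡ v
  minus-injective {x} p q e = box-≡ (trans (sym (+ᵛ-∸ᵛ (proj₁ p))) (trans (cong (λ z → proj₁ x +ᵛ proj₁ z) e) (+ᵛ-∸ᵛ (proj₁ q))))

  of-｛｝ : ∀ {x v} → ∂ ｛ x ｝ ∋ v → x ⋖ v
  of-｛｝ {x} {v} p = let y , q , c = ∂⁻ {｛ x ｝} {v} p in subst (_⋖ v) (sym (｛｝⁻ {x} {y} q)) c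

  others : Box d → Subset
  others x = lvl 1 ∖ ｛ x ｝

  card-others : ∀ x → rk x ≡ 1 → suc (card (others x)) ≡ card (lvl 1)
  card-others x r = trans (+-comm 1 _) (trans (cong (card (others x) +_) (sym (card-｛｝ {x})))
    (card-∖ {lvl 1} {｛ x ｝} λ {y} p → lvl⁺ {1} {y} (trans (cong rk (sym (｛｝⁻ {x} {y} p))) r)))

  other-fits : ∀ x → rk x ≡ 1 → ∀ {y} → others x ∋ y → rk y ≡ 1 × fits x y
  other-fits x r {y} p = let l , n = ∖⁻ {lvl 1} {｛ x ｝} {y} p ; ry = lvl-hom {1} {y} l in
    ry , distinct-fit {x} {y} r ry (λ e → n (subst (λ z → ｛ x ｝ z ≡ true) e (｛｝⁺ {x})))

  dim≤ : ∀ x → rk x ≡ 1 → card (lvl 1) ≤ suc (card (∂ ｛ x ｝))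
  dim≤ x r = ≤-trans (≤-reflexive (sym (card-others x r))) (s≤s (card-inj (boxPo d) (boxPo d) (plus x) {others x} {∂ ｛ x ｝}
    (λ {y} p → let ry , f = other-fits x r {y} p in ∂⁺ {｛ x ｝} {x} {plus x y} (｛｝⁺ {x}) (plus-⋖ {x} {y} ry f))
    λ {y} {z} p q → plus-injective {x} {y} {z} (proj₂ (other-fits x r {y} p)) (proj₂ (other-fits x r {z} q))))

  dim≤-long : ∀ x → rk x ≡ 1 → fits x x → card (lvl 1) ≤ card (∂ ｛ x ｝)
  dim≤-long x r f = card-inj (boxPo d) (boxPo d) (plus x) {lvl 1} {∂ ｛ x ｝}
    (λ {y} p → ∂⁺ {｛ x ｝} {x} {plus x y} (｛｝⁺ {x}) (plus-⋖ {x} {y} (lvl-hom {1} {y} p) (fit {y} p)))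
    λ {y} {z} p q → plus-injective {x} {y} {z} (fit {y} p) (fit {z} q)
    where
    fit : ∀ {y} → lvl 1 ∋ y → fits x y
    fit {y} p = case x ≟ y of λ { (yes e) → subst (fits x) e f ; (no n) → distinct-fit {x} {y} r (lvl-hom {1} {y} p) n }

  dim>-two : ∀ x → rk x ≡ 1 → ¬ fits x x → suc (card (∂ ｛ x ｝)) ≤ card (lvl 1)
  dim>-two x r t = ≤-trans (s≤s (card-inj (boxPo d) (boxPo d) (minus x) {∂ ｛ x ｝} {others x}
      (λ {v} p → ∖⁺ {lvl 1} {｛ x ｝} {minus x v} (lvl⁺ {1} {minus x v} (minus-rk {x} {v} (of-｛｝ {x} {v} p)))
        λ q → t (subst (λ z → Pointwise _<_ z d) (trans (sym (+ᵛ-∸ᵛ (proj₁ (of-｛｝ {x} {v} p))))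
                   (cong (λ z → proj₁ x +ᵛ proj₁ z) (sym (｛｝⁻ {x} {minus x v} q)))) (proj₂ v)))
      λ {u} {v} p q → minus-injective {x} {u} {v} (of-｛｝ {x} {u} p) (of-｛｝ {x} {v} q)))
    (≤-reflexive (card-others x r))

  -- A new cover of `x` is determined by the atom left after subtracting `x`. That atom is not in
  -- `A`, or the cover would already lie above it.
  ∂-grow : ∀ A x → Hom 1 A → rk x ≡ 1 → card (∂ (A ∪ ｛ x ｝)) + card A ≤ card (∂ A) + card (lvl 1)
  ∂-grow A x h r = begin
    card (∂ (A ∪ ｛ x ｝)) + card A                ≤⟨ +-monoˡ-≤ (card A) (≤-trans (card-mono {∂ (A ∪ ｛ x ｝)} {∂ A ∪ new} (λ {v} → cover {v})) (card-∪ {∂ A} {new})) ⟩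
    card (∂ A) + card new + card A                ≤⟨ +-monoˡ-≤ (card A) (+-monoʳ-≤ (card (∂ A)) (card-inj (boxPo d) (boxPo d) (minus x) {new} {lvl 1 ∖ A}
                                                       (λ {v} → into {v}) λ {u} {v} p q → minus-injective {x} {u} {v} (new-⋖ {u} p) (new-⋖ {v} q))) ⟩
    card (∂ A) + card (lvl 1 ∖ A) + card A        ≡⟨ +-assoc (card (∂ A)) _ _ ⟩
    card (∂ A) + (card (lvl 1 ∖ A) + card A)      ≡⟨ cong (card (∂ A) +_) (card-∖ {lvl 1} {A} (hom⇒⊆lvl {1} {A} h)) ⟩
    card (∂ A) + card (lvl 1)                     ∎
    where
    open ℕₚ.≤-Reasoning
    new : Subset
    new = ∂ ｛ x ｝ ∖ ∂ A
    new-⋖ : ∀ {v} → new ∋ v → x ⋖ v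
    new-⋖ {v} p = of-｛｝ {x} {v} (proj₁ (∖⁻ {∂ ｛ x ｝} {∂ A} {v} p))
    into : ∀ {v} → new ∋ v → (lvl 1 ∖ A) ∋ minus x v
    into {v} p = ∖⁺ {lvl 1} {A} {minus x v} (lvl⁺ {1} {minus x v} (minus-rk {x} {v} (new-⋖ {v} p)))
      λ a → proj₂ (∖⁻ {∂ ｛ x ｝} {∂ A} {v} p) (∂⁺ {A} {minus x v} {v} a (minus-⋖ {x} {v} r (new-⋖ {v} p)))
    cover : ∂ (A ∪ ｛ x ｝) ⊆ (∂ A ∪ new)
    cover {v} p = case ∂ A ∋? v of λ
      { (yes a) → ∪⁺ˡ {∂ A} {new} {v} a
      ; (no ¬a) → ∪⁺ʳ {∂ A} {new} {v} (∖⁺ {∂ ｛ x ｝} {∂ A} {v}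
          (let u , q , c = ∂⁻ {A ∪ ｛ x ｝} {v} p in case ∪⁻ {A} {｛ x ｝} {u} q of λ
             { (inj₁ a) → contradiction (∂⁺ {A} {u} {v} a c) ¬a ; (inj₂ t) → ∂⁺ {｛ x ｝} {u} {v} t c }) ¬a) }

  -- Divisibility of `c` by `x` means that `x` fits with the complement of `c`, which is an atom.
  -- Distinct atoms always fit, so only the equal case is left.
  coatom : ∀ x c → rk x ≡ 1 → suc (rk c) ≡ height (CL d d⁺) → x ⊑ c ⊎ (¬ fits x x × c ≡ comp x)
  coatom x c r s = case fits? x (comp c) of λ
    { (yes f) → inj₁ (subst (Pointwise _≤_ (proj₁ x)) (cong proj₁ (comp² c)) (+ᵛ<⇒≤co f))
    ; (no ¬f) → case x ≟ comp c of λ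
        { (no n)  → contradiction (distinct-fit {x} {comp c} r (+-cancelʳ-≡ (rk c) _ _ (trans (comp-rk c) (sym s))) n) ¬f
        ; (yes e) → inj₂ ((λ f → ¬f (subst (fits x) e f)) , trans (sym (comp² c)) (cong comp (sym e))) } }


module Pair {r : ℕ} {P Q : Po} (S₁ : OneSided r P) (S₂ : OneSided r Q) where
  open Po (P ⊎ᴾ Q)
  open Subsets (P ⊎ᴾ Q)
  open Halves P Q

  F : Bool → Po
  F false = P
  F true  = Q

  private
    module F b = Po (F b)
    module SF b = Subsets (F b)

    S : ∀ b → OneSided r (F b)
    S false = S₁
    S true  = S₂

    module S b = OneSided (S b)

    ι : ∀ b → F.X b → X
    ι false = inj₁
    ι true  = inj₂

    side : X → Bool
    side = [ (λ _ → false) , (λ _ → true) ]′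

    part′ : Bool → ℕ → Subset
    part′ b e = ⟦ (λ x → (rk x ℕₚ.≟ e) ×-dec (side x Boolₚ.≟ b)) ⟧

    rk-ι : ∀ b {x} → rk (ι b x) ≡ F.rk b x
    rk-ι false = refl
    rk-ι true  = refl

    side-ι : ∀ b {x} → side (ι b x) ≡ b
    side-ι false = refl
    side-ι true  = refl

    ι-injective : ∀ b {x y} → ι b x ≡ ι b y → x ≡ y
    ι-injective false = Sumₚ.inj₁-injective
    ι-injective true  = Sumₚ.inj₂-injective

    ⊑-ι : ∀ b {x y} → F._⊑_ b x y → ι b x ⊑ ι b y
    ⊑-ι false = inj₁
    ⊑-ι true  = inj₂

    preimage : ∀ {b} x → side x ≡ b → ∃ λ x′ → x ≡ ι b x′
    preimage (inj₁ x) refl = x , refl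
    preimage (inj₂ x) refl = x , refl

    view : ∀ {b e} x → part′ b e ∋ x → ∃ λ x′ → x ≡ ι b x′ × F.rk b x′ ≡ e
    view {b} {e} x p = let r , s = does⁻ ((rk x ℕₚ.≟ e) ×-dec (side x Boolₚ.≟ b)) p ; x′ , eq = preimage x s in
      x′ , eq , trans (sym (rk-ι b)) (trans (cong rk (sym eq)) r)

    part′⁺ : ∀ b e {x} → F.rk b x ≡ e → part′ b e ∋ ι b x
    part′⁺ b e {x} p = dec-true ((rk (ι b x) ℕₚ.≟ e) ×-dec (side (ι b x) Boolₚ.≟ b)) (trans (rk-ι b) p , side-ι b)

    card-ι : ∀ b {A} → (∀ {x} → A ∋ x → side x ≡ b) → card A ≡ SF.card b (A ∘ ι b)
    card-ι false {A} s = trans (card-⊎ A) (trans (cong (SF.card false (A ∘ inj₁) +_)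
      (SF.card-∅ true {A ∘ inj₂} λ {x} a → case s {inj₂ x} a of λ ())) (+-identityʳ _))
    card-ι true  {A} s = trans (card-⊎ A) (cong (_+ SF.card true (A ∘ inj₂)) (SF.card-∅ false {A ∘ inj₁} λ {x} a → case s {inj₁ x} a of λ ()))

    card-∂-ι : ∀ b {A} → (∀ {x} → A ∋ x → side x ≡ b) → card (∂ A) ≡ SF.card b (SF.∂ b (A ∘ ι b))
    card-∂-ι false {A} s = trans (card-∂-⊎ A) (trans (cong (SF.card false (SF.∂ false (A ∘ inj₁)) +_)
      (SF.card-∅ true {SF.∂ true (A ∘ inj₂)} λ {x} p → case SF.∂⁻ true {A ∘ inj₂} {x} p of λ { (y , a , _) → case s {inj₂ y} a of λ () })) (+-identityʳ _))
    card-∂-ι true  {A} s = trans (card-∂-⊎ A) (cong (_+ SF.card true (SF.∂ true (A ∘ inj₂)))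
      (SF.card-∅ false {SF.∂ false (A ∘ inj₁)} λ {x} p → case SF.∂⁻ false {A ∘ inj₁} {x} p of λ { (y , a , _) → case s {inj₁ y} a of λ () }))

    part′-side : ∀ b e {x} → part′ b e ∋ x → side x ≡ b
    part′-side b e {x} p = proj₂ (does⁻ ((rk x ℕₚ.≟ e) ×-dec (side x Boolₚ.≟ b)) p)

    ｛｝-to : ∀ b {x y} → SF.｛_｝ b x y ≡ true → ｛ ι b x ｝ ∋ ι b y
    ｛｝-to b {x} {y} p = subst (λ z → ｛ ι b x ｝ (ι b z) ≡ true) (SF.｛｝⁻ b {x} {y} p) (｛｝⁺ {ι b x})

    ｛｝-from : ∀ b {x y} → ｛ ι b x ｝ ∋ ι b y → SF.｛_｝ b x y ≡ true
    ｛｝-from b {x} {y} p = subst (λ z → SF.｛_｝ b x z ≡ true) (ι-injective b (｛｝⁻ {ι b x} {ι b y} p)) (SF.｛｝⁺ b {x})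

    ｛｝-side : ∀ b {x y} → ｛ ι b x ｝ ∋ y → side y ≡ b
    ｛｝-side b {x} {y} p = trans (cong side (sym (｛｝⁻ {ι b x} {y} p))) (side-ι b)

    card-∂｛｝ : ∀ b x → card (∂ ｛ ι b x ｝) ≡ SF.card b (SF.∂ b (SF.｛_｝ b x))
    card-∂｛｝ b x = trans (card-∂-ι b {｛ ι b x ｝} (λ {y} → ｛｝-side b {x} {y}))
      (SF.card-cong b {SF.∂ b (｛ ι b x ｝ ∘ ι b)} {SF.∂ b (SF.｛_｝ b x)}
        (SF.∂-mono b {｛ ι b x ｝ ∘ ι b} {SF.｛_｝ b x} (λ {y} → ｛｝-from b {x} {y}))
        (SF.∂-mono b {SF.｛_｝ b x} {｛ ι b x ｝ ∘ ι b} (λ {y} → ｛｝-to b {x} {y})))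

    Two′ : X → Set
    Two′ = [ S.Two false , S.Two true ]′

    Two-ι : ∀ b {x} → S.Two b x → Two′ (ι b x)
    Two-ι false t = t
    Two-ι true  t = t

    Two-ι⁻ : ∀ b {x} → Two′ (ι b x) → S.Two b x
    Two-ι⁻ false t = t
    Two-ι⁻ true  t = t

    comp′ : X → X
    comp′ = Sum.map (S.comp false) (S.comp true)

    comp-ι : ∀ b {x} → comp′ (ι b x) ≡ ι b (S.comp b x)
    comp-ι false = refl
    comp-ι true  = refl

  card-part : ∀ b e → card (part′ b e) ≡ SF.card b (SF.lvl b e)
  card-part b e = trans (card-ι b {part′ b e} (λ {x} → part′-side b e {x})) (SF.card-cong b {part′ b e ∘ ι b} {SF.lvl b e}
    (λ {x} p → SF.lvl⁺ b {e} {x} (trans (sym (rk-ι b)) (proj₁ (does⁻ ((rk (ι b x) ℕₚ.≟ e) ×-dec (side (ι b x) Boolₚ.≟ b)) p))))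
    (λ {x} p → part′⁺ b e {x} (SF.lvl-hom b {e} {x} p)))

  private
    grow′ : ∀ b {A} x → (∀ {y} → A ∋ y → part′ b 1 ∋ y) → part′ b 1 ∋ x → card (∂ (A ∪ ｛ x ｝)) + card A ≤ card (∂ A) + card (part′ b 1)
    grow′ b {A} x s p = let x′ , eq , r = view {b} {1} x p in subst (λ x → card (∂ (A ∪ ｛ x ｝)) + card A ≤ card (∂ A) + card (part′ b 1)) (sym eq)
        (≤-trans (≤-reflexive (cong₂ _+_ (unions x′) (card-ι b {A} on-side)))
          (≤-trans (S.∂-grow b {A ∘ ι b} {x′} (λ {y} a → trans (sym (rk-ι b)) (proj₁ (does⁻ ((rk (ι b y) ℕₚ.≟ 1) ×-dec (side (ι b y) Boolₚ.≟ b)) (s a)))) r)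
            (≤-reflexive (sym (cong₂ _+_ (card-∂-ι b {A} on-side) (card-part b 1))))))
      where
      on-side : ∀ {y} → A ∋ y → side y ≡ b
      on-side {y} a = part′-side b 1 {y} (s a)
      unions : ∀ x′ → card (∂ (A ∪ ｛ ι b x′ ｝)) ≡ SF.card b (SF.∂ b (SF._∪_ b (A ∘ ι b) (SF.｛_｝ b x′)))
      unions x′ = trans (card-∂-ι b {A ∪ ｛ ι b x′ ｝} (λ {y} q → [ on-side {y} , ｛｝-side b {x′} {y} ]′ (∪⁻ {A} {｛ ι b x′ ｝} {y} q)))
        (SF.card-cong b {SF.∂ b ((A ∪ ｛ ι b x′ ｝) ∘ ι b)} {SF.∂ b (SF._∪_ b (A ∘ ι b) (SF.｛_｝ b x′))}
          (SF.∂-mono b {(A ∪ ｛ ι b x′ ｝) ∘ ι b} {SF._∪_ b (A ∘ ι b) (SF.｛_｝ b x′)} λ {y} q → case ∪⁻ {A} {｛ ι b x′ ｝} {ι b y} q of λ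
             { (inj₁ a) → SF.∪⁺ˡ b {A ∘ ι b} {SF.｛_｝ b x′} {y} a ; (inj₂ t) → SF.∪⁺ʳ b {A ∘ ι b} {SF.｛_｝ b x′} {y} (｛｝-from b {x′} {y} t) })
          (SF.∂-mono b {SF._∪_ b (A ∘ ι b) (SF.｛_｝ b x′)} {(A ∪ ｛ ι b x′ ｝) ∘ ι b} λ {y} q → case SF.∪⁻ b {A ∘ ι b} {SF.｛_｝ b x′} {y} q of λ
             { (inj₁ a) → ∪⁺ˡ {A} {｛ ι b x′ ｝} {ι b y} a ; (inj₂ t) → ∪⁺ʳ {A} {｛ ι b x′ ｝} {ι b y} (｛｝-to b {x′} {y} t) }))

  twoSided : TwoSided (P ⊎ᴾ Q)
  twoSided = record
    { side = side
    ; ⊑-side = λ { (inj₁ _) → refl ; (inj₂ _) → refl }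
    ; ⊑-trans = λ { (inj₁ p) (inj₁ q) → inj₁ (S.⊑-trans false p q) ; (inj₂ p) (inj₂ q) → inj₂ (S.⊑-trans true p q) }
    ; below = λ { (inj₁ p) l → let z , q , c , e = S.below false p l in inj₁ z , inj₁ q , inj₁ c , e
                ; (inj₂ p) l → let z , q , c , e = S.below true p l in inj₂ z , inj₂ q , inj₂ c , e }
    ; r = r
    ; comp = comp′
    ; comp² = λ { (inj₁ x) → cong inj₁ (S.comp² false x) ; (inj₂ x) → cong inj₂ (S.comp² true x) }
    ; comp-rk = λ { (inj₁ x) → S.comp-rk false x ; (inj₂ x) → S.comp-rk true x }
    ; comp-⊑ = λ { (inj₁ p) → inj₁ (S.comp-⊑ false p) ; (inj₂ p) → inj₂ (S.comp-⊑ true p) }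
    ; comp-side = λ { (inj₁ x) → refl ; (inj₂ x) → refl }
    ; above = λ { {inj₁ x} l → let y , p , e = S.above false l in inj₁ y , inj₁ p , e
                ; {inj₂ x} l → let y , p , e = S.above true l in inj₂ y , inj₂ p , e }
    ; atom-below = λ { {inj₁ x} l → let a , e , p = S.atom-below false l in inj₁ a , e , inj₁ p
                     ; {inj₂ x} l → let a , e , p = S.atom-below true l in inj₂ a , e , inj₂ p }
    ; inhabited = λ l b → let a , e = S.inhabited b l in ι b a , part′⁺ b 1 {a} e
    ; Two = Two′
    ; Two? = λ { (inj₁ x) → S.Two? false x ; (inj₂ x) → S.Two? true x }
    ; dim≤ = λ {x} {b} p → let x′ , eq , e = view {b} {1} x p in subst (λ x → card (part′ b 1) ≤ suc (card (∂ ｛ x ｝))) (sym eq)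
        (subst₂ _≤_ (sym (card-part b 1)) (cong suc (sym (card-∂｛｝ b x′))) (S.dim≤ b e))
    ; dim≤-long = λ {x} {b} p t → let x′ , eq , e = view {b} {1} x p in subst (λ x → card (part′ b 1) ≤ card (∂ ｛ x ｝)) (sym eq)
        (subst₂ _≤_ (sym (card-part b 1)) (sym (card-∂｛｝ b x′)) (S.dim≤-long b e (λ u → t (subst Two′ (sym eq) (Two-ι b u)))))
    ; dim>-two = λ {x} {b} p t → let x′ , eq , e = view {b} {1} x p in subst (λ x → suc (card (∂ ｛ x ｝)) ≤ card (part′ b 1)) (sym eq)
        (subst₂ _≤_ (cong suc (sym (card-∂｛｝ b x′))) (sym (card-part b 1)) (S.dim>-two b e (Two-ι⁻ b (subst Two′ eq t))))
    ; ∂-grow = λ {A} {x} {b} s p → grow′ b {A} x s p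
    ; coatom = λ {x} {c} {b} p s t → let x′ , eq , e = view {b} {1} x p ; c′ , eq′ = preimage c s in
        case S.coatom b {x′} {c′} e (trans (cong suc (trans (sym (rk-ι b)) (cong rk (sym eq′)))) t) of λ
          { (inj₁ q) → inj₁ (subst₂ _⊑_ (sym eq) (sym eq′) (⊑-ι b q))
          ; (inj₂ (u , q)) → inj₂ (subst Two′ (sym eq) (Two-ι b u) , trans eq′ (trans (cong (ι b) q) (trans (sym (comp-ι b)) (cong comp′ (sym eq))))) }
    }

  two-member : ∀ b {y} → TwoSided.part twoSided b 1 ∋ y → TwoSided.Two twoSided y → ∃ λ y′ → F.rk b y′ ≡ 1 × OneSided.Two (S b) y′
  two-member b {y} p t = let y′ , eq , e = view {b} {1} y p in y′ , e , Two-ι⁻ b (subst Two′ eq t)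

-- Hilbert functions determine the side lengths

free-sum : (ℕ → ℕ) → ℕ → ℕ
free-sum f zero    = f 0
free-sum f (suc e) = f (suc e) + free-sum f e

-- The Hilbert function of a product of unbounded chains.
free : ℕ → ℕ → ℕ
free zero    = hilbert []
free (suc n) = free-sum (free n)

free-0 : ∀ n → free n 0 ≡ 1
free-0 zero    = refl
free-0 (suc n) = free-0 n

chain-sum-≤ : ∀ m {f g} → (∀ e → f e ≤ g e) → ∀ e → chain-sum m f e ≤ free-sum g e
chain-sum-≤ zero    h e       = z≤n
chain-sum-≤ (suc m) h zero    = h 0
chain-sum-≤ (suc m) h (suc e) = +-mono-≤ (h (suc e)) (chain-sum-≤ m h e)

-- In degree `m` a chain of `m` elements lacks its power of exponent `m`, which alone would
-- contribute `g 0`.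
chain-sum-< : ∀ m {f g} → (∀ e → f e ≤ g e) → chain-sum m f m + g 0 ≤ free-sum g m
chain-sum-< zero    h = ≤-refl
chain-sum-< (suc m) {f} {g} h = ≤-trans (≤-reflexive (+-assoc (f (suc m)) _ _)) (+-mono-≤ (h (suc m)) (chain-sum-< m h))

chain-sum-free : ∀ m {f g} e → e < m → (∀ i → i ≤ e → f i ≡ g i) → chain-sum m f e ≡ free-sum g e
chain-sum-free (suc m) zero    _       h = h 0 z≤n
chain-sum-free (suc m) (suc e) (s≤s l) h = cong₂ _+_ (h (suc e) ≤-refl) (chain-sum-free m e l λ i p → h i (≤-trans p (n≤1+n e)))

hilbert-≤-free : ∀ as e → hilbert as e ≤ free (length as) e
hilbert-≤-free []       e = ≤-refl
hilbert-≤-free (a ∷ as) e = chain-sum-≤ (suc a) (hilbert-≤-free as) e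

hilbert-free : ∀ {as} e → AllL.All (e ≤_) as → hilbert as e ≡ free (length as) e
hilbert-free e []      = refl
hilbert-free e (p ∷ l) = chain-sum-free (suc _) e (s≤s p) λ i q → hilbert-free i (AllL.map (≤-trans q) l)

-- Division of power series by 1 + t + ... + tᵃ: the constant term is one, so the coefficients are
-- recovered by induction.
chain-sum-cancel : ∀ a {f g} → (∀ e → chain-sum (suc a) f e ≡ chain-sum (suc a) g e) → ∀ e → f e ≡ g e
chain-sum-cancel a {f} {g} h e = go e e ≤-refl
  where
  go : ∀ n e → e ≤ n → f e ≡ g e
  go n       zero    _       = h 0
  go (suc n) (suc e) (s≤s l) = +-cancelʳ-≡ (chain-sum a f e) _ _ (trans (h (suc e))
    (cong (g (suc e) +_) (sym (chain-sum-cong a e λ i p → go n i (≤-trans p l)))))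

-- In degree `suc a` no chain of the second list is exhausted, whereas the chain `a` of the first
-- already is; the number of chains is the same.
hilbert-< : ∀ {a b as bs} → a < b → AllL.All (b ≤_) bs → length as ≡ length bs → hilbert (a ∷ as) (suc a) < hilbert (b ∷ bs) (suc a)
hilbert-< {a} {b} {as} {bs} a<b bs≥ eq = ≤-trans (≤-reflexive (trans (+-comm 1 _)
    (cong (hilbert (a ∷ as) (suc a) +_) (sym (free-0 (length as))))))
  (≤-trans (chain-sum-< (suc a) (hilbert-≤-free as)) (≤-reflexive (trans (cong (λ n → free (suc n) (suc a)) eq)
    (sym (hilbert-free {b ∷ bs} (suc a) (a<b ∷ AllL.map (≤-trans a<b) bs≥))))))

-- The shortest sides in which two sorted lists differ are seen by the Hilbert functions.
hilbert-injective : ∀ {as bs} → AllPairs _≤_ as → AllPairs _≤_ bs → AllL.All (1 ≤_) as → AllL.All (1 ≤_) bs →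
                    (∀ e → hilbert as e ≡ hilbert bs e) → as ≡ bs
hilbert-injective {[]}     {[]}     _        _        _       _       h = refl
hilbert-injective {[]}     {b ∷ bs} _        _        _       q       h = contradiction (trans (h 1) (hilbert-1 q)) λ ()
hilbert-injective {a ∷ as} {[]}     _        _        p       _       h = contradiction (trans (sym (h 1)) (hilbert-1 p)) λ ()
hilbert-injective {a ∷ as} {b ∷ bs} (s ∷ ss) (t ∷ ts) p@(_ ∷ ps) q@(_ ∷ qs) h with ℕₚ.<-cmp a b
... | tri≈ _ refl _ = cong (a ∷_) (hilbert-injective ss ts ps qs (chain-sum-cancel a h))
... | tri< l _ _ = contradiction (h (suc a)) (<⇒≢ (hilbert-< {as = as} {bs} l t (suc-injective (trans (sym (hilbert-1 p)) (trans (h 1) (hilbert-1 q))))))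
... | tri> _ _ l = contradiction (sym (h (suc b))) (<⇒≢ (hilbert-< {as = bs} {as} l s (suc-injective (trans (sym (hilbert-1 q)) (trans (sym (h 1)) (hilbert-1 p))))))

hilbert-perm : ∀ {as bs} → as ↭ bs → ∀ e → hilbert as e ≡ hilbert bs e
hilbert-perm {as} {bs} p e = trans (sym (card-lvl-nest as e)) (trans (card-lvl-iso (nest-perm 1 p) e) (card-lvl-nest bs e))

module Ascending = Sort ℕₚ.≤-decTotalOrder

hilbert⇒↭ : ∀ {as bs} → AllL.All (1 ≤_) as → AllL.All (1 ≤_) bs → (∀ e → hilbert as e ≡ hilbert bs e) → as ↭ bs
hilbert⇒↭ {as} {bs} p q h = ↭-trans (↭-sym (sort-↭ as)) (↭-trans (Perm.↭-reflexive (hilbert-injective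
    (Linkedₚ.Linked⇒AllPairs ≤-trans (sort-↗ as)) (Linkedₚ.Linked⇒AllPairs ≤-trans (sort-↗ bs))
    (Permₚ.All-resp-↭ (↭-sym (sort-↭ as)) p) (Permₚ.All-resp-↭ (↭-sym (sort-↭ bs)) q)
    λ e → trans (hilbert-perm (sort-↭ as) e) (trans (h e) (sym (hilbert-perm (sort-↭ bs) e))))) (sort-↭ bs))
  where open Ascending using (sort-↭; sort-↗)

-- The outcome `same-counts` speaks only of ranks strictly between bottom and top. Complementation
-- reduces the top rank to rank zero.
hilbert-height : ∀ {n} {d : Vec ℕ n} (d⁺ : Positive d) → hilbert (shape d) (height (CL d d⁺)) ≡ 1
hilbert-height {d = d} d⁺ = trans (sym (card-lvl-box d⁺ r)) (trans (≤-antisym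
    (card-inj (boxPo d) (boxPo d) comp {lvl r} {lvl 0} (λ {x} p → lvl⁺ {0} {comp x} (+-cancelʳ-≡ (rk x) (rk (comp x)) 0 (trans (comp-rk x) (sym (lvl-hom {r} {x} p)))))
       (λ {x} {y} _ _ → injective {x} {y}))
    (card-inj (boxPo d) (boxPo d) comp {lvl 0} {lvl r} (λ {x} p → lvl⁺ {r} {comp x} (trans (sym (+-identityʳ (rk (comp x)))) (trans (cong (rk (comp x) +_) (sym (lvl-hom {0} {x} p))) (comp-rk x))))
       (λ {x} {y} _ _ → injective {x} {y})))
  (trans (card-lvl-box d⁺ 0) (hilbert-0 (shape d))))
  where
  open Po (boxPo d) using (rk)
  open Subsets (boxPo d)
  open OneSided (box-oneSided d⁺)
  r : ℕ
  r = height (CL d d⁺)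
  injective : ∀ {x y} → comp x ≡ comp y → x ≡ y
  injective {x} {y} q = trans (sym (comp² x)) (trans (cong comp q) (comp² y))

hilbert->height : ∀ {n} {d : Vec ℕ n} (d⁺ : Positive d) {e} → height (CL d d⁺) < e → hilbert (shape d) e ≡ 0
hilbert->height {d = d} d⁺ {e} l = trans (sym (card-lvl-box d⁺ e)) (card-∅ {lvl e} λ {x} p →
    <⇒≱ l (≤-trans (≤-reflexive (sym (lvl-hom {e} {x} p))) (rank≤height d⁺ x)))
  where open Subsets (boxPo d)

two-sides-↭ : ∀ {as bs} → length as ≡ 2 → length bs ≡ 2 → 1 ∈ as → 1 ∈ bs → ℕL.sum as ≡ ℕL.sum bs → as ↭ bs
two-sides-↭ {as} {bs} p q i j s = ↭-trans (proj₂ (split as p i)) (↭-trans (Perm.↭-reflexive (cong (λ z → 1 ∷ z ∷ [])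
    (suc-injective (trans (sym (total (proj₂ (split as p i)))) (trans s (total (proj₂ (split bs q j)))))))) (↭-sym (proj₂ (split bs q j))))
  where
  split : ∀ xs → length xs ≡ 2 → 1 ∈ xs → ∃ λ x → xs ↭ 1 ∷ x ∷ []
  split (_ ∷ x ∷ []) _ (here refl)         = x , ↭-refl
  split (x ∷ _ ∷ []) _ (there (here refl)) = x , Perm.swap x 1 ↭-refl
  total : ∀ {xs x} → xs ↭ 1 ∷ x ∷ [] → ℕL.sum xs ≡ suc x
  total {x = x} h = trans (ℕLₚ.sum-↭ h) (cong suc (+-identityʳ x))

-- Small ranks and conclusion

PathAndStrip : List ℕ → List ℕ → Set
PathAndStrip as bs = length as ≡ 1 × length bs ≡ 2 × 1 ∈ bs

-- Below height three there are only four shapes, and any two of equal height satisfy the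
-- conclusion, so the order itself is not consulted.
small-shapes : ∀ {as bs} → AllL.All (1 ≤_) as → AllL.All (1 ≤_) bs → ℕL.sum as ≡ ℕL.sum bs → ℕL.sum as < 3 →
               as ↭ bs ⊎ (PathAndStrip as bs ⊎ PathAndStrip bs as)
small-shapes {as} {bs} p q s l = compare (small p l) (small q (subst (_< 3) s l)) s
  where
  data Small : List ℕ → Set where
    point  : Small []
    edge   : Small (1 ∷ [])
    path₂  : Small (2 ∷ [])
    square : Small (1 ∷ 1 ∷ [])

  small : ∀ {as} → AllL.All (1 ≤_) as → ℕL.sum as < 3 → Small as
  small {[]} _ _ = point
  small {suc zero ∷ []} _ _ = edge
  small {suc (suc zero) ∷ []} _ _ = path₂
  small {suc (suc (suc _)) ∷ _} _ (s≤s (s≤s (s≤s ())))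
  small {suc zero ∷ suc zero ∷ []} _ _ = square
  small {suc zero ∷ suc (suc _) ∷ _} _ (s≤s (s≤s (s≤s ())))
  small {suc (suc zero) ∷ suc _ ∷ _} _ (s≤s (s≤s (s≤s ())))
  small {suc zero ∷ suc zero ∷ suc _ ∷ _} _ (s≤s (s≤s (s≤s ())))
  small {zero ∷ _} (() ∷ _)
  small {suc zero ∷ zero ∷ _} (_ ∷ () ∷ _)
  small {suc (suc zero) ∷ zero ∷ _} (_ ∷ () ∷ _)
  small {suc zero ∷ suc zero ∷ zero ∷ _} (_ ∷ _ ∷ () ∷ _)

  compare : ∀ {as bs} → Small as → Small bs → ℕL.sum as ≡ ℕL.sum bs → as ↭ bs ⊎ (PathAndStrip as bs ⊎ PathAndStrip bs as)
  compare point  point  _ = inj₁ ↭-refl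
  compare edge   edge   _ = inj₁ ↭-refl
  compare path₂  path₂  _ = inj₁ ↭-refl
  compare square square _ = inj₁ ↭-refl
  compare path₂  square _ = inj₂ (inj₁ (refl , refl , here refl))
  compare square path₂  _ = inj₂ (inj₂ (refl , refl , here refl))

module _ {k l} {d : Vec ℕ k} {e : Vec ℕ l} (d⁺ : Positive d) (e⁺ : Positive e) (same : height (CL d d⁺) ≡ height (CL e e⁺)) where
  private
    Goal : Set
    Goal = CL d d⁺ ≅ CL e e⁺ ⊎ ((IsPath d d⁺ × dimension (CL e e⁺) ≡ 2 × 2 ∈ sides e)
                               ⊎ (IsPath e e⁺ × dimension (CL d d⁺) ≡ 2 × 2 ∈ sides d))

    sums : ℕL.sum (shape d) ≡ ℕL.sum (shape e)
    sums = trans (sym (height-shape d⁺)) (trans same (height-shape e⁺))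

    open Pair (box-oneSided d⁺) (subst (λ r → OneSided r (boxPo e)) (sym same) (box-oneSided e⁺)) using (twoSided; card-part; two-member)

    dim-d : TwoSided.dim twoSided false ≡ length (shape d)
    dim-d = trans (card-part false 1) (card-atoms d⁺)

    dim-e : TwoSided.dim twoSided true ≡ length (shape e)
    dim-e = trans (card-part true 1) (card-atoms e⁺)

    two-d : ∀ {y} → TwoSided.part twoSided false 1 y ≡ true → TwoSided.Two twoSided y → 2 ∈ sides d
    two-d {y} p t = let y′ , r , u = two-member false {y} p t in double-atom r (proj₂ y′) u

    two-e : ∀ {y} → TwoSided.part twoSided true 1 y ≡ true → TwoSided.Two twoSided y → 2 ∈ sides e
    two-e {y} p t = let y′ , r , u = two-member true {y} p t in unfold same y′ r u
      where
      -- Generalising the rank lets the equality be matched, which removes the transport around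
      -- `Two`.
      unfold : ∀ {r′} (s : r′ ≡ height (CL e e⁺)) y′ → Vec.sum (proj₁ y′) ≡ 1 →
               OneSided.Two (subst (λ r → OneSided r (boxPo e)) (sym s) (box-oneSided e⁺)) y′ → 2 ∈ sides e
      unfold refl y′ r u = double-atom r (proj₂ y′) u

    ↭⇒Goal : shape d ↭ shape e → Goal
    ↭⇒Goal p = inj₁ (↭⇒≅ d⁺ e⁺ p)

    conclude : Outcome twoSided → Goal
    conclude (path false {y} p q t u) = inj₂ (inj₁ (trans (dimension-shape d⁺) (trans (sym dim-d) p) , trans (dimension-shape e⁺) (trans (sym dim-e) q) , two-e {y} t u))
    conclude (path true {y} p q t u) = inj₂ (inj₂ (trans (dimension-shape e⁺) (trans (sym dim-e) p) , trans (dimension-shape d⁺) (trans (sym dim-d) q) , two-d {y} t u))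
    conclude (twos h) = ↭⇒Goal (two-sides-↭ (trans (sym dim-d) (proj₁ (h false))) (trans (sym dim-e) (proj₁ (h true)))
      (2∈sides⇒1∈shape {d = d} (let y , p , t = proj₂ (h false) in two-d {y} p t))
      (2∈sides⇒1∈shape {d = e} (let y , p , t = proj₂ (h true) in two-e {y} p t)) sums)
    conclude (same-counts h) = ↭⇒Goal (hilbert⇒↭ (shape-≥1 d) (shape-≥1 e) equal)
      where
      equal : ∀ n → hilbert (shape d) n ≡ hilbert (shape e) n
      equal zero = trans (hilbert-0 (shape d)) (sym (hilbert-0 (shape e)))
      equal (suc n) with ℕₚ.<-cmp (suc n) (height (CL d d⁺))
      ... | tri< q _ _ = trans (trans (sym (card-lvl-box d⁺ (suc n))) (sym (card-part false (suc n))))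
                           (trans (h (s≤s z≤n) q) (trans (card-part true (suc n)) (card-lvl-box e⁺ (suc n))))
      ... | tri≈ _ q _ = trans (trans (cong (hilbert (shape d)) q) (hilbert-height d⁺))
                           (sym (trans (cong (hilbert (shape e)) (trans q same)) (hilbert-height e⁺)))
      ... | tri> _ _ q = trans (hilbert->height d⁺ q) (sym (hilbert->height e⁺ (≤-<-trans (≤-reflexive (sym same)) q)))

    small : ℕL.sum (shape d) < 3 → Goal
    small q = Sum.map (↭⇒≅ d⁺ e⁺) (Sum.map
        (λ (a , b , c) → trans (dimension-shape d⁺) a , trans (dimension-shape e⁺) b , 1∈shape⇒2∈sides e c)
        (λ (a , b , c) → trans (dimension-shape e⁺) a , trans (dimension-shape d⁺) b , 1∈shape⇒2∈sides d c))
      (small-shapes (shape-≥1 d) (shape-≥1 e) sums q)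

  diamond-cases : Macaulay (Diamond d⁺ e⁺ same) → Goal
  -- The argument compares shadows of atoms, so rank two still has to lie strictly below the
  -- identified top.
  diamond-cases mac = case 3 ℕₚ.≤? height (CL d d⁺) of λ
    { (yes l) → conclude (Outcomes.outcome twoSided l (diamond⇒ d⁺ e⁺ same mac))
    ; (no ¬l) → small (≤-<-trans (≤-reflexive (sym (height-shape d⁺))) (≰⇒> ¬l)) }

theorem2 : (∀ {k l : ℕ} (d : Vec ℕ k) (e : Vec ℕ l) (d⁺ : Positive d) (e⁺ : Positive e) →
    let P = CL d d⁺
        Q = CL e e⁺
    in (sameRank : height P ≡ height Q) →
    Macaulay (diamond P Q (least d⁺) (least e⁺) (greatest d⁺) (greatest e⁺) sameRank)
    ⇔ (P ≅ Q
       ⊎ ((IsPath d d⁺ × dimension Q ≡ 2 × 2 ∈ sides e)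
          ⊎ (IsPath e e⁺ × dimension P ≡ 2 × 2 ∈ sides d))))
    ×
    (∀ (m n m′ n′ : ℕ) (m≤n : m ≤ n) (m′≤n′ : m′ ≤ n′) (1<m : 1 < m) (1<m′ : 1 < m′) →
    let d⁺ = rectangle⁺ 1<m m≤n
        e⁺ = rectangle⁺ 1<m′ m′≤n′
    in Macaulay (wedge (CL (m ∷ n ∷ []) d⁺) (CL (m′ ∷ n′ ∷ []) e⁺) (least d⁺) (least e⁺))
       ⇔ ((m ≤ m′ × n ≤ n′) ⊎ (m′ ≤ m × n′ ≤ n)))
theorem2 =
  (λ d e d⁺ e⁺ same → mk⇔
    (λ mac → diamond-cases d⁺ e⁺ same (fold-Diamond d⁺ e⁺ same mac))
    (λ c → unfold-Diamond d⁺ e⁺ same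
      ([ diamond-of-≅ {d⁺ = d⁺} {e⁺} same , [ diamond-path-first {d⁺ = d⁺} {e⁺} same , diamond-path-second {d⁺ = d⁺} {e⁺} same ]′ ]′ c))) ,
  λ m n m′ n′ m≤n m′≤n′ 1<m 1<m′ →
    let d⁺ = rectangle⁺ 1<m m≤n
        e⁺ = rectangle⁺ 1<m′ m′≤n′
        1<n  = <-≤-trans 1<m m≤n
        1<n′ = <-≤-trans 1<m′ m′≤n′
    in mk⇔ (λ mac → wedge-nested d⁺ e⁺ 1<m 1<n 1<m′ 1<n′ m≤n m′≤n′ (wedge⇒ d⁺ e⁺ (fold-Wedge d⁺ e⁺ mac)))
           (λ c → unfold-Wedge d⁺ e⁺ (wedge-of-nested d⁺ e⁺ 1<m 1<n 1<m′ 1<n′ m≤n m′≤n′ c))
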